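{- Let $k$ be a non-archimedean local field with ring of integers $\mathcal O_k$, uniformizing parameter $\pi$, and residue field of cardinality $p$. Let $\mathfrak E\subseteq\mathbb M_2(k)$ be an Eichler order of level $r\ge0$, let $t\ge0$ be an integer, let $\mathfrak H_0=\begin{pmatrix}\mathcal O_k&\mathcal O_k\\0&\mathcal O_k\end{pmatrix}$ be the ring of integral upper triangular matrices, and let $\mathfrak H=\mathfrak H_0^{[t]}=\mathcal O_k\mathfrak 1+\pi^t\mathfrak H_0$. Then $\mathfrak H$ embeds optimally into $\mathfrak E$ if and only if $r\ge 2t$. In this case, if $t>0$, the vector of embedding numbers $\vec e=(e_1,e_2,e_3,e_4)$ of $\mathfrak H$ into $\mathfrak E$ (defined in the context) is $$\vec e=\begin{cases}\left((p-1)p^{2t-1},\ \tfrac12(p-1)p^{2t-1},\ 1,\ 1\right)&\text{if } r=2t,\\[4pt]\left(2(p-1)p^{2t-1},\ (p-1)p^{2t-1},\ 2,\ 1\right)&\text{if } r>2t,\end{cases}$$ while if $t=0$, then $\vec e=(1,1,1,1)$ if $r=0$ and $\vec e=(2,1,2,1)$ if $r>0$.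
   Context: $\mathfrak 1$ denotes the identity matrix. An Eichler order in $\mathbb M_2(k)$ is an intersection $\mathfrak E=\mathfrak D_1\cap\mathfrak D_2$ of two maximal orders; it has level $r\in\mathbb Z_{\ge0}$ if $\mathfrak D_1/\mathfrak E\cong\mathfrak D_2/\mathfrak E\cong\mathcal O_k/\pi^r\mathcal O_k$ as $\mathcal O_k$-modules. For an order $\mathfrak H$ spanning the $k$-algebra $L=k\mathfrak H$, an optimal embedding $\mathfrak H\to\mathfrak E$ is a homomorphism induced by a $k$-algebra embedding $\phi:L\to\mathbb M_2(k)$ with $\phi^{ -1}(\mathfrak E)=\mathfrak H$. A suborder $\mathfrak H'\subseteq\mathfrak E$ is optimal if $k\mathfrak H'\cap\mathfrak E=\mathfrak H'$. Let $X$ be the set of optimal embeddings $\mathfrak H\to\mathfrak E$, and let $Y$ be the set of optimal suborders of $\mathfrak E$ isomorphic to $\mathfrak H$. Let $\Gamma_1=k^*\mathfrak E^*$ and let $\Gamma_2=\{g\in\mathrm{GL}_2(k): g\mathfrak E g^{ -1}=\mathfrak E\}$; both act by conjugation on $X$ and $Y$. The embedding numbers are $$e_1=|X/\Gamma_1|,\quad e_2=|X/\Gamma_2|,\quad e_3=|Y/\Gamma_1|,\quad e_4=|Y/\Gamma_2|.$$ -}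

module Defs where

open import Algebra.Bundles using (CommutativeRing)
open import Algebra.Bundles.Raw using (RawRing)
open import Algebra.Module.Bundles.Raw using (RawLeftModule)
open import Algebra.Module.Morphism.Structures using (module LeftModuleMorphisms)
open import Algebra.Morphism.Structures using (module RingMorphisms)
open import Data.Empty using (⊥-elim)
open import Data.Fin using (Fin; zero; suc)
open import Data.Integer as ℤ using (ℤ; 0ℤ; 1ℤ; -[1+_])
import Data.Integer.Properties as ℤₚ
open import Data.Maybe.Base using (zipWith)
open import Data.Nat using (ℕ; _≥_; z≤n)
open import Data.Nat.Properties using (m≢1+m+n)
open import Data.Product using (∃; ∃-syntax; Σ-syntax; _×_; _,_; proj₁; proj₂)
open import Data.Vec.Functional using (Vector; []; _∷_)
open import Function.Bundles using (_⇔_; module Equivalence)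
open import Function.Structures using (IsBijection)
open import Level using (Level; _⊔_; 0ℓ) renaming (suc to lsuc)
open import Relation.Binary.Construct.Add.Supremum.NonStrict ℤ._≤_ using (_≤⁺_; [_]; _≤⊤⁺)
open import Relation.Binary.Core using (Rel)
open import Relation.Binary.PropositionalEquality as ≡ using (_≡_)
open import Relation.Nullary using (¬_)
open import Relation.Nullary.Construct.Add.Supremum using (_⁺; ⊤⁺; [_])
open import Relation.Unary using (Pred; _∈_; _⊆_; _≐_; _∩_; U)
import Algebra.Properties.Ring as RingProperties
import Algebra.Properties.Semiring.Exp as Exp
import Algebra.Solver.Ring.NaturalCoefficients.Default as Solver

private
  variable
    a b r s : Level

-- ∣ A / ~ ∣ = n; that ~ is an equivalence relation is part of IsBijection.
HasCardinality : (A : Set a) → Rel A b → ℕ → Set (a ⊔ b)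
HasCardinality A _~_ n = Σ[ f ∈ (A → Fin n) ] IsBijection _~_ _≡_ f

-- A field with a normalised discrete valuation v : K → ℤ ∪ {∞}, complete and
-- with finite residue field.  The valuation is a total function, so _≈_ is
-- decidable, as it is classically.
record LocalField (c ℓ : Level) : Set (lsuc (c ⊔ ℓ)) where
  field
    commutativeRing : CommutativeRing c ℓ

  open CommutativeRing commutativeRing public hiding (zero)

  field
    1≉0     : ¬ (1# ≈ 0#)
    inverse : ∀ x → ¬ (x ≈ 0#) → ∃[ y ] x * y ≈ 1#

    v       : Carrier → ℤ ⁺
    v-cong  : ∀ {x y} → x ≈ y → v x ≡ v y
    v-⊤⁺    : ∀ x → v x ≡ ⊤⁺ ⇔ x ≈ 0#
    v-*     : ∀ x y → v (x * y) ≡ zipWith ℤ._+_ (v x) (v y)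
    v-+     : ∀ n x y → n ≤⁺ v x → n ≤⁺ v y → n ≤⁺ v (x + y)

    π       : Carrier
    v-π     : v π ≡ [ 1ℤ ]

    complete : (x : ℕ → Carrier) →
      (∀ (N : ℤ) → ∃[ m ] ∀ i j → i ≥ m → j ≥ m → [ N ] ≤⁺ v (x i - x j)) →
      ∃[ l ] ∀ (N : ℤ) → ∃[ m ] ∀ i → i ≥ m → [ N ] ≤⁺ v (x i - l)

  𝒪 : Pred Carrier 0ℓ
  𝒪 x = [ 0ℤ ] ≤⁺ v x

  field
    p            : ℕ
    residueField : HasCardinality (∃ 𝒪) (λ x y → [ 1ℤ ] ≤⁺ v (proj₁ x - proj₁ y)) p

  open Exp semiring using (_^_)

  π^_ : ℕ → Carrier
  π^ n = π ^ n

  open RingProperties ring using (-1*x≈-x; -‿involutive)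

  0∈𝒪 : 0# ∈ 𝒪
  0∈𝒪 = ≡.subst ([ 0ℤ ] ≤⁺_) (≡.sym (Equivalence.from (v-⊤⁺ 0#) refl)) (_ ≤⊤⁺)

  +∈𝒪 : ∀ {x y} → x ∈ 𝒪 → y ∈ 𝒪 → x + y ∈ 𝒪
  +∈𝒪 = v-+ _ _ _

  *∈𝒪 : ∀ {x y} → x ∈ 𝒪 → y ∈ 𝒪 → x * y ∈ 𝒪
  *∈𝒪 {x} {y} x∈ y∈ = ≡.subst ([ 0ℤ ] ≤⁺_) (≡.sym (v-* x y)) (sum≥0 x∈ y∈)
    where
    sum≥0 : ∀ {m n} → [ 0ℤ ] ≤⁺ m → [ 0ℤ ] ≤⁺ n → [ 0ℤ ] ≤⁺ zipWith ℤ._+_ m n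
    sum≥0 [ i ]     [ j ]     = [ ℤₚ.+-mono-≤ i j ]
    sum≥0 [ _ ]     (_ ≤⊤⁺)   = _ ≤⊤⁺
    sum≥0 (_ ≤⊤⁺)   _         = _ ≤⊤⁺

  1∈𝒪 : 1# ∈ 𝒪
  1∈𝒪 = nonneg (v 1#) (≡.trans (≡.sym (v-* 1# 1#)) (v-cong (*-identityˡ 1#)))
    where
    nonneg : ∀ m → zipWith ℤ._+_ m m ≡ m → [ 0ℤ ] ≤⁺ m
    nonneg ⊤⁺           _  = _ ≤⊤⁺
    nonneg [ ℤ.+ n ]    _  = [ ℤ.+≤+ z≤n ]
    nonneg [ -[1+ n ] ] eq = ⊥-elim (m≢1+m+n n (≡.sym (-[1+]-inj eq)))
      where
      -[1+]-inj : ∀ {i j} → _≡_ {A = ℤ ⁺} [ -[1+ i ] ] [ -[1+ j ] ] → i ≡ j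
      -[1+]-inj ≡.refl = ≡.refl

  -1∈𝒪 : - 1# ∈ 𝒪
  -1∈𝒪 = nonneg (v (- 1#)) (≡.subst ([ 0ℤ ] ≤⁺_) v1≡ 1∈𝒪)
    where
    v1≡ : v 1# ≡ zipWith ℤ._+_ (v (- 1#)) (v (- 1#))
    v1≡ = ≡.trans (v-cong (sym (trans (-1*x≈-x (- 1#)) (-‿involutive 1#)))) (v-* (- 1#) (- 1#))

    nonneg : ∀ m → [ 0ℤ ] ≤⁺ zipWith ℤ._+_ m m → [ 0ℤ ] ≤⁺ m
    nonneg ⊤⁺           _    = _ ≤⊤⁺
    nonneg [ ℤ.+ n ]    _    = [ ℤ.+≤+ z≤n ]
    nonneg [ -[1+ n ] ] [ () ]

  -∈𝒪 : ∀ {x} → x ∈ 𝒪 → - x ∈ 𝒪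
  -∈𝒪 {x} x∈ = ≡.subst ([ 0ℤ ] ≤⁺_) (v-cong (-1*x≈-x x)) (*∈𝒪 -1∈𝒪 x∈)

  π^∈𝒪 : ∀ n → π^ n ∈ 𝒪
  π^∈𝒪 ℕ.zero    = 1∈𝒪
  π^∈𝒪 (ℕ.suc n) = *∈𝒪 (≡.subst ([ 0ℤ ] ≤⁺_) (≡.sym v-π) [ ℤ.+≤+ z≤n ]) (π^∈𝒪 n)

  𝒪/π^_ : ℕ → RawLeftModule (∃ 𝒪) c (c ⊔ ℓ)
  𝒪/π^ n = record
    { Carrierᴹ = ∃ 𝒪
    ; _≈ᴹ_     = λ x y → ∃[ z ] z ∈ 𝒪 × proj₁ x - proj₁ y ≈ π^ n * z
    ; _+ᴹ_     = λ (x , x∈) (y , y∈) → x + y , +∈𝒪 x∈ y∈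
    ; _*ₗ_     = λ (x , x∈) (y , y∈) → x * y , *∈𝒪 x∈ y∈
    ; 0ᴹ       = 0# , 0∈𝒪
    ; -ᴹ_      = λ (x , x∈) → - x , -∈𝒪 x∈
    }

record RawAlgebra (R : Set r) (a ℓ : Level) : Set (r ⊔ lsuc (a ⊔ ℓ)) where
  field
    rawRing : RawRing a ℓ
  open RawRing rawRing public
  field
    _·_ : R → Carrier → Carrier

module _ {R : Set r} {a₁ ℓ₁ a₂ ℓ₂ : Level}
         (A : RawAlgebra R a₁ ℓ₁) (B : RawAlgebra R a₂ ℓ₂) where
  private
    module A = RawAlgebra A
    module B = RawAlgebra B
  open RingMorphisms A.rawRing B.rawRing

  record IsAlgebraMonomorphism (f : A.Carrier → B.Carrier) :
                               Set (r ⊔ a₁ ⊔ ℓ₁ ⊔ ℓ₂) where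
    field
      isRingMonomorphism : IsRingMonomorphism f
      ·-homo             : ∀ c x → f (c A.· x) B.≈ c B.· f x

  record AlgebraIsomorphism : Set (r ⊔ a₁ ⊔ ℓ₁ ⊔ a₂ ⊔ ℓ₂) where
    field
      to                : A.Carrier → B.Carrier
      isRingIsomorphism : IsRingIsomorphism to
      ·-homo            : ∀ c x → to (c A.· x) B.≈ c B.· to x

module Matrices {c ℓ : Level} (k : LocalField c ℓ) where
  open LocalField k
  open RingProperties ring using (-1*x≈-x)
  open Solver commutativeSemiring using (solve; _:+_; _:*_; _:=_; con)

  infix  4 _≈ᴹ_
  infixl 6 _+ᴹ_ _-ᴹ_
  infixl 7 _*ᴹ_
  infixr 7 _·ᴹ_

  record Mat : Set c where
    constructor mat
    field
      m₁₁ m₁₂ m₂₁ m₂₂ : Carrier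

  record _≈ᴹ_ (x y : Mat) : Set ℓ where
    constructor mat≈
    private
      module x = Mat x
      module y = Mat y
    field
      ≈₁₁ : x.m₁₁ ≈ y.m₁₁
      ≈₁₂ : x.m₁₂ ≈ y.m₁₂
      ≈₂₁ : x.m₂₁ ≈ y.m₂₁
      ≈₂₂ : x.m₂₂ ≈ y.m₂₂

  _+ᴹ_ _*ᴹ_ : Mat → Mat → Mat
  mat x₁ x₂ x₃ x₄ +ᴹ mat y₁ y₂ y₃ y₄ = mat (x₁ + y₁) (x₂ + y₂) (x₃ + y₃) (x₄ + y₄)
  mat x₁ x₂ x₃ x₄ *ᴹ mat y₁ y₂ y₃ y₄ =
    mat (x₁ * y₁ + x₂ * y₃) (x₁ * y₂ + x₂ * y₄)
        (x₃ * y₁ + x₄ * y₃) (x₃ * y₂ + x₄ * y₄)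

  -ᴹ_ : Mat → Mat
  -ᴹ mat x₁ x₂ x₃ x₄ = mat (- x₁) (- x₂) (- x₃) (- x₄)

  _-ᴹ_ : Mat → Mat → Mat
  x -ᴹ y = x +ᴹ (-ᴹ y)

  _·ᴹ_ : Carrier → Mat → Mat
  a ·ᴹ mat x₁ x₂ x₃ x₄ = mat (a * x₁) (a * x₂) (a * x₃) (a * x₄)

  0ᴹ 𝟙 : Mat
  0ᴹ = mat 0# 0# 0# 0#
  𝟙  = mat 1# 0# 0# 1#

  matRawRing : RawRing c ℓ
  matRawRing = record
    { Carrier = Mat ; _≈_ = _≈ᴹ_ ; _+_ = _+ᴹ_ ; _*_ = _*ᴹ_ ; -_ = -ᴹ_ ; 0# = 0ᴹ ; 1# = 𝟙 }

  ≈ᴹ-refl : ∀ {x} → x ≈ᴹ x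
  ≈ᴹ-refl = mat≈ refl refl refl refl

  ≈ᴹ-sym : ∀ {x y} → x ≈ᴹ y → y ≈ᴹ x
  ≈ᴹ-sym (mat≈ e₁ e₂ e₃ e₄) = mat≈ (sym e₁) (sym e₂) (sym e₃) (sym e₄)

  ≈ᴹ-trans : ∀ {x y z} → x ≈ᴹ y → y ≈ᴹ z → x ≈ᴹ z
  ≈ᴹ-trans (mat≈ e₁ e₂ e₃ e₄) (mat≈ f₁ f₂ f₃ f₄) =
    mat≈ (trans e₁ f₁) (trans e₂ f₂) (trans e₃ f₃) (trans e₄ f₄)

  +ᴹ-cong : ∀ {x x′ y y′} → x ≈ᴹ x′ → y ≈ᴹ y′ → x +ᴹ y ≈ᴹ x′ +ᴹ y′
  +ᴹ-cong (mat≈ e₁ e₂ e₃ e₄) (mat≈ f₁ f₂ f₃ f₄) =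
    mat≈ (+-cong e₁ f₁) (+-cong e₂ f₂) (+-cong e₃ f₃) (+-cong e₄ f₄)

  *ᴹ-cong : ∀ {x x′ y y′} → x ≈ᴹ x′ → y ≈ᴹ y′ → x *ᴹ y ≈ᴹ x′ *ᴹ y′
  *ᴹ-cong (mat≈ e₁ e₂ e₃ e₄) (mat≈ f₁ f₂ f₃ f₄) = mat≈
    (+-cong (*-cong e₁ f₁) (*-cong e₂ f₃)) (+-cong (*-cong e₁ f₂) (*-cong e₂ f₄))
    (+-cong (*-cong e₃ f₁) (*-cong e₄ f₃)) (+-cong (*-cong e₃ f₂) (*-cong e₄ f₄))

  ·ᴹ-congˡ : ∀ {a x y} → x ≈ᴹ y → a ·ᴹ x ≈ᴹ a ·ᴹ y
  ·ᴹ-congˡ (mat≈ e₁ e₂ e₃ e₄) = mat≈ (*-congˡ e₁) (*-congˡ e₂) (*-congˡ e₃) (*-congˡ e₄)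

  -ᴹ≈-1· : ∀ x → - 1# ·ᴹ x ≈ᴹ -ᴹ x
  -ᴹ≈-1· x = mat≈ (-1*x≈-x _) (-1*x≈-x _) (-1*x≈-x _) (-1*x≈-x _)

  Subset : Set (lsuc (c ⊔ ℓ))
  Subset = Pred Mat (c ⊔ ℓ)

  data Span {s : Level} (R : Pred Carrier 0ℓ) (S : Pred Mat s) : Pred Mat (c ⊔ ℓ ⊔ s) where
    incl : ∀ {x} → x ∈ S → x ∈ Span R S
    zero : 0ᴹ ∈ Span R S
    add  : ∀ {x y} → x ∈ Span R S → y ∈ Span R S → x +ᴹ y ∈ Span R S
    mul  : ∀ {a x} → a ∈ R → x ∈ Span R S → a ·ᴹ x ∈ Span R S
    resp : ∀ {x y} → x ≈ᴹ y → x ∈ Span R S → y ∈ Span R S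

  record Subalgebra (R : Pred Carrier 0ℓ) : Set (lsuc (c ⊔ ℓ)) where
    field
      carrier  : Subset
      respects : ∀ {x y} → x ≈ᴹ y → x ∈ carrier → y ∈ carrier
      0-closed : 0ᴹ ∈ carrier
      1-closed : 𝟙 ∈ carrier
      +-closed : ∀ {x y} → x ∈ carrier → y ∈ carrier → x +ᴹ y ∈ carrier
      *-closed : ∀ {x y} → x ∈ carrier → y ∈ carrier → x *ᴹ y ∈ carrier
      -‿closed : ∀ {x} → x ∈ carrier → -ᴹ x ∈ carrier
      ·-closed : ∀ {a x} → a ∈ R → x ∈ carrier → a ·ᴹ x ∈ carrier

    rawAlgebra : RawAlgebra (∃ R) (c ⊔ ℓ) ℓ
    rawAlgebra = record
      { rawRing = record
        { Carrier = ∃ carrier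
        ; _≈_     = λ x y → proj₁ x ≈ᴹ proj₁ y
        ; _+_     = λ (x , x∈) (y , y∈) → x +ᴹ y , +-closed x∈ y∈
        ; _*_     = λ (x , x∈) (y , y∈) → x *ᴹ y , *-closed x∈ y∈
        ; -_      = λ (x , x∈) → -ᴹ x , -‿closed x∈
        ; 0#      = 0ᴹ , 0-closed
        ; 1#      = 𝟙 , 1-closed
        }
      ; _·_ = λ (a , a∈) (x , x∈) → a ·ᴹ x , ·-closed a∈ x∈
      }

  𝕄₂ : RawAlgebra (∃ λ (a : Carrier) → a ∈ U) c ℓ
  𝕄₂ = record { rawRing = matRawRing ; _·_ = λ a x → proj₁ a ·ᴹ x }

  -- An order in its own k-span, which need not be all of 𝕄₂(k).
  record Order : Set (lsuc (c ⊔ ℓ)) where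
    field
      subalgebra        : Subalgebra 𝒪
      finitelyGenerated :
        ∃[ n ] Σ[ g ∈ Vector Mat n ]
          Subalgebra.carrier subalgebra ≐ Span 𝒪 (λ x → ∃[ i ] x ≈ᴹ g i)
    open Subalgebra subalgebra public

  open Order using (carrier)

  IsFull : Order → Set (c ⊔ ℓ)
  IsFull D = ∀ x → x ∈ Span U (carrier D)

  IsMaximal : Order → Set (lsuc (c ⊔ ℓ))
  IsMaximal D = IsFull D × (∀ D′ → IsFull D′ → carrier D ⊆ carrier D′ → carrier D′ ⊆ carrier D)

  private
    ·-*-assoc : ∀ a x y → a ·ᴹ (x *ᴹ y) ≈ᴹ (a ·ᴹ x) *ᴹ y
    ·-*-assoc a (mat x₁ x₂ x₃ x₄) (mat y₁ y₂ y₃ y₄) =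
      mat≈ (entry x₁ x₂ y₁ y₃) (entry x₁ x₂ y₂ y₄) (entry x₃ x₄ y₁ y₃) (entry x₃ x₄ y₂ y₄)
      where
      entry : ∀ x x′ y y′ → a * (x * y + x′ * y′) ≈ (a * x) * y + (a * x′) * y′
      entry x x′ y y′ = solve 5 (λ a x x′ y y′ →
        a :* (x :* y :+ x′ :* y′) := (a :* x) :* y :+ (a :* x′) :* y′) refl a x x′ y y′

    ·-*-comm : ∀ a x y → a ·ᴹ (x *ᴹ y) ≈ᴹ x *ᴹ (a ·ᴹ y)
    ·-*-comm a (mat x₁ x₂ x₃ x₄) (mat y₁ y₂ y₃ y₄) =
      mat≈ (entry x₁ x₂ y₁ y₃) (entry x₁ x₂ y₂ y₄) (entry x₃ x₄ y₁ y₃) (entry x₃ x₄ y₂ y₄)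
      where
      entry : ∀ x x′ y y′ → a * (x * y + x′ * y′) ≈ x * (a * y) + x′ * (a * y′)
      entry x x′ y y′ = solve 5 (λ a x x′ y y′ →
        a :* (x :* y :+ x′ :* y′) := x :* (a :* y) :+ x′ :* (a :* y′)) refl a x x′ y y′

    distribʳ′ : ∀ x y z → x *ᴹ z +ᴹ y *ᴹ z ≈ᴹ (x +ᴹ y) *ᴹ z
    distribʳ′ (mat x₁ x₂ x₃ x₄) (mat y₁ y₂ y₃ y₄) (mat z₁ z₂ z₃ z₄) =
      mat≈ (entry x₁ x₂ y₁ y₂ z₁ z₃) (entry x₁ x₂ y₁ y₂ z₂ z₄)
           (entry x₃ x₄ y₃ y₄ z₁ z₃) (entry x₃ x₄ y₃ y₄ z₂ z₄)
      where
      entry : ∀ x x′ y y′ z z′ →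
        (x * z + x′ * z′) + (y * z + y′ * z′) ≈ (x + y) * z + (x′ + y′) * z′
      entry = solve 6 (λ x x′ y y′ z z′ →
        (x :* z :+ x′ :* z′) :+ (y :* z :+ y′ :* z′) := (x :+ y) :* z :+ (x′ :+ y′) :* z′) refl

    distribˡ′ : ∀ x y z → x *ᴹ y +ᴹ x *ᴹ z ≈ᴹ x *ᴹ (y +ᴹ z)
    distribˡ′ (mat x₁ x₂ x₃ x₄) (mat y₁ y₂ y₃ y₄) (mat z₁ z₂ z₃ z₄) =
      mat≈ (entry x₁ x₂ y₁ y₃ z₁ z₃) (entry x₁ x₂ y₂ y₄ z₂ z₄)
           (entry x₃ x₄ y₁ y₃ z₁ z₃) (entry x₃ x₄ y₂ y₄ z₂ z₄)
      where
      entry : ∀ x x′ y y′ z z′ →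
        (x * y + x′ * y′) + (x * z + x′ * z′) ≈ x * (y + z) + x′ * (y′ + z′)
      entry = solve 6 (λ x x′ y y′ z z′ →
        (x :* y :+ x′ :* y′) :+ (x :* z :+ x′ :* z′) := x :* (y :+ z) :+ x′ :* (y′ :+ z′)) refl

    0*′ : ∀ x → 0ᴹ ≈ᴹ 0ᴹ *ᴹ x
    0*′ (mat x₁ x₂ x₃ x₄) = mat≈ (entry x₁ x₃) (entry x₂ x₄) (entry x₁ x₃) (entry x₂ x₄)
      where
      entry : ∀ x y → 0# ≈ 0# * x + 0# * y
      entry = solve 2 (λ x y → con 0 := con 0 :* x :+ con 0 :* y) refl

    *0′ : ∀ x → 0ᴹ ≈ᴹ x *ᴹ 0ᴹ
    *0′ (mat x₁ x₂ x₃ x₄) = mat≈ (entry x₁ x₂) (entry x₁ x₂) (entry x₃ x₄) (entry x₃ x₄)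
      where
      entry : ∀ x y → 0# ≈ x * 0# + y * 0#
      entry = solve 2 (λ x y → con 0 := x :* con 0 :+ y :* con 0) refl

    module _ {s : Level} {R : Pred Carrier 0ℓ} {S : Pred Mat s}
             (S-* : ∀ {x y} → x ∈ S → y ∈ S → x *ᴹ y ∈ S) where

      Span-* : ∀ {x y} → x ∈ Span R S → y ∈ Span R S → x *ᴹ y ∈ Span R S
      Span-* (incl x∈) (incl y∈)   = incl (S-* x∈ y∈)
      Span-* {x} (incl x∈) zero    = resp (*0′ x) zero
      Span-* {x} (incl x∈) (add y∈ z∈)  =
        resp (distribˡ′ x _ _) (add (Span-* (incl x∈) y∈) (Span-* (incl x∈) z∈))
      Span-* {x} (incl x∈) (mul a∈ y∈)  = resp (·-*-comm _ x _) (mul a∈ (Span-* (incl x∈) y∈))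
      Span-* (incl x∈) (resp y≈z y∈)    = resp (*ᴹ-cong ≈ᴹ-refl y≈z) (Span-* (incl x∈) y∈)
      Span-* {y = y} zero y∈            = resp (0*′ y) zero
      Span-* {y = y} (add x∈ z∈) y∈     = resp (distribʳ′ _ _ y) (add (Span-* x∈ y∈) (Span-* z∈ y∈))
      Span-* {y = y} (mul a∈ x∈) y∈     = resp (·-*-assoc _ _ y) (mul a∈ (Span-* x∈ y∈))
      Span-* (resp x≈z x∈) y∈           = resp (*ᴹ-cong x≈z ≈ᴹ-refl) (Span-* x∈ y∈)

  k⟨_⟩ : Order → Subalgebra U
  k⟨ H ⟩ = record
    { carrier  = Span U (carrier H)
    ; respects = resp
    ; 0-closed = zero
    ; 1-closed = incl (Order.1-closed H)
    ; +-closed = add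
    ; *-closed = Span-* (Order.*-closed H)
    ; -‿closed = λ x∈ → resp (-ᴹ≈-1· _) (mul _ x∈)
    ; ·-closed = mul
    }

  -- The 𝒪-module quotient; meaningful when E is an 𝒪-submodule of D.
  _/_ : Order → Subset → RawLeftModule (∃ 𝒪) (c ⊔ ℓ) (c ⊔ ℓ)
  D / E = record
    { Carrierᴹ = ∃ (carrier D)
    ; _≈ᴹ_     = λ x y → proj₁ x -ᴹ proj₁ y ∈ E
    ; _+ᴹ_     = λ (x , x∈) (y , y∈) → x +ᴹ y , Order.+-closed D x∈ y∈
    ; _*ₗ_     = λ (a , a∈) (x , x∈) → a ·ᴹ x , Order.·-closed D a∈ x∈
    ; 0ᴹ       = 0ᴹ , Order.0-closed D
    ; -ᴹ_      = λ (x , x∈) → -ᴹ x , Order.-‿closed D x∈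
    }

  record IsEichlerOrder (E : Subset) (r : ℕ) : Set (lsuc (c ⊔ ℓ)) where
    field
      D₁ D₂     : Order
      maximal₁  : IsMaximal D₁
      maximal₂  : IsMaximal D₂
      E≐D₁∩D₂   : E ≐ carrier D₁ ∩ carrier D₂
      level₁    : ∃ (LeftModuleMorphisms.IsLeftModuleIsomorphism (D₁ / E) (𝒪/π^ r))
      level₂    : ∃ (LeftModuleMorphisms.IsLeftModuleIsomorphism (D₂ / E) (𝒪/π^ r))

  record GL₂ : Set (c ⊔ ℓ) where
    field
      matrix inv : Mat
      inverseʳ   : matrix *ᴹ inv ≈ᴹ 𝟙
      inverseˡ   : inv *ᴹ matrix ≈ᴹ 𝟙

  open GL₂ using (matrix; inv)

  conj : GL₂ → Mat → Mat
  conj g x = matrix g *ᴹ x *ᴹ inv g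

  conj[_] : GL₂ → Subset → Subset
  conj[ g ] S y = ∃[ x ] x ∈ S × y ≈ᴹ conj g x

  -- k*E*: u is a unit of E, i.e. both u and u⁻¹ lie in E.
  Γ₁ : Subset → Pred GL₂ (c ⊔ ℓ)
  Γ₁ E g = ∃[ a ] ¬ (a ≈ 0#) × Σ[ u ∈ GL₂ ]
    matrix u ∈ E × inv u ∈ E × matrix g ≈ᴹ a ·ᴹ matrix u

  Γ₂ : Subset → Pred GL₂ (c ⊔ ℓ)
  Γ₂ E g = conj[ g ] E ≐ E

  record OptimalEmbedding (H : Order) (E : Subset) : Set (c ⊔ ℓ) where
    L : Subalgebra U
    L = k⟨ H ⟩
    field
      φ                     : ∃ (Subalgebra.carrier L) → Mat
      isAlgebraMonomorphism : IsAlgebraMonomorphism (Subalgebra.rawAlgebra L) 𝕄₂ φ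
      optimal               : ∀ x → φ x ∈ E ⇔ proj₁ x ∈ carrier H

    restriction : ∀ h → h ∈ carrier H → Mat
    restriction h h∈H = φ (h , incl h∈H)

  record OptimalSuborder (H : Order) (E : Subset) : Set (lsuc (c ⊔ ℓ)) where
    field
      order       : Order
      contained   : carrier order ⊆ E
      optimal     : Span U (carrier order) ∩ E ≐ carrier order
      isomorphism : AlgebraIsomorphism (Order.rawAlgebra order) (Order.rawAlgebra H)

  module _ {H : Order} {E : Subset} where
    open OptimalEmbedding using (restriction)
    open OptimalSuborder using (order)

    -- Embeddings are compared on H only: an element of X is a map H → E.
    X-orbit : Pred GL₂ (c ⊔ ℓ) → Rel (OptimalEmbedding H E) (c ⊔ ℓ)
    X-orbit Γ φ ψ = ∃[ g ] g ∈ Γ ×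
      (∀ h (h∈H : h ∈ carrier H) → restriction ψ h h∈H ≈ᴹ conj g (restriction φ h h∈H))

    Y-orbit : Pred GL₂ (c ⊔ ℓ) → Rel (OptimalSuborder H E) (c ⊔ ℓ)
    Y-orbit Γ S T = ∃[ g ] g ∈ Γ × carrier (order T) ≐ conj[ g ] (carrier (order S))

  record EmbeddingNumbers (H : Order) (E : Subset) (e : ℕ × ℕ × ℕ × ℕ) : Set (lsuc (c ⊔ ℓ)) where
    private
      e₁ = proj₁ e
      e₂ = proj₁ (proj₂ e)
      e₃ = proj₁ (proj₂ (proj₂ e))
      e₄ = proj₂ (proj₂ (proj₂ e))
    field
      ∣X/Γ₁∣ : HasCardinality (OptimalEmbedding H E) (X-orbit (Γ₁ E)) e₁
      ∣X/Γ₂∣ : HasCardinality (OptimalEmbedding H E) (X-orbit (Γ₂ E)) e₂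
      ∣Y/Γ₁∣ : HasCardinality (OptimalSuborder H E) (Y-orbit (Γ₁ E)) e₃
      ∣Y/Γ₂∣ : HasCardinality (OptimalSuborder H E) (Y-orbit (Γ₂ E)) e₄

  _^[_] : Order → ℕ → Order
  H ^[ t ] = record
    { subalgebra = record
      { carrier  = Hᵗ
      ; respects = λ x≈y (a , h , a∈ , h∈ , x≈) → a , h , a∈ , h∈ , ≈ᴹ-trans (≈ᴹ-sym x≈y) x≈
      ; 0-closed = 0# , 0ᴹ , 0∈𝒪 , H.0-closed , 0≈
      ; 1-closed = 1# , 0ᴹ , 1∈𝒪 , H.0-closed , 1≈
      ; +-closed = λ (a , h , a∈ , h∈ , x≈) (b , i , b∈ , i∈ , y≈) →
          a + b , h +ᴹ i , +∈𝒪 a∈ b∈ , H.+-closed h∈ i∈ , ≈ᴹ-trans (+ᴹ-cong x≈ y≈) (+≈ a b h i)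
      ; *-closed = λ (a , h , a∈ , h∈ , x≈) (b , i , b∈ , i∈ , y≈) →
          a * b , a ·ᴹ i +ᴹ b ·ᴹ h +ᴹ q ·ᴹ (h *ᴹ i) , *∈𝒪 a∈ b∈ ,
          H.+-closed (H.+-closed (H.·-closed a∈ i∈) (H.·-closed b∈ h∈))
                     (H.·-closed (π^∈𝒪 t) (H.*-closed h∈ i∈)) ,
          ≈ᴹ-trans (*ᴹ-cong x≈ y≈) (*≈ a b h i)
      ; -‿closed = λ {x} x∈ → let (a , h , a∈ , h∈ , e) = scale -1∈𝒪 x∈ in
          a , h , a∈ , h∈ , ≈ᴹ-trans (≈ᴹ-sym (-ᴹ≈-1· x)) e
      ; ·-closed = scale
      }
    ; finitelyGenerated = ℕ.suc n , 𝟙 ∷ (λ i → q ·ᴹ g i) , to , from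
    }
    where
    module H = Order H
    q = π^ t
    n = proj₁ H.finitelyGenerated
    g = proj₁ (proj₂ H.finitelyGenerated)

    Hᵗ : Subset
    Hᵗ x = ∃[ a ] ∃[ h ] a ∈ 𝒪 × h ∈ H.carrier × x ≈ᴹ a ·ᴹ 𝟙 +ᴹ q ·ᴹ h

    0≈ : 0ᴹ ≈ᴹ 0# ·ᴹ 𝟙 +ᴹ q ·ᴹ 0ᴹ
    0≈ = mat≈ d o o d
      where
      d : 0# ≈ 0# * 1# + q * 0#
      d = solve 1 (λ q → con 0 := con 0 :* con 1 :+ q :* con 0) refl q
      o : 0# ≈ 0# * 0# + q * 0#
      o = solve 1 (λ q → con 0 := con 0 :* con 0 :+ q :* con 0) refl q

    1≈ : 𝟙 ≈ᴹ 1# ·ᴹ 𝟙 +ᴹ q ·ᴹ 0ᴹ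
    1≈ = mat≈ d o o d
      where
      d : 1# ≈ 1# * 1# + q * 0#
      d = solve 1 (λ q → con 1 := con 1 :* con 1 :+ q :* con 0) refl q
      o : 0# ≈ 1# * 0# + q * 0#
      o = solve 1 (λ q → con 0 := con 1 :* con 0 :+ q :* con 0) refl q

    +≈ : ∀ a b h i → (a ·ᴹ 𝟙 +ᴹ q ·ᴹ h) +ᴹ (b ·ᴹ 𝟙 +ᴹ q ·ᴹ i) ≈ᴹ (a + b) ·ᴹ 𝟙 +ᴹ q ·ᴹ (h +ᴹ i)
    +≈ a b h i = mat≈ (entry _ _ _) (entry _ _ _) (entry _ _ _) (entry _ _ _)
      where
      entry : ∀ e x y → (a * e + q * x) + (b * e + q * y) ≈ (a + b) * e + q * (x + y)
      entry e x y = solve 6 (λ a b q e x y →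
        (a :* e :+ q :* x) :+ (b :* e :+ q :* y) := (a :+ b) :* e :+ q :* (x :+ y)) refl a b q e x y

    *≈ : ∀ a b h i → (a ·ᴹ 𝟙 +ᴹ q ·ᴹ h) *ᴹ (b ·ᴹ 𝟙 +ᴹ q ·ᴹ i) ≈ᴹ
                     (a * b) ·ᴹ 𝟙 +ᴹ q ·ᴹ (a ·ᴹ i +ᴹ b ·ᴹ h +ᴹ q ·ᴹ (h *ᴹ i))
    *≈ a b (mat h₁ h₂ h₃ h₄) (mat i₁ i₂ i₃ i₄) =
      mat≈ (e₁₁ h₁ h₂ i₁ i₃) (e₁₂ h₁ h₂ i₂ i₄) (e₂₁ h₃ h₄ i₁ i₃) (e₂₂ h₃ h₄ i₂ i₄)
      where
      e₁₁ : ∀ h h′ i i′ → (a * 1# + q * h) * (b * 1# + q * i) + (a * 0# + q * h′) * (b * 0# + q * i′) ≈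
                          (a * b) * 1# + q * (a * i + b * h + q * (h * i + h′ * i′))
      e₁₁ h h′ i i′ = solve 7 (λ a b q h h′ i i′ →
        (a :* con 1 :+ q :* h) :* (b :* con 1 :+ q :* i) :+ (a :* con 0 :+ q :* h′) :* (b :* con 0 :+ q :* i′) :=
        (a :* b) :* con 1 :+ q :* (a :* i :+ b :* h :+ q :* (h :* i :+ h′ :* i′))) refl a b q h h′ i i′
      e₁₂ : ∀ h h′ i i′ → (a * 1# + q * h) * (b * 0# + q * i) + (a * 0# + q * h′) * (b * 1# + q * i′) ≈
                          (a * b) * 0# + q * (a * i + b * h′ + q * (h * i + h′ * i′))
      e₁₂ h h′ i i′ = solve 7 (λ a b q h h′ i i′ →
        (a :* con 1 :+ q :* h) :* (b :* con 0 :+ q :* i) :+ (a :* con 0 :+ q :* h′) :* (b :* con 1 :+ q :* i′) :=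
        (a :* b) :* con 0 :+ q :* (a :* i :+ b :* h′ :+ q :* (h :* i :+ h′ :* i′))) refl a b q h h′ i i′
      e₂₁ : ∀ h h′ i i′ → (a * 0# + q * h) * (b * 1# + q * i) + (a * 1# + q * h′) * (b * 0# + q * i′) ≈
                          (a * b) * 0# + q * (a * i′ + b * h + q * (h * i + h′ * i′))
      e₂₁ h h′ i i′ = solve 7 (λ a b q h h′ i i′ →
        (a :* con 0 :+ q :* h) :* (b :* con 1 :+ q :* i) :+ (a :* con 1 :+ q :* h′) :* (b :* con 0 :+ q :* i′) :=
        (a :* b) :* con 0 :+ q :* (a :* i′ :+ b :* h :+ q :* (h :* i :+ h′ :* i′))) refl a b q h h′ i i′
      e₂₂ : ∀ h h′ i i′ → (a * 0# + q * h) * (b * 0# + q * i) + (a * 1# + q * h′) * (b * 1# + q * i′) ≈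
                          (a * b) * 1# + q * (a * i′ + b * h′ + q * (h * i + h′ * i′))
      e₂₂ h h′ i i′ = solve 7 (λ a b q h h′ i i′ →
        (a :* con 0 :+ q :* h) :* (b :* con 0 :+ q :* i) :+ (a :* con 1 :+ q :* h′) :* (b :* con 1 :+ q :* i′) :=
        (a :* b) :* con 1 :+ q :* (a :* i′ :+ b :* h′ :+ q :* (h :* i :+ h′ :* i′))) refl a b q h h′ i i′

    ·≈ : ∀ b a h → b ·ᴹ (a ·ᴹ 𝟙 +ᴹ q ·ᴹ h) ≈ᴹ (b * a) ·ᴹ 𝟙 +ᴹ q ·ᴹ (b ·ᴹ h)
    ·≈ b a h = mat≈ (entry _ _) (entry _ _) (entry _ _) (entry _ _)
      where
      entry : ∀ e x → b * (a * e + q * x) ≈ (b * a) * e + q * (b * x)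
      entry e x = solve 5 (λ b a q e x →
        b :* (a :* e :+ q :* x) := (b :* a) :* e :+ q :* (b :* x)) refl b a q e x

    scale : ∀ {b x} → b ∈ 𝒪 → x ∈ Hᵗ → b ·ᴹ x ∈ Hᵗ
    scale {b} b∈ (a , h , a∈ , h∈ , x≈) =
      b * a , b ·ᴹ h , *∈𝒪 b∈ a∈ , H.·-closed b∈ h∈ , ≈ᴹ-trans (·ᴹ-congˡ x≈) (·≈ b a h)

    G : Pred Mat ℓ
    G x = ∃[ i ] x ≈ᴹ (𝟙 ∷ λ i → q ·ᴹ g i) i

    scaled : ∀ {h} → h ∈ Span 𝒪 (λ x → ∃[ i ] x ≈ᴹ g i) → q ·ᴹ h ∈ Span 𝒪 G
    scaled (incl (i , x≈)) = incl (suc i , ·ᴹ-congˡ x≈)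
    scaled zero            = mul (π^∈𝒪 t) zero
    scaled (add x∈ y∈)     =
      resp (mat≈ (sym (distribˡ _ _ _)) (sym (distribˡ _ _ _))
                 (sym (distribˡ _ _ _)) (sym (distribˡ _ _ _)))
           (add (scaled x∈) (scaled y∈))
    scaled (mul {a} a∈ x∈) = resp (mat≈ (swap _) (swap _) (swap _) (swap _)) (mul a∈ (scaled x∈))
      where
      swap : ∀ x → a * (q * x) ≈ q * (a * x)
      swap = λ x → solve 3 (λ a q x → a :* (q :* x) := q :* (a :* x)) refl a q x
    scaled (resp x≈y x∈)   = resp (·ᴹ-congˡ x≈y) (scaled x∈)

    to : Hᵗ ⊆ Span 𝒪 G
    to (a , h , a∈ , h∈ , x≈) = resp (≈ᴹ-sym x≈)
      (add (mul a∈ (incl (zero , ≈ᴹ-refl)))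
           (scaled (proj₁ (proj₂ (proj₂ H.finitelyGenerated)) h∈)))

    from : Span 𝒪 G ⊆ Hᵗ
    from (incl (zero , x≈))  = 1# , 0ᴹ , 1∈𝒪 , H.0-closed , ≈ᴹ-trans x≈ 1≈
    from (incl (suc i , x≈)) = 0# , g i , 0∈𝒪 ,
      proj₂ (proj₂ (proj₂ H.finitelyGenerated)) (incl (i , ≈ᴹ-refl)) ,
      ≈ᴹ-trans x≈ (mat≈ (entry _ _) (entry _ _) (entry _ _) (entry _ _))
      where
      entry : ∀ e x → q * x ≈ 0# * e + q * x
      entry e x = solve 3 (λ q e x → q :* x := con 0 :* e :+ q :* x) refl q e x
    from zero                = 0# , 0ᴹ , 0∈𝒪 , H.0-closed , 0≈
    from (add x∈ y∈)         = let (a , h , a∈ , h∈ , x≈) = from x∈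
                                   (b , i , b∈ , i∈ , y≈) = from y∈ in
      a + b , h +ᴹ i , +∈𝒪 a∈ b∈ , H.+-closed h∈ i∈ , ≈ᴹ-trans (+ᴹ-cong x≈ y≈) (+≈ a b h i)
    from (mul a∈ x∈)         = scale a∈ (from x∈)
    from (resp x≈y x∈)       = let (a , h , a∈ , h∈ , x≈) = from x∈ in
      a , h , a∈ , h∈ , ≈ᴹ-trans (≈ᴹ-sym x≈y) x≈

  H₀ : Order
  H₀ = record
    { subalgebra = record
      { carrier  = T
      ; respects = λ x≈y (a , b , d , a∈ , b∈ , d∈ , x≈) →
          a , b , d , a∈ , b∈ , d∈ , ≈ᴹ-trans (≈ᴹ-sym x≈y) x≈
      ; 0-closed = 0T
      ; 1-closed = 1# , 0# , 1# , 1∈𝒪 , 0∈𝒪 , 1∈𝒪 , ≈ᴹ-refl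
      ; +-closed = addT
      ; *-closed = λ (a , b , d , a∈ , b∈ , d∈ , x≈) (a′ , b′ , d′ , a′∈ , b′∈ , d′∈ , y≈) →
          a * a′ , a * b′ + b * d′ , d * d′ ,
          *∈𝒪 a∈ a′∈ , +∈𝒪 (*∈𝒪 a∈ b′∈) (*∈𝒪 b∈ d′∈) , *∈𝒪 d∈ d′∈ ,
          ≈ᴹ-trans (*ᴹ-cong x≈ y≈) (mat≈
            (solve 3 (λ a b a′ → a :* a′ :+ b :* con 0 := a :* a′) refl a b a′)
            refl
            (solve 2 (λ d a′ → con 0 :* a′ :+ d :* con 0 := con 0) refl d a′)
            (solve 3 (λ d b′ d′ → con 0 :* b′ :+ d :* d′ := d :* d′) refl d b′ d′))
      ; -‿closed = λ {x} x∈ → let (a , b , d , a∈ , b∈ , d∈ , e) = scale -1∈𝒪 x∈ in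
          a , b , d , a∈ , b∈ , d∈ , ≈ᴹ-trans (≈ᴹ-sym (-ᴹ≈-1· x)) e
      ; ·-closed = scale
      }
    ; finitelyGenerated = 3 , E₁₁ ∷ E₁₂ ∷ E₂₂ ∷ [] , to , from
    }
    where
    T : Subset
    T x = ∃[ a ] ∃[ b ] ∃[ d ] a ∈ 𝒪 × b ∈ 𝒪 × d ∈ 𝒪 × x ≈ᴹ mat a b 0# d

    E₁₁ E₁₂ E₂₂ : Mat
    E₁₁ = mat 1# 0# 0# 0#
    E₁₂ = mat 0# 1# 0# 0#
    E₂₂ = mat 0# 0# 0# 1#

    0T : 0ᴹ ∈ T
    0T = 0# , 0# , 0# , 0∈𝒪 , 0∈𝒪 , 0∈𝒪 , ≈ᴹ-refl

    addT : ∀ {x y} → x ∈ T → y ∈ T → x +ᴹ y ∈ T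
    addT (a , b , d , a∈ , b∈ , d∈ , x≈) (a′ , b′ , d′ , a′∈ , b′∈ , d′∈ , y≈) =
      a + a′ , b + b′ , d + d′ , +∈𝒪 a∈ a′∈ , +∈𝒪 b∈ b′∈ , +∈𝒪 d∈ d′∈ ,
      ≈ᴹ-trans (+ᴹ-cong x≈ y≈) (mat≈ refl refl (+-identityˡ 0#) refl)

    scale : ∀ {a x} → a ∈ 𝒪 → x ∈ T → a ·ᴹ x ∈ T
    scale {e} e∈ (a , b , d , a∈ , b∈ , d∈ , x≈) =
      e * a , e * b , e * d , *∈𝒪 e∈ a∈ , *∈𝒪 e∈ b∈ , *∈𝒪 e∈ d∈ ,
      ≈ᴹ-trans (·ᴹ-congˡ x≈) (mat≈ refl refl (zeroʳ e) refl)

    G : Pred Mat ℓ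
    G x = ∃[ i ] x ≈ᴹ (E₁₁ ∷ E₁₂ ∷ E₂₂ ∷ []) i

    to : T ⊆ Span 𝒪 G
    to (a , b , d , a∈ , b∈ , d∈ , x≈) = resp (≈ᴹ-trans sum≈ (≈ᴹ-sym x≈))
      (add (add (mul a∈ (incl (zero , ≈ᴹ-refl))) (mul b∈ (incl (suc zero , ≈ᴹ-refl))))
           (mul d∈ (incl (suc (suc zero) , ≈ᴹ-refl))))
      where
      sum≈ : a ·ᴹ E₁₁ +ᴹ b ·ᴹ E₁₂ +ᴹ d ·ᴹ E₂₂ ≈ᴹ mat a b 0# d
      sum≈ = mat≈
        (solve 3 (λ a b d → a :* con 1 :+ b :* con 0 :+ d :* con 0 := a) refl a b d)
        (solve 3 (λ a b d → a :* con 0 :+ b :* con 1 :+ d :* con 0 := b) refl a b d)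
        (solve 3 (λ a b d → a :* con 0 :+ b :* con 0 :+ d :* con 0 := con 0) refl a b d)
        (solve 3 (λ a b d → a :* con 0 :+ b :* con 0 :+ d :* con 1 := d) refl a b d)

    from : Span 𝒪 G ⊆ T
    from (incl (zero , x≈))             = 1# , 0# , 0# , 1∈𝒪 , 0∈𝒪 , 0∈𝒪 , x≈
    from (incl (suc zero , x≈))         = 0# , 1# , 0# , 0∈𝒪 , 1∈𝒪 , 0∈𝒪 , x≈
    from (incl (suc (suc zero) , x≈))   = 0# , 0# , 1# , 0∈𝒪 , 0∈𝒪 , 1∈𝒪 , x≈
    from zero                           = 0T
    from (add x∈ y∈)                    = addT (from x∈) (from y∈)
    from (mul a∈ x∈)                    = scale a∈ (from x∈)
    from (resp x≈y x∈)                  = let (a , b , d , a∈ , b∈ , d∈ , x≈) = from x∈ in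
      a , b , d , a∈ , b∈ , d∈ , ≈ᴹ-trans (≈ᴹ-sym x≈y) x≈

{-# OPTIONS --safe #-}
-- A maximal order is conjugate to M₂(𝒪), because by maximality it is the full
-- stabiliser of the lattice of its first columns.  The Cartan decomposition turns an
-- Eichler order of level r into h E h⁻¹ with E = (𝒪 𝒪 ; πʳ𝒪 𝒪).  An embedding of
-- H = H₀^[t] is conjugation by some P ∈ GL₂(k), unique up to scalars, and it is
-- optimal when g = h⁻¹ P satisfies g x g⁻¹ ∈ E ⇔ x ∈ H for all upper triangular
-- x.  Testing this on a few matrices x shows that 2t ≤ r and that, up to k*E*
-- on the left, g or w g equals M b(x , z), where M = (1 0 ; πʳ⁻ᵗ πᵗ),
-- b(x , z) = (1 x ; 0 z) with x ∈ 𝒪 and z ∈ 𝒪*, and w = (0 1 ; πʳ 0).  The class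
-- of M b(x , z) determines x and z modulo πᵗ, which leaves
-- pᵗ · (p - 1) pᵗ⁻¹ classes.  The classes of M b and w M b are disjoint if r > 2t
-- (compare first columns); if r = 2t, then w identifies (x , z) with
-- (x + z , - z), a free involution for t > 0.  The normaliser of E is k*E* ∪ w k*E*,
-- because its elements are the optimal ones for t = 0.  Finally suborders
-- correspond to double cosets, and b(x , z) normalises H.
module Submission where

open import Algebra.Bundles using (CommutativeRing; Ring; Group)
open import Algebra.Module.Morphism.Structures using (module LeftModuleMorphisms)
open import Algebra.Morphism.Structures using (module RingMorphisms)
import Algebra.Properties.AbelianGroup as AbelianGroupProperties
import Algebra.Properties.Group as GroupProperties
import Algebra.Properties.Ring as RingProperties
import Algebra.Properties.Semiring.Exp as Exp
import Algebra.Properties.Semiring.Mult.TCOptimised as Mult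
import Algebra.Solver.Ring as RingSolver
open import Algebra.Solver.Ring.AlmostCommutativeRing
  using (fromCommutativeRing; _-Raw-AlmostCommutative⟶_)
open import Algebra.Structures using (IsGroup)
open import Data.Bool.Base using (Bool; true; false; if_then_else_)
open import Data.Empty using (⊥-elim; ⊥)
open import Data.Fin.Base as Fin using (Fin; zero; suc; combine; remQuot; punchIn; punchOut)
import Data.Fin.Properties as Finₚ
open import Data.Integer.Base as ℤ using (ℤ; +_; -[1+_]; _⊖_; 0ℤ; 1ℤ; +≤+)
import Data.Integer.Properties as ℤₚ
open import Data.Maybe.Base as Maybe using (zipWith)
open import Data.Nat.Base as ℕ using (ℕ; zero; suc; z≤n; s≤s)
import Data.Nat.Properties as ℕₚ
open import Data.Nat.Solver using (module +-*-Solver)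
open import Data.Product.Base using (∃; ∃-syntax; _×_; _,_; proj₁; proj₂; Σ-syntax)
open import Data.Product.Relation.Binary.Pointwise.NonDependent using (Pointwise)
open import Data.Sum.Base as Sum using (_⊎_; inj₁; inj₂)
open import Data.Vec.Functional using (Vector; []; _∷_)
open import Defs
  using (HasCardinality; LocalField; module Matrices; IsAlgebraMonomorphism; AlgebraIsomorphism)
open import Function.Base using (_∘_; _on_)
open import Function.Bundles using (_⇔_; mk⇔; module Equivalence)
open import Function.Structures using (IsBijection)
open import Level using (Level; _⊔_)
open import Relation.Binary.Bundles using (Setoid)
open import Relation.Binary.Core using (Rel)
open import Relation.Binary.Definitions using (tri<; tri≈; tri>)
open import Relation.Binary.PropositionalEquality as ≡ using (_≡_; _≢_)
import Relation.Binary.Reasoning.Setoid as SetoidReasoning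
open import Relation.Nullary using (¬_; Dec; yes; no; does)
open import Relation.Nullary.Construct.Add.Supremum using (⊤⁺; [_])
open import Relation.Nullary.Decidable using (dec⇒maybe; dec-true; dec-false)
open import Relation.Unary using (Pred; Decidable; _∈_; _∉_; _⊆_; U)
open import Relation.Binary.Construct.Add.Supremum.NonStrict ℤ._≤_ using (_≤⁺_; [_]; _≤⊤⁺)

-- In the Bruhat-Tits tree the standard order E fixes a path of length r, with vertices the lattices
-- spanned by e₁ and πⁱe₂ for 0 ≤ i ≤ r. The first column (a , c) of g is an end of the tree, and if
-- 0 ≤ v(c/a) ≤ r its ray leaves the path at distance v(c/a) from one extremity and r - v(c/a) from
-- the other. Optimality puts the branching point at distance t from an extremity. This is the
-- origin of the entry πʳ⁻ᵗ of M and of the bound 2t ≤ r, and the reason why w, which reverses the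
-- path, may be needed. Comparing c² with πʳa² decides which half of the path contains the branching
-- point, whatever the parity of r. All four numbers count classes of one set, that of the optimal
-- g. The scalar ambiguity of P costs nothing, as scalars belong to both groups; a suborder also
-- forgets how H is mapped onto it, hence the second group acting on the right. Right multiplication
-- by elements b(x , z) changes the parameters but not the side of the path, so that only the side
-- can distinguish suborders.

open Equivalence using (to; from)

-- The ring solver with integer coefficients, which cancels x - x (the solvers
-- of the standard library for an abstract ring do not).
module IntegerSolver {c ℓ} (R : CommutativeRing c ℓ) where
  open CommutativeRing R
  open RingProperties ring using (-‿distribˡ-*; -‿distribʳ-*; -‿involutive; -0#≈0#)
  open AbelianGroupProperties +-abelianGroup using (⁻¹-∙-comm)
  open Mult semiring using (×1-homo-*; ×-homo-+; 1+×) renaming (_×_ to _·ℕ_)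
  open import Relation.Binary.Reasoning.Setoid setoid

  ⟦_⟧ : ℤ → Carrier
  ⟦ + n ⟧      = n ·ℕ 1#
  ⟦ -[1+ n ] ⟧ = - (suc n ·ℕ 1#)

  ⟦-⟧ : ∀ i → ⟦ ℤ.- i ⟧ ≈ - ⟦ i ⟧
  ⟦-⟧ (+ zero)  = sym -0#≈0#
  ⟦-⟧ (+ suc n) = refl
  ⟦-⟧ -[1+ n ]  = sym (-‿involutive _)

  ⟦⊖⟧ : ∀ m n → ⟦ m ⊖ n ⟧ ≈ m ·ℕ 1# - n ·ℕ 1#
  ⟦⊖⟧ m       zero    = sym (trans (+-congˡ -0#≈0#) (+-identityʳ _))
  ⟦⊖⟧ zero    (suc n) = sym (+-identityˡ _)
  ⟦⊖⟧ (suc m) (suc n) = begin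
    ⟦ suc m ⊖ suc n ⟧                        ≡⟨ ≡.cong ⟦_⟧ (ℤₚ.[1+m]⊖[1+n]≡m⊖n m n) ⟩
    ⟦ m ⊖ n ⟧                                ≈⟨ ⟦⊖⟧ m n ⟩
    m ·ℕ 1# - n ·ℕ 1#                          ≈⟨ +-congʳ (+-identityʳ _) ⟨
    (m ·ℕ 1# + 0#) - n ·ℕ 1#                   ≈⟨ +-congʳ (+-congˡ (-‿inverseʳ 1#)) ⟨
    (m ·ℕ 1# + (1# - 1#)) - n ·ℕ 1#            ≈⟨ +-congʳ (+-assoc _ _ _) ⟨
    ((m ·ℕ 1# + 1#) - 1#) - n ·ℕ 1#            ≈⟨ +-congʳ (+-congʳ (+-comm _ _)) ⟩
    ((1# + m ·ℕ 1#) - 1#) - n ·ℕ 1#            ≈⟨ +-assoc _ _ _ ⟩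
    (1# + m ·ℕ 1#) + (- 1# - n ·ℕ 1#)          ≈⟨ +-congˡ (⁻¹-∙-comm _ _) ⟩
    (1# + m ·ℕ 1#) - (1# + n ·ℕ 1#)            ≈⟨ +-cong (1+× m 1#) (-‿cong (1+× n 1#)) ⟨
    suc m ·ℕ 1# - suc n ·ℕ 1#                  ∎

  ⟦+⟧ : ∀ i j → ⟦ i ℤ.+ j ⟧ ≈ ⟦ i ⟧ + ⟦ j ⟧
  ⟦+⟧ (+ m)      (+ n)      = ×-homo-+ 1# m n
  ⟦+⟧ (+ m)      -[1+ n ]   = ⟦⊖⟧ m (suc n)
  ⟦+⟧ -[1+ m ]   (+ n)      = trans (⟦⊖⟧ n (suc m)) (+-comm _ _)
  ⟦+⟧ -[1+ m ]   -[1+ n ]   = begin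
    - (suc (suc (m ℕ.+ n)) ·ℕ 1#)         ≡⟨ ≡.cong (λ k → - (suc k ·ℕ 1#)) (ℕₚ.+-suc m n) ⟨
    - ((suc m ℕ.+ suc n) ·ℕ 1#)           ≈⟨ -‿cong (×-homo-+ 1# (suc m) (suc n)) ⟩
    - (suc m ·ℕ 1# + suc n ·ℕ 1#)          ≈⟨ ⁻¹-∙-comm _ _ ⟨
    - (suc m ·ℕ 1#) - suc n ·ℕ 1#          ∎

  private
    ⟦+*⟧ : ∀ m j → ⟦ + m ℤ.* j ⟧ ≈ ⟦ + m ⟧ * ⟦ j ⟧
    ⟦+*⟧ m (+ n)     = trans (reflexive (≡.cong ⟦_⟧ (≡.sym (ℤₚ.pos-* m n)))) (×1-homo-* m n)
    ⟦+*⟧ m -[1+ n ] = begin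
      ⟦ + m ℤ.* -[1+ n ] ⟧        ≡⟨ ≡.cong ⟦_⟧ (ℤₚ.neg-distribʳ-* (+ m) (+ suc n)) ⟨
      ⟦ ℤ.- (+ m ℤ.* + suc n) ⟧   ≈⟨ ⟦-⟧ (+ m ℤ.* + suc n) ⟩
      - ⟦ + m ℤ.* + suc n ⟧       ≈⟨ -‿cong (⟦+*⟧ m (+ suc n)) ⟩
      - (m ·ℕ 1# * (suc n ·ℕ 1#))   ≈⟨ -‿distribʳ-* _ _ ⟩
      m ·ℕ 1# * - (suc n ·ℕ 1#)     ∎

  ⟦*⟧ : ∀ i j → ⟦ i ℤ.* j ⟧ ≈ ⟦ i ⟧ * ⟦ j ⟧
  ⟦*⟧ (+ m)    j = ⟦+*⟧ m j
  ⟦*⟧ -[1+ m ] j = begin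
    ⟦ -[1+ m ] ℤ.* j ⟧          ≡⟨ ≡.cong ⟦_⟧ (ℤₚ.neg-distribˡ-* (+ suc m) j) ⟨
    ⟦ ℤ.- (+ suc m ℤ.* j) ⟧     ≈⟨ ⟦-⟧ (+ suc m ℤ.* j) ⟩
    - ⟦ + suc m ℤ.* j ⟧         ≈⟨ -‿cong (⟦+*⟧ (suc m) j) ⟩
    - (suc m ·ℕ 1# * ⟦ j ⟧)      ≈⟨ -‿distribˡ-* _ _ ⟩
    - (suc m ·ℕ 1#) * ⟦ j ⟧      ∎

  morphism : ℤ.+-*-rawRing -Raw-AlmostCommutative⟶ fromCommutativeRing R
  morphism = record
    { ⟦_⟧ = ⟦_⟧ ; +-homo = ⟦+⟧ ; *-homo = ⟦*⟧ ; -‿homo = ⟦-⟧ ; 0-homo = refl ; 1-homo = refl }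

  open RingSolver ℤ.+-*-rawRing (fromCommutativeRing R) morphism
    (λ i j → Maybe.map (λ i≡j → reflexive (≡.cong ⟦_⟧ i≡j)) (dec⇒maybe (i ℤₚ.≟ j)))
    public using (solve; _:+_; _:*_; _:-_; :-_; _:=_; con; Polynomial)

  :0 :1 : ∀ {n} → Polynomial n
  :0 = con (+ 0)
  :1 = con (+ 1)

-- Counting the classes of an equivalence relation.

module Cardinality where
  open ≡ using (refl; sym; trans; cong; cong₂)

  private
    variable
      a b r s : Level
      A B : Set a
      _~_ _≈_ : Rel A r
      m n : ℕ

  -- `~` is the kernel of `f`, so its being an equivalence relation, which `IsBijection` demands,
  -- comes for free.
  card-intro : (f : A → Fin n) → (∀ x y → x ~ y ⇔ f x ≡ f y) → (∀ i → ∃[ x ] f x ≡ i) →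
               HasCardinality A _~_ n
  card-intro f f-⇔ f-onto = f , record
    { isInjection = record
      { isCongruent = record
        { cong = to (f-⇔ _ _)
        ; isEquivalence₁ = record
          { refl  = from (f-⇔ _ _) refl
          ; sym   = λ x~y → from (f-⇔ _ _) (sym (to (f-⇔ _ _) x~y))
          ; trans = λ x~y y~z → from (f-⇔ _ _) (trans (to (f-⇔ _ _) x~y) (to (f-⇔ _ _) y~z))
          }
        ; isEquivalence₂ = ≡.isEquivalence
        }
      ; injective = from (f-⇔ _ _)
      }
    ; surjective = λ i → let (x , fx≡i) = f-onto i in x , λ z~x → trans (to (f-⇔ _ _) z~x) fx≡i
    }

  module Card {A : Set a} {_~_ : Rel A r} (c : HasCardinality A _~_ n) where
    index : A → Fin n
    index = proj₁ c

    open IsBijection (proj₂ c) public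
      renaming (cong to index-cong; injective to index-injective)
      using (module Eq₁)

    element : Fin n → A
    element i = proj₁ (IsBijection.surjective (proj₂ c) i)

    index-element : ∀ i → index (element i) ≡ i
    index-element i = proj₂ (IsBijection.surjective (proj₂ c) i) Eq₁.refl

  card-transfer : (F : A → B) → (∀ x y → x ~ y ⇔ F x ≈ F y) → (∀ y → ∃[ x ] F x ≈ y) →
                  HasCardinality B _≈_ n → HasCardinality A _~_ n
  card-transfer F F-⇔ F-onto c = card-intro (index ∘ F)
    (λ x y → mk⇔ (index-cong ∘ to (F-⇔ x y)) (from (F-⇔ x y) ∘ index-injective))
    (λ i → let (x , Fx≈) = F-onto (element i) in x , trans (index-cong Fx≈) (index-element i))
    where open Card c

  card-≤ : HasCardinality A _~_ m → HasCardinality A _~_ n → m ℕ.≤ n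
  card-≤ c d = Finₚ.injective⇒≤ {f = D.index ∘ C.element} λ {i} {j} eq →
    trans (sym (C.index-element i)) (trans (C.index-cong (D.index-injective eq)) (C.index-element j))
    where module C = Card c
          module D = Card d

  card-unique : HasCardinality A _~_ m → HasCardinality A _~_ n → m ≡ n
  card-unique c d = ℕₚ.≤-antisym (card-≤ c d) (card-≤ d c)

  card-× : HasCardinality A _~_ m → HasCardinality B _≈_ n →
           HasCardinality (A × B) (Pointwise _~_ _≈_) (m ℕ.* n)
  card-× {m = m} {n = n} c d = card-intro (λ (x , y) → combine (C.index x) (D.index y))
    (λ (x , y) (x′ , y′) → mk⇔
      (λ (x~ , y~) → cong₂ combine (C.index-cong x~) (D.index-cong y~))
      (λ eq → let (ex , ey) = Finₚ.combine-injective (C.index x) (D.index y) (C.index x′) (D.index y′) eq in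
        C.index-injective ex , D.index-injective ey))
    (λ i → let (j , l) = remQuot {m} n i in (C.element j , D.element l) ,
      trans (cong₂ combine (C.index-element j) (D.index-element l)) (Finₚ.combine-remQuot {m} n i))
    where module C = Card c
          module D = Card d

  card-Fin : HasCardinality (Fin n) _≡_ n
  card-Fin = card-intro (λ i → i) (λ _ _ → mk⇔ (λ e → e) (λ e → e)) (λ i → i , refl)

  card-Bool : HasCardinality Bool _≡_ 2
  card-Bool = card-intro (λ { false → zero ; true → suc zero })
    (λ { false false → mk⇔ (λ _ → refl) (λ _ → refl)
       ; true true → mk⇔ (λ _ → refl) (λ _ → refl)
       ; false true → mk⇔ (λ ()) (λ ())
       ; true false → mk⇔ (λ ()) (λ ()) })
    (λ { zero → false , refl ; (suc zero) → true , refl })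

  card-inhabited : (∀ x y → x ~ y) → A → HasCardinality A _~_ 1
  card-inhabited all x = card-intro (λ _ → zero) (λ x y → mk⇔ (λ _ → refl) (λ _ → all x y))
    (λ { zero → x , refl ; (suc ()) })

  card-≢ : (i : Fin n) → HasCardinality (∃[ j ] i ≢ j) (_≡_ on proj₁) (n ℕ.∸ 1)
  card-≢ {suc n} i = card-intro (λ (j , i≢j) → punchOut i≢j)
    (λ (j , i≢j) (k , i≢k) → mk⇔ (Finₚ.punchOut-cong i) (Finₚ.punchOut-injective i≢j i≢k))
    (λ j → (punchIn i j , λ eq → Finₚ.punchInᵢ≢i i j (sym eq)) ,
           trans (Finₚ.punchOut-cong i refl) (Finₚ.punchOut-punchIn i))

  -- The size is left existential: it is identified afterwards, through the value of its double.
  card-Σ : {P : Pred (Fin n) s} → Decidable P → ∃[ m ] HasCardinality (∃ P) (_≡_ on proj₁) m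
  card-Σ {zero}  P? = 0 , card-intro (λ ()) (λ ()) (λ ())
  card-Σ {suc n} {P = P} P? with P? zero | card-Σ {P = P ∘ suc} (P? ∘ suc)
  ... | no ¬p | m , c = m , card-transfer {B = ∃ (P ∘ suc)} {_≈_ = _≡_ on proj₁} F
      (λ { (zero , p) _ → ⊥-elim (¬p p) ; (suc _ , _) (zero , p) → ⊥-elim (¬p p)
         ; (suc i , _) (suc j , _) → mk⇔ Finₚ.suc-injective (cong suc) })
      (λ (i , p) → (suc i , p) , refl) c
    where
    F : ∃ P → ∃ (P ∘ suc)
    F (zero , p)  = ⊥-elim (¬p p)
    F (suc i , p) = i , p
  ... | yes p₀ | m , c = suc m , card-intro F
      (λ { (zero , _) (zero , _) → mk⇔ (λ _ → refl) (λ _ → refl)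
         ; (zero , _) (suc _ , _) → mk⇔ (λ ()) (λ ())
         ; (suc _ , _) (zero , _) → mk⇔ (λ ()) (λ ())
         ; (suc i , p) (suc j , q) → mk⇔ (λ e → cong suc (index-cong (Finₚ.suc-injective e)))
                                         (λ e → cong suc (index-injective (Finₚ.suc-injective e))) })
      (λ { zero → (zero , p₀) , refl
         ; (suc i) → let (j , p) = element i in (suc j , p) , cong suc (index-element i) })
    where
    open Card c
    F : ∃ P → Fin (suc m)
    F (zero , p)  = zero
    F (suc i , p) = suc (index (i , p))

  -- A free involution ι whose orbits contain exactly one element of P: the
  -- elements of P represent the orbits, and A ≅ Bool × (A / ι).
  card-/involution : {A : Set a} {_≈_ : Rel A r} → HasCardinality A _≈_ n →
    (ι : A → A) → (∀ {x y} → x ≈ y → ι x ≈ ι y) → (∀ x → ι (ι x) ≈ x) →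
    {P : Pred A s} → Decidable P → (∀ {x y} → x ≈ y → P x → P y) → (∀ x → P (ι x) ⇔ (¬ P x)) →
    ∃[ m ] 2 ℕ.* m ≡ n × HasCardinality A (λ x y → x ≈ y ⊎ x ≈ ι y) m
  card-/involution {n = n} {A = A} {_≈_ = _≈_} c ι ι-cong ι-involutive {P} P? P-resp P-ι =
    -- `c` and `2k` count the same quotient, so the equation 2k = n is uniqueness of the count.
    k , card-unique 2k c , cA/ι
    where
    open Card c
    open Eq₁ using () renaming (refl to ≈-refl; sym to ≈-sym; trans to ≈-trans)

    _≃_ : Rel A _
    x ≃ y = x ≈ y ⊎ x ≈ ι y

    ≃-sym : ∀ {x y} → x ≃ y → y ≃ x
    ≃-sym (inj₁ e) = inj₁ (≈-sym e)
    ≃-sym (inj₂ e) = inj₂ (≈-trans (≈-sym (ι-involutive _)) (ι-cong (≈-sym e)))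

    ≃-trans : ∀ {x y z} → x ≃ y → y ≃ z → x ≃ z
    ≃-trans (inj₁ e) (inj₁ f) = inj₁ (≈-trans e f)
    ≃-trans (inj₁ e) (inj₂ f) = inj₂ (≈-trans e f)
    ≃-trans (inj₂ e) (inj₁ f) = inj₂ (≈-trans e (ι-cong f))
    ≃-trans (inj₂ e) (inj₂ f) = inj₁ (≈-trans e (≈-trans (ι-cong f) (ι-involutive _)))

    ≃⇒≈ : ∀ {x y} → P x → P y → x ≃ y → x ≈ y
    ≃⇒≈ px py (inj₁ e) = e
    ≃⇒≈ px py (inj₂ e) = ⊥-elim (to (P-ι _) (P-resp e px) py)

    ¬P⇒Pι : ∀ {x} → ¬ P x → P (ι x)
    ¬P⇒Pι = from (P-ι _)

    rep : ∀ x → ∃[ y ] P y × y ≃ x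
    rep x with P? x
    ... | yes p = x , p , inj₁ ≈-refl
    ... | no ¬p = ι x , ¬P⇒Pι ¬p , inj₂ ≈-refl

    PF : Pred (Fin n) _
    PF i = P (element i)

    element-index : ∀ x → element (index x) ≈ x
    element-index x = index-injective (index-element (index x))

    counted = card-Σ {P = PF} (λ i → P? (element i))
    k = proj₁ counted

    cA/ι : HasCardinality A _≃_ k
    cA/ι = card-transfer {B = ∃ PF} {_≈_ = _≡_ on proj₁}
      (λ x → let (y , py , _) = rep x in index y , P-resp (≈-sym (element-index y)) py)
      (λ x y → let (x′ , px , x′≃x) = rep x ; (y′ , py , y′≃y) = rep y in mk⇔
        (λ x≃y → index-cong (≃⇒≈ px py (≃-trans x′≃x (≃-trans x≃y (≃-sym y′≃y)))))
        (λ e → ≃-trans (≃-sym x′≃x) (≃-trans (inj₁ (index-injective e)) y′≃y)))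
      (λ (i , p) → element i , (let (y , py , y≃) = rep (element i) in
        trans (index-cong (≃⇒≈ py p y≃)) (index-element i)))
      (proj₂ counted)

    2k : HasCardinality A _≈_ (2 ℕ.* k)
    2k = card-transfer {B = Bool × A} {_≈_ = Pointwise _≡_ _≃_}
      -- Within an orbit of ι the Boolean separates x from ι x, since exactly one of the two
      -- satisfies `P`.
      (λ x → does (P? x) , x)
      (λ x y → mk⇔
        (λ x≈y → does-cong x≈y , inj₁ x≈y)
        (λ { (e , inj₁ x≈y) → x≈y ; (e , inj₂ x≈ιy) → ⊥-elim (differ x≈ιy e) }))
      (λ (β , x) → choose β x (P? x))
      (card-× card-Bool cA/ι)
      where
      does-cong : ∀ {x y} → x ≈ y → does (P? x) ≡ does (P? y)
      does-cong {x} {y} e with P? y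
      ... | yes p = dec-true (P? x) (P-resp (≈-sym e) p)
      ... | no ¬p = dec-false (P? x) (¬p ∘ P-resp e)

      differ : ∀ {x y} → x ≈ ι y → does (P? x) ≢ does (P? y)
      differ {x} {y} e eq with P? x | P? y
      ... | yes p | yes q = to (P-ι y) (P-resp e p) q
      ... | no ¬p | no ¬q = ¬p (P-resp (≈-sym e) (¬P⇒Pι ¬q))
      differ e () | yes _ | no _
      differ e () | no _ | yes _

      choose : ∀ β x → Dec (P x) → ∃[ y ] (does (P? y) ≡ β × y ≃ x)
      choose true  x (yes p) = x , dec-true (P? x) p , inj₁ ≈-refl
      choose true  x (no ¬p) = ι x , dec-true (P? (ι x)) (¬P⇒Pι ¬p) , inj₂ ≈-refl
      choose false x (yes p) = ι x , dec-false (P? (ι x)) (λ q → to (P-ι x) q p) , inj₂ ≈-refl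
      choose false x (no ¬p) = x , dec-false (P? x) ¬p , inj₁ ≈-refl

-- The valuation ring, the powers of its maximal ideal, its units.

module Valuation {c ℓ} (k : LocalField c ℓ) where
  open LocalField k
  open IntegerSolver commutativeRing public using (solve; _:+_; _:*_; _:-_; :-_; _:=_; :0; :1)
  open Exp semiring using (^-homo-*)

  𝒪-resp : ∀ {x y} → x ≈ y → x ∈ 𝒪 → y ∈ 𝒪
  𝒪-resp x≈y = ≡.subst ([ 0ℤ ] ≤⁺_) (v-cong x≈y)

  private
    []-injective : ∀ {i j : ℤ} → [ i ] ≡ [ j ] → i ≡ j
    []-injective ≡.refl = ≡.refl

    []≢⊤⁺ : ∀ {i : ℤ} → ¬ ([ i ] ≡ ⊤⁺)
    []≢⊤⁺ ()

  _≈0? : ∀ x → Dec (x ≈ 0#)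
  x ≈0? with v x in eq
  ... | ⊤⁺    = yes (to (v-⊤⁺ x) eq)
  ... | [ i ] = no λ x≈0 → []≢⊤⁺ (≡.trans (≡.sym eq) (from (v-⊤⁺ x) x≈0))

  v-*-[] : ∀ {x y i j} → v x ≡ [ i ] → v y ≡ [ j ] → v (x * y) ≡ [ i ℤ.+ j ]
  v-*-[] {x} {y} vx vy = ≡.trans (v-* x y) (≡.cong₂ (zipWith ℤ._+_) vx vy)

  v-1 : v 1# ≡ [ 0ℤ ]
  v-1 with v 1# in eq
  ... | ⊤⁺    = ⊥-elim (1≉0 (to (v-⊤⁺ 1#) eq))
  ... | [ i ] = ≡.cong [_] (x+x≈x⇒x≈0ℤ i ([]-injective
    (≡.trans (≡.sym (v-*-[] eq eq)) (≡.trans (v-cong (*-identityˡ 1#)) eq))))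
    where open RingProperties ℤₚ.+-*-ring using () renaming (x+x≈x⇒x≈0 to x+x≈x⇒x≈0ℤ)

  v-[]⇒≉0 : ∀ {x i} → v x ≡ [ i ] → ¬ (x ≈ 0#)
  v-[]⇒≉0 vx x≈0 = []≢⊤⁺ (≡.trans (≡.sym vx) (from (v-⊤⁺ _) x≈0))

  v-inverse : ∀ {x y i} → x * y ≈ 1# → v x ≡ [ i ] → v y ≡ [ ℤ.- i ]
  v-inverse {x} {y} {i} xy≈1 vx with v y in eq
  ... | ⊤⁺    = ⊥-elim (1≉0 (trans (sym xy≈1) (trans (*-congˡ (to (v-⊤⁺ y) eq)) (zeroʳ x))))
  ... | [ j ] = ≡.cong [_] (inverseʳ-uniqueℤ i j ([]-injective
    (≡.trans (≡.sym (v-*-[] vx eq)) (≡.trans (v-cong xy≈1) v-1))))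
    where open GroupProperties (Ring.+-group ℤₚ.+-*-ring) using () renaming (inverseʳ-unique to inverseʳ-uniqueℤ)

  v-π^ : ∀ n → v (π^ n) ≡ [ + n ]
  v-π^ zero    = v-1
  v-π^ (suc n) = v-*-[] v-π (v-π^ n)

  π^≉0 : ∀ n → ¬ (π^ n ≈ 0#)
  π^≉0 n = v-[]⇒≉0 (v-π^ n)

  v≥⇒∈𝒪 : ∀ {x n} → v x ≡ [ + n ] → x ∈ 𝒪
  v≥⇒∈𝒪 vx = ≡.subst ([ 0ℤ ] ≤⁺_) (≡.sym vx) [ +≤+ z≤n ]

  *-cancel-≉0 : ∀ {x y z} → ¬ (x ≈ 0#) → x * y ≈ x * z → y ≈ z
  *-cancel-≉0 {x} {y} {z} x≉0 e = let (x⁻¹ , xx⁻¹≈1) = inverse x x≉0 in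
    trans (sym (undo xx⁻¹≈1 y)) (trans (*-congˡ e) (undo xx⁻¹≈1 z))
    where
    undo : ∀ {x⁻¹} → x * x⁻¹ ≈ 1# → ∀ u → x⁻¹ * (x * u) ≈ u
    undo {x⁻¹} e u = trans (solve 3 (λ x y u → y :* (x :* u) := (x :* y) :* u) refl x x⁻¹ u)
                           (trans (*-congʳ e) (*-identityˡ u))

  *-≈0 : ∀ {x y} → ¬ (x ≈ 0#) → x * y ≈ 0# → y ≈ 0#
  *-≈0 x≉0 e = *-cancel-≉0 x≉0 (trans e (sym (zeroʳ _)))

  *-≉0 : ∀ {x y} → ¬ (x ≈ 0#) → ¬ (y ≈ 0#) → ¬ (x * y ≈ 0#)
  *-≉0 x≉0 y≉0 = y≉0 ∘ *-≈0 x≉0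

  square≈0 : ∀ {x} → x * x ≈ 0# → x ≈ 0#
  square≈0 {x} e with x ≈0?
  ... | yes x≈0 = x≈0
  ... | no x≉0  = *-≈0 x≉0 e

  *≈1⇒≉0 : ∀ {x y} → x * y ≈ 1# → ¬ (x ≈ 0#)
  *≈1⇒≉0 {y = y} e x≈0 = 1≉0 (trans (sym e) (trans (*-congʳ x≈0) (zeroˡ y)))

  π^-* : ∀ m n → π^ m * π^ n ≈ π^ (m ℕ.+ n)
  π^-* m n = sym (^-homo-* π m n)

  -- Divisibility by πⁿ rather than an inequality of valuations: membership is then proved by
  -- exhibiting the quotient and solving a ring identity. `v≥1⇔𝔭1` is the link to the residue field,
  -- whose congruence is stated through `v`.
  record 𝔭 (n : ℕ) (x : Carrier) : Set (c ⊔ ℓ) where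
    constructor mk𝔭
    field
      quot  : Carrier
      quot∈ : quot ∈ 𝒪
      eq    : x ≈ π^ n * quot

  𝔭-resp : ∀ {n x y} → x ≈ y → x ∈ 𝔭 n → y ∈ 𝔭 n
  𝔭-resp x≈y (mk𝔭 z z∈ e) = mk𝔭 z z∈ (trans (sym x≈y) e)

  𝔭-+ : ∀ {n x y} → x ∈ 𝔭 n → y ∈ 𝔭 n → x + y ∈ 𝔭 n
  𝔭-+ (mk𝔭 z z∈ e) (mk𝔭 w w∈ f) = mk𝔭 (z + w) (+∈𝒪 z∈ w∈) (trans (+-cong e f) (sym (distribˡ _ _ _)))

  𝔭-* : ∀ {m n x y} → x ∈ 𝔭 m → y ∈ 𝔭 n → x * y ∈ 𝔭 (m ℕ.+ n)
  𝔭-* {m} {n} (mk𝔭 z z∈ e) (mk𝔭 w w∈ f) = mk𝔭 (z * w) (*∈𝒪 z∈ w∈) (trans (*-cong e f)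
    (trans (solve 4 (λ a b z w → (a :* z) :* (b :* w) := (a :* b) :* (z :* w)) refl (π^ m) (π^ n) z w)
           (*-congʳ (sym (^-homo-* π m n)))))

  𝔭-*ˡ : ∀ {n a x} → a ∈ 𝒪 → x ∈ 𝔭 n → a * x ∈ 𝔭 n
  𝔭-*ˡ {a = a} a∈ (mk𝔭 z z∈ e) = mk𝔭 (a * z) (*∈𝒪 a∈ z∈)
    (trans (*-congˡ e) (solve 3 (λ a b z → a :* (b :* z) := b :* (a :* z)) refl a _ z))

  𝔭-*ʳ : ∀ {n a x} → x ∈ 𝔭 n → a ∈ 𝒪 → x * a ∈ 𝔭 n
  𝔭-*ʳ x∈ a∈ = 𝔭-resp (*-comm _ _) (𝔭-*ˡ a∈ x∈)

  𝔭-neg : ∀ {n x} → x ∈ 𝔭 n → - x ∈ 𝔭 n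
  𝔭-neg {x = x} x∈ = 𝔭-resp (solve 1 (λ x → (:- :1) :* x := :- x) refl x) (𝔭-*ˡ -1∈𝒪 x∈)

  𝔭-0 : ∀ n → 0# ∈ 𝔭 n
  𝔭-0 n = mk𝔭 0# 0∈𝒪 (sym (zeroʳ _))

  π^∈𝔭 : ∀ n → π^ n ∈ 𝔭 n
  π^∈𝔭 n = mk𝔭 1# 1∈𝒪 (sym (*-identityʳ _))

  𝒪⇒𝔭0 : ∀ {x} → x ∈ 𝒪 → x ∈ 𝔭 0
  𝒪⇒𝔭0 x∈ = mk𝔭 _ x∈ (sym (*-identityˡ _))

  𝔭⇒𝒪 : ∀ {n x} → x ∈ 𝔭 n → x ∈ 𝒪
  𝔭⇒𝒪 {n} (mk𝔭 z z∈ e) = 𝒪-resp (sym e) (*∈𝒪 (π^∈𝒪 n) z∈)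

  𝔭-mono : ∀ {m n x} → m ℕ.≤ n → x ∈ 𝔭 n → x ∈ 𝔭 m
  𝔭-mono {m} {n} m≤n (mk𝔭 z z∈ e) = mk𝔭 (π^ (n ℕ.∸ m) * z) (*∈𝒪 (π^∈𝒪 (n ℕ.∸ m)) z∈) (trans e
    (trans (*-congʳ (trans (reflexive (≡.cong π^_ (≡.sym (ℕₚ.m+[n∸m]≡n m≤n)))) (^-homo-* π m (n ℕ.∸ m))))
           (*-assoc _ _ _)))

  𝔭-cancel : ∀ {m n x} → π^ m * x ∈ 𝔭 (m ℕ.+ n) → x ∈ 𝔭 n
  𝔭-cancel {m} {n} (mk𝔭 z z∈ e) = mk𝔭 z z∈ (*-cancel-≉0 (π^≉0 m)
    (trans e (trans (*-congʳ (^-homo-* π m n)) (*-assoc _ _ _))))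

  v≥1⇔𝔭1 : ∀ x → [ 1ℤ ] ≤⁺ v x ⇔ x ∈ 𝔭 1
  v≥1⇔𝔭1 x = mk⇔ there back
    where
    there : [ 1ℤ ] ≤⁺ v x → x ∈ 𝔭 1
    there v≥1 with v x in eq
    ... | ⊤⁺ = 𝔭-resp (sym (to (v-⊤⁺ x) eq)) (𝔭-0 1)
    there [ +≤+ (s≤s _) ] | [ + suc n ] =
      let (π⁻¹ , ππ⁻¹≈1) = inverse π (v-[]⇒≉0 v-π) in
      mk𝔭 (π⁻¹ * x) (v≥⇒∈𝒪 (v-*-[] (v-inverse ππ⁻¹≈1 v-π) eq))
      (sym (trans (solve 3 (λ p q x → (p :* :1) :* (q :* x) := (p :* q) :* x) refl π π⁻¹ x)
          (trans (*-congʳ ππ⁻¹≈1) (*-identityˡ x))))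

    back : x ∈ 𝔭 1 → [ 1ℤ ] ≤⁺ v x
    back (mk𝔭 z z∈ e) = ≡.subst ([ 1ℤ ] ≤⁺_)
      (≡.sym (≡.trans (v-cong e) (≡.trans (v-* (π^ 1) z) (≡.cong (λ i → zipWith ℤ._+_ i (v z)) (v-π^ 1)))))
      (shift (v z) z∈)
      where
      shift : ∀ i → [ 0ℤ ] ≤⁺ i → [ 1ℤ ] ≤⁺ zipWith ℤ._+_ [ 1ℤ ] i
      shift [ i ] [ 0≤i ] = [ ℤₚ.+-monoʳ-≤ 1ℤ 0≤i ]
      shift ⊤⁺    _       = _ ≤⊤⁺

  record Unit (x : Carrier) : Set (c ⊔ ℓ) where
    constructor unit
    field
      u∈   : x ∈ 𝒪
      u⁻¹  : Carrier
      u⁻¹∈ : u⁻¹ ∈ 𝒪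
      uu⁻¹ : x * u⁻¹ ≈ 1#

  Unit-1 : Unit 1#
  Unit-1 = unit 1∈𝒪 1# 1∈𝒪 (*-identityˡ 1#)

  Unit-resp : ∀ {x y} → x ≈ y → Unit x → Unit y
  Unit-resp x≈y (unit x∈ x⁻¹ x⁻¹∈ e) = unit (𝒪-resp x≈y x∈) x⁻¹ x⁻¹∈ (trans (*-congʳ (sym x≈y)) e)

  Unit-* : ∀ {x y} → Unit x → Unit y → Unit (x * y)
  Unit-* {x} {y} (unit x∈ x⁻¹ x⁻¹∈ e) (unit y∈ y⁻¹ y⁻¹∈ f) =
    unit (*∈𝒪 x∈ y∈) (x⁻¹ * y⁻¹) (*∈𝒪 x⁻¹∈ y⁻¹∈) (trans
      (solve 4 (λ x y x′ y′ → (x :* y) :* (x′ :* y′) := (x :* x′) :* (y :* y′)) refl x y x⁻¹ y⁻¹)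
      (trans (*-cong e f) (*-identityˡ 1#)))

  Unit-⁻¹ : ∀ {x} (u : Unit x) → Unit (Unit.u⁻¹ u)
  Unit-⁻¹ (unit x∈ x⁻¹ x⁻¹∈ e) = unit x⁻¹∈ _ x∈ (trans (*-comm _ _) e)

  Unit-neg : ∀ {x} → Unit x → Unit (- x)
  Unit-neg {x} (unit x∈ x⁻¹ x⁻¹∈ e) = unit (-∈𝒪 x∈) (- x⁻¹) (-∈𝒪 x⁻¹∈)
    (trans (solve 2 (λ x y → :- x :* :- y := x :* y) refl x x⁻¹) e)

  1∉𝔭 : ∀ {n} → 1# ∉ 𝔭 (suc n)
  1∉𝔭 1∈ with ≡.subst ([ 1ℤ ] ≤⁺_) v-1 (from (v≥1⇔𝔭1 1#) (𝔭-mono (s≤s z≤n) 1∈))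
  ... | [ +≤+ () ]

  Unit⇒∉𝔭 : ∀ {n x} → Unit x → x ∉ 𝔭 (suc n)
  Unit⇒∉𝔭 (unit _ _ x⁻¹∈ e) x∈ = 1∉𝔭 (𝔭-resp e (𝔭-*ʳ x∈ x⁻¹∈))

  -- Dividing by πⁿ with n = v(x) leaves an element of valuation 0, and the inverse of such an
  -- element again has valuation 0.
  factor : ∀ {x} → x ∈ 𝒪 → ¬ (x ≈ 0#) → ∃[ n ] ∃[ u ] Unit u × x ≈ π^ n * u
  factor {x} x∈ x≉0 with v x in eq
  ... | ⊤⁺ = ⊥-elim (x≉0 (to (v-⊤⁺ x) eq))
  factor {x} [ () ] x≉0 | [ -[1+ n ] ]
  factor {x} x∈ x≉0     | [ + n ] = n , u , unit (v≥⇒∈𝒪 vu≡0) u⁻¹ (v≥⇒∈𝒪 (v-inverse uu⁻¹≈1 vu≡0)) uu⁻¹≈1 ,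
    sym (trans (sym (*-assoc _ _ _)) (trans (*-congʳ qq⁻¹≈1) (*-identityˡ x)))
    where
    q⁻¹ = proj₁ (inverse (π^ n) (π^≉0 n))
    qq⁻¹≈1 = proj₂ (inverse (π^ n) (π^≉0 n))
    u = q⁻¹ * x
    vu≡0 : v u ≡ [ 0ℤ ]
    vu≡0 = ≡.trans (v-*-[] (v-inverse qq⁻¹≈1 (v-π^ n)) eq) (≡.cong [_] (ℤₚ.+-inverseˡ (+ n)))
    u⁻¹ = proj₁ (inverse u (v-[]⇒≉0 vu≡0))
    uu⁻¹≈1 = proj₂ (inverse u (v-[]⇒≉0 vu≡0))

  unit? : ∀ {x} → x ∈ 𝒪 → Unit x ⊎ x ∈ 𝔭 1
  unit? {x} x∈ with x ≈0?
  ... | yes x≈0 = inj₂ (𝔭-resp (sym x≈0) (𝔭-0 1))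
  ... | no x≉0 with factor x∈ x≉0
  ... | zero  , u , u-unit , e = inj₁ (Unit-resp (sym (trans e (*-identityˡ u))) u-unit)
  ... | suc n , u , u-unit , e = inj₂ (𝔭-mono {n = suc n} (s≤s z≤n) (mk𝔭 u (Unit.u∈ u-unit) e))

  ∈𝒪⊎inverse∈𝔭 : ∀ x → x ∈ 𝒪 ⊎ (∃[ y ] y ∈ 𝔭 1 × x * y ≈ 1#)
  ∈𝒪⊎inverse∈𝔭 x with v x in eq
  ... | ⊤⁺         = inj₁ (_ ≤⊤⁺)
  ... | [ + n ]    = inj₁ [ +≤+ z≤n ]
  ... | [ -[1+ n ] ] = let (y , xy≈1) = inverse x (v-[]⇒≉0 eq) in
    inj₂ (y , to (v≥1⇔𝔭1 y) (≡.subst ([ 1ℤ ] ≤⁺_) (≡.sym (v-inverse xy≈1 eq)) [ +≤+ (s≤s z≤n) ]) , xy≈1)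

  -- Any two elements of k are comparable for divisibility. This drives every case distinction
  -- below: column reduction, the Cartan decomposition, and the choice between g and w g.
  divides : ∀ x y → (∃[ z ] z ∈ 𝒪 × y ≈ x * z) ⊎ (∃[ z ] z ∈ 𝔭 1 × x ≈ y * z)
  divides x y with x ≈0?
  ... | yes x≈0 = inj₂ (0# , 𝔭-0 1 , trans x≈0 (sym (zeroʳ y)))
  ... | no x≉0 with inverse x x≉0
  ... | x⁻¹ , xx⁻¹≈1 with ∈𝒪⊎inverse∈𝔭 (x⁻¹ * y)
  ... | inj₁ z∈ = inj₁ (x⁻¹ * y , z∈ , sym (trans (sym (*-assoc _ _ _)) (trans (*-congʳ xx⁻¹≈1) (*-identityˡ y))))
  ... | inj₂ (z , z∈ , e) = inj₂ (z , z∈ , sym (trans (sym (*-identityˡ _)) (trans (*-congʳ (sym xx⁻¹≈1))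
    (trans (solve 4 (λ x x′ y z → (x :* x′) :* (y :* z) := x :* ((x′ :* y) :* z)) refl x x⁻¹ y z)
           (trans (*-congˡ e) (*-identityʳ x))))))

  -- A non-integral x has an inverse y in 𝔭, and then 1 = x²y² would lie in 𝔭.
  square∈𝒪 : ∀ {x} → x * x ∈ 𝒪 → x ∈ 𝒪
  square∈𝒪 {x} xx∈ with ∈𝒪⊎inverse∈𝔭 x
  ... | inj₁ x∈ = x∈
  ... | inj₂ (y , y∈ , e) = ⊥-elim (1∉𝔭 (𝔭-resp
    (trans (solve 2 (λ x y → (x :* x) :* (y :* y) := (x :* y) :* (x :* y)) refl x y)
           (trans (*-cong e e) (*-identityˡ 1#)))
    (𝔭-*ˡ xx∈ (𝔭-* y∈ y∈))))

-- Digits modulo powers of π and the count of parameters.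

module Residues {c ℓ} (k : LocalField c ℓ) where
  open LocalField k
  open Valuation k
  open Cardinality
  open Card residueField using (index; element; index-cong; index-injective; index-element)

  infix 4 _≋_[mod_] _≋ᵖ_[mod_]

  _≋_[mod_] : Carrier → Carrier → ℕ → Set (c ⊔ ℓ)
  x ≋ y [mod n ] = x - y ∈ 𝔭 n

  mod-reflexive : ∀ {x y n} → x ≈ y → x ≋ y [mod n ]
  mod-reflexive {x} {y} {n} x≈y = 𝔭-resp (sym (trans (+-congʳ x≈y) (-‿inverseʳ y))) (𝔭-0 n)

  mod-sym : ∀ {x y n} → x ≋ y [mod n ] → y ≋ x [mod n ]
  mod-sym {x} {y} e = 𝔭-resp (solve 2 (λ x y → :- (x :- y) := y :- x) refl x y) (𝔭-neg e)

  residue : ∀ {x} → x ∈ 𝒪 → Fin p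
  residue x∈ = index (_ , x∈)

  lift : Fin p → Carrier
  lift i = proj₁ (element i)

  lift∈ : ∀ i → lift i ∈ 𝒪
  lift∈ i = proj₂ (element i)

  residue-⇔ : ∀ {x y} (x∈ : x ∈ 𝒪) (y∈ : y ∈ 𝒪) → residue x∈ ≡ residue y∈ ⇔ x ≋ y [mod 1 ]
  residue-⇔ x∈ y∈ = mk⇔ (to (v≥1⇔𝔭1 _) ∘ index-injective) (index-cong ∘ from (v≥1⇔𝔭1 _))

  residue-lift : ∀ i → residue (lift∈ i) ≡ i
  residue-lift = index-element

  private
    π′ = π^ 1

  digit : ∀ {x} (x∈ : x ∈ 𝒪) → x - lift (residue x∈) ∈ 𝔭 1
  digit x∈ = to (residue-⇔ x∈ (lift∈ _)) (≡.sym (residue-lift _))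

  tail : ∀ {x} → x ∈ 𝒪 → ∃ 𝒪
  tail x∈ = 𝔭.quot (digit x∈) , 𝔭.quot∈ (digit x∈)

  digit-expansion : ∀ {x} (x∈ : x ∈ 𝒪) → x ≈ lift (residue x∈) + π′ * proj₁ (tail x∈)
  digit-expansion {x} x∈ = trans (solve 2 (λ x a → x := a :+ (x :- a)) refl x _) (+-congˡ (𝔭.eq (digit x∈)))

  -- For equal first digits the chosen lifts cancel and x - y is π times the difference of the
  -- tails. As a set, 𝒪/𝔭ⁿ⁺¹ is therefore the residue field times 𝒪/𝔭ⁿ.
  mod-suc : ∀ {x y n} (x∈ : x ∈ 𝒪) (y∈ : y ∈ 𝒪) → x ≋ y [mod suc n ] ⇔
            (residue x∈ ≡ residue y∈ × proj₁ (tail x∈) ≋ proj₁ (tail y∈) [mod n ])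
  mod-suc {x} {y} {n} x∈ y∈ = mk⇔
    (λ e → let r≡ = from (residue-⇔ x∈ y∈) (𝔭-mono (s≤s z≤n) e) in
      r≡ , 𝔭-cancel {m = 1} (𝔭-resp (difference r≡) e))
    (λ (r≡ , e) → 𝔭-resp (sym (difference r≡)) (𝔭-* (π^∈𝔭 1) e))
    where
    difference : residue x∈ ≡ residue y∈ → x - y ≈ π′ * (proj₁ (tail x∈) - proj₁ (tail y∈))
    difference r≡ = trans
      (+-cong (digit-expansion x∈) (-‿cong (trans (digit-expansion y∈) (+-congʳ (reflexive (≡.cong lift (≡.sym r≡)))))))
      (solve 4 (λ a p u v → (a :+ p :* u) :- (a :+ p :* v) := p :* (u :- v)) refl (lift (residue x∈)) π′ _ _)

  module _ (i : Fin p) {y} (y∈ : y ∈ 𝒪) where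
    fromDigits : Carrier
    fromDigits = lift i + π′ * y

    fromDigits∈ : fromDigits ∈ 𝒪
    fromDigits∈ = +∈𝒪 (lift∈ i) (*∈𝒪 (π^∈𝒪 1) y∈)

    fromDigits≡lift : fromDigits ≋ lift i [mod 1 ]
    fromDigits≡lift = mk𝔭 y y∈ (solve 2 (λ a b → (a :+ b) :- a := b) refl (lift i) (π′ * y))

    residue-fromDigits : ∀ x∈ → residue {fromDigits} x∈ ≡ i
    residue-fromDigits x∈ =
      ≡.trans (from (residue-⇔ x∈ (lift∈ i)) fromDigits≡lift) (residue-lift i)

    tail-fromDigits : ∀ {n} x∈ → proj₁ (tail {fromDigits} x∈) ≋ y [mod n ]
    tail-fromDigits x∈ = mod-reflexive (*-cancel-≉0 (π^≉0 1) (trans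
      (solve 2 (λ a b → b := (a :+ b) :- a) refl (lift i) _)
      (trans (+-congʳ (trans (+-congʳ (reflexive (≡.cong lift (≡.sym (residue-fromDigits x∈)))))
                             (sym (digit-expansion x∈))))
             (solve 2 (λ a b → (a :+ b) :- a := b) refl (lift i) _))))

  card-𝒪/𝔭 : ∀ n → HasCardinality (∃ 𝒪) (λ x y → proj₁ x ≋ proj₁ y [mod n ]) (p ℕ.^ n)
  card-𝒪/𝔭 zero    = card-inhabited
    (λ (x , x∈) (y , y∈) → 𝒪⇒𝔭0 (+∈𝒪 x∈ (-∈𝒪 y∈))) (0# , 0∈𝒪)
  card-𝒪/𝔭 (suc n) = card-transfer
    (λ (x , x∈) → residue x∈ , tail x∈)
    (λ (x , x∈) (y , y∈) → mod-suc x∈ y∈)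
    (λ (i , y , y∈) → (fromDigits i y∈ , fromDigits∈ i y∈) ,
      residue-fromDigits i y∈ (fromDigits∈ i y∈) , tail-fromDigits i y∈ (fromDigits∈ i y∈))
    (card-× card-Fin (card-𝒪/𝔭 n))

  -- The number of units modulo 𝔭ⁿ. The value at 0 is 1, not an instance of the general formula: all
  -- units are congruent modulo 𝔭⁰.
  unitCount : ℕ → ℕ
  unitCount zero    = 1
  unitCount (suc n) = (p ℕ.∸ 1) ℕ.* p ℕ.^ n

  private
    unit-residue : ∀ {x} (x∈ : x ∈ 𝒪) → Unit x → residue 0∈𝒪 ≢ residue x∈
    unit-residue {x} x∈ u eq = Unit⇒∉𝔭 u (𝔭-resp (solve 1 (λ x → x :- :0 := x) refl x)
      (to (residue-⇔ x∈ 0∈𝒪) (≡.sym eq)))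

    residue-unit : ∀ {x} (x∈ : x ∈ 𝒪) → residue 0∈𝒪 ≢ residue x∈ → Unit x
    residue-unit {x} x∈ 0≢ with unit? x∈
    ... | inj₁ u   = u
    ... | inj₂ x∈𝔭 = ⊥-elim (0≢ (≡.sym (from (residue-⇔ x∈ 0∈𝒪)
      (𝔭-resp (solve 1 (λ x → x := x :- :0) refl x) x∈𝔭))))

  -- An integral element is a unit exactly if its first digit is not that of 0; the tail is then
  -- arbitrary.
  card-units : ∀ n → HasCardinality (∃ Unit) (λ x y → proj₁ x ≋ proj₁ y [mod n ]) (unitCount n)
  card-units zero    = card-inhabited
    (λ (x , u) (y , w) → 𝒪⇒𝔭0 (+∈𝒪 (Unit.u∈ u) (-∈𝒪 (Unit.u∈ w)))) (1# , Unit-1)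
  card-units (suc n) = card-transfer
    (λ (x , u) → (residue (Unit.u∈ u) , unit-residue (Unit.u∈ u) u) , tail (Unit.u∈ u))
    (λ (x , u) (y , w) → mod-suc (Unit.u∈ u) (Unit.u∈ w))
    (λ ((i , 0≢i) , y , y∈) → let x∈ = fromDigits∈ i y∈
                                  r≡ = residue-fromDigits i y∈ x∈
                                  u = residue-unit x∈ (λ e → 0≢i (≡.trans e r≡)) in
      (fromDigits i y∈ , u) , residue-fromDigits i y∈ (Unit.u∈ u) , tail-fromDigits i y∈ (Unit.u∈ u))
    (card-× (card-≢ (residue 0∈𝒪)) (card-𝒪/𝔭 n))

  Parameter : Set (c ⊔ ℓ)
  Parameter = ∃ 𝒪 × ∃ Unit

  _≋ᵖ_[mod_] : Parameter → Parameter → ℕ → Set (c ⊔ ℓ)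
  ((x , _) , (z , _)) ≋ᵖ ((x′ , _) , (z′ , _)) [mod n ] = x ≋ x′ [mod n ] × z ≋ z′ [mod n ]

  card-parameters : ∀ t → HasCardinality Parameter (_≋ᵖ_[mod t ]) (p ℕ.^ t ℕ.* unitCount t)
  card-parameters t = card-× (card-𝒪/𝔭 t) (card-units t)

  parameterCount-suc : ∀ t → 0 ℕ.< t → p ℕ.^ t ℕ.* unitCount t ≡ (p ℕ.∸ 1) ℕ.* p ℕ.^ (2 ℕ.* t ℕ.∸ 1)
  parameterCount-suc (suc n) _ = begin
    p ℕ.^ suc n ℕ.* ((p ℕ.∸ 1) ℕ.* p ℕ.^ n)      ≡⟨ rearrange (p ℕ.^ suc n) (p ℕ.∸ 1) (p ℕ.^ n) ⟩
    (p ℕ.∸ 1) ℕ.* (p ℕ.^ n ℕ.* p ℕ.^ suc n)      ≡⟨ ≡.cong ((p ℕ.∸ 1) ℕ.*_) (ℕₚ.^-distribˡ-+-* p n (suc n)) ⟨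
    -- The exponent `2 * suc n ∸ 1` computes to `n + (suc n + 0)`; only the final 0 has to be
    -- matched.
    (p ℕ.∸ 1) ℕ.* p ℕ.^ (n ℕ.+ suc n)            ≡⟨ ≡.cong (λ m → (p ℕ.∸ 1) ℕ.* p ℕ.^ (n ℕ.+ m)) (ℕₚ.+-identityʳ (suc n)) ⟨
    (p ℕ.∸ 1) ℕ.* p ℕ.^ (2 ℕ.* suc n ℕ.∸ 1)      ∎
    where
    open ≡.≡-Reasoning
    open +-*-Solver using () renaming (solve to solveℕ; _:*_ to _⊗_; _:=_ to _⊜_)
    rearrange : ∀ a b c → a ℕ.* (b ℕ.* c) ≡ b ℕ.* (c ℕ.* a)
    rearrange = solveℕ 3 (λ a b c → a ⊗ (b ⊗ c) ⊜ b ⊗ (c ⊗ a)) ≡.refl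

  -- Seen as the ordered pair (x , x + z) of elements with distinct residues, a parameter is simply
  -- reversed. This is the action of w when r = 2t.
  flip : Parameter → Parameter
  flip ((x , x∈) , (z , u)) = (x + z , +∈𝒪 x∈ (Unit.u∈ u)) , (- z , Unit-neg u)

  flip-cong : ∀ {t} q q′ → q ≋ᵖ q′ [mod t ] → flip q ≋ᵖ flip q′ [mod t ]
  flip-cong ((x , _) , (z , _)) ((x′ , _) , (z′ , _)) (e , f) =
    𝔭-resp (solve 4 (λ x z x′ z′ → (x :- x′) :+ (z :- z′) := (x :+ z) :- (x′ :+ z′)) refl x z x′ z′) (𝔭-+ e f) ,
    𝔭-resp (solve 2 (λ z z′ → :- (z :- z′) := :- z :- :- z′) refl z z′) (𝔭-neg f)

  flip-involutive : ∀ {t} q → flip (flip q) ≋ᵖ q [mod t ]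
  flip-involutive ((x , _) , (z , _)) =
    mod-reflexive (solve 2 (λ x z → (x :+ z) :- z := x) refl x z) ,
    mod-reflexive (solve 1 (λ z → :- (:- z) := z) refl z)

  -- The residues of x and x + z differ because z is a unit, and they are determined by the class
  -- modulo 𝔭ᵗ because t > 0. So the involution is free, and the order on `Fin p` picks the
  -- representative with x before x + z. The sign change of z alone would not do: it can have fixed
  -- points in characteristic 2.
  card-parameters/flip : ∀ t → 0 ℕ.< t → ∃[ m ] 2 ℕ.* m ≡ p ℕ.^ t ℕ.* unitCount t ×
    HasCardinality Parameter (λ q q′ → q ≋ᵖ q′ [mod t ] ⊎ q ≋ᵖ flip q′ [mod t ]) m
  card-parameters/flip t@(suc _) _ = card-/involution (card-parameters t) flip
    (λ {q} {q′} → flip-cong q q′) (λ q → flip-involutive q) {P = Ascending} ascending? (λ {q} {q′} → ascending-resp {q} {q′}) ascending-flip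
    where
    start end : Parameter → Fin p
    start ((x , x∈) , _) = residue x∈
    end ((x , x∈) , (z , u)) = residue (+∈𝒪 x∈ (Unit.u∈ u))

    Ascending : Pred Parameter _
    Ascending q = start q Fin.< end q

    ascending? : Decidable Ascending
    ascending? q = start q Finₚ.<? end q

    start-cong : ∀ q q′ → q ≋ᵖ q′ [mod t ] → start q ≡ start q′
    start-cong ((_ , x∈) , _) ((_ , x′∈) , _) (e , _) =
      from (residue-⇔ x∈ x′∈) (𝔭-mono (s≤s z≤n) e)




    end-flip : ∀ q → end (flip q) ≡ start q
    end-flip q = start-cong (flip (flip q)) q (flip-involutive q)

    start≢end : ∀ q → start q ≢ end q
    start≢end ((x , x∈) , (z , u)) eq = Unit⇒∉𝔭 u (𝔭-resp
      (solve 2 (λ x z → (x :+ z) :- x := z) refl x z)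
      (to (residue-⇔ (+∈𝒪 x∈ (Unit.u∈ u)) x∈) (≡.sym eq)))

    ascending-resp : ∀ {q q′} → q ≋ᵖ q′ [mod t ] → Ascending q → Ascending q′
    ascending-resp {q} {q′} e = ≡.subst₂ Fin._<_ (start-cong q q′ e)
      (start-cong (flip q) (flip q′) (flip-cong q q′ e))

    ascending-flip : ∀ q → Ascending (flip q) ⇔ (¬ Ascending q)
    ascending-flip q = mk⇔
      (λ asc → Finₚ.<-asym (≡.subst (start (flip q) Fin.<_) (end-flip q) asc))
      (λ ¬asc → ≡.subst (end q Fin.<_) (≡.sym (end-flip q)) (descending ¬asc))
      where
      descending : ¬ Ascending q → end q Fin.< start q
      descending ¬asc with Finₚ.<-cmp (start q) (end q)
      ... | tri< asc _ _ = ⊥-elim (¬asc asc)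
      ... | tri≈ _ eq _  = ⊥-elim (start≢end q eq)
      ... | tri> _ _ desc = desc

  -- Modulo 𝔭⁰ there is a single class, which the involution fixes. The count is not halved, whence
  -- the exceptional vector for t = 0.
  card-parameters/flip-0 : HasCardinality Parameter (λ q q′ → q ≋ᵖ q′ [mod 0 ] ⊎ q ≋ᵖ flip q′ [mod 0 ]) 1
  card-parameters/flip-0 = card-inhabited
    (λ ((x , x∈) , (z , u)) ((x′ , x′∈) , (z′ , u′)) →
      inj₁ (𝒪⇒𝔭0 (+∈𝒪 x∈ (-∈𝒪 x′∈)) , 𝒪⇒𝔭0 (+∈𝒪 (Unit.u∈ u) (-∈𝒪 (Unit.u∈ u′)))))
    ((0# , 0∈𝒪) , (1# , Unit-1))

-- Matrices, the group GL₂ and conjugation.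

module MatrixAlgebra {c ℓ} (k : LocalField c ℓ) where
  open LocalField k
  open Valuation k
  open Matrices k public
  open Mat public
  open GL₂ public

  matSetoid : Setoid c ℓ
  matSetoid = record
    { Carrier = Mat ; _≈_ = _≈ᴹ_
    ; isEquivalence = record { refl = ≈ᴹ-refl ; sym = ≈ᴹ-sym ; trans = ≈ᴹ-trans } }

  E₁₁ E₁₂ E₂₁ E₂₂ : Mat
  E₁₁ = mat 1# 0# 0# 0#
  E₁₂ = mat 0# 1# 0# 0#
  E₂₁ = mat 0# 0# 1# 0#
  E₂₂ = mat 0# 0# 0# 1#

  ≈ᴹ-reflexive : ∀ {x y} → x ≡ y → x ≈ᴹ y
  ≈ᴹ-reflexive ≡.refl = ≈ᴹ-refl

  *ᴹ-assoc : ∀ x y z → (x *ᴹ y) *ᴹ z ≈ᴹ x *ᴹ (y *ᴹ z)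
  *ᴹ-assoc (mat x₁ x₂ x₃ x₄) (mat y₁ y₂ y₃ y₄) (mat z₁ z₂ z₃ z₄) =
    mat≈ (e x₁ x₂ z₁ z₃) (e x₁ x₂ z₂ z₄) (e x₃ x₄ z₁ z₃) (e x₃ x₄ z₂ z₄)
    where
    e : ∀ a b u w → (a * y₁ + b * y₃) * u + (a * y₂ + b * y₄) * w ≈
                    a * (y₁ * u + y₂ * w) + b * (y₃ * u + y₄ * w)
    e a b u w = solve 8 (λ a b u w y₁ y₂ y₃ y₄ →
      (a :* y₁ :+ b :* y₃) :* u :+ (a :* y₂ :+ b :* y₄) :* w :=
      a :* (y₁ :* u :+ y₂ :* w) :+ b :* (y₃ :* u :+ y₄ :* w)) refl a b u w y₁ y₂ y₃ y₄

  *ᴹ-identityˡ : ∀ x → 𝟙 *ᴹ x ≈ᴹ x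
  *ᴹ-identityˡ (mat x₁ x₂ x₃ x₄) = mat≈ (e x₁ x₃) (e x₂ x₄) (f x₁ x₃) (f x₂ x₄)
    where
    e : ∀ a b → 1# * a + 0# * b ≈ a
    e = solve 2 (λ a b → :1 :* a :+ :0 :* b := a) refl
    f : ∀ a b → 0# * a + 1# * b ≈ b
    f = solve 2 (λ a b → :0 :* a :+ :1 :* b := b) refl

  *ᴹ-identityʳ : ∀ x → x *ᴹ 𝟙 ≈ᴹ x
  *ᴹ-identityʳ (mat x₁ x₂ x₃ x₄) = mat≈ (e x₁ x₂) (f x₁ x₂) (e x₃ x₄) (f x₃ x₄)
    where
    e : ∀ a b → a * 1# + b * 0# ≈ a
    e = solve 2 (λ a b → a :* :1 :+ b :* :0 := a) refl
    f : ∀ a b → a * 0# + b * 1# ≈ b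
    f = solve 2 (λ a b → a :* :0 :+ b :* :1 := b) refl

  *ᴹ-distribˡ : ∀ x y z → x *ᴹ (y +ᴹ z) ≈ᴹ x *ᴹ y +ᴹ x *ᴹ z
  *ᴹ-distribˡ (mat x₁ x₂ x₃ x₄) (mat y₁ y₂ y₃ y₄) (mat z₁ z₂ z₃ z₄) =
    mat≈ (e x₁ x₂ y₁ y₃ z₁ z₃) (e x₁ x₂ y₂ y₄ z₂ z₄) (e x₃ x₄ y₁ y₃ z₁ z₃) (e x₃ x₄ y₂ y₄ z₂ z₄)
    where
    e : ∀ a b y y′ z z′ → a * (y + z) + b * (y′ + z′) ≈ (a * y + b * y′) + (a * z + b * z′)
    e = solve 6 (λ a b y y′ z z′ →
      a :* (y :+ z) :+ b :* (y′ :+ z′) := (a :* y :+ b :* y′) :+ (a :* z :+ b :* z′)) refl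

  *ᴹ-distribʳ : ∀ x y z → (y +ᴹ z) *ᴹ x ≈ᴹ y *ᴹ x +ᴹ z *ᴹ x
  *ᴹ-distribʳ (mat x₁ x₂ x₃ x₄) (mat y₁ y₂ y₃ y₄) (mat z₁ z₂ z₃ z₄) =
    mat≈ (e x₁ x₃ y₁ y₂ z₁ z₂) (e x₂ x₄ y₁ y₂ z₁ z₂) (e x₁ x₃ y₃ y₄ z₃ z₄) (e x₂ x₄ y₃ y₄ z₃ z₄)
    where
    e : ∀ a b y y′ z z′ → (y + z) * a + (y′ + z′) * b ≈ (y * a + y′ * b) + (z * a + z′ * b)
    e = solve 6 (λ a b y y′ z z′ →
      (y :+ z) :* a :+ (y′ :+ z′) :* b := (y :* a :+ y′ :* b) :+ (z :* a :+ z′ :* b)) refl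

  ·-*ᴹˡ : ∀ a x y → (a ·ᴹ x) *ᴹ y ≈ᴹ a ·ᴹ (x *ᴹ y)
  ·-*ᴹˡ a (mat x₁ x₂ x₃ x₄) (mat y₁ y₂ y₃ y₄) =
    mat≈ (e x₁ x₂ y₁ y₃) (e x₁ x₂ y₂ y₄) (e x₃ x₄ y₁ y₃) (e x₃ x₄ y₂ y₄)
    where
    e : ∀ x x′ y y′ → (a * x) * y + (a * x′) * y′ ≈ a * (x * y + x′ * y′)
    e = solve 5 (λ a x x′ y y′ → (a :* x) :* y :+ (a :* x′) :* y′ := a :* (x :* y :+ x′ :* y′)) refl a

  ·-*ᴹʳ : ∀ a x y → x *ᴹ (a ·ᴹ y) ≈ᴹ a ·ᴹ (x *ᴹ y)
  ·-*ᴹʳ a (mat x₁ x₂ x₃ x₄) (mat y₁ y₂ y₃ y₄) =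
    mat≈ (e x₁ x₂ y₁ y₃) (e x₁ x₂ y₂ y₄) (e x₃ x₄ y₁ y₃) (e x₃ x₄ y₂ y₄)
    where
    e : ∀ x x′ y y′ → x * (a * y) + x′ * (a * y′) ≈ a * (x * y + x′ * y′)
    e = solve 5 (λ a x x′ y y′ → x :* (a :* y) :+ x′ :* (a :* y′) := a :* (x :* y :+ x′ :* y′)) refl a

  ·ᴹ-cong : ∀ {a b x y} → a ≈ b → x ≈ᴹ y → a ·ᴹ x ≈ᴹ b ·ᴹ y
  ·ᴹ-cong e (mat≈ e₁ e₂ e₃ e₄) = mat≈ (*-cong e e₁) (*-cong e e₂) (*-cong e e₃) (*-cong e e₄)

  ·ᴹ-assoc : ∀ a b x → (a * b) ·ᴹ x ≈ᴹ a ·ᴹ (b ·ᴹ x)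
  ·ᴹ-assoc a b x = mat≈ (*-assoc _ _ _) (*-assoc _ _ _) (*-assoc _ _ _) (*-assoc _ _ _)

  ·ᴹ-identity : ∀ x → 1# ·ᴹ x ≈ᴹ x
  ·ᴹ-identity x = mat≈ (*-identityˡ _) (*-identityˡ _) (*-identityˡ _) (*-identityˡ _)

  ·ᴹ-inverse : ∀ {a b} → b * a ≈ 1# → ∀ x → b ·ᴹ (a ·ᴹ x) ≈ᴹ x
  ·ᴹ-inverse e x = ≈ᴹ-trans (≈ᴹ-sym (·ᴹ-assoc _ _ _)) (≈ᴹ-trans (·ᴹ-cong e ≈ᴹ-refl) (·ᴹ-identity x))

  det : Mat → Carrier
  det (mat a b c d) = a * d - b * c

  det-* : ∀ x y → det (x *ᴹ y) ≈ det x * det y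
  det-* (mat x₁ x₂ x₃ x₄) (mat y₁ y₂ y₃ y₄) = solve 8 (λ x₁ x₂ x₃ x₄ y₁ y₂ y₃ y₄ →
    (x₁ :* y₁ :+ x₂ :* y₃) :* (x₃ :* y₂ :+ x₄ :* y₄) :- (x₁ :* y₂ :+ x₂ :* y₄) :* (x₃ :* y₁ :+ x₄ :* y₃) :=
    (x₁ :* x₄ :- x₂ :* x₃) :* (y₁ :* y₄ :- y₂ :* y₃)) refl x₁ x₂ x₃ x₄ y₁ y₂ y₃ y₄

  det-cong : ∀ {x y} → x ≈ᴹ y → det x ≈ det y
  det-cong (mat≈ e₁ e₂ e₃ e₄) = +-cong (*-cong e₁ e₄) (-‿cong (*-cong e₂ e₃))

  det-𝟙 : det 𝟙 ≈ 1#
  det-𝟙 = solve 0 (:1 :* :1 :- :0 :* :0 := :1) refl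

  adjugate : Mat → Mat
  adjugate (mat a b c d) = mat d (- b) (- c) a

  -- A definition by a record expression computes by copatterns, and unification
  -- then compares its values componentwise; pack prevents this.
  pack : ∀ x y → x *ᴹ y ≈ᴹ 𝟙 → y *ᴹ x ≈ᴹ 𝟙 → GL₂
  pack x y xy≈𝟙 yx≈𝟙 = record { matrix = x ; inv = y ; inverseʳ = xy≈𝟙 ; inverseˡ = yx≈𝟙 }

  opaque
    fromDet-inverseʳ : ∀ x δ⁻¹ → det x * δ⁻¹ ≈ 1# → x *ᴹ (δ⁻¹ ·ᴹ adjugate x) ≈ᴹ 𝟙
    fromDet-inverseʳ (mat a b c d) δ⁻¹ δδ⁻¹≈1 = mat≈
        (trans (solve 5 (λ a b c d e → a :* (e :* d) :+ b :* (e :* (:- c)) := (a :* d :- b :* c) :* e) refl a b c d δ⁻¹) δδ⁻¹≈1)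
        (solve 5 (λ a b c d e → a :* (e :* (:- b)) :+ b :* (e :* a) := :0) refl a b c d δ⁻¹)
        (solve 5 (λ a b c d e → c :* (e :* d) :+ d :* (e :* (:- c)) := :0) refl a b c d δ⁻¹)
        (trans (solve 5 (λ a b c d e → c :* (e :* (:- b)) :+ d :* (e :* a) := (a :* d :- b :* c) :* e) refl a b c d δ⁻¹) δδ⁻¹≈1)

    fromDet-inverseˡ : ∀ x δ⁻¹ → det x * δ⁻¹ ≈ 1# → (δ⁻¹ ·ᴹ adjugate x) *ᴹ x ≈ᴹ 𝟙
    fromDet-inverseˡ (mat a b c d) δ⁻¹ δδ⁻¹≈1 = mat≈
        (trans (solve 5 (λ a b c d e → (e :* d) :* a :+ (e :* (:- b)) :* c := (a :* d :- b :* c) :* e) refl a b c d δ⁻¹) δδ⁻¹≈1)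
        (solve 5 (λ a b c d e → (e :* d) :* b :+ (e :* (:- b)) :* d := :0) refl a b c d δ⁻¹)
        (solve 5 (λ a b c d e → (e :* (:- c)) :* a :+ (e :* a) :* c := :0) refl a b c d δ⁻¹)
        (trans (solve 5 (λ a b c d e → (e :* (:- c)) :* b :+ (e :* a) :* d := (a :* d :- b :* c) :* e) refl a b c d δ⁻¹) δδ⁻¹≈1)

  fromDet : ∀ x δ⁻¹ → det x * δ⁻¹ ≈ 1# → GL₂
  fromDet x δ⁻¹ δδ⁻¹≈1 = pack x (δ⁻¹ ·ᴹ adjugate x)
    (fromDet-inverseʳ x δ⁻¹ δδ⁻¹≈1) (fromDet-inverseˡ x δ⁻¹ δδ⁻¹≈1)

  infix 4 _≈ᴳ_
  -- Only the matrices are compared; by `inv-cong` the inverses then agree as well.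
  record _≈ᴳ_ (g h : GL₂) : Set ℓ where
    constructor wrap
    field unwrap : matrix g ≈ᴹ matrix h
  open _≈ᴳ_ public

  private module ≈M = SetoidReasoning matSetoid

  infixl 7 _∙_
  infix 8 _⁻¹

  -- Opaque, since unification would otherwise unfold products down to the entries.
  opaque
    _∙_ : GL₂ → GL₂ → GL₂
    g ∙ h = pack (matrix g *ᴹ matrix h) (inv h *ᴹ inv g)
      (product (matrix g) (matrix h) (inv h) (inv g) (inverseʳ h) (inverseʳ g))
      (product (inv h) (inv g) (matrix g) (matrix h) (inverseˡ g) (inverseˡ h))
      where
      product : ∀ a b b′ a′ → b *ᴹ b′ ≈ᴹ 𝟙 → a *ᴹ a′ ≈ᴹ 𝟙 → (a *ᴹ b) *ᴹ (b′ *ᴹ a′) ≈ᴹ 𝟙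
      product a b b′ a′ e f = begin
        (a *ᴹ b) *ᴹ (b′ *ᴹ a′)   ≈⟨ *ᴹ-assoc a b _ ⟩
        a *ᴹ (b *ᴹ (b′ *ᴹ a′))   ≈⟨ *ᴹ-cong ≈ᴹ-refl (*ᴹ-assoc b b′ a′) ⟨
        a *ᴹ ((b *ᴹ b′) *ᴹ a′)   ≈⟨ *ᴹ-cong ≈ᴹ-refl (*ᴹ-cong e ≈ᴹ-refl) ⟩
        a *ᴹ (𝟙 *ᴹ a′)           ≈⟨ *ᴹ-cong ≈ᴹ-refl (*ᴹ-identityˡ a′) ⟩
        a *ᴹ a′                  ≈⟨ f ⟩
        𝟙                        ∎
        where open ≈M

    ε : GL₂
    ε = pack 𝟙 𝟙 (*ᴹ-identityˡ 𝟙) (*ᴹ-identityˡ 𝟙)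

    _⁻¹ : GL₂ → GL₂
    g ⁻¹ = pack (inv g) (matrix g) (inverseˡ g) (inverseʳ g)

  opaque
    unfolding _∙_

    matrix-∙ : ∀ g h → matrix (g ∙ h) ≡ matrix g *ᴹ matrix h
    matrix-∙ g h = ≡.refl

    inv-∙ : ∀ g h → inv (g ∙ h) ≡ inv h *ᴹ inv g
    inv-∙ g h = ≡.refl

    matrix-ε : matrix ε ≡ 𝟙
    matrix-ε = ≡.refl

    inv-ε : inv ε ≡ 𝟙
    inv-ε = ≡.refl

    matrix-⁻¹ : ∀ g → matrix (g ⁻¹) ≡ inv g
    matrix-⁻¹ g = ≡.refl

    inv-⁻¹ : ∀ g → inv (g ⁻¹) ≡ matrix g
    inv-⁻¹ g = ≡.refl

  inv-cong : ∀ {g h} → g ≈ᴳ h → inv g ≈ᴹ inv h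
  inv-cong {g} {h} (wrap e) = begin
    inv g                             ≈⟨ *ᴹ-identityʳ _ ⟨
    inv g *ᴹ 𝟙                        ≈⟨ *ᴹ-cong ≈ᴹ-refl (inverseʳ h) ⟨
    inv g *ᴹ (matrix h *ᴹ inv h)      ≈⟨ *ᴹ-cong ≈ᴹ-refl (*ᴹ-cong e ≈ᴹ-refl) ⟨
    inv g *ᴹ (matrix g *ᴹ inv h)      ≈⟨ *ᴹ-assoc _ _ _ ⟨
    (inv g *ᴹ matrix g) *ᴹ inv h      ≈⟨ *ᴹ-cong (inverseˡ g) ≈ᴹ-refl ⟩
    𝟙 *ᴹ inv h                        ≈⟨ *ᴹ-identityˡ _ ⟩
    inv h                             ∎
    where open ≈M

  opaque
    unfolding _∙_

    GL₂-isGroup : IsGroup _≈ᴳ_ _∙_ ε _⁻¹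
    GL₂-isGroup = record
      { isMonoid = record
        { isSemigroup = record
          { isMagma = record
            { isEquivalence = record
              { refl = wrap ≈ᴹ-refl ; sym = λ e → wrap (≈ᴹ-sym (unwrap e))
              ; trans = λ e f → wrap (≈ᴹ-trans (unwrap e) (unwrap f)) }
            ; ∙-cong = λ e f → wrap (*ᴹ-cong (unwrap e) (unwrap f)) }
          ; assoc = λ g h i → wrap (*ᴹ-assoc (matrix g) (matrix h) (matrix i)) }
        ; identity = (λ g → wrap (*ᴹ-identityˡ (matrix g))) , (λ g → wrap (*ᴹ-identityʳ (matrix g))) }
      ; inverse = (λ g → wrap (inverseˡ g)) , (λ g → wrap (inverseʳ g))
      ; ⁻¹-cong = λ e → wrap (inv-cong e) }

  GL₂-group : Group (c ⊔ ℓ) ℓ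
  GL₂-group = record { isGroup = GL₂-isGroup }

  private
    module G = Group GL₂-group
    module Gₚ = GroupProperties GL₂-group

  GL₂-setoid : Setoid (c ⊔ ℓ) ℓ
  GL₂-setoid = G.setoid

  -- Restated in terms of _∙_ and _⁻¹, so that unification need not unfold the
  -- operations of the bundle.
  ≈ᴳ-refl : ∀ {g} → g ≈ᴳ g
  ≈ᴳ-refl = wrap ≈ᴹ-refl
  ≈ᴳ-sym : ∀ {g h} → g ≈ᴳ h → h ≈ᴳ g
  ≈ᴳ-sym (wrap e) = wrap (≈ᴹ-sym e)
  ≈ᴳ-trans : ∀ {g h i} → g ≈ᴳ h → h ≈ᴳ i → g ≈ᴳ i
  ≈ᴳ-trans (wrap e) (wrap f) = wrap (≈ᴹ-trans e f)
  ∙-cong : ∀ {g g′ h h′} → g ≈ᴳ g′ → h ≈ᴳ h′ → g ∙ h ≈ᴳ g′ ∙ h′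
  ∙-cong = G.∙-cong
  ∙-congˡ : ∀ {g h h′} → h ≈ᴳ h′ → g ∙ h ≈ᴳ g ∙ h′
  ∙-congˡ = G.∙-congˡ
  ∙-congʳ : ∀ {g g′ h} → g ≈ᴳ g′ → g ∙ h ≈ᴳ g′ ∙ h
  ∙-congʳ = G.∙-congʳ
  ⁻¹-congᴳ : ∀ {g h} → g ≈ᴳ h → g ⁻¹ ≈ᴳ h ⁻¹
  ⁻¹-congᴳ = G.⁻¹-cong
  ∙-assoc : ∀ g h i → g ∙ h ∙ i ≈ᴳ g ∙ (h ∙ i)
  ∙-assoc = G.assoc
  ∙-identityˡ : ∀ g → ε ∙ g ≈ᴳ g
  ∙-identityˡ = G.identityˡ
  ∙-identityʳ : ∀ g → g ∙ ε ≈ᴳ g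
  ∙-identityʳ = G.identityʳ
  ⁻¹-inverseˡ : ∀ g → g ⁻¹ ∙ g ≈ᴳ ε
  ⁻¹-inverseˡ = G.inverseˡ
  ⁻¹-inverseʳ : ∀ g → g ∙ g ⁻¹ ≈ᴳ ε
  ⁻¹-inverseʳ = G.inverseʳ
  ⁻¹-anti-homo-∙ : ∀ g h → (g ∙ h) ⁻¹ ≈ᴳ h ⁻¹ ∙ g ⁻¹
  ⁻¹-anti-homo-∙ = Gₚ.⁻¹-anti-homo-∙
  ⁻¹-involutive : ∀ g → (g ⁻¹) ⁻¹ ≈ᴳ g
  ⁻¹-involutive = Gₚ.⁻¹-involutive
  g∙[g⁻¹∙h]≈h : ∀ g h → g ∙ (g ⁻¹ ∙ h) ≈ᴳ h
  g∙[g⁻¹∙h]≈h = Gₚ.\\-leftDividesˡ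
  g⁻¹∙[g∙h]≈h : ∀ g h → g ⁻¹ ∙ (g ∙ h) ≈ᴳ h
  g⁻¹∙[g∙h]≈h = Gₚ.\\-leftDividesʳ
  [h∙g⁻¹]∙g≈h : ∀ g h → h ∙ g ⁻¹ ∙ g ≈ᴳ h
  [h∙g⁻¹]∙g≈h = Gₚ.//-rightDividesˡ
  [h∙g]∙g⁻¹≈h : ∀ g h → h ∙ g ∙ g ⁻¹ ≈ᴳ h
  [h∙g]∙g⁻¹≈h = Gₚ.//-rightDividesʳ

  conj-cong : ∀ {g h x y} → g ≈ᴳ h → x ≈ᴹ y → conj g x ≈ᴹ conj h y
  conj-cong e x≈y = *ᴹ-cong (*ᴹ-cong (unwrap e) x≈y) (inv-cong e)

  conj-congʳ : ∀ g {x y} → x ≈ᴹ y → conj g x ≈ᴹ conj g y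
  conj-congʳ g = conj-cong (≈ᴳ-refl {g})

  opaque
    unfolding _∙_

    conj-ε : ∀ x → conj ε x ≈ᴹ x
    conj-ε x = ≈ᴹ-trans (*ᴹ-identityʳ _) (*ᴹ-identityˡ x)

    conj-∙ : ∀ g h x → conj (g ∙ h) x ≈ᴹ conj g (conj h x)
    conj-∙ g h x = begin
      ((G *ᴹ H) *ᴹ x) *ᴹ (inv h *ᴹ inv g)     ≈⟨ *ᴹ-assoc _ _ _ ⟨
      (((G *ᴹ H) *ᴹ x) *ᴹ inv h) *ᴹ inv g     ≈⟨ *ᴹ-cong (*ᴹ-cong (*ᴹ-assoc G H x) ≈ᴹ-refl) ≈ᴹ-refl ⟩
      ((G *ᴹ (H *ᴹ x)) *ᴹ inv h) *ᴹ inv g     ≈⟨ *ᴹ-cong (*ᴹ-assoc G _ _) ≈ᴹ-refl ⟩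
      (G *ᴹ ((H *ᴹ x) *ᴹ inv h)) *ᴹ inv g     ∎
      where
      open ≈M
      G H : Mat
      G = matrix g
      H = matrix h

  conj-⁻¹ˡ : ∀ g x → conj (g ⁻¹) (conj g x) ≈ᴹ x
  conj-⁻¹ˡ g x = ≈ᴹ-trans (≈ᴹ-sym (conj-∙ (g ⁻¹) g x))
    (≈ᴹ-trans (conj-cong (⁻¹-inverseˡ g) ≈ᴹ-refl) (conj-ε x))

  conj-⁻¹ʳ : ∀ g x → conj g (conj (g ⁻¹) x) ≈ᴹ x
  conj-⁻¹ʳ g x = ≈ᴹ-trans (≈ᴹ-sym (conj-∙ g (g ⁻¹) x))
    (≈ᴹ-trans (conj-cong (⁻¹-inverseʳ g) ≈ᴹ-refl) (conj-ε x))

  conj-move : ∀ g {x y} → conj g x ≈ᴹ y → x ≈ᴹ conj (g ⁻¹) y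
  conj-move g {x} e = ≈ᴹ-trans (≈ᴹ-sym (conj-⁻¹ˡ g x)) (conj-congʳ (g ⁻¹) e)

  conj-+ : ∀ g x y → conj g (x +ᴹ y) ≈ᴹ conj g x +ᴹ conj g y
  conj-+ g x y = ≈ᴹ-trans (*ᴹ-cong (*ᴹ-distribˡ (matrix g) x y) ≈ᴹ-refl) (*ᴹ-distribʳ (inv g) _ _)

  conj-· : ∀ g a x → conj g (a ·ᴹ x) ≈ᴹ a ·ᴹ conj g x
  conj-· g a x = ≈ᴹ-trans (*ᴹ-cong (·-*ᴹʳ a (matrix g) x) ≈ᴹ-refl) (·-*ᴹˡ a _ _)

  conj-* : ∀ g x y → conj g (x *ᴹ y) ≈ᴹ conj g x *ᴹ conj g y
  conj-* g x y = begin
    (G *ᴹ (x *ᴹ y)) *ᴹ G⁻¹                      ≈⟨ *ᴹ-cong (*ᴹ-assoc G x y) ≈ᴹ-refl ⟨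
    ((G *ᴹ x) *ᴹ y) *ᴹ G⁻¹                      ≈⟨ *ᴹ-assoc _ _ _ ⟩
    (G *ᴹ x) *ᴹ (y *ᴹ G⁻¹)                      ≈⟨ *ᴹ-cong ≈ᴹ-refl (*ᴹ-identityˡ _) ⟨
    (G *ᴹ x) *ᴹ (𝟙 *ᴹ (y *ᴹ G⁻¹))               ≈⟨ *ᴹ-cong ≈ᴹ-refl (*ᴹ-cong (inverseˡ g) ≈ᴹ-refl) ⟨
    (G *ᴹ x) *ᴹ ((G⁻¹ *ᴹ G) *ᴹ (y *ᴹ G⁻¹))      ≈⟨ *ᴹ-cong ≈ᴹ-refl (*ᴹ-assoc _ _ _) ⟩
    (G *ᴹ x) *ᴹ (G⁻¹ *ᴹ (G *ᴹ (y *ᴹ G⁻¹)))      ≈⟨ *ᴹ-assoc _ _ _ ⟨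
    ((G *ᴹ x) *ᴹ G⁻¹) *ᴹ (G *ᴹ (y *ᴹ G⁻¹))      ≈⟨ *ᴹ-cong ≈ᴹ-refl (*ᴹ-assoc _ _ _) ⟨
    ((G *ᴹ x) *ᴹ G⁻¹) *ᴹ ((G *ᴹ y) *ᴹ G⁻¹)      ∎
    where
    open ≈M
    G = matrix g
    G⁻¹ = inv g

  conj-𝟙 : ∀ g → conj g 𝟙 ≈ᴹ 𝟙
  conj-𝟙 g = ≈ᴹ-trans (*ᴹ-cong (*ᴹ-identityʳ _) ≈ᴹ-refl) (inverseʳ g)

  0·ᴹ : ∀ x → 0# ·ᴹ x ≈ᴹ 0ᴹ
  0·ᴹ x = mat≈ (zeroˡ _) (zeroˡ _) (zeroˡ _) (zeroˡ _)

  conj-0 : ∀ g → conj g 0ᴹ ≈ᴹ 0ᴹ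
  conj-0 g = ≈ᴹ-trans (conj-congʳ g (≈ᴹ-sym (0·ᴹ 0ᴹ))) (≈ᴹ-trans (conj-· g 0# 0ᴹ) (0·ᴹ _))

  conj-neg : ∀ g x → conj g (-ᴹ x) ≈ᴹ -ᴹ conj g x
  conj-neg g x = ≈ᴹ-trans (conj-congʳ g (≈ᴹ-sym (-ᴹ≈-1· x))) (≈ᴹ-trans (conj-· g (- 1#) x) (-ᴹ≈-1· _))

  -- With the inverse moved to the other side, a statement about conjugation becomes four polynomial
  -- identities between entries.
  conj-intro : ∀ g {x y} → x *ᴹ matrix g ≈ᴹ matrix g *ᴹ y → x ≈ᴹ conj g y
  conj-intro g {x} {y} e = begin
    x                              ≈⟨ *ᴹ-identityʳ x ⟨
    x *ᴹ 𝟙                         ≈⟨ *ᴹ-cong ≈ᴹ-refl (inverseʳ g) ⟨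
    x *ᴹ (matrix g *ᴹ inv g)       ≈⟨ *ᴹ-assoc _ _ _ ⟨
    (x *ᴹ matrix g) *ᴹ inv g       ≈⟨ *ᴹ-cong e ≈ᴹ-refl ⟩
    conj g y                       ∎
    where open ≈M

  conj-elim : ∀ g {x y} → x ≈ᴹ conj g y → x *ᴹ matrix g ≈ᴹ matrix g *ᴹ y
  conj-elim g {x} {y} e = begin
    x *ᴹ matrix g                             ≈⟨ *ᴹ-cong e ≈ᴹ-refl ⟩
    ((matrix g *ᴹ y) *ᴹ inv g) *ᴹ matrix g    ≈⟨ *ᴹ-assoc _ _ _ ⟩
    (matrix g *ᴹ y) *ᴹ (inv g *ᴹ matrix g)    ≈⟨ *ᴹ-cong ≈ᴹ-refl (inverseˡ g) ⟩
    (matrix g *ᴹ y) *ᴹ 𝟙                      ≈⟨ *ᴹ-identityʳ _ ⟩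
    matrix g *ᴹ y                             ∎
    where open ≈M

  opaque
    scalar-inverse : ∀ {a b} → a * b ≈ 1# → (a ·ᴹ 𝟙) *ᴹ (b ·ᴹ 𝟙) ≈ᴹ 𝟙
    scalar-inverse {a} {b} e = ≈ᴹ-trans (·-*ᴹˡ a 𝟙 _)
      (≈ᴹ-trans (·ᴹ-congˡ (*ᴹ-identityˡ _)) (·ᴹ-inverse e 𝟙))

  scalar : ∀ {a b} → a * b ≈ 1# → GL₂
  scalar {a} {b} ab≈1 = pack (a ·ᴹ 𝟙) (b ·ᴹ 𝟙)
    (scalar-inverse ab≈1) (scalar-inverse (trans (*-comm b a) ab≈1))

  opaque
    unfolding _∙_

    scalar-∙ : ∀ {a b} (e : a * b ≈ 1#) g → matrix (scalar e ∙ g) ≈ᴹ a ·ᴹ matrix g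
    scalar-∙ {a} e g = ≈ᴹ-trans (·-*ᴹˡ a 𝟙 (matrix g)) (·ᴹ-congˡ (*ᴹ-identityˡ _))

    ∙-scalar : ∀ {a b} (e : a * b ≈ 1#) g → matrix (g ∙ scalar e) ≈ᴹ a ·ᴹ matrix g
    ∙-scalar {a} e g = ≈ᴹ-trans (·-*ᴹʳ a (matrix g) 𝟙) (·ᴹ-congˡ (*ᴹ-identityʳ _))

  conj-scalar : ∀ {a b} (e : a * b ≈ 1#) x → conj (scalar e) x ≈ᴹ x
  conj-scalar {a} {b} e x = ≈ᴹ-sym (conj-intro (scalar e)
    (≈ᴹ-trans (·-*ᴹʳ a x 𝟙) (≈ᴹ-trans (·ᴹ-congˡ (≈ᴹ-trans (*ᴹ-identityʳ x) (≈ᴹ-sym (*ᴹ-identityˡ x))))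
                                      (≈ᴹ-sym (·-*ᴹˡ a 𝟙 x)))))

  det-inverse : ∀ g → det (matrix g) * det (inv g) ≈ 1#
  det-inverse g = trans (sym (det-* (matrix g) (inv g))) (trans (det-cong (inverseʳ g)) det-𝟙)

  det≉0 : ∀ g → ¬ (det (matrix g) ≈ 0#)
  det≉0 g = *≈1⇒≉0 (det-inverse g)

  Span-conj : ∀ {s s′ R} {S : Pred Mat s} {S′ : Pred Mat s′} g →
    (∀ {x} → x ∈ S → conj g x ∈ Span R S′) → ∀ {x} → x ∈ Span R S → conj g x ∈ Span R S′
  Span-conj g S⇒ (incl x∈)     = S⇒ x∈
  Span-conj g S⇒ zero          = resp (≈ᴹ-sym (conj-0 g)) zero
  Span-conj g S⇒ (add x∈ y∈)   = resp (≈ᴹ-sym (conj-+ g _ _)) (add (Span-conj g S⇒ x∈) (Span-conj g S⇒ y∈))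
  Span-conj g S⇒ (mul a∈ x∈)   = resp (≈ᴹ-sym (conj-· g _ _)) (mul a∈ (Span-conj g S⇒ x∈))
  Span-conj g S⇒ (resp x≈y x∈) = resp (conj-congʳ g x≈y) (Span-conj g S⇒ x∈)

  -- The order g D g⁻¹, described by pulling back to D instead of as an image, so that its closure
  -- properties need no choice of preimages.
  conjOrder : GL₂ → Order → Order
  conjOrder g D = record
    { subalgebra = record
      { carrier  = λ x → conj (g ⁻¹) x ∈ D.carrier
      ; respects = λ x≈y → D.respects (conj-congʳ (g ⁻¹) x≈y)
      ; 0-closed = D.respects (≈ᴹ-sym (conj-0 (g ⁻¹))) D.0-closed
      ; 1-closed = D.respects (≈ᴹ-sym (conj-𝟙 (g ⁻¹))) D.1-closed
      ; +-closed = λ x∈ y∈ → D.respects (≈ᴹ-sym (conj-+ (g ⁻¹) _ _)) (D.+-closed x∈ y∈)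
      ; *-closed = λ x∈ y∈ → D.respects (≈ᴹ-sym (conj-* (g ⁻¹) _ _)) (D.*-closed x∈ y∈)
      ; -‿closed = λ x∈ → D.respects (≈ᴹ-sym (conj-neg (g ⁻¹) _)) (D.-‿closed x∈)
      ; ·-closed = λ a∈ x∈ → D.respects (≈ᴹ-sym (conj-· (g ⁻¹) _ _)) (D.·-closed a∈ x∈)
      }
    ; finitelyGenerated = let (n , γ , D⊆ , ⊆D) = D.finitelyGenerated in
        n , (λ i → conj g (γ i)) ,
        (λ {x} x∈ → resp (conj-⁻¹ʳ g x)
          (Span-conj g (λ (i , x≈) → incl (i , conj-congʳ g x≈)) (D⊆ x∈))) ,
        (λ x∈ → ⊆D (Span-conj (g ⁻¹)
          (λ (i , x≈) → incl (i , ≈ᴹ-trans (conj-congʳ (g ⁻¹) x≈) (conj-⁻¹ˡ g (γ i)))) x∈))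
    }
    where module D = Order D

-- The standard Eichler order and optimal elements.

module Optimality {c ℓ} (k : LocalField c ℓ) where
  open LocalField k
  open Valuation k
  open Residues k using (Parameter)
  open MatrixAlgebra k

  record Eichler (r : ℕ) (x : Mat) : Set (c ⊔ ℓ) where
    constructor eichler
    field
      e₁₁ : m₁₁ x ∈ 𝒪
      e₁₂ : m₁₂ x ∈ 𝒪
      e₂₁ : m₂₁ x ∈ 𝔭 r
      e₂₂ : m₂₂ x ∈ 𝒪
  open Eichler public

  Eichler-resp : ∀ {r x y} → x ≈ᴹ y → x ∈ Eichler r → y ∈ Eichler r
  Eichler-resp (mat≈ f₁ f₂ f₃ f₄) (eichler x₁ x₂ x₃ x₄) =
    eichler (𝒪-resp f₁ x₁) (𝒪-resp f₂ x₂) (𝔭-resp f₃ x₃) (𝒪-resp f₄ x₄)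

  Eichler-* : ∀ {r x y} → x ∈ Eichler r → y ∈ Eichler r → x *ᴹ y ∈ Eichler r
  Eichler-* (eichler x₁ x₂ x₃ x₄) (eichler y₁ y₂ y₃ y₄) = eichler
    (+∈𝒪 (*∈𝒪 x₁ y₁) (*∈𝒪 x₂ (𝔭⇒𝒪 y₃))) (+∈𝒪 (*∈𝒪 x₁ y₂) (*∈𝒪 x₂ y₄))
    (𝔭-+ (𝔭-*ʳ x₃ y₁) (𝔭-*ˡ x₄ y₃)) (+∈𝒪 (*∈𝒪 (𝔭⇒𝒪 x₃) y₂) (*∈𝒪 x₄ y₄))

  Eichler-· : ∀ {r a x} → a ∈ 𝒪 → x ∈ Eichler r → a ·ᴹ x ∈ Eichler r
  Eichler-· a∈ (eichler x₁ x₂ x₃ x₄) =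
    eichler (*∈𝒪 a∈ x₁) (*∈𝒪 a∈ x₂) (𝔭-*ˡ a∈ x₃) (*∈𝒪 a∈ x₄)

  Eichler-𝟙 : ∀ {r} → 𝟙 ∈ Eichler r
  Eichler-𝟙 = eichler 1∈𝒪 0∈𝒪 (𝔭-0 _) 1∈𝒪

  Eichler-det : ∀ {r x} → x ∈ Eichler r → det x ∈ 𝒪
  Eichler-det (eichler x₁ x₂ x₃ x₄) = +∈𝒪 (*∈𝒪 x₁ x₄) (-∈𝒪 (*∈𝒪 x₂ (𝔭⇒𝒪 x₃)))

  -- The order 𝒪 1 + πᵗ H₀ in coordinates: the scalar part disappears into the congruence between
  -- the diagonal entries.
  record Triangular (t : ℕ) (x : Mat) : Set (c ⊔ ℓ) where
    constructor triangular
    field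
      t₁₁   : m₁₁ x ∈ 𝒪
      t₁₂   : m₁₂ x ∈ 𝔭 t
      t₂₁≈0 : m₂₁ x ≈ 0#
      t₂₂   : m₂₂ x ∈ 𝒪
      t₁₁₋₂₂ : m₁₁ x - m₂₂ x ∈ 𝔭 t
  open Triangular public

  Triangular-resp : ∀ {t x y} → x ≈ᴹ y → x ∈ Triangular t → y ∈ Triangular t
  Triangular-resp (mat≈ f₁ f₂ f₃ f₄) (triangular x₁ x₂ x₃ x₄ x₅) = triangular
    (𝒪-resp f₁ x₁) (𝔭-resp f₂ x₂) (trans (sym f₃) x₃) (𝒪-resp f₄ x₄) (𝔭-resp (+-cong f₁ (-‿cong f₄)) x₅)

  opaque
    H₀^[t]⇔Triangular : ∀ t x → x ∈ Order.carrier (H₀ ^[ t ]) ⇔ x ∈ Triangular t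
    H₀^[t]⇔Triangular t x = mk⇔ there back
      where
      q : Carrier
      q = π^ t
      there : x ∈ Order.carrier (H₀ ^[ t ]) → x ∈ Triangular t
      there (e , h , e∈ , (a , b , d , a∈ , b∈ , d∈ , mat≈ h₁ h₂ h₃ h₄) , mat≈ x₁ x₂ x₃ x₄) =
        Triangular-resp (mat≈ (sym x₁′) (sym x₂′) (sym x₃′) (sym x₄′)) (triangular
          (+∈𝒪 e∈ (*∈𝒪 (π^∈𝒪 t) a∈)) (mk𝔭 b b∈ refl) refl
          (+∈𝒪 e∈ (*∈𝒪 (π^∈𝒪 t) d∈)) (mk𝔭 (a - d) (+∈𝒪 a∈ (-∈𝒪 d∈))
            (solve 4 (λ e q a d → (e :+ q :* a) :- (e :+ q :* d) := q :* (a :- d)) refl e q a d)))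
        where
        x₁′ : m₁₁ x ≈ e + q * a
        x₁′ = trans x₁ (+-cong (*-identityʳ e) (*-congˡ h₁))
        x₂′ : m₁₂ x ≈ q * b
        x₂′ = trans x₂ (trans (+-cong (zeroʳ e) (*-congˡ h₂)) (+-identityˡ _))
        x₃′ : m₂₁ x ≈ 0#
        x₃′ = trans x₃ (trans (+-cong (zeroʳ e) (trans (*-congˡ h₃) (zeroʳ q))) (+-identityˡ _))
        x₄′ : m₂₂ x ≈ e + q * d
        x₄′ = trans x₄ (+-cong (*-identityʳ e) (*-congˡ h₄))

      back : x ∈ Triangular t → x ∈ Order.carrier (H₀ ^[ t ])
      back (triangular x₁ (mk𝔭 b b∈ x₂) x₃ x₄ (mk𝔭 a a∈ x₅)) =
        -- The scalar part is not unique; taking the lower right entry of x makes that entry of h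
        -- zero.
        m₂₂ x , mat a b 0# 0# , x₄ , (a , b , 0# , a∈ , b∈ , 0∈𝒪 , ≈ᴹ-refl) , mat≈
          (trans (solve 2 (λ x d → x := d :* :1 :+ (x :- d)) refl (m₁₁ x) (m₂₂ x)) (+-congˡ x₅))
          (trans x₂ (solve 3 (λ d q b → q :* b := d :* :0 :+ q :* b) refl (m₂₂ x) q b))
          (trans x₃ (solve 2 (λ d q → :0 := d :* :0 :+ q :* :0) refl (m₂₂ x) q))
          (solve 2 (λ d q → d := d :* :1 :+ q :* :0) refl (m₂₂ x) q)

  -- The condition on `m₂₁` describes kH, so this says that conjugation by g restricts to an optimal
  -- embedding of H into the standard order.
  Optimal : ℕ → ℕ → Pred GL₂ (c ⊔ ℓ)
  Optimal r t g = ∀ x → m₂₁ x ≈ 0# → conj g x ∈ Eichler r ⇔ x ∈ Triangular t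

  Normalises : ∀ {s} → Pred Mat s → Pred GL₂ (c ⊔ s)
  Normalises S g = ∀ x → conj g x ∈ S ⇔ x ∈ S

  Normalises-∙ : ∀ {s} {S : Pred Mat s} → (∀ {x y} → x ≈ᴹ y → x ∈ S → y ∈ S) →
                 ∀ {g h} → g ∈ Normalises S → h ∈ Normalises S → g ∙ h ∈ Normalises S
  Normalises-∙ S-resp {g} {h} g∈ h∈ x = mk⇔
    (λ gh∈ → to (h∈ x) (to (g∈ _) (S-resp (conj-∙ g h x) gh∈)))
    (λ x∈ → S-resp (≈ᴹ-sym (conj-∙ g h x)) (from (g∈ _) (from (h∈ x) x∈)))

  Normalises-⁻¹ : ∀ {s} {S : Pred Mat s} → (∀ {x y} → x ≈ᴹ y → x ∈ S → y ∈ S) →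
                  ∀ {g} → g ∈ Normalises S → g ⁻¹ ∈ Normalises S
  Normalises-⁻¹ S-resp {g} g∈ x = mk⇔
    (λ g⁻¹x∈ → S-resp (conj-⁻¹ʳ g x) (from (g∈ _) g⁻¹x∈))
    (λ x∈ → to (g∈ _) (S-resp (≈ᴹ-sym (conj-⁻¹ʳ g x)) x∈))

  Γ₂⇔Normalises : ∀ {S : Subset} → (∀ {x y} → x ≈ᴹ y → x ∈ S → y ∈ S) →
                  ∀ g → g ∈ Γ₂ S ⇔ g ∈ Normalises S
  Γ₂⇔Normalises {S} S-resp g = mk⇔ there back
    where
    there : g ∈ Γ₂ S → g ∈ Normalises S
    there (⊆S , S⊆) x = mk⇔ pull (λ x∈ → ⊆S (x , x∈ , ≈ᴹ-refl))
      where
      pull : conj g x ∈ S → x ∈ S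
      pull gx∈ with S⊆ gx∈
      ... | y , y∈ , gx≈gy = S-resp (≈ᴹ-sym (≈ᴹ-trans (conj-move g gx≈gy) (conj-⁻¹ˡ g y))) y∈

    back : g ∈ Normalises S → g ∈ Γ₂ S
    back g∈ = (λ (x , x∈ , y≈) → S-resp (≈ᴹ-sym y≈) (from (g∈ x) x∈)) ,
              (λ {y} y∈ → conj (g ⁻¹) y , from (Normalises-⁻¹ S-resp {g} g∈ y) y∈ , ≈ᴹ-sym (conj-⁻¹ʳ g y))

  Optimal-∙ : ∀ {r t γ g} → γ ∈ Normalises (Eichler r) → Optimal r t g → Optimal r t (γ ∙ g)
  Optimal-∙ {γ = γ} {g} γ∈ g-opt x x↑ = mk⇔
    (λ γgx∈ → to (g-opt x x↑) (to (γ∈ _) (Eichler-resp (conj-∙ γ g x) γgx∈)))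
    (λ x∈ → Eichler-resp (≈ᴹ-sym (conj-∙ γ g x)) (from (γ∈ _) (from (g-opt x x↑) x∈)))

  Optimal-resp : ∀ {r t g h} → g ≈ᴳ h → Optimal r t g → Optimal r t h
  Optimal-resp g≈h g-opt x x↑ = mk⇔
    (λ hx∈ → to (g-opt x x↑) (Eichler-resp (≈ᴹ-sym (conj-cong g≈h ≈ᴹ-refl)) hx∈))
    (λ x∈ → Eichler-resp (conj-cong g≈h ≈ᴹ-refl) (from (g-opt x x↑) x∈))

  opaque
    borel-inverseʳ : ∀ x {z z⁻¹} → z * z⁻¹ ≈ 1# → mat 1# x 0# z *ᴹ mat 1# (- (x * z⁻¹)) 0# z⁻¹ ≈ᴹ 𝟙
    borel-inverseʳ x {z} {z⁻¹} zz⁻¹ = mat≈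
        (solve 1 (λ x → :1 :* :1 :+ x :* :0 := :1) refl x)
        (solve 2 (λ x z → :1 :* :- (x :* z) :+ x :* z := :0) refl x z⁻¹)
        (solve 1 (λ z → :0 :* :1 :+ z :* :0 := :0) refl z)
        (trans (solve 3 (λ x z z′ → :0 :* (:- (x :* z′)) :+ z :* z′ := z :* z′) refl x z z⁻¹) zz⁻¹)

    borel-inverseˡ : ∀ x {z z⁻¹} → z * z⁻¹ ≈ 1# → mat 1# (- (x * z⁻¹)) 0# z⁻¹ *ᴹ mat 1# x 0# z ≈ᴹ 𝟙
    borel-inverseˡ x {z} {z⁻¹} zz⁻¹ = mat≈
        (solve 2 (λ x z → :1 :* :1 :+ (:- (x :* z)) :* :0 := :1) refl x z⁻¹)
        (trans (solve 3 (λ x z z′ → :1 :* x :+ (:- (x :* z′)) :* z := x :* (:1 :- z :* z′)) refl x z z⁻¹)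
               (trans (*-congˡ (trans (+-congˡ (-‿cong zz⁻¹)) (-‿inverseʳ 1#))) (zeroʳ x)))
        (solve 1 (λ z → :0 :* :1 :+ z :* :0 := :0) refl z⁻¹)
        (trans (solve 3 (λ x z z′ → :0 :* x :+ z′ :* z := z :* z′) refl x z z⁻¹) zz⁻¹)

  borel : Parameter → GL₂
  borel ((x , _) , (z , unit _ z⁻¹ _ zz⁻¹)) =
    pack (mat 1# x 0# z) (mat 1# (- (x * z⁻¹)) 0# z⁻¹) (borel-inverseʳ x zz⁻¹) (borel-inverseˡ x zz⁻¹)

  private
    det-basepoint : ∀ r t → det (mat 1# 0# (π^ (r ℕ.∸ t)) (π^ t)) ≈ π^ t
    det-basepoint r t = solve 2 (λ m q → :1 :* q :- :0 :* m := q) refl (π^ (r ℕ.∸ t)) (π^ t)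

    det-reversal : ∀ r → det (mat 0# 1# (π^ r) 0#) ≈ - π^ r
    det-reversal r = solve 1 (λ q → :0 :* :0 :- :1 :* q := :- q) refl (π^ r)

    inverse-neg : ∀ {x y} → x * y ≈ 1# → - x * - y ≈ 1#
    inverse-neg {x} {y} = trans (solve 2 (λ x y → :- x :* :- y := x :* y) refl x y)

  π^⁻¹ : ℕ → Carrier
  π^⁻¹ n = proj₁ (inverse (π^ n) (π^≉0 n))

  ππ⁻¹ : ∀ n → π^ n * π^⁻¹ n ≈ 1#
  ππ⁻¹ n = proj₂ (inverse (π^ n) (π^≉0 n))

  -- The first column (1 , πʳ⁻ᵗ) is an end that leaves the path of the standard order at distance t
  -- from one extremity. The determinant πᵗ is the one that optimality imposes, up to a unit, on the
  -- normal form.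
  basepoint : ℕ → ℕ → GL₂
  basepoint r t = fromDet (mat 1# 0# (π^ (r ℕ.∸ t)) (π^ t)) (π^⁻¹ t)
    (trans (*-congʳ (det-basepoint r t)) (ππ⁻¹ t))

  -- The element of the normaliser that reverses the path of length r in the
  -- tree fixed by the Eichler order.
  reversal : ℕ → GL₂
  reversal r = fromDet (mat 0# 1# (π^ r) 0#) (- π^⁻¹ r)
    (trans (*-congʳ (det-reversal r)) (inverse-neg (ππ⁻¹ r)))

  opaque
    unfolding _∙_

    reversal² : ∀ r → reversal r ∙ reversal r ≈ᴳ scalar (ππ⁻¹ r)
    reversal² r = wrap (mat≈
      (solve 1 (λ q → :0 :* :0 :+ :1 :* q := q :* :1) refl (π^ r))
      (solve 1 (λ q → :0 :* :1 :+ :1 :* :0 := q :* :0) refl (π^ r))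
      (solve 1 (λ q → q :* :0 :+ :0 :* q := q :* :0) refl (π^ r))
      (solve 1 (λ q → q :* :1 :+ :0 :* :0 := q :* :1) refl (π^ r)))

  -- One inclusion suffices: w² is a scalar, so applying it twice gives back x.
  reversal-normalises : ∀ r → reversal r ∈ Normalises (Eichler r)
  reversal-normalises r x = mk⇔
    (λ wx∈ → Eichler-resp (≈ᴹ-trans (≈ᴹ-sym (conj-∙ w w x))
      (≈ᴹ-trans (conj-cong (reversal² r) ≈ᴹ-refl) (conj-scalar (ππ⁻¹ r) x))) (stable wx∈))
    stable
    where
    w = reversal r
    stable : ∀ {x} → x ∈ Eichler r → conj w x ∈ Eichler r
    stable {x@(mat x₁ x₂ x₃ x₄)} (eichler x₁∈ x₂∈ (mk𝔭 y y∈ e) x₄∈) =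
      Eichler-resp (conj-intro w {y = x} (mat≈
        (trans (solve 4 (λ d y q a → d :* :0 :+ y :* q := q :* y) refl x₄ y (π^ r) x₁)
               (trans (sym e) (solve 2 (λ a c → c := :0 :* a :+ :1 :* c) refl x₁ x₃)))
        (solve 3 (λ d y b → d :* :1 :+ y :* :0 := :0 :* b :+ :1 :* d) refl x₄ y x₂)
        (solve 4 (λ q b a c → (q :* b) :* :0 :+ a :* q := q :* a :+ :0 :* c) refl (π^ r) x₂ x₁ x₃)
        (solve 4 (λ q b a d → (q :* b) :* :1 :+ a :* :0 := q :* b :+ :0 :* d) refl (π^ r) x₂ x₁ x₄)))
      (eichler x₄∈ y∈ (mk𝔭 x₂ x₂∈ refl) x₁∈)

  scalar-normalises : ∀ {s} {S : Pred Mat s} → (∀ {x y} → x ≈ᴹ y → x ∈ S → y ∈ S) →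
                      ∀ {a b} (e : a * b ≈ 1#) → scalar e ∈ Normalises S
  scalar-normalises S-resp e x = mk⇔ (S-resp (conj-scalar e x)) (S-resp (≈ᴹ-sym (conj-scalar e x)))

  module _ {r t : ℕ} (2t≤r : 2 ℕ.* t ℕ.≤ r) where
    t≤r : t ℕ.≤ r
    t≤r = ℕₚ.≤-trans (ℕₚ.m≤m+n t _) 2t≤r

    t≤r∸t : t ℕ.≤ r ℕ.∸ t
    t≤r∸t = ℕₚ.m+n≤o⇒m≤o∸n t (≡.subst (ℕ._≤ r) (≡.cong (t ℕ.+_) (ℕₚ.+-identityʳ t)) 2t≤r)

    r≤2[r∸t] : r ℕ.≤ (r ℕ.∸ t) ℕ.+ (r ℕ.∸ t)
    r≤2[r∸t] = ≡.subst (ℕ._≤ (r ℕ.∸ t) ℕ.+ (r ℕ.∸ t)) (ℕₚ.m∸n+n≡m t≤r) (ℕₚ.+-monoʳ-≤ (r ℕ.∸ t) t≤r∸t)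

    private
      m = π^ (r ℕ.∸ t)
      q = π^ t
      M = basepoint r t

    -- Let m = πʳ⁻ᵗ and β = πᵗb. Conjugating (α β ; 0 δ) by M gives (α - mb , b ; m(α - δ) - m²b , δ
    -- + mb). Integrality of b says β ∈ 𝔭ᵗ. Since 2t ≤ r, the term m²b lies in 𝔭ʳ, and what remains
    -- of the lower left condition is m(α - δ) ∈ 𝔭ʳ, that is α ≡ δ modulo 𝔭ᵗ.
    basepoint-optimal : Optimal r t (basepoint r t)
    basepoint-optimal X@(mat α β ζ δ) ζ≈0 = mk⇔ there back
      where
      there : conj M X ∈ Eichler r → X ∈ Triangular t
      there Y∈ = go Y∈ (conj-elim M {conj M X} {X} ≈ᴹ-refl)
        where
        go : ∀ {Y} → Y ∈ Eichler r → Y *ᴹ matrix M ≈ᴹ matrix M *ᴹ X → X ∈ Triangular t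
        go {mat y₁ y₂ y₃ y₄} (eichler y₁∈ y₂∈ y₃∈ y₄∈) (mat≈ f₁ f₂ f₃ f₄) = triangular
          (𝒪-resp (sym α≈) (+∈𝒪 y₁∈ (*∈𝒪 (π^∈𝒪 (r ℕ.∸ t)) y₂∈)))
          (mk𝔭 y₂ y₂∈ β≈) ζ≈0
          (𝒪-resp (sym δ≈) (+∈𝒪 y₄∈ (-∈𝒪 (*∈𝒪 (π^∈𝒪 (r ℕ.∸ t)) y₂∈))))
          (𝔭-resp (trans (solve 4 (λ a y m b → (a :- y) :+ m :* b := a :- (y :- m :* b)) refl α y₄ m y₂)
                         (+-congˡ (-‿cong (sym δ≈))))
                  (𝔭-+ α-y₄∈ (𝔭-*ʳ (𝔭-mono t≤r∸t (π^∈𝔭 (r ℕ.∸ t))) y₂∈)))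
          where
          α≈ : α ≈ y₁ + m * y₂
          α≈ = trans (solve 2 (λ a z → a := :1 :* a :+ :0 :* z) refl α ζ) (trans (sym f₁)
               (solve 3 (λ y z m → y :* :1 :+ z :* m := y :+ m :* z) refl y₁ y₂ m))
          β≈ : β ≈ q * y₂
          β≈ = trans (solve 2 (λ b d → b := :1 :* b :+ :0 :* d) refl β δ) (trans (sym f₂)
               (solve 3 (λ y z q → y :* :0 :+ z :* q := q :* z) refl y₁ y₂ q))
          δ≈ : δ ≈ y₄ - m * y₂
          δ≈ = *-cancel-≉0 (π^≉0 t) (trans
            (solve 4 (λ q d m b → q :* d := (m :* b :+ q :* d) :- m :* b) refl q δ m β)
            (trans (+-cong (sym f₄) (-‿cong (*-congˡ β≈)))
              (solve 5 (λ y₃ y₄ q m y₂ → (y₃ :* :0 :+ y₄ :* q) :- m :* (q :* y₂) := q :* (y₄ :- m :* y₂))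
                refl y₃ y₄ q m y₂)))
          α-y₄∈ : α - y₄ ∈ 𝔭 t
          α-y₄∈ = 𝔭-cancel {m = r ℕ.∸ t} (≡.subst (λ n → m * (α - y₄) ∈ 𝔭 n) (≡.sym (ℕₚ.m∸n+n≡m t≤r))
            (𝔭-resp (sym (trans
              (solve 4 (λ m a q y → m :* (a :- y) := (m :* a :+ q :* :0) :- m :* y) refl m α q y₄)
              (trans (+-congʳ (trans (+-congˡ (*-congˡ (sym ζ≈0))) (sym f₃)))
                (solve 3 (λ y₃ y₄ m → (y₃ :* :1 :+ y₄ :* m) :- m :* y₄ := y₃) refl y₃ y₄ m)))) y₃∈))

      back : X ∈ Triangular t → conj M X ∈ Eichler r
      back (triangular α∈ (mk𝔭 b b∈ β≈) _ δ∈ α-δ∈) = Eichler-resp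
        (conj-intro M {y = X} (mat≈
          (solve 4 (λ a m b z → (a :- m :* b) :* :1 :+ b :* m := :1 :* a :+ :0 :* z) refl α m b ζ)
          (trans (solve 5 (λ a m b q d → (a :- m :* b) :* :0 :+ b :* q := :1 :* (q :* b) :+ :0 :* d) refl α m b q δ)
                 (+-congʳ (*-congˡ (sym β≈))))
          (trans (solve 5 (λ a m b q d → (m :* (a :- d) :- (m :* m) :* b) :* :1 :+ (d :+ m :* b) :* m :=
                                         m :* a :+ q :* :0) refl α m b q δ)
                 (+-congˡ (*-congˡ (sym ζ≈0))))
          (trans (solve 5 (λ a m b q d → (m :* (a :- d) :- (m :* m) :* b) :* :0 :+ (d :+ m :* b) :* q :=
                                         m :* (q :* b) :+ q :* d) refl α m b q δ)
                 (+-congʳ (*-congˡ (sym β≈))))))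
        (eichler (+∈𝒪 α∈ (-∈𝒪 mb∈)) b∈
          (𝔭-+ (≡.subst (λ n → m * (α - δ) ∈ 𝔭 n) (ℕₚ.m∸n+n≡m t≤r) (𝔭-* (π^∈𝔭 (r ℕ.∸ t)) α-δ∈))
                (𝔭-neg (𝔭-*ʳ (𝔭-mono r≤2[r∸t] (𝔭-* (π^∈𝔭 (r ℕ.∸ t)) (π^∈𝔭 (r ℕ.∸ t)))) b∈)))
          (+∈𝒪 δ∈ mb∈))
        where
        mb∈ : m * b ∈ 𝒪
        mb∈ = *∈𝒪 (π^∈𝒪 (r ℕ.∸ t)) b∈

-- Orbits under k*E* and the normal form of an optimal element.

module Classification {c ℓ} (k : LocalField c ℓ) where
  open LocalField k
  open Valuation k
  open Residues k using (Parameter)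
  open MatrixAlgebra k
  open Optimality k
  private module ≈G = SetoidReasoning GL₂-setoid

  record IsSubgroup {s} (Γ : Pred GL₂ s) : Set (c ⊔ ℓ ⊔ s) where
    field
      Γ-resp : ∀ {g h} → g ≈ᴳ h → g ∈ Γ → h ∈ Γ
      Γ-ε    : ε ∈ Γ
      Γ-∙    : ∀ {g h} → g ∈ Γ → h ∈ Γ → g ∙ h ∈ Γ
      Γ-⁻¹   : ∀ {g} → g ∈ Γ → g ⁻¹ ∈ Γ

  Orbit : ∀ {s} → Pred GL₂ s → GL₂ → GL₂ → Set (c ⊔ ℓ ⊔ s)
  Orbit Γ g h = ∃[ γ ] γ ∈ Γ × h ≈ᴳ γ ∙ g

  module _ {s} {Γ : Pred GL₂ s} (isSubgroup : IsSubgroup Γ) where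
    open IsSubgroup isSubgroup

    orbit-reflexive : ∀ {g h} → g ≈ᴳ h → Orbit Γ g h
    orbit-reflexive {g} g≈h = ε , Γ-ε , ≈ᴳ-trans (≈ᴳ-sym g≈h) (≈ᴳ-sym (∙-identityˡ g))

    orbit-sym : ∀ {g h} → Orbit Γ g h → Orbit Γ h g
    orbit-sym {g} {h} (γ , γ∈ , e) = γ ⁻¹ , Γ-⁻¹ γ∈ ,
      ≈ᴳ-trans (≈ᴳ-sym (g⁻¹∙[g∙h]≈h γ g)) (∙-congˡ (≈ᴳ-sym e))

    orbit-trans : ∀ {g h i} → Orbit Γ g h → Orbit Γ h i → Orbit Γ g i
    orbit-trans {g} {h} {i} (γ , γ∈ , e) (η , η∈ , f) = η ∙ γ , Γ-∙ η∈ γ∈ ,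
      ≈ᴳ-trans f (≈ᴳ-trans (∙-congˡ e) (≈ᴳ-sym (∙-assoc η γ g)))

    orbit-∙ : ∀ {γ} g → γ ∈ Γ → Orbit Γ g (γ ∙ g)
    orbit-∙ g γ∈ = _ , γ∈ , ≈ᴳ-refl

    orbit-cancelʳ : ∀ g h i j → Orbit Γ (g ∙ h) (i ∙ (g ∙ j)) → Orbit Γ (g ∙ (h ∙ j ⁻¹)) (i ∙ g)
    orbit-cancelʳ g h i j (γ , γ∈ , e) = γ , γ∈ , (begin
      i ∙ g                        ≈⟨ [h∙g]∙g⁻¹≈h j (i ∙ g) ⟨
      i ∙ g ∙ j ∙ j ⁻¹             ≈⟨ ∙-congʳ (∙-assoc i g j) ⟩
      i ∙ (g ∙ j) ∙ j ⁻¹           ≈⟨ ∙-congʳ e ⟩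
      γ ∙ (g ∙ h) ∙ j ⁻¹           ≈⟨ ∙-assoc γ (g ∙ h) (j ⁻¹) ⟩
      γ ∙ (g ∙ h ∙ j ⁻¹)           ≈⟨ ∙-congˡ (∙-assoc g h (j ⁻¹)) ⟩
      γ ∙ (g ∙ (h ∙ j ⁻¹))         ∎)
      where open ≈G

  orbit-∙ʳ : ∀ {s} {Γ : Pred GL₂ s} {g h} i → Orbit Γ g h → Orbit Γ (g ∙ i) (h ∙ i)
  orbit-∙ʳ i (γ , γ∈ , e) = γ , γ∈ , ≈ᴳ-trans (∙-congʳ e) (∙-assoc γ _ i)

  orbit-⊆ : ∀ {s s′} {Γ : Pred GL₂ s} {Γ′ : Pred GL₂ s′} → Γ ⊆ Γ′ → ∀ {g h} → Orbit Γ g h → Orbit Γ′ g h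
  orbit-⊆ Γ⊆ (γ , γ∈ , e) = γ , Γ⊆ γ∈ , e

  module _ {r : ℕ} where
    private
      E = Eichler r

    record E* (u : GL₂) : Set (c ⊔ ℓ) where
      constructor _,_
      field
        matrix∈ : matrix u ∈ E
        inv∈    : inv u ∈ E

    opaque
      unfolding _∙_

      E*-ε : E* ε
      E*-ε = Eichler-𝟙 , Eichler-𝟙

      E*-∙ : ∀ u w → E* u → E* w → E* (u ∙ w)
      E*-∙ u w (u∈ , u⁻¹∈) (w∈ , w⁻¹∈) = Eichler-* u∈ w∈ , Eichler-* w⁻¹∈ u⁻¹∈

      E*-⁻¹ : ∀ u → E* u → E* (u ⁻¹)
      E*-⁻¹ u (u∈ , u⁻¹∈) = u⁻¹∈ , u∈

      E*-conj : ∀ g u → conj g (matrix u) ∈ E → conj g (inv u) ∈ E → E* (g ∙ u ∙ g ⁻¹)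
      E*-conj g u u∈ u⁻¹∈ = u∈ , Eichler-resp (*ᴹ-assoc _ _ _) u⁻¹∈

      unit-normalises : ∀ u → E* u → u ∈ Normalises E
      unit-normalises u (u∈ , u⁻¹∈) x = mk⇔
        (λ ux∈ → Eichler-resp (conj-⁻¹ˡ u x) (Eichler-* (Eichler-* u⁻¹∈ ux∈) u∈))
        (λ x∈ → Eichler-* (Eichler-* u∈ x∈) u⁻¹∈)

    Γ₁-decompose : ∀ {g} → g ∈ Γ₁ E → ∃[ a ] ∃[ b ] Σ[ e ∈ a * b ≈ 1# ] Σ[ u ∈ GL₂ ] E* u × g ≈ᴳ scalar e ∙ u
    Γ₁-decompose (a , a≉0 , u , u∈ , u⁻¹∈ , g≈) = let (b , ab≈1) = inverse a a≉0 in
      a , b , ab≈1 , u , (u∈ , u⁻¹∈) , wrap (≈ᴹ-trans g≈ (≈ᴹ-sym (scalar-∙ ab≈1 u)))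

    Γ₁-compose : ∀ {a b g} (e : a * b ≈ 1#) u → E* u → g ≈ᴳ scalar e ∙ u → g ∈ Γ₁ E
    Γ₁-compose e u (u∈ , u⁻¹∈) g≈ = _ , *≈1⇒≉0 e , u , u∈ , u⁻¹∈ , ≈ᴹ-trans (unwrap g≈) (scalar-∙ e u)

    Γ₁-unit : ∀ u → E* u → u ∈ Γ₁ E
    Γ₁-unit u (u∈ , u⁻¹∈) = 1# , 1≉0 , u , u∈ , u⁻¹∈ , ≈ᴹ-sym (·ᴹ-identity _)

    Γ₁-scalar : ∀ {a b} (e : a * b ≈ 1#) → scalar e ∈ Γ₁ E
    Γ₁-scalar e = Γ₁-compose e ε E*-ε (≈ᴳ-sym (∙-identityʳ (scalar e)))

    scalar-central : ∀ {a b} (e : a * b ≈ 1#) g → scalar e ∙ g ≈ᴳ g ∙ scalar e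
    scalar-central e g = wrap (≈ᴹ-trans (scalar-∙ e g) (≈ᴹ-sym (∙-scalar e g)))

    Γ₁-∙ : ∀ {g h} → g ∈ Γ₁ E → h ∈ Γ₁ E → g ∙ h ∈ Γ₁ E
    Γ₁-∙ {g} {h} (a , a≉0 , u , u∈ , u⁻¹∈ , g≈) (b , b≉0 , w , w∈ , w⁻¹∈ , h≈) =
      let (uw∈ , uw⁻¹∈) = E*-∙ u w (u∈ , u⁻¹∈) (w∈ , w⁻¹∈) in
      a * b , *-≉0 a≉0 b≉0 , u ∙ w , uw∈ , uw⁻¹∈ ,
      ≡.subst₂ (λ x y → x ≈ᴹ (a * b) ·ᴹ y) (≡.sym (matrix-∙ g h)) (≡.sym (matrix-∙ u w))
        (≈ᴹ-trans (*ᴹ-cong g≈ h≈) (≈ᴹ-trans (·-*ᴹˡ a _ _)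
          (≈ᴹ-trans (·ᴹ-congˡ (·-*ᴹʳ b _ _)) (≈ᴹ-sym (·ᴹ-assoc a b _)))))

    Γ₁-⁻¹ : ∀ {g} → g ∈ Γ₁ E → g ⁻¹ ∈ Γ₁ E
    Γ₁-⁻¹ {g} g∈ = let (a , b , e , u , u∈ , g≈) = Γ₁-decompose {g} g∈
                       e′ = trans (*-comm b a) e in
      Γ₁-compose e′ (u ⁻¹) (E*-⁻¹ u u∈) (begin
        g ⁻¹                     ≈⟨ ⁻¹-congᴳ g≈ ⟩
        (scalar e ∙ u) ⁻¹        ≈⟨ ⁻¹-anti-homo-∙ (scalar e) u ⟩
        u ⁻¹ ∙ scalar e ⁻¹       ≈⟨ ∙-congˡ (wrap (≈ᴹ-reflexive (matrix-⁻¹ (scalar e)))) ⟩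
        u ⁻¹ ∙ scalar e′         ≈⟨ scalar-central e′ (u ⁻¹) ⟨
        scalar e′ ∙ u ⁻¹         ∎)
      where open ≈G

    Γ₁-isSubgroup : IsSubgroup (Γ₁ E)
    Γ₁-isSubgroup = record
      { Γ-resp = λ g≈h (a , a≉0 , u , u∈ , u⁻¹∈ , g≈) →
          a , a≉0 , u , u∈ , u⁻¹∈ , ≈ᴹ-trans (≈ᴹ-sym (unwrap g≈h)) g≈
      ; Γ-ε = Γ₁-unit ε E*-ε
      ; Γ-∙ = λ {g} {h} → Γ₁-∙ {g} {h}
      ; Γ-⁻¹ = λ {g} → Γ₁-⁻¹ {g}
      }

    Γ₂-isSubgroup : IsSubgroup (Γ₂ E)
    Γ₂-isSubgroup = record
      { Γ-resp = λ {g} {h} g≈h g∈ → from (Γ₂⇔Normalises Eichler-resp h) λ x → let N = to (Γ₂⇔Normalises Eichler-resp g) g∈ x in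
          mk⇔ (λ hx∈ → to N (Eichler-resp (≈ᴹ-sym (conj-cong g≈h ≈ᴹ-refl)) hx∈))
              (λ x∈ → Eichler-resp (conj-cong g≈h ≈ᴹ-refl) (from N x∈))
      ; Γ-ε = from (Γ₂⇔Normalises Eichler-resp ε) λ x →
          mk⇔ (Eichler-resp (conj-ε x)) (Eichler-resp (≈ᴹ-sym (conj-ε x)))
      ; Γ-∙ = λ {g} {h} g∈ h∈ → from (Γ₂⇔Normalises Eichler-resp (g ∙ h))
          (Normalises-∙ Eichler-resp {g} {h} (to (Γ₂⇔Normalises Eichler-resp g) g∈) (to (Γ₂⇔Normalises Eichler-resp h) h∈))
      ; Γ-⁻¹ = λ {g} g∈ → from (Γ₂⇔Normalises Eichler-resp (g ⁻¹))
          (Normalises-⁻¹ Eichler-resp {g} (to (Γ₂⇔Normalises Eichler-resp g) g∈))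
      }

    Γ₁⊆Γ₂ : Γ₁ E ⊆ Γ₂ E
    Γ₁⊆Γ₂ {g} g∈ = let (a , b , e , u , u∈ , g≈) = Γ₁-decompose {g} g∈ in
      IsSubgroup.Γ-resp Γ₂-isSubgroup (≈ᴳ-sym g≈) (from (Γ₂⇔Normalises Eichler-resp (scalar e ∙ u))
        (Normalises-∙ Eichler-resp {scalar e} {u} (scalar-normalises Eichler-resp e) (unit-normalises u u∈)))

    Γ₂-normalises : ∀ {g} → g ∈ Γ₂ E → g ∈ Normalises E
    Γ₂-normalises {g} = to (Γ₂⇔Normalises Eichler-resp g)

    reversal∈Γ₂ : reversal r ∈ Γ₂ E
    reversal∈Γ₂ = from (Γ₂⇔Normalises Eichler-resp (reversal r)) (reversal-normalises r)

    -- Conjugation by a normalising element keeps both u and u⁻¹ in E, and scalars are central. This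
    -- is what makes Γ₂ act on Γ₁-orbits.
    Γ₁-normal : ∀ {γ g} → g ∈ Γ₂ E → γ ∈ Γ₁ E → g ∙ γ ∙ g ⁻¹ ∈ Γ₁ E
    Γ₁-normal {γ} {g} g∈ γ∈ = let (a , b , e , u , (u∈ , u⁻¹∈) , γ≈) = Γ₁-decompose {γ} γ∈ in
      Γ₁-compose e (g ∙ u ∙ g ⁻¹)
        (E*-conj g u (from (Γ₂-normalises {g} g∈ (matrix u)) u∈) (from (Γ₂-normalises {g} g∈ (inv u)) u⁻¹∈))
        (begin
          g ∙ γ ∙ g ⁻¹                  ≈⟨ ∙-congʳ (∙-congˡ γ≈) ⟩
          g ∙ (scalar e ∙ u) ∙ g ⁻¹     ≈⟨ ∙-congʳ (∙-assoc g _ u) ⟨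
          g ∙ scalar e ∙ u ∙ g ⁻¹       ≈⟨ ∙-congʳ (∙-congʳ (scalar-central e g)) ⟨
          scalar e ∙ g ∙ u ∙ g ⁻¹       ≈⟨ ∙-congʳ (∙-assoc _ g u) ⟩
          scalar e ∙ (g ∙ u) ∙ g ⁻¹     ≈⟨ ∙-assoc _ _ _ ⟩
          scalar e ∙ (g ∙ u ∙ g ⁻¹)     ∎)
      where open ≈G

    Γ₂-permutes-orbits : ∀ {g h i} → i ∈ Γ₂ E → Orbit (Γ₁ E) g h → Orbit (Γ₁ E) (i ∙ g) (i ∙ h)
    Γ₂-permutes-orbits {g} {h} {i} i∈ (γ , γ∈ , e) = i ∙ γ ∙ i ⁻¹ , Γ₁-normal {γ} {i} i∈ γ∈ , (begin
      i ∙ h                          ≈⟨ ∙-congˡ e ⟩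
      i ∙ (γ ∙ g)                    ≈⟨ ∙-assoc i γ g ⟨
      i ∙ γ ∙ g                      ≈⟨ ∙-congˡ (g⁻¹∙[g∙h]≈h i g) ⟨
      i ∙ γ ∙ (i ⁻¹ ∙ (i ∙ g))       ≈⟨ ∙-assoc _ _ _ ⟨
      i ∙ γ ∙ i ⁻¹ ∙ (i ∙ g)         ∎)
      where open ≈G

    reversal²-orbit : ∀ g → Orbit (Γ₁ E) g (reversal r ∙ (reversal r ∙ g))
    reversal²-orbit g = scalar (ππ⁻¹ r) , Γ₁-scalar (ππ⁻¹ r) ,
      ≈ᴳ-trans (≈ᴳ-sym (∙-assoc (reversal r) (reversal r) g)) (∙-congʳ (reversal² r))

  point : ℕ → ℕ → Parameter → GL₂
  point r t q = basepoint r t ∙ borel q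

  -- If n < m, cancelling πⁿ would put the unit u into 𝔭. Inequalities between exponents are proved
  -- below by exhibiting such memberships.
  unit∣⇒≤ : ∀ {m n u} → Unit u → π^ n * u ∈ 𝔭 m → m ℕ.≤ n
  unit∣⇒≤ {m} {n} {u} u-unit e with m ℕₚ.≤? n
  ... | yes m≤n = m≤n
  ... | no m≰n  = ⊥-elim (Unit⇒∉𝔭 u-unit (𝔭-cancel {m = n} {n = suc (m ℕ.∸ suc n)}
    (≡.subst (λ i → π^ n * u ∈ 𝔭 i)
      (≡.trans (≡.sym (ℕₚ.m+[n∸m]≡n (ℕₚ.≰⇒> m≰n))) (≡.sym (ℕₚ.+-suc n (m ℕ.∸ suc n)))) e)))

  -- If γη ∈ 𝔭ʳ forces η ∈ 𝔭ᵗ, while γπᵗ ∈ 𝔭ʳ, then v(γ) = r - t.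
  valuation-r∸t : ∀ {r t γ} → 0 ℕ.< t → γ ∈ 𝒪 → γ * γ ∈ 𝔭 r → γ * π^ t ∈ 𝔭 r →
    (∀ {η} → η ∈ 𝒪 → γ * η ∈ 𝔭 r → η ∈ 𝔭 t) →
    2 ℕ.* t ℕ.≤ r × ∃[ e ] Unit e × e * γ ≈ π^ (r ℕ.∸ t)
  valuation-r∸t {r} {t@(suc t′)} {γ} _ γ∈ γ²∈ γq∈ η∈𝔭t with γ ≈0?
  ... | yes γ≈0 = ⊥-elim (1∉𝔭 (η∈𝔭t 1∈𝒪 (𝔭-resp (sym (trans (*-congʳ γ≈0) (zeroˡ 1#))) (𝔭-0 r))))
  ... | no γ≉0 with factor γ∈ γ≉0
  ... | n , ε′ , ε-unit@(unit _ ε⁻¹ _ εε⁻¹) , γ≈ = 2t≤ , ε⁻¹ , Unit-⁻¹ ε-unit ,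
    trans (*-congˡ γ≈) (trans
      (solve 3 (λ a b c → a :* (b :* c) := b :* (c :* a)) refl ε⁻¹ (π^ n) ε′)
      (trans (*-congˡ εε⁻¹) (trans (*-identityʳ _) (reflexive (≡.cong π^_ n≡)))))
    where
    γπ : ∀ a → γ * π^ a ≈ π^ (n ℕ.+ a) * ε′
    γπ a = trans (*-congʳ γ≈) (trans (solve 3 (λ p e a → (p :* e) :* a := (p :* a) :* e) refl (π^ n) ε′ (π^ a))
                                     (*-congʳ (π^-* n a)))
    r≤n+t : r ℕ.≤ n ℕ.+ t
    r≤n+t = unit∣⇒≤ {n = n ℕ.+ t} ε-unit (𝔭-resp (γπ t) γq∈)
    n+t≤r : n ℕ.+ t ℕ.≤ r
    n+t≤r with r ℕₚ.≤? n ℕ.+ t′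
    ... | no r≰  = ≡.subst (ℕ._≤ r) (≡.sym (ℕₚ.+-suc n t′)) (ℕₚ.≰⇒> r≰)
    -- The test value η = πᵗ⁻¹: it would satisfy γη ∈ 𝔭ʳ without lying in 𝔭ᵗ.
    ... | yes r≤ = ⊥-elim (ℕₚ.<-irrefl ≡.refl (unit∣⇒≤ {m = t} {n = t′} Unit-1 (𝔭-resp (sym (*-identityʳ _))
      (η∈𝔭t (π^∈𝒪 t′) (𝔭-resp (sym (γπ t′)) (𝔭-mono r≤ (mk𝔭 ε′ (Unit.u∈ ε-unit) refl)))))))
    n+t≡r : n ℕ.+ t ≡ r
    n+t≡r = ℕₚ.≤-antisym n+t≤r r≤n+t
    n≡ : n ≡ r ℕ.∸ t
    n≡ = ≡.trans (≡.sym (ℕₚ.m+n∸n≡m n t)) (≡.cong (ℕ._∸ t) n+t≡r)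
    r≤n+n : r ℕ.≤ n ℕ.+ n
    r≤n+n = unit∣⇒≤ {n = n ℕ.+ n} (Unit-* ε-unit ε-unit) (𝔭-resp
      (trans (*-cong γ≈ γ≈) (trans (solve 2 (λ p e → (p :* e) :* (p :* e) := (p :* p) :* (e :* e)) refl (π^ n) ε′)
             (*-congʳ (π^-* n n)))) γ²∈)
    2t≤ : 2 ℕ.* t ℕ.≤ r
    2t≤ = ≡.subst₂ ℕ._≤_ (≡.cong (t ℕ.+_) (≡.sym (ℕₚ.+-identityʳ t))) n+t≡r
      (ℕₚ.+-monoˡ-≤ t (ℕₚ.+-cancelˡ-≤ n t n (≡.subst (ℕ._≤ n ℕ.+ n) (≡.sym n+t≡r) r≤n+n)))

  lowerUnit : Carrier → ∀ {e} → Unit e → GL₂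
  lowerUnit y {e} (unit _ e⁻¹ _ ee⁻¹) = fromDet (mat 1# 0# y e) e⁻¹
    (trans (*-congʳ (solve 2 (λ y e → :1 :* e :- :0 :* y := e) refl y e)) ee⁻¹)

  lowerUnit-unit : ∀ {r y e} → y ∈ 𝔭 r → (u : Unit e) → E* {r} (lowerUnit y u)
  lowerUnit-unit y∈ (unit e∈ e⁻¹ e⁻¹∈ _) =
    eichler 1∈𝒪 0∈𝒪 y∈ e∈ , Eichler-· e⁻¹∈ (eichler e∈ (-∈𝒪 0∈𝒪) (𝔭-neg y∈) 1∈𝒪)

  lowerUnit∈Γ₁ : ∀ {r y e} → y ∈ 𝔭 r → (u : Unit e) → lowerUnit y u ∈ Γ₁ (Eichler r)
  lowerUnit∈Γ₁ {r} y∈ u = Γ₁-unit {r} (lowerUnit _ u) (lowerUnit-unit y∈ u)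

  -- The test matrices below are conjugated by g = (1 x ; γ δ) to
  -- (-γ 1 ; -γ² γ) and (η 0 ; γη 0).
  module _ {r t : ℕ} (x γ δ Δ⁻¹ : Carrier) (ΔΔ⁻¹ : (1# * δ - x * γ) * Δ⁻¹ ≈ 1#) where
    private
      g = fromDet (mat 1# x γ δ) Δ⁻¹ ΔΔ⁻¹
      Δ = δ - x * γ
      q = π^ t

    module _ (g-opt : Optimal r t g) where
      private
        Δ∈𝔭t : γ ∈ 𝒪 → γ * γ ∈ 𝔭 r → Δ ∈ 𝔭 t
        -- The nilpotent (-γ 1 ; -γ² γ), which kills the first column (1 , γ) of `g`, lies in E
        -- because γ² ∈ 𝔭ʳ. It equals g (0 Δ ; 0 0) g⁻¹, so Δ must be divisible by πᵗ.
        Δ∈𝔭t γ∈ γ²∈ = t₁₂ (to (g-opt (mat 0# Δ 0# 0#) refl) (Eichler-resp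
          (conj-intro g {x = mat (- γ) 1# (- (γ * γ)) γ} (mat≈
            (solve 2 (λ x γ → :- γ :* :1 :+ :1 :* γ := :1 :* :0 :+ x :* :0) refl x γ)
            (solve 3 (λ x γ δ → :- γ :* x :+ :1 :* δ := :1 :* (δ :- x :* γ) :+ x :* :0) refl x γ δ)
            (solve 2 (λ γ δ → :- (γ :* γ) :* :1 :+ γ :* γ := γ :* :0 :+ δ :* :0) refl γ δ)
            (solve 3 (λ x γ δ → :- (γ :* γ) :* x :+ γ :* δ := γ :* (δ :- x :* γ) :+ δ :* :0) refl x γ δ)))
          (eichler (-∈𝒪 γ∈) 1∈𝒪 (𝔭-neg γ²∈) γ∈)))

        η∈𝔭t : ∀ {η} → η ∈ 𝒪 → γ * η ∈ 𝔭 r → η ∈ 𝔭 t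
        -- Here (η 0 ; γη 0) = g (η xη ; 0 0) g⁻¹, and the diagonal entries of the matrix in the
        -- middle differ by η.
        η∈𝔭t {η} η∈ γη∈ = 𝔭-resp (solve 1 (λ η → η :- :0 := η) refl η)
          (t₁₁₋₂₂ (to (g-opt (mat η (x * η) 0# 0#) refl) (Eichler-resp
            (conj-intro g {x = mat η 0# (γ * η) 0#} (mat≈
              (solve 3 (λ η x γ → η :* :1 :+ :0 :* γ := :1 :* η :+ x :* :0) refl η x γ)
              (solve 3 (λ η x δ → η :* x :+ :0 :* δ := :1 :* (x :* η) :+ x :* :0) refl η x δ)
              (solve 3 (λ η γ δ → (γ :* η) :* :1 :+ :0 :* γ := γ :* η :+ δ :* :0) refl η γ δ)
              (solve 4 (λ η x γ δ → (γ :* η) :* x :+ :0 :* δ := γ :* (x :* η) :+ δ :* :0) refl η x γ δ)))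
            (eichler η∈ 0∈𝒪 γη∈ 0∈𝒪))))

        module _ {z : Carrier} (Δ≈qz : Δ ≈ q * z) where
          -- Row i of y g = g X, with g = (1 x ; γ δ), solved for the second entry of row i of y.
          solveRow : ∀ {y y′ u u′} → y * 1# + y′ * γ ≈ u → y * x + y′ * δ ≈ u′ → q * (z * y′) ≈ u′ - x * u
          solveRow {y} {y′} {u} {u′} e e′ = trans (sym (*-assoc q z y′)) (trans (*-congʳ (sym Δ≈qz)) (trans
            (solve 5 (λ x γ δ y y′ → (δ :- x :* γ) :* y′ := (y :* x :+ y′ :* δ) :- x :* (y :* :1 :+ y′ :* γ))
              refl x γ δ y y′)
            (+-cong e′ (-‿cong (*-congˡ e)))))

          -- The matrix (0 πᵗ ; 0 0) lies in H, so the upper right entry πᵗ/Δ = z⁻¹ of its conjugate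
          -- is integral.
          z-unit : z ∈ 𝒪 → Unit z
          z-unit z∈ = go Y∈ (conj-elim g {y = X} ≈ᴹ-refl)
            where
            X = mat 0# q 0# 0#
            Y∈ = from (g-opt X refl) (triangular 0∈𝒪 (π^∈𝔭 t) refl 0∈𝒪 (𝔭-resp (sym (-‿inverseʳ 0#)) (𝔭-0 t)))
            go : ∀ {Y} → Y ∈ Eichler r → Y *ᴹ matrix g ≈ᴹ matrix g *ᴹ X → Unit z
            go {mat y₁ y₂ y₃ y₄} (eichler _ y₂∈ _ _) (mat≈ f₁ f₂ _ _) = unit z∈ y₂ y₂∈ (*-cancel-≉0 (π^≉0 t)
              (trans (solveRow f₁ f₂) (solve 2 (λ x q → (:1 :* q :+ x :* :0) :- x :* (:1 :* :0 :+ x :* :0)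
                                                        := q :* :1) refl x q)))

          -- The conjugate of (πᵗ 0 ; 0 0) is z⁻¹ (δ -x ; γδ -γx). Its upper right entry gives x ∈
          -- 𝒪, and γδ = zγπᵗ + xγ² isolates γπᵗ in the lower left one.
          x∈,γq∈ : Unit z → γ * γ ∈ 𝔭 r → x ∈ 𝒪 × γ * q ∈ 𝔭 r
          x∈,γq∈ (unit z∈ z⁻¹ z⁻¹∈ zz⁻¹) γ²∈ = go Y∈ (conj-elim g {y = X} ≈ᴹ-refl)
            where
            X = mat q 0# 0# 0#
            Y∈ = from (g-opt X refl) (triangular (π^∈𝒪 t) (𝔭-0 t) refl 0∈𝒪
              (𝔭-resp (solve 1 (λ q → q := q :- :0) refl q) (π^∈𝔭 t)))
            go : ∀ {Y} → Y ∈ Eichler r → Y *ᴹ matrix g ≈ᴹ matrix g *ᴹ X → x ∈ 𝒪 × γ * q ∈ 𝔭 r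
            go {mat y₁ y₂ y₃ y₄} (eichler y₁∈ y₂∈ y₃∈ y₄∈) (mat≈ f₁ f₂ f₃ f₄) = x∈ , 𝔭-resp undo (𝔭-*ˡ z⁻¹∈ zγq∈)
              where
              -x≈zy₂ : - x ≈ z * y₂
              -x≈zy₂ = *-cancel-≉0 (π^≉0 t) (sym (trans (solveRow f₁ f₂)
                (solve 2 (λ x q → (:1 :* :0 :+ x :* :0) :- x :* (:1 :* q :+ x :* :0) := q :* :- x) refl x q)))
              x∈ : x ∈ 𝒪
              x∈ = 𝒪-resp (solve 1 (λ x → :- (:- x) := x) refl x) (-∈𝒪 (𝒪-resp (sym -x≈zy₂) (*∈𝒪 z∈ y₂∈)))
              -xγ≈zy₄ : - x * γ ≈ z * y₄
              -xγ≈zy₄ = *-cancel-≉0 (π^≉0 t) (sym (trans (solveRow f₃ f₄)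
                (solve 4 (λ x q γ δ → (γ :* :0 :+ δ :* :0) :- x :* (γ :* q :+ δ :* :0) := q :* (:- x :* γ)) refl x q γ δ)))
              zγq∈ : z * (γ * q) ∈ 𝔭 r
              zγq∈ = 𝔭-resp (sym (trans (*-congˡ (trans (solve 3 (λ γ q δ → γ :* q := γ :* q :+ δ :* :0) refl γ q δ) (sym f₃)))
                  (trans (solve 4 (λ z y₃ y₄ γ → z :* (y₃ :* :1 :+ y₄ :* γ) := z :* y₃ :+ (z :* y₄) :* γ) refl z y₃ y₄ γ)
                         (+-congˡ (trans (*-congʳ (sym -xγ≈zy₄)) (*-assoc _ _ _))))))
                (𝔭-+ (𝔭-*ˡ z∈ y₃∈) (𝔭-*ˡ (-∈𝒪 x∈) γ²∈))
              undo : z⁻¹ * (z * (γ * q)) ≈ γ * q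
              undo = trans (solve 3 (λ z′ z a → z′ :* (z :* a) := (z :* z′) :* a) refl z⁻¹ z (γ * q))
                           (trans (*-congʳ zz⁻¹) (*-identityˡ _))

          -- Left multiplication by `lowerUnit y u` keeps the first row, moves the first column to
          -- (1 , y + eγ) and multiplies the determinant by e. Once that column is the one of M,
          -- only x and the determinant are left, and they are the parameter (x , ze).
          reach : Unit z → x ∈ 𝒪 → ∀ {y e} → y ∈ 𝔭 r → Unit e → y + e * γ ≈ π^ (r ℕ.∸ t) →
                  ∃[ b ] Orbit (Γ₁ (Eichler r)) g (point r t b)
          reach z-unit x∈ {y} {e} y∈ u m≈ = ((x , x∈) , (z * e , Unit-* z-unit u)) , lowerUnit y u , lowerUnit∈Γ₁ y∈ u , wrap
           (≡.subst₂ _≈ᴹ_ (≡.sym (matrix-∙ (basepoint r t) _)) (≡.sym (matrix-∙ (lowerUnit y u) g)) (mat≈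
            (solve 1 (λ γ → :1 :* :1 :+ :0 :* :0 := :1 :* :1 :+ :0 :* γ) refl γ)
            (solve 3 (λ x d e → :1 :* x :+ :0 :* e := :1 :* x :+ :0 :* d) refl x δ (z * e))
            (trans (+-congʳ (*-congʳ (sym m≈)))
              (solve 4 (λ y e γ q → (y :+ e :* γ) :* :1 :+ q :* :0 := y :* :1 :+ e :* γ) refl y e γ q))
            (trans (+-cong (*-congʳ (sym m≈)) (trans (sym (*-assoc q z e)) (*-congʳ (sym Δ≈qz))))
              (solve 5 (λ y e γ x δ → (y :+ e :* γ) :* x :+ (δ :- x :* γ) :* e := y :* x :+ e :* δ) refl y e γ x δ))))

          -- For t = 0, γ lies in 𝔭ʳ and may vanish, so no unit multiple need equal πʳ; a summand
          -- from 𝔭ʳ makes up the difference. For t > 0 the valuation of γ is exactly r - t, and a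
          -- unit factor is enough.
          conclude : Unit z → x ∈ 𝒪 → γ ∈ 𝒪 → γ * γ ∈ 𝔭 r → γ * q ∈ 𝔭 r → ∀ t′ → t′ ≡ t →
                     2 ℕ.* t ℕ.≤ r × ∃[ b ] Orbit (Γ₁ (Eichler r)) g (point r t b)
          conclude z-unit x∈ γ∈ γ²∈ (mk𝔭 s s∈ γ≈) zero ≡.refl =
            z≤n , reach z-unit x∈ (mk𝔭 (1# - s) (+∈𝒪 1∈𝒪 (-∈𝒪 s∈)) refl) Unit-1
              (trans (+-congˡ (trans (*-identityˡ γ) (trans (sym (*-identityʳ γ)) γ≈)))
                     (solve 2 (λ m s → m :* (:1 :- s) :+ m :* s := m) refl (π^ r) s))
          conclude z-unit x∈ γ∈ γ²∈ γq∈ (suc t′) ≡.refl =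
            let (2t≤r , e , e-unit , eγ≈) = valuation-r∸t (s≤s z≤n) γ∈ γ²∈ γq∈ η∈𝔭t in
            2t≤r , reach z-unit x∈ (𝔭-0 r) e-unit (trans (+-identityˡ _) eγ≈)

      normalForm₁ : γ * γ ∈ 𝔭 r → 2 ℕ.* t ℕ.≤ r × ∃[ b ] Orbit (Γ₁ (Eichler r)) g (point r t b)
      normalForm₁ γ²∈ =
        let γ∈ = square∈𝒪 (𝔭⇒𝒪 γ²∈)
            mk𝔭 z z∈ Δ≈qz = Δ∈𝔭t γ∈ γ²∈
            z-u = z-unit Δ≈qz z∈
            (x∈ , γq∈) = x∈,γq∈ Δ≈qz z-u γ²∈
        in conclude Δ≈qz z-u x∈ γ∈ γ²∈ γq∈ t ≡.refl

-- The class of an optimal element and equality of classes.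

module Orbits {c ℓ} (k : LocalField c ℓ) where
  open LocalField k
  open Valuation k
  open Residues k
  open MatrixAlgebra k
  open Optimality k
  open Classification k
  private module ≈G = SetoidReasoning GL₂-setoid

  private
    columnNonzero : ∀ g → m₁₁ (matrix g) ≈ 0# → m₂₁ (matrix g) ≈ 0# → ⊥
    columnNonzero g a≈0 c≈0 = det≉0 g (trans
      (+-cong (*-congʳ a≈0) (-‿cong (*-congˡ c≈0)))
      (solve 2 (λ b d → :0 :* d :- b :* :0 := :0) refl (m₁₂ (matrix g)) (m₂₂ (matrix g))))

  turn : GL₂ → Bool → GL₂ → GL₂
  turn w false g = g
  turn w true  g = w ∙ g

  module _ {r t : ℕ} where
    private
      Γ = Γ₁ (Eichler r)
      sub = Γ₁-isSubgroup {r}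

    -- The hypothesis is homogeneous in the first column (a , c). It excludes a = 0, since c would
    -- vanish too, and division by a turns it into γ² ∈ 𝔭ʳ.
    normalForm : ∀ g → Optimal r t g →
      ∃[ z ] z ∈ 𝒪 × m₂₁ (matrix g) * m₂₁ (matrix g) ≈ (π^ r * (m₁₁ (matrix g) * m₁₁ (matrix g))) * z →
      2 ℕ.* t ℕ.≤ r × ∃[ q ] Orbit Γ g (point r t q)
    normalForm g g-opt (z , z∈ , c²≈) =
      let (2t≤r , q , g′~) = normalForm₁ x γ δ Δ⁻¹ ΔΔ⁻¹ g′-opt (𝔭-resp (sym γ²≈) (mk𝔭 z z∈ refl)) in
      2t≤r , q , orbit-trans sub {g} {g′} {point r t q}
        (scalar a⁻¹a , Γ₁-scalar a⁻¹a , g′≈) g′~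
      where
      a b c′ d : Carrier
      a = m₁₁ (matrix g)
      b = m₁₂ (matrix g)
      c′ = m₂₁ (matrix g)
      d = m₂₂ (matrix g)
      a≉0 : ¬ (a ≈ 0#)
      a≉0 a≈0 = columnNonzero g a≈0 (square≈0 (trans c²≈ (trans (*-congʳ (*-congˡ (*-congʳ a≈0)))
        (solve 3 (λ q a z → (q :* (:0 :* a)) :* z := :0) refl (π^ r) a z))))
      a⁻¹ : Carrier
      a⁻¹ = proj₁ (inverse a a≉0)
      aa⁻¹ : a * a⁻¹ ≈ 1#
      aa⁻¹ = proj₂ (inverse a a≉0)
      a⁻¹a : a⁻¹ * a ≈ 1#
      a⁻¹a = trans (*-comm a⁻¹ a) aa⁻¹
      x γ δ Δ⁻¹ : Carrier
      x = a⁻¹ * b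
      γ = a⁻¹ * c′
      δ = a⁻¹ * d
      Δ⁻¹ = (a * a) * det (inv g)
      square-cancel : ∀ e → (a * a⁻¹) * (a * a⁻¹) * e ≈ e
      square-cancel e = trans (*-congʳ (trans (*-cong aa⁻¹ aa⁻¹) (*-identityˡ 1#))) (*-identityˡ e)
      ΔΔ⁻¹ : (1# * δ - x * γ) * Δ⁻¹ ≈ 1#
      ΔΔ⁻¹ = trans (*-congʳ (trans (+-congʳ (*-congʳ (sym aa⁻¹)))
          (solve 5 (λ a a′ b c d → (a :* a′) :* (a′ :* d) :- (a′ :* b) :* (a′ :* c) := (a′ :* a′) :* (a :* d :- b :* c))
            refl a a⁻¹ b c′ d)))
        (trans (solve 4 (λ a a′ D D′ → ((a′ :* a′) :* D) :* ((a :* a) :* D′) := ((a :* a′) :* (a :* a′)) :* (D :* D′))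
                 refl a a⁻¹ (det (matrix g)) (det (inv g)))
               (trans (square-cancel _) (det-inverse g)))
      g′ : GL₂
      g′ = fromDet (mat 1# x γ δ) Δ⁻¹ ΔΔ⁻¹
      g′≈ : g′ ≈ᴳ scalar a⁻¹a ∙ g
      g′≈ = wrap (≈ᴹ-sym (≈ᴹ-trans (scalar-∙ a⁻¹a g) (mat≈ a⁻¹a refl refl refl)))
      g′-opt : Optimal r t g′
      g′-opt = Optimal-resp (≈ᴳ-sym g′≈) (Optimal-∙ {γ = scalar a⁻¹a} {g} (scalar-normalises Eichler-resp a⁻¹a) g-opt)
      γ²≈ : γ * γ ≈ π^ r * z
      γ²≈ = trans (solve 2 (λ a c → (a :* c) :* (a :* c) := (a :* a) :* (c :* c)) refl a⁻¹ c′)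
        (trans (*-congˡ c²≈) (trans
          (solve 4 (λ a a′ q z → (a′ :* a′) :* ((q :* (a :* a)) :* z) := (a :* a′) :* (a :* a′) :* (q :* z)) refl a a⁻¹ (π^ r) z)
          (square-cancel _)))

    -- Since w turns the first column (a , c) into (c , πʳa), the divisibility required of w g is
    -- that of πʳa² by c², the reverse of the one required of g. One of the two always holds.
    classify : ∀ {g} → Optimal r t g → 2 ℕ.* t ℕ.≤ r × ∃[ β ] ∃[ q ] Orbit Γ (turn (reversal r) β g) (point r t q)
    classify {g} g-opt = dichotomy (divides (π^ r * (a * a)) (c′ * c′))
      where
      a c′ : Carrier
      a = m₁₁ (matrix g)
      c′ = m₂₁ (matrix g)
      w∙g : Mat
      w∙g = matrix (reversal r) *ᴹ matrix g
      reversed : ∀ {z} → π^ r * (a * a) ≈ (c′ * c′) * z → m₂₁ w∙g * m₂₁ w∙g ≈ (π^ r * (m₁₁ w∙g * m₁₁ w∙g)) * z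
      reversed {z} e = trans
        (solve 3 (λ q a c → (q :* a :+ :0 :* c) :* (q :* a :+ :0 :* c) := q :* (q :* (a :* a))) refl (π^ r) a c′)
        (trans (*-congˡ e)
          (solve 4 (λ q a c z → q :* ((c :* c) :* z) := (q :* ((:0 :* a :+ :1 :* c) :* (:0 :* a :+ :1 :* c))) :* z)
            refl (π^ r) a c′ z))
      dichotomy : _ → 2 ℕ.* t ℕ.≤ r × ∃[ β ] ∃[ q ] Orbit Γ (turn (reversal r) β g) (point r t q)
      dichotomy (inj₁ (z , z∈ , e)) = let (2t≤r , q , o) = normalForm g g-opt (z , z∈ , e) in 2t≤r , false , q , o
      dichotomy (inj₂ (z , z∈ , e)) =
        let (2t≤r , q , o) = normalForm (reversal r ∙ g)
              (Optimal-∙ {γ = reversal r} {g} (reversal-normalises r) g-opt)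
              (z , 𝔭⇒𝒪 z∈ , ≡.subst (λ y → m₂₁ y * m₂₁ y ≈ (π^ r * (m₁₁ y * m₁₁ y)) * z)
                (≡.sym (matrix-∙ (reversal r) g)) (reversed e))
        in 2t≤r , true , q , o

  Upper : Pred GL₂ ℓ
  Upper g = m₂₁ (matrix g) ≈ 0#

  Upper-borel : ∀ q → Upper (borel q)
  Upper-borel q = refl

  private
    upper-* : ∀ x y → m₂₁ x ≈ 0# → m₂₁ y ≈ 0# → m₂₁ (x *ᴹ y) ≈ 0#
    upper-* x y x↑ y↑ = trans (+-cong (*-congʳ x↑) (*-congˡ y↑))
      (solve 2 (λ a d → :0 :* a :+ d :* :0 := :0) refl (m₁₁ y) (m₂₂ x))

  Upper-∙ : ∀ g h → Upper g → Upper h → Upper (g ∙ h)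
  Upper-∙ g h g↑ h↑ = ≡.subst (λ y → m₂₁ y ≈ 0#) (≡.sym (matrix-∙ g h)) (upper-* (matrix g) (matrix h) g↑ h↑)

  Upper-⁻¹ : ∀ g → Upper g → Upper (g ⁻¹)
  Upper-⁻¹ g g↑ = ≡.subst (λ y → m₂₁ y ≈ 0#) (≡.sym (matrix-⁻¹ g))
    (*-≈0 (λ a≈0 → columnNonzero g a≈0 g↑) (trans
      (solve 3 (λ a s u → a :* s := s :* a :+ u :* :0) refl (m₁₁ (matrix g)) (m₂₁ (inv g)) (m₂₂ (inv g)))
      (trans (+-congˡ (*-congˡ (sym g↑))) (_≈ᴹ_.≈₂₁ (inverseˡ g)))))

  Upper-conj : ∀ g x → Upper g → m₂₁ x ≈ 0# → m₂₁ (conj g x) ≈ 0#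
  Upper-conj g x g↑ x↑ = upper-* (matrix g *ᴹ x) (inv g) (upper-* (matrix g) x g↑ x↑)
    (≡.subst (λ y → m₂₁ y ≈ 0#) (matrix-⁻¹ g) (Upper-⁻¹ g g↑))

  private
    quotient : Parameter → Parameter → GL₂
    quotient q′ q = borel q′ ∙ borel q ⁻¹

    quotient-inverse : ∀ q′ q → quotient q′ q ⁻¹ ≈ᴳ quotient q q′
    quotient-inverse q′ q = ≈ᴳ-trans (⁻¹-anti-homo-∙ (borel q′) (borel q ⁻¹)) (∙-congʳ (⁻¹-involutive (borel q)))

    matrix-quotient : ∀ q′ q → matrix (quotient q′ q) ≡ matrix (borel q′) *ᴹ inv (borel q)
    matrix-quotient q′ q = ≡.trans (matrix-∙ (borel q′) (borel q ⁻¹)) (≡.cong (matrix (borel q′) *ᴹ_) (matrix-⁻¹ (borel q)))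

  -- The quotient is (1 , (x′ - x)/z ; 0 , z′/z), and z is a unit.
  quotient-triangular : ∀ {t} q′ q → matrix (quotient q′ q) ∈ Triangular t ⇔ q ≋ᵖ q′ [mod t ]
  quotient-triangular {t} q′@((x′ , x′∈) , (z′ , z′-unit)) q@((x , x∈) , (z , unit z∈ z⁻¹ z⁻¹∈ zz⁻¹)) =
    ≡.subst (λ y → y ∈ Triangular t ⇔ q ≋ᵖ q′ [mod t ]) (≡.sym (matrix-quotient q′ q)) (mk⇔ there back)
    where
    Y = matrix (borel q′) *ᴹ inv (borel q)
    f₁₂ : 1# * - (x * z⁻¹) + x′ * z⁻¹ ≈ z⁻¹ * (x′ - x)
    f₁₂ = solve 3 (λ x x′ z → :1 :* (:- (x :* z)) :+ x′ :* z := z :* (x′ :- x)) refl x x′ z⁻¹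
    f₁₁ : 1# * 1# + x′ * 0# ≈ 1#
    f₁₁ = solve 1 (λ x → :1 :* :1 :+ x :* :0 := :1) refl x′
    f₂₂ : 0# * - (x * z⁻¹) + z′ * z⁻¹ ≈ z⁻¹ * z′
    f₂₂ = solve 3 (λ x z′ z → :0 :* (:- (x :* z)) :+ z′ :* z := z :* z′) refl x z′ z⁻¹
    f₁₁₋₂₂ : m₁₁ Y - m₂₂ Y ≈ z⁻¹ * (z - z′)
    f₁₁₋₂₂ = trans (+-cong (trans f₁₁ (sym zz⁻¹)) (-‿cong f₂₂))
      (solve 3 (λ z i z′ → z :* i :- i :* z′ := i :* (z :- z′)) refl z z⁻¹ z′)
    cancel : ∀ {y} → z⁻¹ * y ∈ 𝔭 t → y ∈ 𝔭 t
    cancel {y} e = 𝔭-resp (trans (sym (*-assoc z z⁻¹ y)) (trans (*-congʳ zz⁻¹) (*-identityˡ y))) (𝔭-*ˡ z∈ e)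
    there : Y ∈ Triangular t → q ≋ᵖ q′ [mod t ]
    there Y∈ = mod-sym (cancel (𝔭-resp f₁₂ (t₁₂ Y∈))) , cancel (𝔭-resp f₁₁₋₂₂ (t₁₁₋₂₂ Y∈))
    back : q ≋ᵖ q′ [mod t ] → Y ∈ Triangular t
    back (x≋x′ , z≋z′) = triangular (𝒪-resp (sym f₁₁) 1∈𝒪) (𝔭-resp (sym f₁₂) (𝔭-*ˡ z⁻¹∈ (mod-sym x≋x′)))
      (solve 1 (λ z → :0 :* :1 :+ z :* :0 := :0) refl z′)
      (𝒪-resp (sym f₂₂) (*∈𝒪 z⁻¹∈ (Unit.u∈ z′-unit)))
      (𝔭-resp (sym f₁₁₋₂₂) (𝔭-*ˡ z⁻¹∈ z≋z′))

  quotient-upper : ∀ q′ q → Upper (quotient q′ q)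
  quotient-upper q′ q = Upper-∙ (borel q′) (borel q ⁻¹) (Upper-borel q′) (Upper-⁻¹ (borel q) (Upper-borel q))

  det-quotient : ∀ q′ q → Unit (det (matrix (quotient q′ q)))
  det-quotient q′@((x′ , _) , (z′ , z′-unit)) q@((x , _) , (z , z-unit)) =
    ≡.subst (λ y → Unit (det y)) (≡.sym (matrix-quotient q′ q))
      (Unit-resp (sym (trans (det-* (matrix (borel q′)) (inv (borel q))) (*-cong
        (solve 2 (λ x z → :1 :* z :- x :* :0 := z) refl x′ z′)
        (solve 2 (λ x z → :1 :* z :- x :* :0 := z) refl (- (x * Unit.u⁻¹ z-unit)) (Unit.u⁻¹ z-unit)))))
        (Unit-* z′-unit (Unit-⁻¹ z-unit)))

  module _ {r t : ℕ} (2t≤r : 2 ℕ.* t ℕ.≤ r) where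
    private
      M = basepoint r t
      Γ = Γ₁ (Eichler r)

      difference : Parameter → Parameter → GL₂
      difference q q′ = M ∙ quotient q′ q ∙ M ⁻¹

      point-difference : ∀ q q′ → point r t q′ ≈ᴳ difference q q′ ∙ point r t q
      point-difference q q′ = ≈ᴳ-sym (begin
        M ∙ (borel q′ ∙ borel q ⁻¹) ∙ M ⁻¹ ∙ (M ∙ borel q)     ≈⟨ ∙-assoc _ _ _ ⟩
        M ∙ (borel q′ ∙ borel q ⁻¹) ∙ (M ⁻¹ ∙ (M ∙ borel q))   ≈⟨ ∙-congˡ (g⁻¹∙[g∙h]≈h M (borel q)) ⟩
        M ∙ (borel q′ ∙ borel q ⁻¹) ∙ borel q                  ≈⟨ ∙-assoc _ _ _ ⟩
        M ∙ (borel q′ ∙ borel q ⁻¹ ∙ borel q)                  ≈⟨ ∙-congˡ ([h∙g⁻¹]∙g≈h (borel q) (borel q′)) ⟩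
        M ∙ borel q′                                           ∎)
        where open ≈G

      matrix-difference : ∀ q q′ → matrix (difference q q′) ≡ conj M (matrix (quotient q′ q))
      matrix-difference q q′ = ≡.trans (matrix-∙ (M ∙ quotient q′ q) (M ⁻¹))
        (≡.cong₂ _*ᴹ_ (matrix-∙ M (quotient q′ q)) (matrix-⁻¹ M))

      difference-inverse : ∀ q q′ → difference q q′ ⁻¹ ≈ᴳ difference q′ q
      difference-inverse q q′ = begin
        (M ∙ Q ∙ M ⁻¹) ⁻¹              ≈⟨ ⁻¹-anti-homo-∙ (M ∙ Q) (M ⁻¹) ⟩
        (M ⁻¹) ⁻¹ ∙ (M ∙ Q) ⁻¹         ≈⟨ ∙-cong (⁻¹-involutive M) (⁻¹-anti-homo-∙ M Q) ⟩
        M ∙ (Q ⁻¹ ∙ M ⁻¹)              ≈⟨ ∙-assoc _ _ _ ⟨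
        M ∙ Q ⁻¹ ∙ M ⁻¹                ≈⟨ ∙-congʳ (∙-congˡ (quotient-inverse q′ q)) ⟩
        M ∙ quotient q q′ ∙ M ⁻¹       ∎
        where
        open ≈G
        Q : GL₂
        Q = quotient q′ q

      difference-integral : ∀ q q′ → matrix (difference q q′) ∈ Eichler r ⇔ q ≋ᵖ q′ [mod t ]
      difference-integral q q′ = ≡.subst (λ y → y ∈ Eichler r ⇔ q ≋ᵖ q′ [mod t ]) (≡.sym (matrix-difference q q′))
        (mk⇔ (λ e → to (quotient-triangular q′ q) (to opt e)) (λ e → from opt (from (quotient-triangular q′ q) e)))
        where
        opt : conj M (matrix (quotient q′ q)) ∈ Eichler r ⇔ matrix (quotient q′ q) ∈ Triangular t
        opt = basepoint-optimal 2t≤r (matrix (quotient q′ q)) (quotient-upper q′ q)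

      det-difference : ∀ q q′ → Unit (det (matrix (difference q q′)))
      det-difference q q′ = ≡.subst (λ y → Unit (det y)) (≡.sym (matrix-difference q q′))
        (Unit-resp (sym (trans (det-* (matrix M *ᴹ B) (inv M)) (trans (*-congʳ (det-* (matrix M) B))
          (trans (solve 3 (λ m b m′ → (m :* b) :* m′ := (m :* m′) :* b) refl (det (matrix M)) (det B) (det (inv M)))
            (trans (*-congʳ (det-inverse M)) (*-identityˡ _)))))) (det-quotient q′ q))
        where
        B : Mat
        B = matrix (quotient q′ q)

    -- For g = a u with u ∈ E*, the square a² = det g · det u⁻¹ is integral, hence so is a.
    unit-det⇒integral : ∀ {g} → g ∈ Γ → Unit (det (matrix g)) → matrix g ∈ Eichler r
    unit-det⇒integral (a , _ , u , u∈ , u⁻¹∈ , g≈) δ =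
      Eichler-resp (≈ᴹ-sym g≈) (Eichler-· (square∈𝒪 (𝒪-resp a²≈ (*∈𝒪 (Unit.u∈ δ) (Eichler-det u⁻¹∈)))) u∈)
      where
      a²≈ : det _ * det (inv u) ≈ a * a
      a²≈ = trans (*-congʳ (trans (det-cong g≈)
              (solve 5 (λ a x y z w → (a :* x) :* (a :* w) :- (a :* y) :* (a :* z) := (a :* a) :* (x :* w :- y :* z))
                refl a (m₁₁ (matrix u)) (m₁₂ (matrix u)) (m₂₁ (matrix u)) (m₂₂ (matrix u)))))
            (trans (*-assoc _ _ _) (trans (*-congˡ (det-inverse u)) (*-identityʳ _)))

    -- The connecting element is forced to be M b(q′) b(q)⁻¹ M⁻¹. Its determinant is a unit, so for
    -- it membership in k*E* implies membership in E, and optimality of M translates the latter into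
    -- a condition on b(q′) b(q)⁻¹.
    point-orbit : ∀ q q′ → Orbit Γ (point r t q) (point r t q′) ⇔ q ≋ᵖ q′ [mod t ]
    point-orbit q q′ = mk⇔ there back
      where
      there : Orbit Γ (point r t q) (point r t q′) → q ≋ᵖ q′ [mod t ]
      there (γ , γ∈ , e) = to (difference-integral q q′)
        (unit-det⇒integral {difference q q′} (IsSubgroup.Γ-resp Γ₁-isSubgroup {γ} {difference q q′} γ≈ γ∈) (det-difference q q′))
        where
        open ≈G
        γ≈ : γ ≈ᴳ difference q q′
        γ≈ = begin
          γ                                                          ≈⟨ [h∙g]∙g⁻¹≈h (point r t q) γ ⟨
          γ ∙ point r t q ∙ point r t q ⁻¹                           ≈⟨ ∙-congʳ e ⟨
          point r t q′ ∙ point r t q ⁻¹                              ≈⟨ ∙-congʳ (point-difference q q′) ⟩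
          difference q q′ ∙ point r t q ∙ point r t q ⁻¹             ≈⟨ [h∙g]∙g⁻¹≈h (point r t q) (difference q q′) ⟩
          difference q q′                                            ∎
      back : q ≋ᵖ q′ [mod t ] → Orbit Γ (point r t q) (point r t q′)
      back (e , f) = difference q q′ , Γ₁-unit (difference q q′)
        (from (difference-integral q q′) (e , f) ,
         Eichler-resp (≈ᴹ-trans (unwrap (≈ᴳ-sym (difference-inverse q q′))) (≈ᴹ-reflexive (matrix-⁻¹ (difference q q′))))
           (from (difference-integral q′ q) (mod-sym e , mod-sym f))) , point-difference q q′

-- The two sides of the path and their exchange by w.

module Reversal {c ℓ} (k : LocalField c ℓ) where
  open LocalField k
  open Valuation k
  open Residues k
  open MatrixAlgebra k
  open Optimality k
  open Classification k
  open Orbits k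

  module _ {r t : ℕ} (2t<r : 2 ℕ.* t ℕ.< r) where
    private
      2t≤r : 2 ℕ.* t ℕ.≤ r
      2t≤r = ℕₚ.<⇒≤ 2t<r
      M = basepoint r t
      m = π^ (r ℕ.∸ t)

      t<r∸t : t ℕ.< r ℕ.∸ t
      t<r∸t = ℕₚ.m+n≤o⇒m≤o∸n (suc t) (≡.subst (ℕ._≤ r) (≡.cong (λ n → suc (t ℕ.+ n)) (ℕₚ.+-identityʳ t)) 2t<r)

      r<2[r∸t] : suc r ℕ.≤ (r ℕ.∸ t) ℕ.+ (r ℕ.∸ t)
      r<2[r∸t] = ≡.subst (ℕ._≤ (r ℕ.∸ t) ℕ.+ (r ℕ.∸ t))
        (≡.trans (ℕₚ.+-suc (r ℕ.∸ t) t) (≡.cong suc (ℕₚ.m∸n+n≡m (t≤r {r} {t} 2t≤r)))) (ℕₚ.+-monoʳ-≤ (r ℕ.∸ t) t<r∸t)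

      m∈𝔭1 : m ∈ 𝔭 1
      m∈𝔭1 = 𝔭-mono (ℕₚ.≤-trans (s≤s z≤n) t<r∸t) (π^∈𝔭 (r ℕ.∸ t))

    -- Suppose κ u (1 , m) = (m , πʳ), where m ∈ 𝔭 because t < r - t. The first coordinate s of u (1
    -- , m) is a unit, as otherwise det u ∈ 𝔭. Hence κ ∈ 𝔭ʳ⁻ᵗ, and the second coordinate lies in the
    -- square of this ideal, which is inside 𝔭ʳ⁺¹ because 2t < r; but it is πʳ.
    columns-separated : ∀ {κ} u → matrix u ∈ Eichler r → inv u ∈ Eichler r →
      m ≈ κ * (m₁₁ (matrix u) + m₁₂ (matrix u) * m) → π^ r ≈ κ * (m₂₁ (matrix u) + m₂₂ (matrix u) * m) → ⊥
    columns-separated {κ} u (eichler u₁∈ u₂∈ u₃∈ u₄∈) u⁻¹∈ m≈ πʳ≈ = conclude (unit? s∈)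
      where
      u₁ u₂ u₃ u₄ s : Carrier
      u₁ = m₁₁ (matrix u)
      u₂ = m₁₂ (matrix u)
      u₃ = m₂₁ (matrix u)
      u₄ = m₂₂ (matrix u)
      s = u₁ + u₂ * m
      s∈ : s ∈ 𝒪
      s∈ = +∈𝒪 u₁∈ (*∈𝒪 u₂∈ (π^∈𝒪 (r ℕ.∸ t)))
      conclude : Unit s ⊎ s ∈ 𝔭 1 → ⊥
      conclude (inj₂ s∈𝔭) = 1∉𝔭 (𝔭-resp (det-inverse u) (𝔭-*ʳ (𝔭-resp
        (solve 5 (λ u₁ u₂ u₃ u₄ m → ((u₁ :+ u₂ :* m) :* u₄ :+ :- ((u₂ :* m) :* u₄)) :+ :- (u₂ :* u₃) := u₁ :* u₄ :- u₂ :* u₃)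
          refl u₁ u₂ u₃ u₄ m)
        (𝔭-+ (𝔭-+ (𝔭-*ʳ s∈𝔭 u₄∈) (𝔭-neg (𝔭-*ʳ (𝔭-*ˡ u₂∈ m∈𝔭1) u₄∈)))
             (𝔭-neg (𝔭-*ˡ u₂∈ (𝔭-mono (ℕₚ.≤-trans (s≤s z≤n) 2t<r) u₃∈))))) (Eichler-det u⁻¹∈)))
      conclude (inj₁ (unit _ s⁻¹ s⁻¹∈ ss⁻¹)) = ℕₚ.<-irrefl ≡.refl (unit∣⇒≤ {n = r} Unit-1
        (𝔭-resp (sym (*-identityʳ _)) (𝔭-mono r<2[r∸t] (𝔭-resp (sym πʳ≈) (𝔭-* κ∈
          (𝔭-+ (𝔭-mono (ℕₚ.m∸n≤m r t) u₃∈) (𝔭-*ˡ u₄∈ (π^∈𝔭 (r ℕ.∸ t)))))))))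
        where
        κ∈ : κ ∈ 𝔭 (r ℕ.∸ t)
        κ∈ = 𝔭-resp (trans (*-congʳ m≈) (trans (*-assoc κ s s⁻¹) (trans (*-congˡ ss⁻¹) (*-identityʳ κ))))
                    (𝔭-*ʳ (π^∈𝔭 (r ℕ.∸ t)) s⁻¹∈)

    private
      basepoint-separated : ∀ b → Upper b → ¬ Orbit (Γ₁ (Eichler r)) (M ∙ b) (reversal r ∙ M)
      basepoint-separated b b↑ (γ , (a , _ , u , u∈ , u⁻¹∈ , γ≈) , e) = columns-separated u u∈ u⁻¹∈ column₁ column₂
        where
        b₁ = m₁₁ (matrix b)
        b₃ = m₂₁ (matrix b)
        q = π^ t
        entries : matrix (reversal r) *ᴹ matrix M ≈ᴹ (a ·ᴹ matrix u) *ᴹ (matrix M *ᴹ matrix b)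
        entries = ≈ᴹ-trans (≈ᴹ-reflexive (≡.sym (matrix-∙ (reversal r) M))) (≈ᴹ-trans (unwrap e)
          (≈ᴹ-trans (≈ᴹ-reflexive (matrix-∙ γ (M ∙ b)))
            (*ᴹ-cong γ≈ (≈ᴹ-reflexive (matrix-∙ M b)))))
        row : ∀ y y′ → (a * y) * (1# * b₁ + 0# * b₃) + (a * y′) * (m * b₁ + q * b₃) ≈ (a * b₁) * (y + y′ * m)
        row y y′ = trans (+-cong (*-congˡ (+-congˡ (*-congˡ b↑))) (*-congˡ (+-congˡ (*-congˡ b↑))))
          (solve 6 (λ a y y′ b m q → (a :* y) :* (:1 :* b :+ :0 :* :0) :+ (a :* y′) :* (m :* b :+ q :* :0)
                                     := (a :* b) :* (y :+ y′ :* m)) refl a y y′ b₁ m q)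
        column₁ : m ≈ (a * b₁) * (m₁₁ (matrix u) + m₁₂ (matrix u) * m)
        column₁ = trans (solve 1 (λ m → m := :0 :* :1 :+ :1 :* m) refl m)
                        (trans (_≈ᴹ_.≈₁₁ entries) (row _ _))
        column₂ : π^ r ≈ (a * b₁) * (m₂₁ (matrix u) + m₂₂ (matrix u) * m)
        column₂ = trans (solve 2 (λ p m → p := p :* :1 :+ :0 :* m) refl (π^ r) m)
                        (trans (_≈ᴹ_.≈₂₁ entries) (row _ _))

    -- Multiplying on the right by b′⁻¹ preserves orbits, so only w M has to be kept apart from M
    -- times an upper triangular element.
    separated : ∀ b b′ → Upper b → Upper b′ → ¬ Orbit (Γ₁ (Eichler r)) (M ∙ b) (reversal r ∙ (M ∙ b′))
    separated b b′ b↑ b′↑ o = basepoint-separated (b ∙ b′ ⁻¹) (Upper-∙ b (b′ ⁻¹) b↑ (Upper-⁻¹ b′ b′↑))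
      (orbit-cancelʳ (Γ₁-isSubgroup {r}) M b (reversal r) b′ o)

  private
    reversal-entries : ∀ {m p s} x z → m ≈ p → s ≈ p * p →
      mat 0# 1# s 0# *ᴹ (mat 1# 0# m p *ᴹ mat 1# x 0# z) ≈ᴹ p ·ᴹ (mat 1# 0# m p *ᴹ mat 1# (x + z) 0# (- z))
    reversal-entries {m} {p} {s} x z m≈ s≈ = mat≈
      (trans (+-congˡ (*-congˡ (+-congʳ (*-congʳ m≈))))
        (solve 2 (λ p x → :0 :* (:1 :* :1 :+ :0 :* :0) :+ :1 :* (p :* :1 :+ p :* :0)
                          := p :* (:1 :* :1 :+ :0 :* :0)) refl p x))
      (trans (+-congˡ (*-congˡ (+-congʳ (*-congʳ m≈))))
        (solve 3 (λ p x z → :0 :* (:1 :* x :+ :0 :* z) :+ :1 :* (p :* x :+ p :* z)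
                            := p :* (:1 :* (x :+ z) :+ :0 :* (:- z))) refl p x z))
      (trans (+-cong (*-congʳ s≈) (*-congˡ (+-congʳ (*-congʳ m≈)))) (trans
        (solve 1 (λ p → (p :* p) :* (:1 :* :1 :+ :0 :* :0) :+ :0 :* (p :* :1 :+ p :* :0)
                        := p :* (p :* :1 :+ p :* :0)) refl p)
        (*-congˡ (+-congʳ (*-congʳ (sym m≈))))))
      (trans (+-cong (*-congʳ s≈) (*-congˡ (+-congʳ (*-congʳ m≈)))) (trans
        (solve 3 (λ p x z → (p :* p) :* (:1 :* x :+ :0 :* z) :+ :0 :* (p :* x :+ p :* z)
                            := p :* (p :* (x :+ z) :+ p :* (:- z))) refl p x z)
        (*-congˡ (+-congʳ (*-congʳ (sym m≈))))))

  -- When r = 2t the two halves of the path have the same length, and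
  -- reversal r · M · (1 1 ; 0 -1) = πᵗ M for the base point M.
  reversal-flip : ∀ {r t} → r ≡ 2 ℕ.* t → ∀ q →
    Orbit (Γ₁ (Eichler r)) (point r t (flip q)) (reversal r ∙ point r t q)
  reversal-flip {r} {t} r≡2t q@((x , _) , (z , z-unit)) = scalar (ππ⁻¹ t) , Γ₁-scalar (ππ⁻¹ t) , wrap
    (≈ᴹ-trans (≈ᴹ-reflexive (≡.trans (matrix-∙ (reversal r) (point r t q)) (≡.cong (matrix (reversal r) *ᴹ_) (matrix-∙ M (borel q)))))
      (≈ᴹ-trans (reversal-entries x z m≈ πʳ≈)
        (≈ᴹ-trans (·ᴹ-congˡ (≈ᴹ-reflexive (≡.sym (matrix-∙ M (borel (flip q)))))) (≈ᴹ-sym (scalar-∙ (ππ⁻¹ t) (point r t (flip q)))))))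
    where
    M = basepoint r t
    m p′ : Carrier
    m = π^ (r ℕ.∸ t)
    p′ = π^ t
    t+t≡r : t ℕ.+ t ≡ r
    t+t≡r = ≡.sym (≡.trans r≡2t (≡.cong (t ℕ.+_) (ℕₚ.+-identityʳ t)))
    m≈ : m ≈ p′
    m≈ = reflexive (≡.cong π^_ (≡.trans (≡.cong (ℕ._∸ t) (≡.sym t+t≡r)) (ℕₚ.m+n∸n≡m t t)))
    πʳ≈ : π^ r ≈ p′ * p′
    πʳ≈ = trans (reflexive (≡.cong π^_ (≡.sym t+t≡r))) (sym (π^-* t t))

  borel∈Γ₁ : ∀ {r} q → borel q ∈ Γ₁ (Eichler r)
  borel∈Γ₁ q@((x , x∈) , (z , unit z∈ z⁻¹ z⁻¹∈ _)) = Γ₁-unit (borel q)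
    (eichler 1∈𝒪 x∈ (𝔭-0 _) z∈ , eichler 1∈𝒪 (-∈𝒪 (*∈𝒪 x∈ z⁻¹∈)) (𝔭-0 _) z⁻¹∈)

  basepoint∈Γ₁ : ∀ {r} → basepoint r 0 ∈ Γ₁ (Eichler r)
  basepoint∈Γ₁ {r} = Γ₁-unit (basepoint r 0)
    (eichler 1∈𝒪 0∈𝒪 (π^∈𝔭 r) 1∈𝒪 ,
     Eichler-· (𝒪-resp (trans (sym (ππ⁻¹ 0)) (*-identityˡ _)) 1∈𝒪) (eichler 1∈𝒪 (-∈𝒪 0∈𝒪) (𝔭-neg (π^∈𝔭 r)) 1∈𝒪))

  Normalises⇒Optimal : ∀ {r g} → g ∈ Normalises (Eichler r) → Optimal r 0 g
  Normalises⇒Optimal {r} {g} g∈ x x↑ = mk⇔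
    (λ gx∈ → upper (to (g∈ x) gx∈))
    (λ (triangular x₁ x₂ x₃≈0 x₄ _) → from (g∈ x) (eichler x₁ (𝔭⇒𝒪 x₂) (𝔭-resp (sym x₃≈0) (𝔭-0 r)) x₄))
    where
    upper : x ∈ Eichler r → x ∈ Triangular 0
    upper (eichler x₁ x₂ x₃ x₄) = triangular x₁ (𝒪⇒𝔭0 x₂) x↑ x₄ (𝒪⇒𝔭0 (+∈𝒪 x₁ (-∈𝒪 x₄)))

  -- A normalising element is an optimal embedding of H₀, and for t = 0 the
  -- representatives point r 0 q lie in E*.
  Γ₂⇒turn∈Γ₁ : ∀ {r γ} → γ ∈ Γ₂ (Eichler r) → ∃[ β ] turn (reversal r) β γ ∈ Γ₁ (Eichler r)
  Γ₂⇒turn∈Γ₁ {r} {γ} γ∈ =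
    let (_ , β , q , η , η∈ , e) = classify {r} {0} {γ} (Normalises⇒Optimal {r} {γ} (Γ₂-normalises {r} {γ} γ∈))
    in β , IsSubgroup.Γ-resp Γ₁-isSubgroup
      (≈ᴳ-trans (∙-congˡ e) (g⁻¹∙[g∙h]≈h η (turn (reversal r) β γ)))
      (Γ₁-∙ {r} {η ⁻¹} {point r 0 q} (Γ₁-⁻¹ {r} {η} η∈)
        (Γ₁-∙ {r} {basepoint r 0} {borel q} (basepoint∈Γ₁ {r}) (borel∈Γ₁ {r} q)))

-- The normaliser of H.

module Normaliser {c ℓ} (k : LocalField c ℓ) where
  open LocalField k
  open Valuation k
  open Residues k
  open MatrixAlgebra k
  open Optimality k
  open Orbits k

  module _ {t : ℕ} where
    -- Let (c , d) be the second row of h, and let y be the triangular conjugate of X. The second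
    -- row of y h = h X reads y₂₂c = 0 and y₂₂d = πᵗc, so c ≠ 0 would force y₂₂ = 0 and then c = 0.
    normalises⇒upper : ∀ h → h ∈ Normalises (Triangular t) → Upper h
    normalises⇒upper h h∈ = decide (m₂₁ (matrix h) ≈0?)
      where
      X = mat 0# (π^ t) 0# 0#
      X∈ : X ∈ Triangular t
      X∈ = triangular 0∈𝒪 (π^∈𝔭 t) refl 0∈𝒪 (𝔭-resp (sym (-‿inverseʳ 0#)) (𝔭-0 t))
      row₂ : ∀ {y} → y ∈ Triangular t → y *ᴹ matrix h ≈ᴹ matrix h *ᴹ X → ¬ (m₂₁ (matrix h) ≈ 0#) → m₂₁ (matrix h) ≈ 0#
      row₂ {y} y∈ e c≉0 = *-≈0 (π^≉0 t) (trans
        (solve 3 (λ q c d → q :* c := c :* q :+ d :* :0) refl (π^ t) (m₂₁ (matrix h)) (m₂₂ (matrix h)))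
        (trans (sym (_≈ᴹ_.≈₂₂ e)) (trans (+-cong (*-congʳ (t₂₁≈0 y∈)) (*-congʳ y₂₂≈0))
          (solve 2 (λ b d → :0 :* b :+ :0 :* d := :0) refl (m₁₂ (matrix h)) (m₂₂ (matrix h))))))
        where
        y₂₂≈0 : m₂₂ y ≈ 0#
        y₂₂≈0 = *-≈0 c≉0 (trans
          (solve 3 (λ y a c → c :* y := :0 :* a :+ y :* c) refl (m₂₂ y) (m₁₁ (matrix h)) (m₂₁ (matrix h)))
          (trans (+-congʳ (*-congʳ (sym (t₂₁≈0 y∈)))) (trans (_≈ᴹ_.≈₂₁ e)
            (solve 2 (λ c d → c :* :0 :+ d :* :0 := :0) refl (m₂₁ (matrix h)) (m₂₂ (matrix h))))))
      decide : Dec (m₂₁ (matrix h) ≈ 0#) → Upper h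
      decide (yes c≈0) = c≈0
      decide (no c≉0)  = row₂ (from (h∈ X) X∈) (conj-elim h {y = X} ≈ᴹ-refl) c≉0

    private
      borel-stable : ∀ q {y} → y ∈ Triangular t → conj (borel q) y ∈ Triangular t
      borel-stable q@((x , x∈) , (z , unit z∈ z⁻¹ z⁻¹∈ zz⁻¹)) {y@(mat α β ζ δ)} (triangular α∈ β∈ ζ≈0 δ∈ α-δ∈) =
        Triangular-resp
          (conj-intro (borel q) {mat α (z⁻¹ * (β - x * (α - δ))) 0# δ} {y} (mat≈
            (trans (solve 3 (λ a b x → a :* :1 :+ b :* :0 := :1 :* a :+ x :* :0) refl α _ x)
                   (+-congˡ (*-congˡ (sym ζ≈0))))
            (trans (solve 6 (λ a b x d z i → a :* x :+ (i :* (b :- x :* (a :- d))) :* z :=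
                              a :* x :+ (z :* i) :* (b :- x :* (a :- d))) refl α β x δ z z⁻¹)
              (trans (+-congˡ (trans (*-congʳ zz⁻¹) (*-identityˡ _)))
                (solve 4 (λ a b x d → a :* x :+ (b :- x :* (a :- d)) := :1 :* b :+ x :* d) refl α β x δ)))
            (trans (solve 3 (λ d a z → :0 :* :1 :+ d :* :0 := :0 :* a :+ z :* :0) refl δ α z)
                   (+-congˡ (*-congˡ (sym ζ≈0))))
            (solve 4 (λ x d z b → :0 :* x :+ d :* z := :0 :* b :+ z :* d) refl x δ z β)))
          (triangular α∈ (𝔭-*ˡ z⁻¹∈ (𝔭-+ β∈ (𝔭-neg (𝔭-*ˡ x∈ α-δ∈)))) refl δ∈ α-δ∈)

      inverseParameter : Parameter → Parameter
      inverseParameter ((x , x∈) , (z , u@(unit _ z⁻¹ z⁻¹∈ _))) =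
        (- (x * z⁻¹) , -∈𝒪 (*∈𝒪 x∈ z⁻¹∈)) , (z⁻¹ , Unit-⁻¹ u)

      borel⁻¹ : ∀ q → borel (inverseParameter q) ≈ᴳ borel q ⁻¹
      borel⁻¹ q = wrap (≈ᴹ-reflexive (≡.sym (matrix-⁻¹ (borel q))))

    -- Conjugation by b(x , z) keeps the diagonal and replaces β by z⁻¹(β - x(α - δ)), which stays
    -- in 𝔭ᵗ because α ≡ δ. The other direction is the same computation for the inverse parameter.
    borel-normalises : ∀ q → borel q ∈ Normalises (Triangular t)
    borel-normalises q y = mk⇔
      (λ qy∈ → Triangular-resp (≈ᴹ-trans (conj-cong (borel⁻¹ q) ≈ᴹ-refl) (conj-⁻¹ˡ (borel q) y))
        (borel-stable (inverseParameter q) qy∈))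
      (borel-stable q)

    borel⁻¹∙borel-normalises : ∀ q q′ → borel q ⁻¹ ∙ borel q′ ∈ Normalises (Triangular t)
    borel⁻¹∙borel-normalises q q′ = Normalises-∙ Triangular-resp {borel q ⁻¹} {borel q′}
      (Normalises-⁻¹ Triangular-resp {borel q} (borel-normalises q)) (borel-normalises q′)

  Optimal-∙ʳ : ∀ {r t} g b → Upper b → b ∈ Normalises (Triangular t) → Optimal r t g → Optimal r t (g ∙ b)
  Optimal-∙ʳ g b b↑ b∈ g-opt x x↑ = mk⇔
    (λ e → to (b∈ x) (to opt (Eichler-resp (conj-∙ g b x) e)))
    (λ x∈ → Eichler-resp (≈ᴹ-sym (conj-∙ g b x)) (from opt (from (b∈ x) x∈)))
    where
    opt : _ ⇔ _
    opt = g-opt (conj b x) (Upper-conj b x b↑ x↑)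

-- Counting orbits and double cosets of optimal elements.

module Counting {c ℓ} (k : LocalField c ℓ) {r t : ℕ} where
  open LocalField k
  open Valuation k using (Unit-1)
  open Residues k
  open MatrixAlgebra k
  open Optimality k
  open Classification k
  open Orbits k
  open Reversal k
  open Normaliser k
  open Cardinality

  private
    E = Eichler r
    sub₁ = Γ₁-isSubgroup {r}
    sub₂ = Γ₂-isSubgroup {r}

  -- What the count uses of base point M, reversal w and Borel elements b; the
  -- concrete matrices are hidden behind it to keep them from being unfolded.
  record Representatives : Set (c ⊔ ℓ) where
    field
      M w : GL₂
      b   : Parameter → GL₂

    P : Parameter → GL₂
    P q = M ∙ b q

    field
      b↑ : ∀ q → Upper (b q)
      b-normalises   : ∀ q q′ → b q ⁻¹ ∙ b q′ ∈ Normalises (Triangular t)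
      P-optimal      : ∀ q → Optimal r t (P q)
      P-orbit        : ∀ q q′ → Orbit (Γ₁ E) (P q) (P q′) ⇔ q ≋ᵖ q′ [mod t ]
      w∈Γ₂           : w ∈ Γ₂ E
      w²             : ∀ g → Orbit (Γ₁ E) g (w ∙ (w ∙ g))
      optimal-class  : ∀ g → Optimal r t g → ∃[ β ] ∃[ q ] Orbit (Γ₁ E) (turn w β g) (P q)
      Γ₂-class       : ∀ γ → γ ∈ Γ₂ E → ∃[ β ] turn w β γ ∈ Γ₁ E
      sides-disjoint : 2 ℕ.* t ℕ.< r → ∀ g h → Upper g → Upper h → ¬ Orbit (Γ₁ E) (M ∙ g) (w ∙ (M ∙ h))
      sides-equal    : r ≡ 2 ℕ.* t → ∀ q → Orbit (Γ₁ E) (P (flip q)) (w ∙ P q)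

  representatives : 2 ℕ.* t ℕ.≤ r → Representatives
  representatives 2t≤r = record
    { M = basepoint r t
    ; w = reversal r
    ; b = borel
    ; b↑ = Upper-borel
    ; b-normalises = borel⁻¹∙borel-normalises {t}
    ; P-optimal = λ q → Optimal-∙ʳ {r} {t} (basepoint r t) (borel q) (Upper-borel q) (borel-normalises {t} q)
        (basepoint-optimal {r} {t} 2t≤r)
    ; P-orbit = point-orbit {r} {t} 2t≤r
    ; w∈Γ₂ = reversal∈Γ₂ {r}
    ; w² = reversal²-orbit {r}
    ; optimal-class = λ g g-opt → proj₂ (classify {r} {t} {g} g-opt)
    ; Γ₂-class = λ γ → Γ₂⇒turn∈Γ₁ {r} {γ}
    ; sides-disjoint = separated {r} {t}
    ; sides-equal = reversal-flip {r} {t}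
    }

  module Count (ρ : Representatives) where
    open Representatives ρ

    swing : Bool → GL₂ → GL₂
    swing = turn w

    private
      swing-Γ₂ : ∀ β g → Orbit (Γ₂ E) g (swing β g)
      swing-Γ₂ false g = orbit-reflexive sub₂ ≈ᴳ-refl
      swing-Γ₂ true  g = orbit-∙ sub₂ g w∈Γ₂

      swing-cong : ∀ β {g h} → Orbit (Γ₁ E) g h → Orbit (Γ₁ E) (swing β g) (swing β h)
      swing-cong false o = o
      swing-cong true  o = Γ₂-permutes-orbits w∈Γ₂ o

      swing² : ∀ β g → Orbit (Γ₁ E) g (swing β (swing β g))
      swing² false g = orbit-reflexive sub₁ ≈ᴳ-refl
      swing² true  g = w² g

      swing-injective : ∀ β {g h} → Orbit (Γ₁ E) (swing β g) (swing β h) → Orbit (Γ₁ E) g h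
      swing-injective β {g} {h} o =
        orbit-trans sub₁ (swing² β g) (orbit-trans sub₁ (swing-cong β o) (orbit-sym sub₁ (swing² β h)))

      swing-∙ : ∀ β g h → swing β g ∙ h ≈ᴳ swing β (g ∙ h)
      swing-∙ false g h = ≈ᴳ-refl
      swing-∙ true  g h = ∙-assoc w g h

      swing-≈ : ∀ β {g h} → g ≈ᴳ h → swing β g ≈ᴳ swing β h
      swing-≈ false e = e
      swing-≈ true  e = ∙-congˡ e

      swing-optimal : ∀ β g → Optimal r t g → Optimal r t (swing β g)
      swing-optimal false g g-opt = g-opt
      swing-optimal true  g g-opt = Optimal-∙ {γ = w} {g} (Γ₂-normalises {r} {w} w∈Γ₂) g-opt

    -- A Γ₂-orbit splits into at most two Γ₁-orbits, those of h and of w h.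
    Γ₂-orbit : ∀ {g h} → Orbit (Γ₂ E) g h → ∃[ β ] Orbit (Γ₁ E) g (swing β h)
    Γ₂-orbit {g} {h} (γ , γ∈ , e) = let (β , βγ∈) = Γ₂-class γ γ∈ in
      β , swing β γ , βγ∈ , ≈ᴳ-trans (swing-≈ β e) (≈ᴳ-sym (swing-∙ β γ g))

    sameSide : 2 ℕ.* t ℕ.< r → ∀ β β′ g h → Upper g → Upper h →
               Orbit (Γ₁ E) (swing β (M ∙ g)) (swing β′ (M ∙ h)) → β ≡ β′
    sameSide 2t<r false false g h g↑ h↑ o = ≡.refl
    sameSide 2t<r true  true  g h g↑ h↑ o = ≡.refl
    sameSide 2t<r false true  g h g↑ h↑ o = ⊥-elim (sides-disjoint 2t<r g h g↑ h↑ o)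
    sameSide 2t<r true  false g h g↑ h↑ o = ⊥-elim (sides-disjoint 2t<r h g h↑ g↑ (orbit-sym sub₁ o))

    -- A family of optimal elements meeting all orbits, with the equivalence
    -- relations that count embeddings (R₁, R₂) or suborders (S₁, S₂).
    module Family {a} {I : Set a} (gen : I → GL₂) (gen-optimal : ∀ i → Optimal r t (gen i))
                  (onto : ∀ g → Optimal r t g → ∃[ i ] Orbit (Γ₁ E) (gen i) g) where

      private
        class : ∀ i → ∃[ β ] ∃[ q ] Orbit (Γ₁ E) (gen i) (swing β (P q))
        -- `optimal-class` turns `gen i`; as w² preserves orbits, turning once more moves the turn
        -- over to `P q`.
        class i = let (β , q , o) = optimal-class (gen i) (gen-optimal i) in
          β , q , orbit-trans sub₁ (swing² β (gen i)) (swing-cong β o)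

        side : I → Bool
        side i = proj₁ (class i)

        parameter : I → Parameter
        parameter i = proj₁ (proj₂ (class i))

        class-orbit : ∀ i → Orbit (Γ₁ E) (gen i) (swing (side i) (P (parameter i)))
        class-orbit i = proj₂ (proj₂ (class i))

        class-orbit₂ : ∀ i → Orbit (Γ₂ E) (gen i) (P (parameter i))
        class-orbit₂ i = orbit-trans sub₂ (orbit-⊆ (λ {g} → Γ₁⊆Γ₂ {r} {g}) (class-orbit i))
          (orbit-sym sub₂ (swing-Γ₂ (side i) (P (parameter i))))

        element : ∀ β q → ∃[ i ] Orbit (Γ₁ E) (gen i) (swing β (P q))
        element β q = onto (swing β (P q)) (swing-optimal β (P q) (P-optimal q))

        class-element : ∀ {i β q} → Orbit (Γ₁ E) (gen i) (swing β (P q)) →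
                        Orbit (Γ₁ E) (swing (side i) (P (parameter i))) (swing β (P q))
        class-element {i} o = orbit-trans sub₁ (orbit-sym sub₁ (class-orbit i)) o

        someIndex : I
        someIndex = proj₁ (element false ((0# , 0∈𝒪) , (1# , Unit-1)))

        point-move : ∀ m g h → (m ∙ g) ∙ (g ⁻¹ ∙ h) ≈ᴳ m ∙ h
        point-move m g h = ≈ᴳ-trans (∙-assoc m g _) (∙-congˡ (g∙[g⁻¹∙h]≈h g h))

        -- The element b(q)⁻¹ b(q′) normalises H and carries P q to P q′ from the right, on either
        -- side of the path. Two elements on the same side therefore share a double coset, whatever
        -- their parameters.
        connect : ∀ β {q q′ g h} → Orbit (Γ₁ E) g (swing β (P q)) → Orbit (Γ₁ E) h (swing β (P q′)) →
                  ∃[ i ] i ∈ Normalises (Triangular t) × Orbit (Γ₁ E) (g ∙ i) h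
        connect β {q} {q′} o o′ = b q ⁻¹ ∙ b q′ , b-normalises q q′ ,
          orbit-trans sub₁ (orbit-∙ʳ (b q ⁻¹ ∙ b q′) o) (orbit-trans sub₁ (orbit-reflexive sub₁
            (≈ᴳ-trans (swing-∙ β (P q) (b q ⁻¹ ∙ b q′)) (swing-≈ β (point-move M (b q) (b q′)))))
            (orbit-sym sub₁ o′))

        connect₂ : ∀ {q q′ g h} → Orbit (Γ₂ E) g (P q) → Orbit (Γ₂ E) h (P q′) →
                   ∃[ i ] i ∈ Normalises (Triangular t) × Orbit (Γ₂ E) (g ∙ i) h
        connect₂ {q} {q′} o o′ = b q ⁻¹ ∙ b q′ , b-normalises q q′ ,
          orbit-trans sub₂ (orbit-∙ʳ (b q ⁻¹ ∙ b q′) o)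
            (orbit-trans sub₂ (orbit-reflexive sub₂ (point-move M (b q) (b q′))) (orbit-sym sub₂ o′))

      module Long (2t<r : 2 ℕ.* t ℕ.< r) where
        private
          classes : ∀ β q β′ q′ → Orbit (Γ₁ E) (swing β (P q)) (swing β′ (P q′)) ⇔ (β ≡ β′ × q ≋ᵖ q′ [mod t ])
          classes β q β′ q′ = mk⇔ there back
            where
            there : Orbit (Γ₁ E) (swing β (P q)) (swing β′ (P q′)) → β ≡ β′ × q ≋ᵖ q′ [mod t ]
            there o = β≡β′ , to (P-orbit q q′) (swing-injective β′
              (≡.subst (λ b → Orbit (Γ₁ E) (swing b (P q)) (swing β′ (P q′))) β≡β′ o))
              where
              β≡β′ : β ≡ β′
              β≡β′ = sameSide 2t<r β β′ (b q) (b q′) (b↑ q) (b↑ q′) o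
            back : β ≡ β′ × q ≋ᵖ q′ [mod t ] → Orbit (Γ₁ E) (swing β (P q)) (swing β′ (P q′))
            back (≡.refl , e) = swing-cong β (from (P-orbit q q′) e)

          classes₂ : ∀ q q′ → Orbit (Γ₂ E) (P q) (P q′) ⇔ q ≋ᵖ q′ [mod t ]
          classes₂ q q′ = mk⇔
            -- The sides are disjoint, so β is `false` here and w takes no part in the relation
            -- between the parameters.
            (λ o → let (β , o′) = Γ₂-orbit o in proj₂ (to (classes false q β q′) o′))
            (λ e → orbit-⊆ (λ {g} → Γ₁⊆Γ₂ {r} {g}) (from (P-orbit q q′) e))

        card-R₁ : ∀ {s} {R : Rel I s} → (∀ i j → R i j ⇔ Orbit (Γ₁ E) (gen i) (gen j)) →
                  ∀ {n} → HasCardinality Parameter (_≋ᵖ_[mod t ]) n → HasCardinality I R (2 ℕ.* n)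
        card-R₁ R⇔ card = card-transfer {_≈_ = Pointwise _≡_ (_≋ᵖ_[mod t ])}
          (λ i → side i , parameter i)
          (λ i j → mk⇔
            (λ ij → to (classes (side i) (parameter i) (side j) (parameter j)) (orbit-trans sub₁ (orbit-sym sub₁ (class-orbit i))
              (orbit-trans sub₁ (to (R⇔ i j) ij) (class-orbit j))))
            (λ e → from (R⇔ i j) (orbit-trans sub₁ (class-orbit i)
              (orbit-trans sub₁ (from (classes (side i) (parameter i) (side j) (parameter j)) e)
                (orbit-sym sub₁ (class-orbit j))))))
          (λ (β , q) → let (i , o) = element β q in i , to (classes (side i) (parameter i) β q) (class-element {i} {β} {q} o))
          (card-× card-Bool card)

        card-R₂ : ∀ {s} {R : Rel I s} → (∀ i j → R i j ⇔ Orbit (Γ₂ E) (gen i) (gen j)) →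
                  ∀ {n} → HasCardinality Parameter (_≋ᵖ_[mod t ]) n → HasCardinality I R n
        card-R₂ R⇔ card = card-transfer {_≈_ = _≋ᵖ_[mod t ]} parameter
          (λ i j → mk⇔
            (λ ij → to (classes₂ (parameter i) (parameter j)) (orbit-trans sub₂ (orbit-sym sub₂ (class-orbit₂ i))
              (orbit-trans sub₂ (to (R⇔ i j) ij) (class-orbit₂ j))))
            (λ e → from (R⇔ i j) (orbit-trans sub₂ (class-orbit₂ i)
              (orbit-trans sub₂ (from (classes₂ (parameter i) (parameter j)) e) (orbit-sym sub₂ (class-orbit₂ j))))))
          (λ q → let (i , o) = element false q in
            i , proj₂ (to (classes (side i) (parameter i) false q) (class-element {i} {false} {q} o)))
          card

        -- An element normalising H is upper triangular, so right multiplication by it cannot change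
        -- the side. Conversely `connect` joins elements of one side: the side is a complete
        -- invariant.
        card-S₁ : ∀ {s} {S : Rel I s} →
          (∀ i j → S i j ⇔ (∃[ h ] h ∈ Normalises (Triangular t) × Orbit (Γ₁ E) (gen i ∙ h) (gen j))) →
          HasCardinality I S 2
        card-S₁ S⇔ = card-transfer side
          (λ i j → mk⇔ (λ ij → let (h , h∈ , o) = to (S⇔ i j) ij in there i j h h∈ o) (λ e → from (S⇔ i j) (back i j e)))
          (λ β → let (i , o) = element β ((0# , 0∈𝒪) , (1# , Unit-1)) in
            i , proj₁ (to (classes (side i) (parameter i) β ((0# , 0∈𝒪) , (1# , Unit-1))) (class-element {i} {β} o)))
          card-Bool
          where
          there : ∀ i j h → h ∈ Normalises (Triangular t) → Orbit (Γ₁ E) (gen i ∙ h) (gen j) → side i ≡ side j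
          there i j h h∈ o = sameSide 2t<r (side i) (side j) (b (parameter i) ∙ h) (b (parameter j))
            (Upper-∙ (b (parameter i)) h (b↑ (parameter i)) (normalises⇒upper {t} h h∈)) (b↑ (parameter j))
            (orbit-trans sub₁ (orbit-reflexive sub₁ (≈ᴳ-sym (≈ᴳ-trans (swing-∙ (side i) (P (parameter i)) h)
                (swing-≈ (side i) (∙-assoc M (b (parameter i)) h)))))
              (orbit-trans sub₁ (orbit-∙ʳ h (orbit-sym sub₁ (class-orbit i))) (orbit-trans sub₁ o (class-orbit j))))
          back : ∀ i j → side i ≡ side j → ∃[ h ] h ∈ Normalises (Triangular t) × Orbit (Γ₁ E) (gen i ∙ h) (gen j)
          back i j e = connect (side i) (class-orbit i)
            (≡.subst (λ β → Orbit (Γ₁ E) (gen j) (swing β (P (parameter j)))) (≡.sym e) (class-orbit j))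

      -- Γ₂ absorbs the side and the normaliser of H absorbs the parameter, so nothing is left to
      -- distinguish two elements.
      card-S₂ : ∀ {s} {S : Rel I s} →
        (∀ i j → S i j ⇔ (∃[ h ] h ∈ Normalises (Triangular t) × Orbit (Γ₂ E) (gen i ∙ h) (gen j))) →
        HasCardinality I S 1
      card-S₂ S⇔ = card-inhabited (λ i j → from (S⇔ i j) (connect₂ (class-orbit₂ i) (class-orbit₂ j))) someIndex

      module Short (r≡2t : r ≡ 2 ℕ.* t) where
        private
          parameter′ : I → Parameter
          parameter′ i = if side i then flip (parameter i) else parameter i

          -- For r = 2t the reversed point w P q is equivalent to P (flip q), so every class can be
          -- represented on the unreversed side.
          unswing : ∀ β q {g} → Orbit (Γ₁ E) g (swing β (P q)) → Orbit (Γ₁ E) g (P (if β then flip q else q))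
          unswing false q o = o
          unswing true  q o = orbit-trans sub₁ o (orbit-sym sub₁ (sides-equal r≡2t q))

          class-orbit′ : ∀ i → Orbit (Γ₁ E) (gen i) (P (parameter′ i))
          class-orbit′ i = unswing (side i) (parameter i) (class-orbit i)

          classes₂ : ∀ q q′ → Orbit (Γ₂ E) (P q) (P q′) ⇔ (q ≋ᵖ q′ [mod t ] ⊎ q ≋ᵖ flip q′ [mod t ])
          classes₂ q q′ = mk⇔ (λ o → let (β , o′) = Γ₂-orbit o in there β o′) back
            where
            there : ∀ β → Orbit (Γ₁ E) (P q) (swing β (P q′)) → q ≋ᵖ q′ [mod t ] ⊎ q ≋ᵖ flip q′ [mod t ]
            there false o = inj₁ (to (P-orbit q q′) o)
            there true  o = inj₂ (to (P-orbit q (flip q′)) (unswing true q′ o))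
            back : q ≋ᵖ q′ [mod t ] ⊎ q ≋ᵖ flip q′ [mod t ] → Orbit (Γ₂ E) (P q) (P q′)
            back (inj₁ e) = orbit-⊆ (λ {g} → Γ₁⊆Γ₂ {r} {g}) (from (P-orbit q q′) e)
            back (inj₂ e) = orbit-trans sub₂
              (orbit-⊆ (λ {g} → Γ₁⊆Γ₂ {r} {g}) (orbit-trans sub₁ (from (P-orbit q (flip q′)) e) (sides-equal r≡2t q′)))
              (orbit-sym sub₂ (swing-Γ₂ true (P q′)))

        card-R₁ : ∀ {s} {R : Rel I s} → (∀ i j → R i j ⇔ Orbit (Γ₁ E) (gen i) (gen j)) →
                  ∀ {n} → HasCardinality Parameter (_≋ᵖ_[mod t ]) n → HasCardinality I R n
        card-R₁ R⇔ card = card-transfer {_≈_ = _≋ᵖ_[mod t ]} parameter′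
          (λ i j → mk⇔
            (λ ij → to (P-orbit (parameter′ i) (parameter′ j)) (orbit-trans sub₁ (orbit-sym sub₁ (class-orbit′ i))
              (orbit-trans sub₁ (to (R⇔ i j) ij) (class-orbit′ j))))
            (λ e → from (R⇔ i j) (orbit-trans sub₁ (class-orbit′ i)
              (orbit-trans sub₁ (from (P-orbit (parameter′ i) (parameter′ j)) e) (orbit-sym sub₁ (class-orbit′ j))))))
          (λ q → let (i , o) = element false q in
            i , to (P-orbit (parameter′ i) q) (orbit-trans sub₁ (orbit-sym sub₁ (class-orbit′ i)) o))
          card

        card-R₂ : ∀ {s} {R : Rel I s} → (∀ i j → R i j ⇔ Orbit (Γ₂ E) (gen i) (gen j)) →
                  ∀ {n} → HasCardinality Parameter (λ q q′ → q ≋ᵖ q′ [mod t ] ⊎ q ≋ᵖ flip q′ [mod t ]) n →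
                  HasCardinality I R n
        card-R₂ R⇔ card = card-transfer
          {_≈_ = λ q q′ → q ≋ᵖ q′ [mod t ] ⊎ q ≋ᵖ flip q′ [mod t ]} parameter
          (λ i j → mk⇔
            (λ ij → to (classes₂ (parameter i) (parameter j)) (orbit-trans sub₂ (orbit-sym sub₂ (class-orbit₂ i))
              (orbit-trans sub₂ (to (R⇔ i j) ij) (class-orbit₂ j))))
            (λ e → from (R⇔ i j) (orbit-trans sub₂ (class-orbit₂ i)
              (orbit-trans sub₂ (from (classes₂ (parameter i) (parameter j)) e) (orbit-sym sub₂ (class-orbit₂ j))))))
          (λ q → let (i , o) = element false q in
            i , to (classes₂ (parameter i) q) (orbit-trans sub₂ (orbit-sym sub₂ (class-orbit₂ i))
              (orbit-⊆ (λ {g} → Γ₁⊆Γ₂ {r} {g}) o)))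
          card

        card-S₁ : ∀ {s} {S : Rel I s} →
          (∀ i j → S i j ⇔ (∃[ h ] h ∈ Normalises (Triangular t) × Orbit (Γ₁ E) (gen i ∙ h) (gen j))) →
          HasCardinality I S 1
        card-S₁ S⇔ = card-inhabited
          (λ i j → from (S⇔ i j) (connect false (class-orbit′ i) (class-orbit′ j))) someIndex

-- Injective homomorphisms from H into matrices are conjugations.

module Frames {c ℓ} (k : LocalField c ℓ) {t : ℕ} where
  open LocalField k
  open Valuation k
  open MatrixAlgebra k
  open Optimality k

  -- The common shape of two situations: an embedding restricted to H, and the inverse of an
  -- isomorphism from a suborder onto H. By `f-cong` the membership proof influences the value only
  -- up to `≈ᴹ`.
  record TriangularHom : Set (c ⊔ ℓ) where
    field
      f           : ∀ x → x ∈ Triangular t → Mat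
      f-cong      : ∀ {x y} x∈ y∈ → x ≈ᴹ y → f x x∈ ≈ᴹ f y y∈
      f-+         : ∀ {x y} x∈ y∈ x+y∈ → f (x +ᴹ y) x+y∈ ≈ᴹ f x x∈ +ᴹ f y y∈
      f-*         : ∀ {x y} x∈ y∈ xy∈ → f (x *ᴹ y) xy∈ ≈ᴹ f x x∈ *ᴹ f y y∈
      f-·         : ∀ {a x} → a ∈ 𝒪 → ∀ x∈ ax∈ → f (a ·ᴹ x) ax∈ ≈ᴹ a ·ᴹ f x x∈
      f-injective : ∀ {x} x∈ → f x x∈ ≈ᴹ 0ᴹ → x ≈ᴹ 0ᴹ

  private
    q = π^ t

  Triangular-+ : ∀ {x y} → x ∈ Triangular t → y ∈ Triangular t → x +ᴹ y ∈ Triangular t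
  Triangular-+ {x} {y} (triangular x₁ x₂ x₃ x₄ x₅) (triangular y₁ y₂ y₃ y₄ y₅) = triangular
    (+∈𝒪 x₁ y₁) (𝔭-+ x₂ y₂) (trans (+-cong x₃ y₃) (+-identityˡ 0#)) (+∈𝒪 x₄ y₄)
    (𝔭-resp (solve 4 (λ a b c d → (a :- b) :+ (c :- d) := (a :+ c) :- (b :+ d)) refl (m₁₁ x) (m₂₂ x) (m₁₁ y) (m₂₂ y)) (𝔭-+ x₅ y₅))

  Triangular-· : ∀ {a x} → a ∈ 𝒪 → x ∈ Triangular t → a ·ᴹ x ∈ Triangular t
  Triangular-· {a} {x} a∈ (triangular x₁ x₂ x₃ x₄ x₅) = triangular
    (*∈𝒪 a∈ x₁) (𝔭-*ˡ a∈ x₂) (trans (*-congˡ x₃) (zeroʳ a)) (*∈𝒪 a∈ x₄)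
    (𝔭-resp (solve 3 (λ a x y → a :* (x :- y) := a :* x :- a :* y) refl a (m₁₁ x) (m₂₂ x)) (𝔭-*ˡ a∈ x₅))

  Triangular-π^· : ∀ {x} → m₁₁ x ∈ 𝒪 → m₁₂ x ∈ 𝒪 → m₂₁ x ≈ 0# → m₂₂ x ∈ 𝒪 → q ·ᴹ x ∈ Triangular t
  Triangular-π^· {x} x₁ x₂ x₃ x₄ = triangular (*∈𝒪 q∈ x₁) (mk𝔭 _ x₂ refl) (trans (*-congˡ x₃) (zeroʳ q)) (*∈𝒪 q∈ x₄)
    (mk𝔭 (m₁₁ x - m₂₂ x) (+∈𝒪 x₁ (-∈𝒪 x₄)) (solve 3 (λ a x y → a :* x :- a :* y := a :* (x :- y)) refl q (m₁₁ x) (m₂₂ x)))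
    where
    q∈ = π^∈𝒪 t

  qE₁₁∈ : q ·ᴹ E₁₁ ∈ Triangular t
  qE₁₁∈ = Triangular-π^· 1∈𝒪 0∈𝒪 refl 0∈𝒪
  qE₁₂∈ : q ·ᴹ E₁₂ ∈ Triangular t
  qE₁₂∈ = Triangular-π^· 0∈𝒪 1∈𝒪 refl 0∈𝒪
  qE₂₂∈ : q ·ᴹ E₂₂ ∈ Triangular t
  qE₂₂∈ = Triangular-π^· 0∈𝒪 0∈𝒪 refl 1∈𝒪

  Triangular-0 : 0ᴹ ∈ Triangular t
  Triangular-0 = triangular 0∈𝒪 (𝔭-0 t) refl 0∈𝒪 (𝔭-resp (sym (-‿inverseʳ 0#)) (𝔭-0 t))

  ·ᴹ-0 : ∀ a → a ·ᴹ 0ᴹ ≈ᴹ 0ᴹ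
  ·ᴹ-0 a = mat≈ (zeroʳ a) (zeroʳ a) (zeroʳ a) (zeroʳ a)

  +ᴹ-0ʳ : ∀ x → x +ᴹ 0ᴹ ≈ᴹ x
  +ᴹ-0ʳ x = mat≈ (+-identityʳ _) (+-identityʳ _) (+-identityʳ _) (+-identityʳ _)

  +ᴹ-0ˡ : ∀ x → 0ᴹ +ᴹ x ≈ᴹ x
  +ᴹ-0ˡ x = mat≈ (+-identityˡ _) (+-identityˡ _) (+-identityˡ _) (+-identityˡ _)

  0*ᴹ : ∀ x → 0ᴹ *ᴹ x ≈ᴹ 0ᴹ
  0*ᴹ x = mat≈ (e _ _) (e _ _) (e _ _) (e _ _)
    where
    e : ∀ a b → 0# * a + 0# * b ≈ 0#
    e = solve 2 (λ a b → :0 :* a :+ :0 :* b := :0) refl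

  *ᴹ0 : ∀ x → x *ᴹ 0ᴹ ≈ᴹ 0ᴹ
  *ᴹ0 x = mat≈ (e _ _) (e _ _) (e _ _) (e _ _)
    where
    e : ∀ a b → a * 0# + b * 0# ≈ 0#
    e = solve 2 (λ a b → a :* :0 :+ b :* :0 := :0) refl

  private
    -- The columns of P are N₁₂ e and N₂₂ e for a vector e with N₁₂ e ≠ 0, where
    -- N₁₁, N₁₂, N₂₂ multiply like πᵗ times the matrix units.
    module Columns (N₁₂ N₂₂ : Mat) (e₁ e₂ : Carrier) where
      C₁ C₂ P : Mat
      C₁ = mat e₁ 0# e₂ 0#
      C₂ = mat 0# e₁ 0# e₂
      P = N₁₂ *ᴹ C₁ +ᴹ N₂₂ *ᴹ C₂

      applyˡ : ∀ {N A B} → N *ᴹ N₁₂ ≈ᴹ A → N *ᴹ N₂₂ ≈ᴹ B → N *ᴹ P ≈ᴹ A *ᴹ C₁ +ᴹ B *ᴹ C₂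
      applyˡ {N} e f = ≈ᴹ-trans (*ᴹ-distribˡ N _ _) (+ᴹ-cong
        (≈ᴹ-trans (≈ᴹ-sym (*ᴹ-assoc N N₁₂ C₁)) (*ᴹ-cong e ≈ᴹ-refl))
        (≈ᴹ-trans (≈ᴹ-sym (*ᴹ-assoc N N₂₂ C₂)) (*ᴹ-cong f ≈ᴹ-refl)))

      applyʳ : ∀ {X A B} → C₁ *ᴹ X ≈ᴹ A → C₂ *ᴹ X ≈ᴹ B → P *ᴹ X ≈ᴹ N₁₂ *ᴹ A +ᴹ N₂₂ *ᴹ B
      applyʳ {X} e f = ≈ᴹ-trans (*ᴹ-distribʳ X _ _) (+ᴹ-cong
        (≈ᴹ-trans (*ᴹ-assoc N₁₂ C₁ X) (*ᴹ-cong ≈ᴹ-refl e))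
        (≈ᴹ-trans (*ᴹ-assoc N₂₂ C₂ X) (*ᴹ-cong ≈ᴹ-refl f)))

      private
        z₁ : ∀ a → a * 1# + 0# * 0# ≈ a
        z₁ = solve 1 (λ a → a :* :1 :+ :0 :* :0 := a) refl
        z₂ : ∀ a → a * 0# + 0# * 0# ≈ 0#
        z₂ = solve 1 (λ a → a :* :0 :+ :0 :* :0 := :0) refl
        z₃ : ∀ a → 0# * 1# + a * 0# ≈ 0#
        z₃ = solve 1 (λ a → :0 :* :1 :+ a :* :0 := :0) refl
        z₄ : ∀ a → 0# * 0# + a * 0# ≈ 0#
        z₄ = solve 1 (λ a → :0 :* :0 :+ a :* :0 := :0) refl
        z₅ : ∀ a → a * 0# + 0# * 1# ≈ 0#
        z₅ = solve 1 (λ a → a :* :0 :+ :0 :* :1 := :0) refl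
        z₆ : ∀ a → 0# * 0# + a * 1# ≈ a
        z₆ = solve 1 (λ a → :0 :* :0 :+ a :* :1 := a) refl

      P*E₁₁ : P *ᴹ E₁₁ ≈ᴹ N₁₂ *ᴹ C₁
      P*E₁₁ = ≈ᴹ-trans (applyʳ {E₁₁} {C₁} {0ᴹ} (mat≈ (z₁ e₁) (z₂ e₁) (z₁ e₂) (z₂ e₂)) (mat≈ (z₃ e₁) (z₄ e₁) (z₃ e₂) (z₄ e₂)))
        (≈ᴹ-trans (+ᴹ-cong ≈ᴹ-refl (*ᴹ0 N₂₂)) (+ᴹ-0ʳ _))

      P*E₁₂ : P *ᴹ E₁₂ ≈ᴹ N₁₂ *ᴹ C₂
      P*E₁₂ = ≈ᴹ-trans (applyʳ {E₁₂} {C₂} {0ᴹ} (mat≈ (z₂ e₁) (z₁ e₁) (z₂ e₂) (z₁ e₂)) (mat≈ (z₄ e₁) (z₃ e₁) (z₄ e₂) (z₃ e₂)))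
        (≈ᴹ-trans (+ᴹ-cong ≈ᴹ-refl (*ᴹ0 N₂₂)) (+ᴹ-0ʳ _))

      P*E₂₂ : P *ᴹ E₂₂ ≈ᴹ N₂₂ *ᴹ C₂
      P*E₂₂ = ≈ᴹ-trans (applyʳ {E₂₂} {0ᴹ} {C₂} (mat≈ (z₂ e₁) (z₅ e₁) (z₂ e₂) (z₅ e₂)) (mat≈ (z₄ e₁) (z₆ e₁) (z₄ e₂) (z₆ e₂)))
        (≈ᴹ-trans (+ᴹ-cong (*ᴹ0 N₁₂) ≈ᴹ-refl) (+ᴹ-0ˡ _))

      -- N₁₂ kills the first column p₁ of P and sends the second one to πᵗp₁. If the columns were
      -- dependent with p₁ ≠ 0, then N₁₂ would kill both, and πᵗp₁ = 0. The computations `vanish`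
      -- and `vanish′` express this as πᵗs² = 0 for each coordinate s of p₁, without naming the
      -- dependence.
      det-P≉0 : N₁₂ *ᴹ N₁₂ ≈ᴹ 0ᴹ → N₁₂ *ᴹ N₂₂ ≈ᴹ q ·ᴹ N₁₂ →
                ¬ (m₁₁ N₁₂ * e₁ + m₁₂ N₁₂ * e₂ ≈ 0# × m₂₁ N₁₂ * e₁ + m₂₂ N₁₂ * e₂ ≈ 0#) → ¬ (det P ≈ 0#)
      det-P≉0 N² N₁₂₂ p₁≉0 det≈0 = p₁≉0
        ( trans (sym (entry _ _ _ _ _ _)) (square≈0 (*-≈0 (π^≉0 t) (vanish r₁₁ r₁₂)))
        , trans (sym (entry _ _ _ _ _ _)) (square≈0 (*-≈0 (π^≉0 t) (vanish′ r₂₁ r₂₂))))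
        where
        s x u y : Carrier
        s = m₁₁ P
        x = m₁₂ P
        u = m₂₁ P
        y = m₂₂ P
        entry : ∀ a b m m′ e e′ → (a * e + b * e′) + (m * 0# + m′ * 0#) ≈ a * e + b * e′
        entry = solve 6 (λ a b m m′ e e′ → (a :* e :+ b :* e′) :+ (m :* :0 :+ m′ :* :0) := a :* e :+ b :* e′) refl
        N₁₂P : N₁₂ *ᴹ P ≈ᴹ q ·ᴹ (P *ᴹ E₁₂)
        N₁₂P = ≈ᴹ-trans (applyˡ {N₁₂} N² N₁₂₂) (≈ᴹ-trans (+ᴹ-cong (0*ᴹ C₁) (·-*ᴹˡ q N₁₂ C₂))
          (≈ᴹ-trans (+ᴹ-0ˡ _) (·ᴹ-congˡ (≈ᴹ-sym P*E₁₂))))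
        r₁₁ : m₁₁ N₁₂ * s + m₁₂ N₁₂ * u ≈ 0#
        r₁₁ = trans (_≈ᴹ_.≈₁₁ N₁₂P) (solve 3 (λ q a b → q :* (a :* :0 :+ b :* :0) := :0) refl q s x)
        r₁₂ : m₁₁ N₁₂ * x + m₁₂ N₁₂ * y ≈ q * s
        r₁₂ = trans (_≈ᴹ_.≈₁₂ N₁₂P) (solve 3 (λ q a b → q :* (a :* :1 :+ b :* :0) := q :* a) refl q s x)
        r₂₁ : m₂₁ N₁₂ * s + m₂₂ N₁₂ * u ≈ 0#
        r₂₁ = trans (_≈ᴹ_.≈₂₁ N₁₂P) (solve 3 (λ q a b → q :* (a :* :0 :+ b :* :0) := :0) refl q u y)
        r₂₂ : m₂₁ N₁₂ * x + m₂₂ N₁₂ * y ≈ q * u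
        r₂₂ = trans (_≈ᴹ_.≈₂₂ N₁₂P) (solve 3 (λ q a b → q :* (a :* :1 :+ b :* :0) := q :* a) refl q u y)
        vanish : ∀ {n m} → n * s + m * u ≈ 0# → n * x + m * y ≈ q * s → q * (s * s) ≈ 0#
        vanish {n} {m} f g = trans (solve 2 (λ q s → q :* (s :* s) := s :* (q :* s)) refl q s) (trans (*-congˡ (sym g)) (trans
          (solve 6 (λ n m s x u y → s :* (n :* x :+ m :* y) := m :* (s :* y :- x :* u) :+ x :* (n :* s :+ m :* u)) refl n m s x u y)
          (trans (+-cong (*-congˡ det≈0) (*-congˡ f)) (solve 2 (λ m x → m :* :0 :+ x :* :0 := :0) refl m x))))
        vanish′ : ∀ {n m} → n * s + m * u ≈ 0# → n * x + m * y ≈ q * u → q * (u * u) ≈ 0#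
        vanish′ {n} {m} f g = trans (solve 2 (λ q s → q :* (s :* s) := s :* (q :* s)) refl q u) (trans (*-congˡ (sym g)) (trans
          (solve 6 (λ n m s x u y → u :* (n :* x :+ m :* y) := y :* (n :* s :+ m :* u) :- n :* (s :* y :- x :* u)) refl n m s x u y)
          (trans (+-cong (*-congˡ f) (-‿cong (*-congˡ det≈0))) (solve 2 (λ m x → m :* :0 :- x :* :0 := :0) refl y n))))

  module _ (hom : TriangularHom) where
    open TriangularHom hom

    private
      N₁₁ N₁₂ N₂₂ : Mat
      N₁₁ = f (q ·ᴹ E₁₁) qE₁₁∈
      N₁₂ = f (q ·ᴹ E₁₂) qE₁₂∈
      N₂₂ = f (q ·ᴹ E₂₂) qE₂₂∈

      q∈ = π^∈𝒪 t

      f-0 : ∀ {x} x∈ → x ≈ᴹ 0ᴹ → f x x∈ ≈ᴹ 0ᴹ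
      f-0 {x} x∈ x≈0 = ≈ᴹ-trans (f-cong x∈ 0x∈ (≈ᴹ-trans x≈0 (≈ᴹ-sym (0·ᴹ x)))) (≈ᴹ-trans (f-· 0∈𝒪 x∈ 0x∈) (0·ᴹ _))
        where
        0x∈ = Triangular-· {x = x} 0∈𝒪 x∈

      product : ∀ {x y z} x∈ y∈ z∈ → x *ᴹ y ≈ᴹ q ·ᴹ z → f x x∈ *ᴹ f y y∈ ≈ᴹ q ·ᴹ f z z∈
      product {x} {y} {z} x∈ y∈ z∈ e = ≈ᴹ-trans (≈ᴹ-sym (f-* x∈ y∈ xy∈)) (≈ᴹ-trans (f-cong xy∈ qz∈ e) (f-· q∈ z∈ qz∈))
        where
        qz∈ = Triangular-· {x = z} q∈ z∈
        xy∈ = Triangular-resp (≈ᴹ-sym e) qz∈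

      product-0 : ∀ {x y} x∈ y∈ → x *ᴹ y ≈ᴹ 0ᴹ → f x x∈ *ᴹ f y y∈ ≈ᴹ 0ᴹ
      product-0 x∈ y∈ e = ≈ᴹ-trans (≈ᴹ-sym (f-* x∈ y∈ xy∈)) (f-0 xy∈ e)
        where
        xy∈ = Triangular-resp (≈ᴹ-sym e) Triangular-0

      scaled : ∀ x y → (q ·ᴹ x) *ᴹ (q ·ᴹ y) ≈ᴹ q ·ᴹ (q ·ᴹ (x *ᴹ y))
      scaled x y = ≈ᴹ-trans (·-*ᴹˡ q x _) (·ᴹ-congˡ (·-*ᴹʳ q x y))

      i₁ : 0# * 0# + 0# * 0# ≈ 0#
      i₁ = solve 0 (:0 :* :0 :+ :0 :* :0 := :0) refl
      i₂ : 1# * 0# + 0# * 0# ≈ 0#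
      i₂ = solve 0 (:1 :* :0 :+ :0 :* :0 := :0) refl
      i₃ : 1# * 1# + 0# * 0# ≈ 1#
      i₃ = solve 0 (:1 :* :1 :+ :0 :* :0 := :1) refl
      i₄ : 1# * 0# + 0# * 1# ≈ 0#
      i₄ = solve 0 (:1 :* :0 :+ :0 :* :1 := :0) refl
      i₅ : 0# * 1# + 1# * 0# ≈ 0#
      i₅ = solve 0 (:0 :* :1 :+ :1 :* :0 := :0) refl
      i₆ : 0# * 0# + 1# * 0# ≈ 0#
      i₆ = solve 0 (:0 :* :0 :+ :1 :* :0 := :0) refl
      i₇ : 0# * 0# + 1# * 1# ≈ 1#
      i₇ = solve 0 (:0 :* :0 :+ :1 :* :1 := :1) refl
      i₈ : 0# * 1# + 0# * 0# ≈ 0#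
      i₈ = solve 0 (:0 :* :1 :+ :0 :* :0 := :0) refl
      i₉ : 0# * 0# + 0# * 1# ≈ 0#
      i₉ = solve 0 (:0 :* :0 :+ :0 :* :1 := :0) refl

      zero-product : ∀ {x y} → x *ᴹ y ≈ᴹ 0ᴹ → (q ·ᴹ x) *ᴹ (q ·ᴹ y) ≈ᴹ 0ᴹ
      zero-product {x} {y} e = ≈ᴹ-trans (scaled x y)
        (≈ᴹ-trans (·ᴹ-congˡ (≈ᴹ-trans (·ᴹ-congˡ e) (·ᴹ-0 q))) (·ᴹ-0 q))

      N₁₁N₁₂ : N₁₁ *ᴹ N₁₂ ≈ᴹ q ·ᴹ N₁₂
      N₁₁N₁₂ = product qE₁₁∈ qE₁₂∈ qE₁₂∈ (≈ᴹ-trans (scaled E₁₁ E₁₂) (·ᴹ-congˡ (·ᴹ-congˡ (mat≈ i₂ i₃ i₁ i₈))))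
      N₁₁N₂₂ : N₁₁ *ᴹ N₂₂ ≈ᴹ 0ᴹ
      N₁₁N₂₂ = product-0 qE₁₁∈ qE₂₂∈ (zero-product {E₁₁} {E₂₂} (mat≈ i₂ i₄ i₁ i₉))
      N₁₂N₁₂ : N₁₂ *ᴹ N₁₂ ≈ᴹ 0ᴹ
      N₁₂N₁₂ = product-0 qE₁₂∈ qE₁₂∈ (zero-product {E₁₂} {E₁₂} (mat≈ i₆ i₅ i₁ i₈))
      N₁₂N₂₂ : N₁₂ *ᴹ N₂₂ ≈ᴹ q ·ᴹ N₁₂
      N₁₂N₂₂ = product qE₁₂∈ qE₂₂∈ qE₁₂∈ (≈ᴹ-trans (scaled E₁₂ E₂₂) (·ᴹ-congˡ (·ᴹ-congˡ (mat≈ i₆ i₇ i₁ i₉))))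
      N₂₂N₁₂ : N₂₂ *ᴹ N₁₂ ≈ᴹ 0ᴹ
      N₂₂N₁₂ = product-0 qE₂₂∈ qE₁₂∈ (zero-product {E₂₂} {E₁₂} (mat≈ i₁ i₈ i₆ i₅))
      N₂₂N₂₂ : N₂₂ *ᴹ N₂₂ ≈ᴹ q ·ᴹ N₂₂
      N₂₂N₂₂ = product qE₂₂∈ qE₂₂∈ qE₂₂∈ (≈ᴹ-trans (scaled E₂₂ E₂₂) (·ᴹ-congˡ (·ᴹ-congˡ (mat≈ i₁ i₉ i₆ i₇))))

      Frame : Set (c ⊔ ℓ)
      Frame = Σ[ P ∈ GL₂ ] N₁₁ ≈ᴹ conj P (q ·ᴹ E₁₁) × N₁₂ ≈ᴹ conj P (q ·ᴹ E₁₂) × N₂₂ ≈ᴹ conj P (q ·ᴹ E₂₂)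

      frameFrom : ∀ e₁ e₂ → ¬ (m₁₁ N₁₂ * e₁ + m₁₂ N₁₂ * e₂ ≈ 0# × m₂₁ N₁₂ * e₁ + m₂₂ N₁₂ * e₂ ≈ 0#) → Frame
      frameFrom e₁ e₂ p₁≉0 = G ,
        conj-intro G (≈ᴹ-trans (applyˡ {N₁₁} N₁₁N₁₂ N₁₁N₂₂) (≈ᴹ-trans (+ᴹ-cong (·-*ᴹˡ q _ _) (0*ᴹ C₂))
          (≈ᴹ-trans (+ᴹ-0ʳ _) (≈ᴹ-sym (≈ᴹ-trans (·-*ᴹʳ q P E₁₁) (·ᴹ-congˡ P*E₁₁)))))) ,
        conj-intro G (≈ᴹ-trans (applyˡ {N₁₂} N₁₂N₁₂ N₁₂N₂₂) (≈ᴹ-trans (+ᴹ-cong (0*ᴹ C₁) (·-*ᴹˡ q _ _))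
          (≈ᴹ-trans (+ᴹ-0ˡ _) (≈ᴹ-sym (≈ᴹ-trans (·-*ᴹʳ q P E₁₂) (·ᴹ-congˡ P*E₁₂)))))) ,
        conj-intro G (≈ᴹ-trans (applyˡ {N₂₂} N₂₂N₁₂ N₂₂N₂₂) (≈ᴹ-trans (+ᴹ-cong (0*ᴹ C₁) (·-*ᴹˡ q _ _))
          (≈ᴹ-trans (+ᴹ-0ˡ _) (≈ᴹ-sym (≈ᴹ-trans (·-*ᴹʳ q P E₂₂) (·ᴹ-congˡ P*E₂₂))))))
        where
        open Columns N₁₂ N₂₂ e₁ e₂
        det⁻¹ : ∃[ d ] det P * d ≈ 1#
        det⁻¹ = inverse (det P) (det-P≉0 N₁₂N₁₂ N₁₂N₂₂ p₁≉0)
        G : GL₂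
        G = fromDet P (proj₁ det⁻¹) (proj₂ det⁻¹)

      column₁ : ∀ a b → a * 1# + b * 0# ≈ a
      column₁ = solve 2 (λ a b → a :* :1 :+ b :* :0 := a) refl
      column₂ : ∀ a b → a * 0# + b * 1# ≈ b
      column₂ = solve 2 (λ a b → a :* :0 :+ b :* :1 := b) refl

      N₁₂≉0 : ¬ (N₁₂ ≈ᴹ 0ᴹ)
      N₁₂≉0 e = π^≉0 t (trans (sym (*-identityʳ q)) (_≈ᴹ_.≈₁₂ (f-injective qE₁₂∈ e)))

      -- Injectivity of f makes N₁₂ nonzero, so one of the two standard basis vectors is outside its
      -- kernel and can serve as e.
      unitFrame : Frame
      unitFrame = choose (m₁₁ N₁₂ ≈0?) (m₂₁ N₁₂ ≈0?)
        where
        choose : Dec (m₁₁ N₁₂ ≈ 0#) → Dec (m₂₁ N₁₂ ≈ 0#) → Frame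
        choose (no a≉0)  _         = frameFrom 1# 0# (λ (e , _) → a≉0 (trans (sym (column₁ _ _)) e))
        choose (yes a≈0) (no c≉0)  = frameFrom 1# 0# (λ (_ , e) → c≉0 (trans (sym (column₁ _ _)) e))
        choose (yes a≈0) (yes c≈0) = frameFrom 0# 1# (λ (e , e′) →
          N₁₂≉0 (mat≈ a≈0 (trans (sym (column₂ _ _)) e) c≈0 (trans (sym (column₂ _ _)) e′)))

    opaque
      -- The analogue of Skolem-Noether for upper triangular matrices, which do not form a simple
      -- algebra. For t > 0 the matrix units are not in H, so agreement with a conjugation is
      -- checked on their multiples by πᵗ; it extends to πᵗx for every x in H, and πᵗ is cancelled.
      frame : Σ[ P ∈ GL₂ ] (∀ x (x∈ : x ∈ Triangular t) → f x x∈ ≈ᴹ conj P x)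
      frame = fromUnits unitFrame
        where
        fromUnits : Frame → Σ[ P ∈ GL₂ ] (∀ x (x∈ : x ∈ Triangular t) → f x x∈ ≈ᴹ conj P x)
        fromUnits (P , n₁₁ , n₁₂ , n₂₂) = P , λ x x∈ →
          cancel (≈ᴹ-trans (≈ᴹ-sym (f-· q∈ x∈ (Triangular-· {x = x} q∈ x∈)))
            (≈ᴹ-trans (f-cong (Triangular-· {x = x} q∈ x∈) (sum∈ x x∈) (expand x x∈))
              (≈ᴹ-trans (onSum x x∈ (sum∈ x x∈)) (≈ᴹ-trans (≈ᴹ-sym (conj-congʳ P (expand x x∈))) (conj-· P q x)))))
          where
          cancel : ∀ {x y} → q ·ᴹ x ≈ᴹ q ·ᴹ y → x ≈ᴹ y
          cancel (mat≈ e₁ e₂ e₃ e₄) = mat≈ (c′ e₁) (c′ e₂) (c′ e₃) (c′ e₄)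
            where
            c′ : ∀ {a b} → q * a ≈ q * b → a ≈ b
            c′ = *-cancel-≉0 (π^≉0 t)
          Conjugated : Mat → Set (c ⊔ ℓ)
          Conjugated y = ∀ y∈ → f y y∈ ≈ᴹ conj P y
          additive : ∀ y z → y ∈ Triangular t → z ∈ Triangular t → Conjugated y → Conjugated z → Conjugated (y +ᴹ z)
          additive y z y∈ z∈ ey ez y+z∈ = ≈ᴹ-trans (f-+ y∈ z∈ y+z∈)
            (≈ᴹ-trans (+ᴹ-cong (ey y∈) (ez z∈)) (≈ᴹ-sym (conj-+ P y z)))
          homogeneous : ∀ a y y∈ → a ∈ 𝒪 → f (q ·ᴹ y) y∈ ≈ᴹ conj P (q ·ᴹ y) → Conjugated (a ·ᴹ q ·ᴹ y)
          homogeneous a y y∈ a∈ n ay∈ = ≈ᴹ-trans (f-· a∈ y∈ ay∈) (≈ᴹ-trans (·ᴹ-congˡ n) (≈ᴹ-sym (conj-· P a (q ·ᴹ y))))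
          part₁ part₂ part₃ two sum : Mat → Mat
          part₁ x = m₁₁ x ·ᴹ q ·ᴹ E₁₁
          part₂ x = m₁₂ x ·ᴹ q ·ᴹ E₁₂
          part₃ x = m₂₂ x ·ᴹ q ·ᴹ E₂₂
          two x = part₁ x +ᴹ part₂ x
          sum x = two x +ᴹ part₃ x
          part₁∈ : ∀ x → x ∈ Triangular t → part₁ x ∈ Triangular t
          part₁∈ x x∈ = Triangular-· {x = q ·ᴹ E₁₁} (t₁₁ x∈) qE₁₁∈
          part₂∈ : ∀ x → x ∈ Triangular t → part₂ x ∈ Triangular t
          part₂∈ x x∈ = Triangular-· {x = q ·ᴹ E₁₂} (𝔭⇒𝒪 (t₁₂ x∈)) qE₁₂∈
          part₃∈ : ∀ x → x ∈ Triangular t → part₃ x ∈ Triangular t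
          part₃∈ x x∈ = Triangular-· {x = q ·ᴹ E₂₂} (t₂₂ x∈) qE₂₂∈
          two∈ : ∀ x → x ∈ Triangular t → two x ∈ Triangular t
          two∈ x x∈ = Triangular-+ {part₁ x} {part₂ x} (part₁∈ x x∈) (part₂∈ x x∈)
          sum∈ : ∀ x → x ∈ Triangular t → sum x ∈ Triangular t
          sum∈ x x∈ = Triangular-+ {two x} {part₃ x} (two∈ x x∈) (part₃∈ x x∈)
          onSum : ∀ x → x ∈ Triangular t → Conjugated (sum x)
          onSum x x∈ = additive (two x) (part₃ x) (two∈ x x∈) (part₃∈ x x∈)
            (additive (part₁ x) (part₂ x) (part₁∈ x x∈) (part₂∈ x x∈)
              (homogeneous (m₁₁ x) E₁₁ qE₁₁∈ (t₁₁ x∈) n₁₁) (homogeneous (m₁₂ x) E₁₂ qE₁₂∈ (𝔭⇒𝒪 (t₁₂ x∈)) n₁₂))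
            (homogeneous (m₂₂ x) E₂₂ qE₂₂∈ (t₂₂ x∈) n₂₂)
          expand : ∀ x → x ∈ Triangular t → q ·ᴹ x ≈ᴹ sum x
          expand x x∈ = mat≈
            (solve 4 (λ q a b d → q :* a := (a :* (q :* :1) :+ b :* (q :* :0)) :+ d :* (q :* :0)) refl q (m₁₁ x) (m₁₂ x) (m₂₂ x))
            (solve 4 (λ q a b d → q :* b := (a :* (q :* :0) :+ b :* (q :* :1)) :+ d :* (q :* :0)) refl q (m₁₁ x) (m₁₂ x) (m₂₂ x))
            (trans (*-congˡ (t₂₁≈0 x∈))
              (solve 4 (λ q a b d → q :* :0 := (a :* (q :* :0) :+ b :* (q :* :0)) :+ d :* (q :* :0)) refl q (m₁₁ x) (m₁₂ x) (m₂₂ x)))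
            (solve 4 (λ q a b d → q :* d := (a :* (q :* :0) :+ b :* (q :* :0)) :+ d :* (q :* :1)) refl q (m₁₁ x) (m₁₂ x) (m₂₂ x))

  -- The centraliser of the triangular matrices consists of scalars.
  frame-unique : ∀ P Q → (∀ x → x ∈ Triangular t → conj P x ≈ᴹ conj Q x) →
                 ∃[ a ] ∃[ b ] Σ[ e ∈ a * b ≈ 1# ] Q ≈ᴳ scalar e ∙ P
  frame-unique P Q same = a , proj₁ a⁻¹ , proj₂ a⁻¹ , (begin
    Q                             ≈⟨ g∙[g⁻¹∙h]≈h P Q ⟨
    P ∙ R                         ≈⟨ ∙-congˡ R≈ ⟩
    P ∙ scalar (proj₂ a⁻¹)        ≈⟨ wrap (≈ᴹ-trans (scalar-∙ (proj₂ a⁻¹) P) (≈ᴹ-sym (∙-scalar (proj₂ a⁻¹) P))) ⟨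
    scalar (proj₂ a⁻¹) ∙ P        ∎)
    where
    open SetoidReasoning GL₂-setoid
    R : GL₂
    R = P ⁻¹ ∙ Q
    a b′ c′ d : Carrier
    a = m₁₁ (matrix R)
    b′ = m₁₂ (matrix R)
    c′ = m₂₁ (matrix R)
    d = m₂₂ (matrix R)
    centralises : ∀ x → x ∈ Triangular t → x *ᴹ matrix R ≈ᴹ matrix R *ᴹ x
    centralises x x∈ = conj-elim R (≈ᴹ-trans (≈ᴹ-sym (conj-⁻¹ˡ P x))
      (≈ᴹ-trans (conj-congʳ (P ⁻¹) (same x x∈)) (≈ᴹ-sym (conj-∙ (P ⁻¹) Q x))))
    r₁ = centralises (q ·ᴹ E₁₁) qE₁₁∈
    r₂ = centralises (q ·ᴹ E₁₂) qE₁₂∈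
    b≈0 : b′ ≈ 0#
    b≈0 = *-≈0 (π^≉0 t) (trans (solve 3 (λ q b d → q :* b := (q :* :1) :* b :+ (q :* :0) :* d) refl q b′ d)
      (trans (_≈ᴹ_.≈₁₂ r₁) (solve 3 (λ q a b → a :* (q :* :0) :+ b :* (q :* :0) := :0) refl q a b′)))
    c≈0 : c′ ≈ 0#
    c≈0 = *-≈0 (π^≉0 t) (trans (solve 3 (λ q c d → q :* c := c :* (q :* :1) :+ d :* (q :* :0)) refl q c′ d)
      (trans (sym (_≈ᴹ_.≈₂₁ r₁)) (solve 3 (λ q a c → (q :* :0) :* a :+ (q :* :0) :* c := :0) refl q a c′)))
    a≈d : d ≈ a
    a≈d = *-cancel-≉0 (π^≉0 t) (trans (solve 3 (λ q b d → q :* d := (q :* :0) :* b :+ (q :* :1) :* d) refl q b′ d)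
      (trans (_≈ᴹ_.≈₁₂ r₂) (solve 3 (λ q a b → a :* (q :* :1) :+ b :* (q :* :0) := q :* a) refl q a b′)))
    a≉0 : ¬ (a ≈ 0#)
    a≉0 a≈0 = det≉0 R (trans (+-cong (*-congʳ a≈0) (-‿cong (*-congˡ c≈0)))
      (solve 2 (λ b d → :0 :* d :- b :* :0 := :0) refl b′ d))
    a⁻¹ : ∃[ b ] a * b ≈ 1#
    a⁻¹ = inverse a a≉0
    R≈ : R ≈ᴳ scalar (proj₂ a⁻¹)
    R≈ = wrap (mat≈ (sym (*-identityʳ a)) (trans b≈0 (sym (zeroʳ a))) (trans c≈0 (sym (zeroʳ a))) (trans a≈d (sym (*-identityʳ a))))

-- The element of GL₂ attached to an embedding or a suborder.

module Correspondence {c ℓ} (k : LocalField c ℓ) {r t : ℕ} where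
  open LocalField k
  open Valuation k
  open MatrixAlgebra k
  open Optimality k
  open Classification k
  open Frames k {t}
  open OptimalEmbedding using (φ; restriction)
  open OptimalSuborder using (order)

  H : Order
  H = H₀ ^[ t ]

  C : Subset
  C = Order.carrier H

  C⇒ : ∀ {x} → x ∈ C → x ∈ Triangular t
  C⇒ {x} = to (H₀^[t]⇔Triangular t x)

  ⇒C : ∀ {x} → x ∈ Triangular t → x ∈ C
  ⇒C {x} = from (H₀^[t]⇔Triangular t x)

  private
    q = π^ t

  span⇒upper : ∀ {x} → x ∈ Span U C → m₂₁ x ≈ 0#
  span⇒upper (incl x∈)     = t₂₁≈0 (C⇒ x∈)
  span⇒upper zero          = refl
  span⇒upper (add x∈ y∈)   = trans (+-cong (span⇒upper x∈) (span⇒upper y∈)) (+-identityˡ 0#)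
  span⇒upper (mul {a} _ x∈) = trans (*-congˡ (span⇒upper x∈)) (zeroʳ a)
  span⇒upper (resp x≈y x∈) = trans (sym (_≈ᴹ_.≈₂₁ x≈y)) (span⇒upper x∈)

  opaque
    upper⇒span : ∀ x → m₂₁ x ≈ 0# → x ∈ Span U C
    upper⇒span x x↑ = resp (≈ᴹ-sym (mat≈
        (trans (unit-coefficient (m₁₁ x)) (solve 4 (λ a b d q → a :* (q :* :1) := (a :* (q :* :1) :+ b :* (q :* :0)) :+ d :* (q :* :0))
          refl (m₁₁ x * q⁻¹) (m₁₂ x * q⁻¹) (m₂₂ x * q⁻¹) q))
        (trans (unit-coefficient (m₁₂ x)) (solve 4 (λ a b d q → b :* (q :* :1) := (a :* (q :* :0) :+ b :* (q :* :1)) :+ d :* (q :* :0))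
          refl (m₁₁ x * q⁻¹) (m₁₂ x * q⁻¹) (m₂₂ x * q⁻¹) q))
        (trans x↑ (solve 4 (λ a b d q → :0 := (a :* (q :* :0) :+ b :* (q :* :0)) :+ d :* (q :* :0))
          refl (m₁₁ x * q⁻¹) (m₁₂ x * q⁻¹) (m₂₂ x * q⁻¹) q))
        (trans (unit-coefficient (m₂₂ x)) (solve 4 (λ a b d q → d :* (q :* :1) := (a :* (q :* :0) :+ b :* (q :* :0)) :+ d :* (q :* :1))
          refl (m₁₁ x * q⁻¹) (m₁₂ x * q⁻¹) (m₂₂ x * q⁻¹) q))))
      (add (add (mul _ (incl (⇒C qE₁₁∈))) (mul _ (incl (⇒C qE₁₂∈)))) (mul _ (incl (⇒C qE₂₂∈))))
      where
      q⁻¹ : Carrier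
      q⁻¹ = π^⁻¹ t
      unit-coefficient : ∀ a → a ≈ (a * q⁻¹) * (q * 1#)
      unit-coefficient a = sym (trans (solve 3 (λ a q i → (a :* i) :* (q :* :1) := a :* (q :* i)) refl a q q⁻¹)
                                      (trans (*-congˡ (ππ⁻¹ t)) (*-identityʳ a)))

  module X {E : Subset} (X : OptimalEmbedding H E) where
    open OptimalEmbedding X using (isAlgebraMonomorphism; optimal)
    open IsAlgebraMonomorphism isAlgebraMonomorphism using (isRingMonomorphism; ·-homo)
    open RingMorphisms.IsRingMonomorphism isRingMonomorphism using (⟦⟧-cong; +-homo; *-homo; 0#-homo; injective)

    hom : TriangularHom
    hom = record
      { f           = λ x x∈ → φ X (x , incl (⇒C x∈))
      ; f-cong      = λ x∈ y∈ x≈y → ⟦⟧-cong x≈y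
      -- `⟦⟧-cong ≈ᴹ-refl` exchanges one proof of membership in kH for another; the same device
      -- recurs in the next fields.
      ; f-+         = λ {x} {y} x∈ y∈ x+y∈ → ≈ᴹ-trans (⟦⟧-cong ≈ᴹ-refl) (+-homo (x , incl (⇒C x∈)) (y , incl (⇒C y∈)))
      ; f-*         = λ {x} {y} x∈ y∈ xy∈ → ≈ᴹ-trans (⟦⟧-cong ≈ᴹ-refl) (*-homo (x , incl (⇒C x∈)) (y , incl (⇒C y∈)))
      ; f-·         = λ {a} {x} a∈ x∈ ax∈ → ≈ᴹ-trans (⟦⟧-cong ≈ᴹ-refl) (·-homo (a , _) (x , incl (⇒C x∈)))
      ; f-injective = λ x∈ fx≈0 → injective {y = 0ᴹ , zero} (≈ᴹ-trans fx≈0 (≈ᴹ-sym 0#-homo))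
      }

    P : GL₂
    P = proj₁ (frame hom)

    -- P is found from the restriction of φ to H, whereas optimality speaks of all of kH; linearity
    -- over k bridges the gap.
    φ≈conj : ∀ {x} (x∈ : x ∈ Span U C) → φ X (x , x∈) ≈ᴹ conj P x
    φ≈conj (incl x∈)          = ≈ᴹ-trans (⟦⟧-cong ≈ᴹ-refl) (proj₂ (frame hom) _ (C⇒ x∈))
    φ≈conj zero               = ≈ᴹ-trans 0#-homo (≈ᴹ-sym (conj-0 P))
    φ≈conj (add {x} {y} x∈ y∈) = ≈ᴹ-trans (+-homo (x , x∈) (y , y∈))
      (≈ᴹ-trans (+ᴹ-cong (φ≈conj x∈) (φ≈conj y∈)) (≈ᴹ-sym (conj-+ P x y)))
    φ≈conj (mul {a} {x} a∈ x∈) = ≈ᴹ-trans (·-homo (a , a∈) (x , x∈))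
      (≈ᴹ-trans (·ᴹ-congˡ (φ≈conj x∈)) (≈ᴹ-sym (conj-· P a x)))
    φ≈conj (resp x≈y x∈)      = ≈ᴹ-trans (⟦⟧-cong (≈ᴹ-sym x≈y)) (≈ᴹ-trans (φ≈conj x∈) (conj-congʳ P x≈y))

  module Y {E : Subset} (Y : OptimalSuborder H E) where
    open OptimalSuborder Y using (isomorphism)
    open AlgebraIsomorphism isomorphism using (isRingIsomorphism; ·-homo) renaming (to to σ)
    open RingMorphisms.IsRingIsomorphism isRingIsomorphism using (⟦⟧-cong; +-homo; *-homo; 0#-homo; injective; surjective)
    private module S = Order (order Y)

    private
      opaque
        preimage : ∀ x → x ∈ Triangular t → ∃ S.carrier
        preimage x x∈ = proj₁ (surjective (x , ⇒C x∈))

        σ-preimage : ∀ x x∈ → proj₁ (σ (preimage x x∈)) ≈ᴹ x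
        σ-preimage x x∈ = proj₂ (surjective (x , ⇒C x∈)) {preimage x x∈} ≈ᴹ-refl

      preimage-unique : ∀ x x∈ y → proj₁ (σ y) ≈ᴹ x → proj₁ (preimage x x∈) ≈ᴹ proj₁ y
      preimage-unique x x∈ y σy≈x = injective {preimage x x∈} {y} (≈ᴹ-trans (σ-preimage x x∈) (≈ᴹ-sym σy≈x))

      plus times : ∃ S.carrier → ∃ S.carrier → ∃ S.carrier
      plus (a , a∈) (b , b∈)  = a +ᴹ b , S.+-closed a∈ b∈
      times (a , a∈) (b , b∈) = a *ᴹ b , S.*-closed a∈ b∈

      scale : ∃ 𝒪 → ∃ S.carrier → ∃ S.carrier
      scale (e , e∈) (a , a∈) = e ·ᴹ a , S.·-closed e∈ a∈

      σ-plus : ∀ a b → proj₁ (σ (plus a b)) ≈ᴹ proj₁ (σ a) +ᴹ proj₁ (σ b)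
      σ-plus a b = +-homo a b
      σ-times : ∀ a b → proj₁ (σ (times a b)) ≈ᴹ proj₁ (σ a) *ᴹ proj₁ (σ b)
      σ-times a b = *-homo a b
      σ-scale : ∀ e a → proj₁ (σ (scale e a)) ≈ᴹ proj₁ e ·ᴹ proj₁ (σ a)
      σ-scale e a = ·-homo e a

      f : ∀ x → x ∈ Triangular t → Mat
      f x x∈ = proj₁ (preimage x x∈)

      f-+ : ∀ {x y} x∈ y∈ x+y∈ → f (x +ᴹ y) x+y∈ ≈ᴹ f x x∈ +ᴹ f y y∈
      f-+ {x} {y} x∈ y∈ x+y∈ = preimage-unique (x +ᴹ y) x+y∈ (plus (preimage x x∈) (preimage y y∈))
        (≈ᴹ-trans (σ-plus (preimage x x∈) (preimage y y∈)) (+ᴹ-cong (σ-preimage x x∈) (σ-preimage y y∈)))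

      f-* : ∀ {x y} x∈ y∈ xy∈ → f (x *ᴹ y) xy∈ ≈ᴹ f x x∈ *ᴹ f y y∈
      f-* {x} {y} x∈ y∈ xy∈ = preimage-unique (x *ᴹ y) xy∈ (times (preimage x x∈) (preimage y y∈))
        (≈ᴹ-trans (σ-times (preimage x x∈) (preimage y y∈)) (*ᴹ-cong (σ-preimage x x∈) (σ-preimage y y∈)))

      f-· : ∀ {a x} → a ∈ 𝒪 → ∀ x∈ ax∈ → f (a ·ᴹ x) ax∈ ≈ᴹ a ·ᴹ f x x∈
      f-· {a} {x} a∈ x∈ ax∈ = preimage-unique (a ·ᴹ x) ax∈ (scale (a , a∈) (preimage x x∈))
        (≈ᴹ-trans (σ-scale (a , a∈) (preimage x x∈)) (·ᴹ-congˡ (σ-preimage x x∈)))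

      σ-0 : ∀ {a} → proj₁ a ≈ᴹ 0ᴹ → proj₁ (σ a) ≈ᴹ 0ᴹ
      σ-0 {a} a≈0 = ≈ᴹ-trans (⟦⟧-cong {a} {0ᴹ , S.0-closed} a≈0) 0#-homo

    hom : TriangularHom
    hom = record
      { f           = f
      ; f-cong      = λ {x} {y} x∈ y∈ x≈y → preimage-unique x x∈ (preimage y y∈)
          (≈ᴹ-trans (σ-preimage y y∈) (≈ᴹ-sym x≈y))
      ; f-+         = f-+
      ; f-*         = f-*
      ; f-·         = f-·
      ; f-injective = λ {x} x∈ fx≈0 → ≈ᴹ-trans (≈ᴹ-sym (σ-preimage x x∈)) (σ-0 {preimage x x∈} fx≈0)
      }

    P : GL₂
    P = proj₁ (frame hom)

    -- The suborder is thus P H P⁻¹: `hom` is the inverse of the given isomorphism, and it is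
    -- conjugation by P.
    member⇔ : ∀ y → y ∈ S.carrier ⇔ conj (P ⁻¹) y ∈ Triangular t
    member⇔ y = mk⇔ there back
      where
      there : y ∈ S.carrier → conj (P ⁻¹) y ∈ Triangular t
      there y∈ = Triangular-resp (conj-move P (≈ᴹ-trans (≈ᴹ-sym (proj₂ (frame hom) x x∈)) y≈)) x∈
        where
        x : Mat
        x = proj₁ (σ (y , y∈))
        x∈ : x ∈ Triangular t
        x∈ = C⇒ (proj₂ (σ (y , y∈)))
        y≈ : proj₁ (preimage x x∈) ≈ᴹ y
        y≈ = injective {preimage x x∈} {y , y∈} (σ-preimage x x∈)
      back : conj (P ⁻¹) y ∈ Triangular t → y ∈ S.carrier
      back x∈ = S.respects (≈ᴹ-trans (proj₂ (frame hom) (conj (P ⁻¹) y) x∈) (conj-⁻¹ʳ P y))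
        (proj₂ (preimage (conj (P ⁻¹) y) x∈))

    σ-conj : ∀ x → x ∈ Triangular t → Σ[ y∈ ∈ conj P x ∈ S.carrier ] proj₁ (σ (conj P x , y∈)) ≈ᴹ x
    σ-conj x x∈ = y∈ , ≈ᴹ-trans
      (⟦⟧-cong {conj P x , y∈} {preimage x x∈} (≈ᴹ-sym (proj₂ (frame hom) x x∈))) (σ-preimage x x∈)
      where
      y∈ : conj P x ∈ S.carrier
      y∈ = from (member⇔ (conj P x)) (Triangular-resp (≈ᴹ-sym (conj-⁻¹ˡ P x)) x∈)

-- Classes of embeddings as orbits of optimal elements.

module Transfer {c ℓ} (k : LocalField c ℓ) {r t : ℕ} where
  open LocalField k
  open MatrixAlgebra k
  open Optimality k
  open Classification k
  open Frames k {t}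
  open Correspondence k {r} {t}
  open OptimalEmbedding using (φ; restriction)
  open OptimalSuborder using (order)
  private module ≈G = SetoidReasoning GL₂-setoid

  conj-injective : ∀ g {x y} → conj g x ≈ᴹ conj g y → x ≈ᴹ y
  conj-injective g {x} {y} e = ≈ᴹ-trans (conj-move g e) (conj-⁻¹ˡ g y)

  module _ (h : GL₂) where
    private
      conjugateBy-∙ : ∀ γ P → h ⁻¹ ∙ γ ∙ h ∙ (h ⁻¹ ∙ P) ≈ᴳ h ⁻¹ ∙ (γ ∙ P)
      conjugateBy-∙ γ P = begin
        h ⁻¹ ∙ γ ∙ h ∙ (h ⁻¹ ∙ P)      ≈⟨ ∙-assoc (h ⁻¹ ∙ γ) h _ ⟩
        h ⁻¹ ∙ γ ∙ (h ∙ (h ⁻¹ ∙ P))    ≈⟨ ∙-congˡ (g∙[g⁻¹∙h]≈h h P) ⟩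
        h ⁻¹ ∙ γ ∙ P                   ≈⟨ ∙-assoc (h ⁻¹) γ P ⟩
        h ⁻¹ ∙ (γ ∙ P)                 ∎
        where open ≈G

      unconjugate-∙ : ∀ γ P → h ∙ (γ ∙ (h ⁻¹ ∙ P)) ≈ᴳ h ∙ γ ∙ h ⁻¹ ∙ P
      unconjugate-∙ γ P = begin
        h ∙ (γ ∙ (h ⁻¹ ∙ P))   ≈⟨ ∙-assoc h γ _ ⟨
        h ∙ γ ∙ (h ⁻¹ ∙ P)     ≈⟨ ∙-assoc (h ∙ γ) (h ⁻¹) P ⟨
        h ∙ γ ∙ h ⁻¹ ∙ P       ∎
        where open ≈G

      connecting : ∀ γ P Q → h ⁻¹ ∙ γ ∙ h ∙ (h ⁻¹ ∙ P ∙ (P ⁻¹ ∙ (γ ⁻¹ ∙ Q))) ≈ᴳ h ⁻¹ ∙ Q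
      connecting γ P Q = begin
        h ⁻¹ ∙ γ ∙ h ∙ (h ⁻¹ ∙ P ∙ (P ⁻¹ ∙ (γ ⁻¹ ∙ Q)))     ≈⟨ ∙-congˡ (∙-assoc (h ⁻¹) P (P ⁻¹ ∙ (γ ⁻¹ ∙ Q))) ⟩
        h ⁻¹ ∙ γ ∙ h ∙ (h ⁻¹ ∙ (P ∙ (P ⁻¹ ∙ (γ ⁻¹ ∙ Q))))   ≈⟨ conjugateBy-∙ γ (P ∙ (P ⁻¹ ∙ (γ ⁻¹ ∙ Q))) ⟩
        h ⁻¹ ∙ (γ ∙ (P ∙ (P ⁻¹ ∙ (γ ⁻¹ ∙ Q))))               ≈⟨ ∙-congˡ (∙-congˡ (g∙[g⁻¹∙h]≈h P (γ ⁻¹ ∙ Q))) ⟩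
        h ⁻¹ ∙ (γ ∙ (γ ⁻¹ ∙ Q))                              ≈⟨ ∙-congˡ (g∙[g⁻¹∙h]≈h γ Q) ⟩
        h ⁻¹ ∙ Q                                             ∎
        where open ≈G

      solve-Q : ∀ {Q} η P b → Q ≈ᴳ η ∙ (P ∙ b) → b ∙ Q ⁻¹ ≈ᴳ P ⁻¹ ∙ η ⁻¹
      solve-Q {Q} η P b Q≈ = begin
        b ∙ Q ⁻¹                              ≈⟨ ∙-congˡ (⁻¹-congᴳ Q≈) ⟩
        b ∙ (η ∙ (P ∙ b)) ⁻¹                  ≈⟨ ∙-congˡ (⁻¹-anti-homo-∙ η (P ∙ b)) ⟩
        b ∙ ((P ∙ b) ⁻¹ ∙ η ⁻¹)               ≈⟨ ∙-congˡ (∙-congʳ (⁻¹-anti-homo-∙ P b)) ⟩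
        b ∙ (b ⁻¹ ∙ P ⁻¹ ∙ η ⁻¹)              ≈⟨ ∙-congˡ (∙-assoc (b ⁻¹) (P ⁻¹) (η ⁻¹)) ⟩
        b ∙ (b ⁻¹ ∙ (P ⁻¹ ∙ η ⁻¹))            ≈⟨ g∙[g⁻¹∙h]≈h b (P ⁻¹ ∙ η ⁻¹) ⟩
        P ⁻¹ ∙ η ⁻¹                           ∎
        where open ≈G

    -- States Γᴱ = h Γ h⁻¹ for a subgroup Γ, so that Γ₁ and Γ₂ can be treated at once. The field
    -- `scalars` absorbs the scalar by which P is ambiguous.
    record Conjugate (Γᴱ Γ : Pred GL₂ (c ⊔ ℓ)) : Set (c ⊔ ℓ) where
      field
        down       : ∀ γ → γ ∈ Γᴱ → h ⁻¹ ∙ γ ∙ h ∈ Γ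
        up         : ∀ γ → γ ∈ Γ → h ∙ γ ∙ h ⁻¹ ∈ Γᴱ
        isSubgroup : IsSubgroup Γ
        scalars    : ∀ {a b} (e : a * b ≈ 1#) → scalar e ∈ Γ

    module _ {Γᴱ Γ : Pred GL₂ (c ⊔ ℓ)} (Γᴱ~Γ : Conjugate Γᴱ Γ) where
      open Conjugate Γᴱ~Γ
      open IsSubgroup isSubgroup

      private
        frame-orbit : ∀ P Q → (∀ x → x ∈ Triangular t → conj P x ≈ᴹ conj Q x) → Orbit Γ (h ⁻¹ ∙ P) (h ⁻¹ ∙ Q)
        frame-orbit P Q same = let (_ , _ , e , Q≈) = frame-unique P Q same in
          scalar e , scalars e , (begin
            h ⁻¹ ∙ Q                   ≈⟨ ∙-congˡ Q≈ ⟩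
            h ⁻¹ ∙ (scalar e ∙ P)      ≈⟨ ∙-assoc (h ⁻¹) (scalar e) P ⟨
            h ⁻¹ ∙ scalar e ∙ P        ≈⟨ ∙-congʳ (scalar-central {r} e (h ⁻¹)) ⟨
            scalar e ∙ h ⁻¹ ∙ P        ≈⟨ ∙-assoc (scalar e) (h ⁻¹) P ⟩
            scalar e ∙ (h ⁻¹ ∙ P)      ∎)
          where open ≈G

      -- If Q and γP act alike on H, they differ by a scalar, which belongs to Γ. Passing from P to
      -- h⁻¹P replaces Γᴱ by Γ.
      embedding-orbit : ∀ P Q →
        (∃[ γ ] γ ∈ Γᴱ × (∀ x → x ∈ Triangular t → conj Q x ≈ᴹ conj γ (conj P x))) ⇔ Orbit Γ (h ⁻¹ ∙ P) (h ⁻¹ ∙ Q)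
      embedding-orbit P Q = mk⇔ there back
        where
        there : (∃[ γ ] γ ∈ Γᴱ × (∀ x → x ∈ Triangular t → conj Q x ≈ᴹ conj γ (conj P x))) → Orbit Γ (h ⁻¹ ∙ P) (h ⁻¹ ∙ Q)
        there (γ , γ∈ , same) = orbit-trans isSubgroup
          (h ⁻¹ ∙ γ ∙ h , down γ γ∈ , ≈ᴳ-sym (conjugateBy-∙ γ P))
          (frame-orbit (γ ∙ P) Q (λ x x∈ → ≈ᴹ-trans (conj-∙ γ P x) (≈ᴹ-sym (same x x∈))))
        back : Orbit Γ (h ⁻¹ ∙ P) (h ⁻¹ ∙ Q) → ∃[ γ ] γ ∈ Γᴱ × (∀ x → x ∈ Triangular t → conj Q x ≈ᴹ conj γ (conj P x))
        back (γ , γ∈ , e) = h ∙ γ ∙ h ⁻¹ , up γ γ∈ , λ x _ →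
          ≈ᴹ-trans (conj-cong Q≈ ≈ᴹ-refl) (conj-∙ (h ∙ γ ∙ h ⁻¹) P x)
          where
          Q≈ : Q ≈ᴳ h ∙ γ ∙ h ⁻¹ ∙ P
          Q≈ = ≈ᴳ-trans (≈ᴳ-sym (g∙[g⁻¹∙h]≈h h Q)) (≈ᴳ-trans (∙-congˡ e) (unconjugate-∙ γ P))

      -- An element γ carries P H P⁻¹ to Q H Q⁻¹ exactly if P⁻¹γ⁻¹Q normalises H, and this is the
      -- witness b.
      suborder-orbit : ∀ P Q →
        (∃[ γ ] γ ∈ Γᴱ × (∀ y → conj (Q ⁻¹) y ∈ Triangular t ⇔ conj (P ⁻¹) (conj (γ ⁻¹) y) ∈ Triangular t)) ⇔
        (∃[ b ] b ∈ Normalises (Triangular t) × Orbit Γ (h ⁻¹ ∙ P ∙ b) (h ⁻¹ ∙ Q))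
      suborder-orbit P Q = mk⇔ there back
        where
        there : (∃[ γ ] γ ∈ Γᴱ × (∀ y → conj (Q ⁻¹) y ∈ Triangular t ⇔ conj (P ⁻¹) (conj (γ ⁻¹) y) ∈ Triangular t)) →
                ∃[ b ] b ∈ Normalises (Triangular t) × Orbit Γ (h ⁻¹ ∙ P ∙ b) (h ⁻¹ ∙ Q)
        there (γ , γ∈ , same) = P ⁻¹ ∙ (γ ⁻¹ ∙ Q) , b∈ , h ⁻¹ ∙ γ ∙ h , down γ γ∈ , ≈ᴳ-sym (connecting γ P Q)
          where
          conj-b : ∀ x → conj (P ⁻¹ ∙ (γ ⁻¹ ∙ Q)) x ≈ᴹ conj (P ⁻¹) (conj (γ ⁻¹) (conj Q x))
          conj-b x = ≈ᴹ-trans (conj-∙ (P ⁻¹) (γ ⁻¹ ∙ Q) x) (conj-congʳ (P ⁻¹) (conj-∙ (γ ⁻¹) Q x))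
          b∈ : P ⁻¹ ∙ (γ ⁻¹ ∙ Q) ∈ Normalises (Triangular t)
          b∈ x = mk⇔
            (λ bx∈ → Triangular-resp (conj-⁻¹ˡ Q x) (from (same (conj Q x)) (Triangular-resp (conj-b x) bx∈)))
            (λ x∈ → Triangular-resp (≈ᴹ-sym (conj-b x)) (to (same (conj Q x)) (Triangular-resp (≈ᴹ-sym (conj-⁻¹ˡ Q x)) x∈)))
        back : (∃[ b ] b ∈ Normalises (Triangular t) × Orbit Γ (h ⁻¹ ∙ P ∙ b) (h ⁻¹ ∙ Q)) →
               ∃[ γ ] γ ∈ Γᴱ × (∀ y → conj (Q ⁻¹) y ∈ Triangular t ⇔ conj (P ⁻¹) (conj (γ ⁻¹) y) ∈ Triangular t)
        back (b , b∈ , γ , γ∈ , e) = h ∙ γ ∙ h ⁻¹ , up γ γ∈ , λ y → mk⇔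
          (λ Qy∈ → Triangular-resp (conj-b y) (from (b∈ (conj (Q ⁻¹) y)) Qy∈))
          (λ Py∈ → to (b∈ (conj (Q ⁻¹) y)) (Triangular-resp (≈ᴹ-sym (conj-b y)) Py∈))
          where
          Q≈ : Q ≈ᴳ h ∙ γ ∙ h ⁻¹ ∙ (P ∙ b)
          Q≈ = ≈ᴳ-trans (≈ᴳ-sym (g∙[g⁻¹∙h]≈h h Q)) (≈ᴳ-trans (∙-congˡ e)
            (≈ᴳ-trans (∙-congˡ (∙-congˡ (∙-assoc (h ⁻¹) P b))) (unconjugate-∙ γ (P ∙ b))))
          conj-b : ∀ y → conj b (conj (Q ⁻¹) y) ≈ᴹ conj (P ⁻¹) (conj ((h ∙ γ ∙ h ⁻¹) ⁻¹) y)
          conj-b y = ≈ᴹ-trans (≈ᴹ-sym (conj-∙ b (Q ⁻¹) y))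
            (≈ᴹ-trans (conj-cong (solve-Q (h ∙ γ ∙ h ⁻¹) P b Q≈) ≈ᴹ-refl) (conj-∙ (P ⁻¹) ((h ∙ γ ∙ h ⁻¹) ⁻¹) y))

  module _ (E : Subset) (h : GL₂) (E⇔ : ∀ x → x ∈ E ⇔ conj (h ⁻¹) x ∈ Eichler r) where
    E-resp : ∀ {x y} → x ≈ᴹ y → x ∈ E → y ∈ E
    E-resp {x} {y} x≈y x∈ = from (E⇔ y) (Eichler-resp (conj-congʳ (h ⁻¹) x≈y) (to (E⇔ x) x∈))

    private
      conj-h : ∀ {x} → x ∈ Eichler r → conj h x ∈ E
      conj-h {x} x∈ = from (E⇔ (conj h x)) (Eichler-resp (≈ᴹ-sym (conj-⁻¹ˡ h x)) x∈)

      conjugate-matrix : ∀ g γ → matrix (g ∙ γ ∙ g ⁻¹) ≡ conj g (matrix γ)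
      conjugate-matrix g γ = ≡.trans (matrix-∙ (g ∙ γ) (g ⁻¹)) (≡.cong₂ _*ᴹ_ (matrix-∙ g γ) (matrix-⁻¹ g))

      conjugate-inv : ∀ g γ → inv (g ∙ γ ∙ g ⁻¹) ≈ᴹ conj g (inv γ)
      conjugate-inv g γ = ≈ᴹ-trans (≈ᴹ-reflexive (≡.trans (inv-∙ (g ∙ γ) (g ⁻¹)) (≡.cong₂ _*ᴹ_ (inv-⁻¹ g) (inv-∙ g γ))))
        (≈ᴹ-sym (*ᴹ-assoc (matrix g) (inv γ) (inv g)))

      conjugateBy≈ : ∀ γ → h ⁻¹ ∙ γ ∙ h ≈ᴳ h ⁻¹ ∙ γ ∙ (h ⁻¹) ⁻¹
      conjugateBy≈ γ = ∙-congˡ (≈ᴳ-sym (⁻¹-involutive h))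

      conjugate-scaled : ∀ {a} g γ u → matrix γ ≈ᴹ a ·ᴹ matrix u → matrix (g ∙ γ ∙ g ⁻¹) ≈ᴹ a ·ᴹ matrix (g ∙ u ∙ g ⁻¹)
      conjugate-scaled {a} g γ u e = ≡.subst₂ (λ x y → x ≈ᴹ a ·ᴹ y)
        (≡.sym (conjugate-matrix g γ)) (≡.sym (conjugate-matrix g u))
        (≈ᴹ-trans (conj-congʳ g e) (conj-· g a (matrix u)))

      conj-conjugate : ∀ g γ x → conj (g ∙ γ ∙ g ⁻¹) x ≈ᴹ conj g (conj γ (conj (g ⁻¹) x))
      conj-conjugate g γ x = ≈ᴹ-trans (conj-∙ (g ∙ γ) (g ⁻¹) x) (conj-∙ g γ (conj (g ⁻¹) x))

    Γ₁-conjugate : Conjugate h (Γ₁ E) (Γ₁ (Eichler r))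
    Γ₁-conjugate = record
      { down = λ γ γ∈ → IsSubgroup.Γ-resp (Γ₁-isSubgroup {r}) (≈ᴳ-sym (conjugateBy≈ γ)) (down γ γ∈)
      ; up = up
      ; isSubgroup = Γ₁-isSubgroup {r}
      ; scalars = Γ₁-scalar {r}
      }
      where
      down : ∀ γ → γ ∈ Γ₁ E → h ⁻¹ ∙ γ ∙ (h ⁻¹) ⁻¹ ∈ Γ₁ (Eichler r)
      down γ (a , a≉0 , u , u∈ , u⁻¹∈ , γ≈) = a , a≉0 , h ⁻¹ ∙ u ∙ (h ⁻¹) ⁻¹ ,
        ≡.subst (Eichler r) (≡.sym (conjugate-matrix (h ⁻¹) u)) (to (E⇔ (matrix u)) u∈) ,
        Eichler-resp (≈ᴹ-sym (conjugate-inv (h ⁻¹) u)) (to (E⇔ (inv u)) u⁻¹∈) ,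
        conjugate-scaled (h ⁻¹) γ u γ≈
      up : ∀ γ → γ ∈ Γ₁ (Eichler r) → h ∙ γ ∙ h ⁻¹ ∈ Γ₁ E
      up γ (a , a≉0 , u , u∈ , u⁻¹∈ , γ≈) = a , a≉0 , h ∙ u ∙ h ⁻¹ ,
        ≡.subst E (≡.sym (conjugate-matrix h u)) (conj-h u∈) ,
        E-resp (≈ᴹ-sym (conjugate-inv h u)) (conj-h u⁻¹∈) ,
        conjugate-scaled h γ u γ≈

    Γ₂-conjugate : Conjugate h (Γ₂ E) (Γ₂ (Eichler r))
    Γ₂-conjugate = record
      { down = λ γ γ∈ → IsSubgroup.Γ-resp (Γ₂-isSubgroup {r}) (≈ᴳ-sym (conjugateBy≈ γ))
          (from (Γ₂⇔Normalises Eichler-resp (h ⁻¹ ∙ γ ∙ (h ⁻¹) ⁻¹)) (down γ (to (Γ₂⇔Normalises E-resp γ) γ∈)))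
      ; up = λ γ γ∈ → from (Γ₂⇔Normalises E-resp (h ∙ γ ∙ h ⁻¹)) (up γ (Γ₂-normalises {r} {γ} γ∈))
      ; isSubgroup = Γ₂-isSubgroup {r}
      ; scalars = λ e → Γ₁⊆Γ₂ {r} {scalar e} (Γ₁-scalar {r} e)
      }
      where
      down : ∀ γ → γ ∈ Normalises E → h ⁻¹ ∙ γ ∙ (h ⁻¹) ⁻¹ ∈ Normalises (Eichler r)
      down γ γ∈ x = mk⇔
        (λ e → Eichler-resp (conj-⁻¹ˡ h x) (to (E⇔ (conj h x)) (to (γ∈ (conj h x)) (from (E⇔ _) (Eichler-resp (move x) e)))))
        (λ x∈ → Eichler-resp (≈ᴹ-sym (move x)) (to (E⇔ _) (from (γ∈ (conj h x)) (conj-h x∈))))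
        where
        move : ∀ x → conj (h ⁻¹ ∙ γ ∙ (h ⁻¹) ⁻¹) x ≈ᴹ conj (h ⁻¹) (conj γ (conj h x))
        move x = ≈ᴹ-trans (conj-conjugate (h ⁻¹) γ x)
          (conj-congʳ (h ⁻¹) (conj-congʳ γ (conj-cong (⁻¹-involutive h) ≈ᴹ-refl)))
      up : ∀ γ → γ ∈ Normalises (Eichler r) → h ∙ γ ∙ h ⁻¹ ∈ Normalises E
      up γ γ∈ x = mk⇔
        (λ e → from (E⇔ x) (to (γ∈ _) (Eichler-resp (move x) (to (E⇔ _) e))))
        (λ x∈ → from (E⇔ _) (Eichler-resp (≈ᴹ-sym (move x)) (from (γ∈ _) (to (E⇔ x) x∈))))
        where
        move : ∀ x → conj (h ⁻¹) (conj (h ∙ γ ∙ h ⁻¹) x) ≈ᴹ conj γ (conj (h ⁻¹) x)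
        move x = ≈ᴹ-trans (conj-congʳ (h ⁻¹) (conj-conjugate h γ x)) (conj-⁻¹ˡ h _)

    private
      conj-h⁻¹P : ∀ P x → conj (h ⁻¹) (conj P x) ≈ᴹ conj (h ⁻¹ ∙ P) x
      conj-h⁻¹P P x = ≈ᴹ-sym (conj-∙ (h ⁻¹) P x)

    genX : OptimalEmbedding H E → GL₂
    genX φ = h ⁻¹ ∙ X.P φ

    genX-optimal : ∀ φ → Optimal r t (genX φ)
    genX-optimal X x x↑ = mk⇔
      (λ gx∈ → C⇒ (to optimal′ (E-resp (≈ᴹ-sym (X.φ≈conj X x∈)) (from E⇔′ (Eichler-resp (≈ᴹ-sym (conj-h⁻¹P (X.P X) x)) gx∈)))))
      (λ x∈T → Eichler-resp (conj-h⁻¹P (X.P X) x) (to E⇔′ (E-resp (X.φ≈conj X x∈) (from optimal′ (⇒C x∈T)))))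
      where
      x∈ : x ∈ Span U C
      x∈ = upper⇒span x x↑
      optimal′ : φ X (x , x∈) ∈ E ⇔ x ∈ C
      optimal′ = OptimalEmbedding.optimal X (x , x∈)
      E⇔′ : conj (X.P X) x ∈ E ⇔ conj (h ⁻¹) (conj (X.P X) x) ∈ Eichler r
      E⇔′ = E⇔ (conj (X.P X) x)

    genX-orbit : ∀ {Γᴱ Γ} → Conjugate h Γᴱ Γ → ∀ φ ψ → X-orbit Γᴱ φ ψ ⇔ Orbit Γ (genX φ) (genX ψ)
    genX-orbit {Γᴱ} {Γ} Γᴱ~Γ φ ψ = mk⇔ (λ o → to eq (there o)) (λ o → back (from eq o))
      where
      eq = embedding-orbit h Γᴱ~Γ (X.P φ) (X.P ψ)
      Same : Set (c ⊔ ℓ)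
      Same = ∃[ γ ] γ ∈ Γᴱ × (∀ x → x ∈ Triangular t → conj (X.P ψ) x ≈ᴹ conj γ (conj (X.P φ) x))
      there : X-orbit Γᴱ φ ψ → Same
      there (γ , γ∈ , same) = γ , γ∈ , λ x x∈ → ≈ᴹ-trans (≈ᴹ-sym (X.φ≈conj ψ (incl (⇒C x∈))))
        (≈ᴹ-trans (same x (⇒C x∈)) (conj-congʳ γ (X.φ≈conj φ (incl (⇒C x∈)))))
      back : Same → X-orbit Γᴱ φ ψ
      back (γ , γ∈ , same) = γ , γ∈ , λ x x∈ → ≈ᴹ-trans (X.φ≈conj ψ (incl x∈))
        (≈ᴹ-trans (same x (C⇒ x∈)) (conj-congʳ γ (≈ᴹ-sym (X.φ≈conj φ (incl x∈)))))

    private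
      conj-h∙g : ∀ g x → conj (h ⁻¹) (conj (h ∙ g) x) ≈ᴹ conj g x
      conj-h∙g g x = ≈ᴹ-trans (conj-congʳ (h ⁻¹) (conj-∙ h g x)) (conj-⁻¹ˡ h (conj g x))

    embedding : ∀ g → Optimal r t g → OptimalEmbedding H E
    embedding g g-opt = record
      { φ = λ x → conj (h ∙ g) (proj₁ x)
      ; isAlgebraMonomorphism = record
        { isRingMonomorphism = record
          { isRingHomomorphism = record
            { isSemiringHomomorphism = record
              { isNearSemiringHomomorphism = record
                { +-isMonoidHomomorphism = record
                  { isMagmaHomomorphism = record
                    { isRelHomomorphism = record { cong = conj-congʳ (h ∙ g) }
                    ; homo = λ x y → conj-+ (h ∙ g) (proj₁ x) (proj₁ y) }
                  ; ε-homo = conj-0 (h ∙ g) }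
                ; *-homo = λ x y → conj-* (h ∙ g) (proj₁ x) (proj₁ y) }
              ; 1#-homo = conj-𝟙 (h ∙ g) }
            ; -‿homo = λ x → conj-neg (h ∙ g) (proj₁ x) }
          ; injective = conj-injective (h ∙ g) }
        ; ·-homo = λ a x → conj-· (h ∙ g) (proj₁ a) (proj₁ x) }
      ; optimal = λ (x , x∈) → mk⇔
          (λ φx∈ → ⇒C (to (g-opt x (span⇒upper x∈)) (Eichler-resp (conj-h∙g g x) (to (E⇔ (conj (h ∙ g) x)) φx∈))))
          (λ x∈C → from (E⇔ (conj (h ∙ g) x)) (Eichler-resp (≈ᴹ-sym (conj-h∙g g x)) (from (g-opt x (span⇒upper x∈)) (C⇒ x∈C))))
      }

    Γ₁E-ε : ε ∈ Γ₁ E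
    Γ₁E-ε = 1# , 1≉0 , ε , 𝟙∈ (≡.sym matrix-ε) , 𝟙∈ (≡.sym inv-ε) , ≈ᴹ-sym (·ᴹ-identity _)
      where
      𝟙∈ : ∀ {x} → 𝟙 ≡ x → x ∈ E
      𝟙∈ ≡.refl = E-resp (conj-𝟙 h) (conj-h Eichler-𝟙)

    -- The frame of the embedding built from g is chosen anew, but it acts on H as h g does and so
    -- equals h g up to a scalar.
    genX-onto : ∀ g → Optimal r t g → ∃[ φ ] Orbit (Γ₁ (Eichler r)) (genX φ) g
    genX-onto g g-opt = Φ , orbit-trans (Γ₁-isSubgroup {r})
        (to (embedding-orbit h Γ₁-conjugate (X.P Φ) (h ∙ g)) (ε , Γ₁E-ε , λ x x∈ →
          ≈ᴹ-trans (X.φ≈conj Φ (incl (⇒C x∈))) (≈ᴹ-sym (conj-ε _))))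
        (orbit-reflexive (Γ₁-isSubgroup {r}) (g⁻¹∙[g∙h]≈h h g))
      where
      Φ : OptimalEmbedding H E
      Φ = embedding g g-opt

-- Classes of suborders as double cosets.

module TransferSuborders {c ℓ} (k : LocalField c ℓ) {r t : ℕ} where
  open LocalField k
  open MatrixAlgebra k
  open Optimality k
  open Classification k
  open Frames k {t}
  open Correspondence k {r} {t}
  open Transfer k {r} {t}
  open OptimalSuborder using (order; contained; optimal)

  module _ (E : Subset) (h : GL₂) (E⇔ : ∀ x → x ∈ E ⇔ conj (h ⁻¹) x ∈ Eichler r) where

    genY : OptimalSuborder H E → GL₂
    genY S = h ⁻¹ ∙ Y.P S

    -- Optimality of S concerns the elements of kS; since S = P H P⁻¹, these include the conjugates
    -- by P of all upper triangular matrices.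
    genY-optimal : ∀ S → Optimal r t (genY S)
    genY-optimal S x x↑ = mk⇔ there back
      where
      P : GL₂
      P = Y.P S
      member : conj P x ∈ Order.carrier (order S) ⇔ conj (P ⁻¹) (conj P x) ∈ Triangular t
      member = Y.member⇔ S (conj P x)
      spanned : conj P x ∈ Span U (Order.carrier (order S))
      spanned = Span-conj P (λ {y} y∈ → incl (from (Y.member⇔ S (conj P y))
        (Triangular-resp (≈ᴹ-sym (conj-⁻¹ˡ P y)) (C⇒ y∈)))) (upper⇒span x x↑)
      there : conj (h ⁻¹ ∙ P) x ∈ Eichler r → x ∈ Triangular t
      there gx∈ = Triangular-resp (conj-⁻¹ˡ P x) (to member (proj₁ (optimal S)
        (spanned , from (E⇔ (conj P x)) (Eichler-resp (conj-∙ (h ⁻¹) P x) gx∈))))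
      back : x ∈ Triangular t → conj (h ⁻¹ ∙ P) x ∈ Eichler r
      back x∈ = Eichler-resp (≈ᴹ-sym (conj-∙ (h ⁻¹) P x)) (to (E⇔ (conj P x))
        (contained S (from member (Triangular-resp (≈ᴹ-sym (conj-⁻¹ˡ P x)) x∈))))

    genY-orbit : ∀ {Γᴱ Γ} → Conjugate h Γᴱ Γ → ∀ S T → Y-orbit Γᴱ S T ⇔
                 (∃[ b ] b ∈ Normalises (Triangular t) × Orbit Γ (genY S ∙ b) (genY T))
    genY-orbit {Γᴱ} {Γ} Γᴱ~Γ S T = mk⇔ (λ o → to eq (there o)) (λ o → back (from eq o))
      where
      P Q : GL₂
      P = Y.P S
      Q = Y.P T
      eq = suborder-orbit h Γᴱ~Γ P Q
      Same : Set (c ⊔ ℓ)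
      Same = ∃[ γ ] γ ∈ Γᴱ × (∀ y → conj (Q ⁻¹) y ∈ Triangular t ⇔ conj (P ⁻¹) (conj (γ ⁻¹) y) ∈ Triangular t)
      there : Y-orbit Γᴱ S T → Same
      there (γ , γ∈ , T⊆ , ⊆T) = γ , γ∈ , λ y → mk⇔ (forth y) (hither y)
        where
        forth : ∀ y → conj (Q ⁻¹) y ∈ Triangular t → conj (P ⁻¹) (conj (γ ⁻¹) y) ∈ Triangular t
        forth y y∈ = let (x , x∈ , y≈) = T⊆ {y} (from (Y.member⇔ T y) y∈) in
          to (Y.member⇔ S (conj (γ ⁻¹) y)) (Order.respects (order S) (conj-move γ (≈ᴹ-sym y≈)) x∈)
        hither : ∀ y → conj (P ⁻¹) (conj (γ ⁻¹) y) ∈ Triangular t → conj (Q ⁻¹) y ∈ Triangular t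
        hither y y∈ = to (Y.member⇔ T y) (⊆T {y} (conj (γ ⁻¹) y , from (Y.member⇔ S (conj (γ ⁻¹) y)) y∈ , ≈ᴹ-sym (conj-⁻¹ʳ γ y)))
      back : Same → Y-orbit Γᴱ S T
      back (γ , γ∈ , same) = γ , γ∈ ,
        (λ {y} y∈ → conj (γ ⁻¹) y , from (Y.member⇔ S (conj (γ ⁻¹) y)) (to (same y) (to (Y.member⇔ T y) y∈)) , ≈ᴹ-sym (conj-⁻¹ʳ γ y)) ,
        (λ {y} (x , x∈ , y≈) → from (Y.member⇔ T y) (from (same y) (to (Y.member⇔ S (conj (γ ⁻¹) y))
          (Order.respects (order S) (conj-move γ (≈ᴹ-sym y≈)) x∈))))

    module _ (g : GL₂) (g-opt : Optimal r t g) where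
      private
        P : GL₂
        P = h ∙ g

        conj-P⁻¹ : ∀ y → conj g (conj (P ⁻¹) y) ≈ᴹ conj (h ⁻¹) y
        conj-P⁻¹ y = ≈ᴹ-trans (conj-congʳ g (≈ᴹ-trans (conj-cong (⁻¹-anti-homo-∙ h g) ≈ᴹ-refl) (conj-∙ (g ⁻¹) (h ⁻¹) y)))
          (conj-⁻¹ʳ g (conj (h ⁻¹) y))

        member : ∀ y → m₂₁ (conj (P ⁻¹) y) ≈ 0# → y ∈ E ⇔ conj (P ⁻¹) y ∈ C
        member y y↑ = mk⇔
          (λ y∈ → ⇒C (to (g-opt (conj (P ⁻¹) y) y↑) (Eichler-resp (≈ᴹ-sym (conj-P⁻¹ y)) (to (E⇔ y) y∈))))
          (λ y∈ → from (E⇔ y) (Eichler-resp (conj-P⁻¹ y) (from (g-opt (conj (P ⁻¹) y) y↑) (C⇒ y∈))))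

        S : Order
        S = conjOrder P H

        inside : ∀ {y} → conj (P ⁻¹) y ∈ C → y ∈ E
        inside {y} y∈ = from (member y (t₂₁≈0 (C⇒ y∈))) y∈

      suborder : OptimalSuborder H E
      suborder = record
        { order = S
        ; contained = inside
        ; optimal =
            (λ {y} (y∈span , y∈E) → to (member y (span⇒upper (Span-conj (P ⁻¹) incl y∈span))) y∈E) ,
            (λ y∈ → incl y∈ , inside y∈)
        ; isomorphism = record
          { to = λ (y , y∈) → conj (P ⁻¹) y , y∈
          ; isRingIsomorphism = record
            { isRingMonomorphism = record
              { isRingHomomorphism = record
                { isSemiringHomomorphism = record
                  { isNearSemiringHomomorphism = record
                    { +-isMonoidHomomorphism = record
                      { isMagmaHomomorphism = record
                        { isRelHomomorphism = record { cong = conj-congʳ (P ⁻¹) }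
                        ; homo = λ x y → conj-+ (P ⁻¹) (proj₁ x) (proj₁ y) }
                      ; ε-homo = conj-0 (P ⁻¹) }
                    ; *-homo = λ x y → conj-* (P ⁻¹) (proj₁ x) (proj₁ y) }
                  ; 1#-homo = conj-𝟙 (P ⁻¹) }
                ; -‿homo = λ x → conj-neg (P ⁻¹) (proj₁ x) }
              ; injective = conj-injective (P ⁻¹) }
            ; surjective = λ (x , x∈) → (conj P x , Order.respects H (≈ᴹ-sym (conj-⁻¹ˡ P x)) x∈) ,
                λ z≈ → ≈ᴹ-trans (conj-congʳ (P ⁻¹) z≈) (conj-⁻¹ˡ P x) }
          ; ·-homo = λ a x → conj-· (P ⁻¹) (proj₁ a) (proj₁ x) }
        }

    -- The isomorphism carried by `suborder` is conjugation by (h g)⁻¹, so the element recovered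
    -- from it acts on H as h g does, not merely up to an automorphism of H.
    genY-onto : ∀ g → Optimal r t g → ∃[ S ] Orbit (Γ₁ (Eichler r)) (genY S) g
    genY-onto g g-opt = S , orbit-trans (Γ₁-isSubgroup {r})
        (to (embedding-orbit h (Γ₁-conjugate E h E⇔) (Y.P S) (h ∙ g)) (ε , Γ₁E-ε E h E⇔ , λ x x∈ →
          ≈ᴹ-trans (same x x∈) (≈ᴹ-sym (conj-ε _))))
        (orbit-reflexive (Γ₁-isSubgroup {r}) (g⁻¹∙[g∙h]≈h h g))
      where
      S : OptimalSuborder H E
      S = suborder g g-opt
      same : ∀ x → x ∈ Triangular t → conj (h ∙ g) x ≈ᴹ conj (Y.P S) x
      same x x∈ = ≈ᴹ-trans (conj-congʳ (h ∙ g) (≈ᴹ-sym (proj₂ (Y.σ-conj S x x∈)))) (conj-⁻¹ʳ (h ∙ g) (conj (Y.P S) x))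

-- Maximal orders are conjugate to the integral matrices.

module MaximalOrders {c ℓ} (k : LocalField c ℓ) where
  open LocalField k
  open Valuation k
  open MatrixAlgebra k
  open Optimality k
  open Order using (carrier)

  private
    units : Vector Mat 4
    units = E₁₁ ∷ E₁₂ ∷ E₂₁ ∷ E₂₂ ∷ []

    entries-sum : ∀ x → ((m₁₁ x ·ᴹ E₁₁ +ᴹ m₁₂ x ·ᴹ E₁₂) +ᴹ m₂₁ x ·ᴹ E₂₁) +ᴹ m₂₂ x ·ᴹ E₂₂ ≈ᴹ x
    entries-sum (mat a b c′ d) = mat≈
      (solve 4 (λ a b c d → ((a :* :1 :+ b :* :0) :+ c :* :0) :+ d :* :0 := a) refl a b c′ d)
      (solve 4 (λ a b c d → ((a :* :0 :+ b :* :1) :+ c :* :0) :+ d :* :0 := b) refl a b c′ d)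
      (solve 4 (λ a b c d → ((a :* :0 :+ b :* :0) :+ c :* :1) :+ d :* :0 := c) refl a b c′ d)
      (solve 4 (λ a b c d → ((a :* :0 :+ b :* :0) :+ c :* :0) :+ d :* :1 := d) refl a b c′ d)

    span-entries : ∀ {s} {R : Pred Carrier _} {S : Pred Mat s} x → m₁₁ x ∈ R → m₁₂ x ∈ R → m₂₁ x ∈ R → m₂₂ x ∈ R →
      E₁₁ ∈ S → E₁₂ ∈ S → E₂₁ ∈ S → E₂₂ ∈ S → x ∈ Span R S
    span-entries x a∈ b∈ c∈ d∈ i₁ i₂ i₃ i₄ = resp (entries-sum x)
      (add (add (add (mul a∈ (incl i₁)) (mul b∈ (incl i₂))) (mul c∈ (incl i₃))) (mul d∈ (incl i₄)))

    E₁₁∈ : ∀ {r} → E₁₁ ∈ Eichler r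
    E₁₁∈ = eichler 1∈𝒪 0∈𝒪 (𝔭-0 _) 0∈𝒪
    E₁₂∈ : ∀ {r} → E₁₂ ∈ Eichler r
    E₁₂∈ = eichler 0∈𝒪 1∈𝒪 (𝔭-0 _) 0∈𝒪
    E₂₁∈ : E₂₁ ∈ Eichler 0
    E₂₁∈ = eichler 0∈𝒪 0∈𝒪 (𝒪⇒𝔭0 1∈𝒪) 0∈𝒪
    E₂₂∈ : ∀ {r} → E₂₂ ∈ Eichler r
    E₂₂∈ = eichler 0∈𝒪 0∈𝒪 (𝔭-0 _) 1∈𝒪

  Eichler-+ : ∀ {r x y} → x ∈ Eichler r → y ∈ Eichler r → x +ᴹ y ∈ Eichler r
  Eichler-+ (eichler x₁ x₂ x₃ x₄) (eichler y₁ y₂ y₃ y₄) =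
    eichler (+∈𝒪 x₁ y₁) (+∈𝒪 x₂ y₂) (𝔭-+ x₃ y₃) (+∈𝒪 x₄ y₄)

  Eichler-0 : ∀ {r} → 0ᴹ ∈ Eichler r
  Eichler-0 = eichler 0∈𝒪 0∈𝒪 (𝔭-0 _) 0∈𝒪

  M₂𝒪 : Order
  M₂𝒪 = record
    { subalgebra = record
      { carrier  = Eichler 0
      ; respects = Eichler-resp
      ; 0-closed = Eichler-0
      ; 1-closed = Eichler-𝟙
      ; +-closed = Eichler-+
      ; *-closed = Eichler-*
      ; -‿closed = λ {x} x∈ → Eichler-resp (-ᴹ≈-1· x) (Eichler-· -1∈𝒪 x∈)
      ; ·-closed = Eichler-·
      }
    ; finitelyGenerated = 4 , units , generated , integral
    }
    where
    generated : Eichler 0 ⊆ Span 𝒪 (λ x → ∃[ i ] x ≈ᴹ units i)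
    generated {x} (eichler a b c′ d) = span-entries x a b (𝔭⇒𝒪 c′) d
      (zero , ≈ᴹ-refl) (suc zero , ≈ᴹ-refl) (suc (suc zero) , ≈ᴹ-refl) (suc (suc (suc zero)) , ≈ᴹ-refl)
    unit∈ : ∀ i → units i ∈ Eichler 0
    unit∈ zero                   = E₁₁∈
    unit∈ (suc zero)             = E₁₂∈
    unit∈ (suc (suc zero))       = E₂₁∈
    unit∈ (suc (suc (suc zero))) = E₂₂∈
    integral : Span 𝒪 (λ x → ∃[ i ] x ≈ᴹ units i) ⊆ Eichler 0
    integral (incl (i , x≈)) = Eichler-resp (≈ᴹ-sym x≈) (unit∈ i)
    integral zero            = Eichler-0
    integral (add x∈ y∈)     = Eichler-+ (integral x∈) (integral y∈)
    integral (mul a∈ x∈)     = Eichler-· a∈ (integral x∈)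
    integral (resp x≈y x∈)   = Eichler-resp x≈y (integral x∈)

  conj-M₂𝒪-full : ∀ g → IsFull (conjOrder g M₂𝒪)
  conj-M₂𝒪-full g x = resp (conj-⁻¹ʳ g x) (Span-conj g
    (λ {y} y∈ → incl (Eichler-resp (≈ᴹ-sym (conj-⁻¹ˡ g y)) y∈))
    (span-entries {S = Eichler 0} (conj (g ⁻¹) x) _ _ _ _ E₁₁∈ E₁₂∈ E₂₁∈ E₂₂∈))

  -- The first column of x lies in the 𝒪-lattice spanned by those of X and Y.
  record InLattice (X Y x : Mat) : Set (c ⊔ ℓ) where
    constructor inLattice
    field
      λ₁ λ₂ : Carrier
      λ₁∈   : λ₁ ∈ 𝒪
      λ₂∈   : λ₂ ∈ 𝒪
      eq₁   : m₁₁ x ≈ λ₁ * m₁₁ X + λ₂ * m₁₁ Y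
      eq₂   : m₂₁ x ≈ λ₁ * m₂₁ X + λ₂ * m₂₁ Y

  private
    module _ {X Y : Mat} where
      lattice-resp : ∀ {x y} → x ≈ᴹ y → InLattice X Y x → InLattice X Y y
      lattice-resp (mat≈ f₁ _ f₃ _) (inLattice a b a∈ b∈ e₁ e₂) = inLattice a b a∈ b∈ (trans (sym f₁) e₁) (trans (sym f₃) e₂)

      lattice-+ : ∀ {x y} → InLattice X Y x → InLattice X Y y → InLattice X Y (x +ᴹ y)
      lattice-+ (inLattice a b a∈ b∈ e₁ e₂) (inLattice a′ b′ a′∈ b′∈ e₁′ e₂′) =
        inLattice (a + a′) (b + b′) (+∈𝒪 a∈ a′∈) (+∈𝒪 b∈ b′∈) (collect e₁ e₁′) (collect e₂ e₂′)
        where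
        collect : ∀ {s s′ X Y} → s ≈ a * X + b * Y → s′ ≈ a′ * X + b′ * Y → s + s′ ≈ (a + a′) * X + (b + b′) * Y
        collect {X = X} {Y} e f = trans (+-cong e f) (solve 6 (λ a b a′ b′ X Y →
          (a :* X :+ b :* Y) :+ (a′ :* X :+ b′ :* Y) := (a :+ a′) :* X :+ (b :+ b′) :* Y) refl a b a′ b′ X Y)

      lattice-· : ∀ {s x} → s ∈ 𝒪 → InLattice X Y x → InLattice X Y (s ·ᴹ x)
      lattice-· {s} s∈ (inLattice a b a∈ b∈ e₁ e₂) =
        inLattice (s * a) (s * b) (*∈𝒪 s∈ a∈) (*∈𝒪 s∈ b∈) (collect e₁) (collect e₂)
        where
        collect : ∀ {u X Y} → u ≈ a * X + b * Y → s * u ≈ (s * a) * X + (s * b) * Y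
        collect {X = X} {Y} e = trans (*-congˡ e) (solve 5 (λ s a b X Y →
          s :* (a :* X :+ b :* Y) := (s :* a) :* X :+ (s :* b) :* Y) refl s a b X Y)

      lattice-0 : InLattice X Y 0ᴹ
      lattice-0 = inLattice 0# 0# 0∈𝒪 0∈𝒪 (zeros _ _) (zeros _ _)
        where
        zeros : ∀ X Y → 0# ≈ 0# * X + 0# * Y
        zeros = solve 2 (λ X Y → :0 := :0 :* X :+ :0 :* Y) refl

      lattice-left : InLattice X Y X
      lattice-left = inLattice 1# 0# 1∈𝒪 0∈𝒪 (l _ _) (l _ _)
        where
        l : ∀ X Y → X ≈ 1# * X + 0# * Y
        l = solve 2 (λ X Y → X := :1 :* X :+ :0 :* Y) refl

      lattice-right : InLattice X Y Y
      lattice-right = inLattice 0# 1# 0∈𝒪 1∈𝒪 (l _ _) (l _ _)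
        where
        l : ∀ X Y → Y ≈ 0# * X + 1# * Y
        l = solve 2 (λ X Y → Y := :0 :* X :+ :1 :* Y) refl

      lattice-span : ∀ {s} {S : Pred Mat s} → (∀ {x} → x ∈ S → InLattice X Y x) → ∀ {x} → x ∈ Span 𝒪 S → InLattice X Y x
      lattice-span S⇒ (incl x∈)     = S⇒ x∈
      lattice-span S⇒ zero          = lattice-0
      lattice-span S⇒ (add x∈ y∈)   = lattice-+ (lattice-span S⇒ x∈) (lattice-span S⇒ y∈)
      lattice-span S⇒ (mul a∈ x∈)   = lattice-· a∈ (lattice-span S⇒ x∈)
      lattice-span S⇒ (resp x≈y x∈) = lattice-resp x≈y (lattice-span S⇒ x∈)

    lattice-trans : ∀ {X Y X′ Y′ x} → InLattice X′ Y′ X → InLattice X′ Y′ Y → InLattice X Y x → InLattice X′ Y′ x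
    lattice-trans {X} {Y} X∈ Y∈ (inLattice a b a∈ b∈ e₁ e₂) = columns
      (lattice-+ {x = a ·ᴹ X} {b ·ᴹ Y} (lattice-· a∈ X∈) (lattice-· b∈ Y∈))
      where
      columns : InLattice _ _ (a ·ᴹ X +ᴹ b ·ᴹ Y) → InLattice _ _ _
      columns (inLattice p′ q p∈ q∈ f₁ f₂) = inLattice p′ q p∈ q∈ (trans e₁ f₁) (trans e₂ f₂)

  -- A basis of the lattice of first columns of the members of S, in Hermite normal form.
  record ColumnBasis {s} (S : Pred Mat s) : Set (c ⊔ ℓ ⊔ s) where
    field
      X Y   : Mat
      X∈    : X ∈ Span 𝒪 S
      Y∈    : Y ∈ Span 𝒪 S
      Y₁₁≈0 : m₁₁ Y ≈ 0#
      basis : ∀ {x} → x ∈ S → InLattice X Y x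

  private
    module _ {s} {S : Pred Mat s} where
      subtract : ∀ {x y} a → a ∈ 𝒪 → x ∈ Span 𝒪 S → y ∈ Span 𝒪 S → x +ᴹ (- a) ·ᴹ y ∈ Span 𝒪 S
      subtract a a∈ x∈ y∈ = add x∈ (mul (-∈𝒪 a∈) y∈)

      -- Two columns (0 , y) and (0 , z) span a lattice of rank at most one.
      joinColumns : ∀ A B → A ∈ Span 𝒪 S → B ∈ Span 𝒪 S → m₁₁ A ≈ 0# → m₁₁ B ≈ 0# →
                Σ[ Y ∈ Mat ] Y ∈ Span 𝒪 S × m₁₁ Y ≈ 0# × (∀ X → InLattice X Y A × InLattice X Y B)
      joinColumns A B A∈ B∈ A₁₁ B₁₁ = choose (divides (m₂₁ A) (m₂₁ B))
        where
        multiple : ∀ {Y Z z} → z ∈ 𝒪 → m₁₁ Y ≈ 0# → m₁₁ Z ≈ 0# → m₂₁ Z ≈ m₂₁ Y * z → ∀ X → InLattice X Y Z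
        multiple {Y} {Z} {z} z∈ Y₁₁ Z₁₁ e X = inLattice 0# z 0∈𝒪 z∈
          (trans Z₁₁ (trans (solve 2 (λ z X → :0 := :0 :* X :+ z :* :0) refl z (m₁₁ X)) (+-congˡ (*-congˡ (sym Y₁₁)))))
          (trans e (solve 3 (λ Y z X → Y :* z := :0 :* X :+ z :* Y) refl (m₂₁ Y) z (m₂₁ X)))
        choose : (∃[ z ] z ∈ 𝒪 × m₂₁ B ≈ m₂₁ A * z) ⊎ (∃[ z ] z ∈ 𝔭 1 × m₂₁ A ≈ m₂₁ B * z) →
          Σ[ Y ∈ Mat ] Y ∈ Span 𝒪 S × m₁₁ Y ≈ 0# × (∀ X → InLattice X Y A × InLattice X Y B)
        choose (inj₁ (z , z∈ , e)) = A , A∈ , A₁₁ , λ X → lattice-right {X} {A} , multiple {A} {B} z∈ A₁₁ B₁₁ e X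
        choose (inj₂ (z , z∈ , e)) = B , B∈ , B₁₁ , λ X → multiple {B} {A} (𝔭⇒𝒪 z∈) B₁₁ A₁₁ e X , lattice-right {X} {B}

      extend : ∀ X Y G → X ∈ Span 𝒪 S → Y ∈ Span 𝒪 S → m₁₁ Y ≈ 0# → G ∈ Span 𝒪 S →
        Σ[ X′ ∈ Mat ] Σ[ Y′ ∈ Mat ] X′ ∈ Span 𝒪 S × Y′ ∈ Span 𝒪 S × m₁₁ Y′ ≈ 0# ×
          InLattice X′ Y′ X × InLattice X′ Y′ Y × InLattice X′ Y′ G
      extend X Y G X∈ Y∈ Y₁₁ G∈ = choose (divides (m₁₁ X) (m₁₁ G))
        where
        -- B = zA + (B - zA), where B - zA has first entry 0.
        reduce : ∀ A B z → z ∈ 𝒪 → m₁₁ B ≈ m₁₁ A * z → A ∈ Span 𝒪 S → B ∈ Span 𝒪 S →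
          Σ[ Y′ ∈ Mat ] Y′ ∈ Span 𝒪 S × m₁₁ Y′ ≈ 0# × InLattice A Y′ Y × InLattice A Y′ B
        reduce A B z z∈ e A∈ B∈ =
          let (Y′ , Y′∈ , Y′₁₁ , in-Y′) = joinColumns Y (B +ᴹ (- z) ·ᴹ A) Y∈ (subtract z z∈ B∈ A∈) Y₁₁
                (trans (+-congʳ e) (solve 2 (λ a z → a :* z :+ (:- z) :* a := :0) refl (m₁₁ A) z))
          in Y′ , Y′∈ , Y′₁₁ , proj₁ (in-Y′ A) ,
             lattice-resp (mat≈ (restore _ _) (restore _ _) (restore _ _) (restore _ _))
               (lattice-+ (lattice-· {x = A} z∈ lattice-left) (proj₂ (in-Y′ A)))
          where
          restore : ∀ a b → z * a + (b + - z * a) ≈ b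
          restore a b = solve 3 (λ z a b → z :* a :+ (b :+ (:- z) :* a) := b) refl z a b
        Extension : Set _
        Extension = Σ[ X′ ∈ Mat ] Σ[ Y′ ∈ Mat ] X′ ∈ Span 𝒪 S × Y′ ∈ Span 𝒪 S × m₁₁ Y′ ≈ 0# ×
          InLattice X′ Y′ X × InLattice X′ Y′ Y × InLattice X′ Y′ G
        choose : (∃[ z ] z ∈ 𝒪 × m₁₁ G ≈ m₁₁ X * z) ⊎ (∃[ z ] z ∈ 𝔭 1 × m₁₁ X ≈ m₁₁ G * z) → Extension
        choose (inj₁ (z , z∈ , e)) = let (Y′ , Y′∈ , Y′₁₁ , Y-in , G-in) = reduce X G z z∈ e X∈ G∈ in
          X , Y′ , X∈ , Y′∈ , Y′₁₁ , lattice-left {X} {Y′} , Y-in , G-in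
        choose (inj₂ (z , z∈ , e)) = let (Y′ , Y′∈ , Y′₁₁ , Y-in , X-in) = reduce G X z (𝔭⇒𝒪 z∈) e G∈ X∈ in
          G , Y′ , G∈ , Y′∈ , Y′₁₁ , X-in , Y-in , lattice-left {G} {Y′}

    span-mono : ∀ {s s′ R} {S : Pred Mat s} {S′ : Pred Mat s′} → (∀ {x} → x ∈ S → x ∈ S′) → ∀ {x} → x ∈ Span R S → x ∈ Span R S′
    span-mono S⊆ (incl x∈)     = incl (S⊆ x∈)
    span-mono S⊆ zero          = zero
    span-mono S⊆ (add x∈ y∈)   = add (span-mono S⊆ x∈) (span-mono S⊆ y∈)
    span-mono S⊆ (mul a∈ x∈)   = mul a∈ (span-mono S⊆ x∈)
    span-mono S⊆ (resp x≈y x∈) = resp x≈y (span-mono S⊆ x∈)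

  columnBasis : ∀ n (γ : Vector Mat n) → ColumnBasis (λ x → ∃[ i ] x ≈ᴹ γ i)
  columnBasis zero    γ = record { X = 0ᴹ ; Y = 0ᴹ ; X∈ = zero ; Y∈ = zero ; Y₁₁≈0 = refl ; basis = λ () }
  columnBasis (suc n) γ =
    let B = columnBasis n (γ ∘ suc)
        open ColumnBasis B
        (X′ , Y′ , X′∈ , Y′∈ , Y′₁₁ , X-in , Y-in , G-in) = extend X Y (γ zero)
          (span-mono (λ (i , e) → suc i , e) X∈) (span-mono (λ (i , e) → suc i , e) Y∈) Y₁₁≈0 (incl (zero , ≈ᴹ-refl))
    in record { X = X′ ; Y = Y′ ; X∈ = X′∈ ; Y∈ = Y′∈ ; Y₁₁≈0 = Y′₁₁
              ; basis = λ { (zero , e) → lattice-resp (≈ᴹ-sym e) G-in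
                          ; (suc i , e) → lattice-trans X-in Y-in (basis (i , e)) } }

  private
    -- A linear relation between the two entries of the first column passes from S to its k-span. On
    -- a full order it would hold for every matrix, which is how the rank of the lattice of columns
    -- is bounded from below.
    functional : ∀ {s} {S : Pred Mat s} a b → (∀ {x} → x ∈ S → a * m₂₁ x ≈ b * m₁₁ x) →
                 ∀ {x} → x ∈ Span U S → a * m₂₁ x ≈ b * m₁₁ x
    functional a b S⇒ (incl x∈)     = S⇒ x∈
    functional a b S⇒ zero          = trans (zeroʳ a) (sym (zeroʳ b))
    functional a b S⇒ (add x∈ y∈)   = trans (distribˡ a _ _)
      (trans (+-cong (functional a b S⇒ x∈) (functional a b S⇒ y∈)) (sym (distribˡ b _ _)))
    functional a b S⇒ (mul {e} {x} _ x∈) = trans (swap a e _) (trans (*-congˡ (functional a b S⇒ x∈)) (sym (swap b e _)))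
      where
      swap : ∀ a e y → a * (e * y) ≈ e * (a * y)
      swap = solve 3 (λ a e y → a :* (e :* y) := e :* (a :* y)) refl
    functional a b S⇒ (resp (mat≈ f₁ _ f₃ _) x∈) = trans (*-congˡ (sym f₃)) (trans (functional a b S⇒ x∈) (*-congˡ f₁))

  module _ (D : Order) (D-full : IsFull D) where
    private
      module D = Order D
      n = proj₁ D.finitelyGenerated
      γ = proj₁ (proj₂ D.finitelyGenerated)
      D⊆span : D.carrier ⊆ Span 𝒪 (λ x → ∃[ i ] x ≈ᴹ γ i)
      D⊆span = proj₁ (proj₂ (proj₂ D.finitelyGenerated))
      span⊆D : Span 𝒪 (λ x → ∃[ i ] x ≈ᴹ γ i) ⊆ D.carrier
      span⊆D = proj₂ (proj₂ (proj₂ D.finitelyGenerated))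

    -- D is a ring, so left multiplication by D preserves the lattice of first columns of its
    -- elements. Writing this action in the basis given by X and Y makes P⁻¹xP integral, provided
    -- that the lattice has rank two: 1 ∈ D makes the upper entry of X nonzero, and fullness does
    -- the same for the lower entry of Y.
    contained-in-conjugate : Σ[ P ∈ GL₂ ] D.carrier ⊆ Order.carrier (conjOrder P M₂𝒪)
    contained-in-conjugate = build (columnBasis n γ)
      where
      build : ColumnBasis (λ x → ∃[ i ] x ≈ᴹ γ i) → Σ[ P ∈ GL₂ ] D.carrier ⊆ Order.carrier (conjOrder P M₂𝒪)
      build B = P , λ {x} x∈ → stable x (column (D.*-closed x∈ (span⊆D X∈))) (column (D.*-closed x∈ (span⊆D Y∈)))
        where
        open ColumnBasis B
        column : ∀ {x} → x ∈ D.carrier → InLattice X Y x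
        column x∈ = lattice-span basis (D⊆span x∈)
        X₁₁≉0 : ¬ (m₁₁ X ≈ 0#)
        X₁₁≉0 X₁₁≈0 = contradict (column D.1-closed)
          where
          contradict : InLattice X Y 𝟙 → ⊥
          contradict (inLattice a b _ _ e _) = 1≉0 (trans e (trans (+-cong (*-congˡ X₁₁≈0) (*-congˡ Y₁₁≈0))
            (solve 2 (λ a b → a :* :0 :+ b :* :0 := :0) refl a b)))
        Y₂₁≉0 : ¬ (m₂₁ Y ≈ 0#)
        -- Otherwise all first columns of D, and by fullness that of `E₂₁`, would be proportional to
        -- the column of X, which forces its upper entry to be 0.
        Y₂₁≉0 Y₂₁≈0 = X₁₁≉0 (trans (sym (*-identityʳ _)) (trans
          (functional (m₁₁ X) (m₂₁ X) (λ x∈ → proportional (column x∈)) (D-full E₂₁)) (zeroʳ _)))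
          where
          proportional : ∀ {x} → InLattice X Y x → m₁₁ X * m₂₁ x ≈ m₂₁ X * m₁₁ x
          proportional (inLattice a b _ _ f₁ f₂) = trans (*-congˡ (trans f₂ (+-congˡ (*-congˡ Y₂₁≈0)))) (trans
            (solve 4 (λ a b X X′ → X :* (a :* X′ :+ b :* :0) := X′ :* (a :* X :+ b :* :0)) refl a b (m₁₁ X) (m₂₁ X))
            (*-congˡ (sym (trans f₁ (+-congˡ (*-congˡ Y₁₁≈0))))))
        columns : Mat
        columns = mat (m₁₁ X) (m₁₁ Y) (m₂₁ X) (m₂₁ Y)
        det≉0′ : ¬ (det columns ≈ 0#)
        det≉0′ e = *-≉0 X₁₁≉0 Y₂₁≉0 (trans (sym (trans (+-congˡ (-‿cong (*-congʳ Y₁₁≈0)))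
          (solve 3 (λ a d b → a :* d :- :0 :* b := a :* d) refl (m₁₁ X) (m₂₁ Y) (m₂₁ X)))) e)
        P : GL₂
        P = fromDet columns (proj₁ (inverse _ det≉0′)) (proj₂ (inverse _ det≉0′))
        stable : ∀ x → InLattice X Y (x *ᴹ X) → InLattice X Y (x *ᴹ Y) → conj (P ⁻¹) x ∈ Eichler 0
        stable x (inLattice a b a∈ b∈ f₁ f₂) (inLattice a′ b′ a′∈ b′∈ f₁′ f₂′) =
          Eichler-resp (conj-move P (≈ᴹ-sym (conj-intro P {x} {mat a a′ b b′} (mat≈
            (trans f₁ (flip _ _ _ _)) (trans f₁′ (flip _ _ _ _)) (trans f₂ (flip _ _ _ _)) (trans f₂′ (flip _ _ _ _))))))
          (eichler a∈ a′∈ (𝒪⇒𝔭0 b∈) b′∈)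
          where
          flip : ∀ a b X Y → a * X + b * Y ≈ X * a + Y * b
          flip = solve 4 (λ a b X Y → a :* X :+ b :* Y := X :* a :+ Y :* b) refl

  maximal⇒conjugate : ∀ D → IsMaximal D → Σ[ P ∈ GL₂ ] (∀ x → x ∈ Order.carrier D ⇔ conj (P ⁻¹) x ∈ Eichler 0)
  maximal⇒conjugate D (D-full , D-max) = let (P , D⊆) = contained-in-conjugate D D-full in
    P , λ x → mk⇔ (λ x∈ → D⊆ x∈) (λ x∈ → D-max (conjOrder P M₂𝒪) (conj-M₂𝒪-full P) D⊆ x∈)

-- The Cartan decomposition and the level of an Eichler order.

module EichlerOrders {c ℓ} (k : LocalField c ℓ) where
  open LocalField k
  open Valuation k
  open MatrixAlgebra k
  open Optimality k
  open Classification k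
  open MaximalOrders k

  private
    M : Pred Mat _
    M = Eichler 0

  -- M₂(𝒪) ∩ g M₂(𝒪) g⁻¹ = u E u⁻¹ for a standard Eichler order E and some u
  -- that normalises M₂(𝒪): this is what the Cartan decomposition of g gives.
  record Cartan (g : GL₂) : Set (c ⊔ ℓ) where
    field
      u            : GL₂
      u-normalises : u ∈ Normalises M
      level        : ℕ
      intersection : ∀ y → (y ∈ M × conj (g ⁻¹) y ∈ M) ⇔ conj (u ⁻¹) y ∈ Eichler level

  private
    conj-∙⁻¹ : ∀ g h y → conj ((g ∙ h) ⁻¹) y ≈ᴹ conj (h ⁻¹) (conj (g ⁻¹) y)
    conj-∙⁻¹ g h y = ≈ᴹ-trans (conj-cong (⁻¹-anti-homo-∙ g h) ≈ᴹ-refl) (conj-∙ (h ⁻¹) (g ⁻¹) y)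

  cartan-resp : ∀ {g h} → g ≈ᴳ h → Cartan g → Cartan h
  cartan-resp {g} {h} g≈h G = record { u = u ; u-normalises = u-normalises ; level = level ; intersection = λ y → mk⇔
    (λ (y∈ , hy∈) → to (intersection y) (y∈ , Eichler-resp (≈ᴹ-sym (moved y)) hy∈))
    (λ uy∈ → let (y∈ , gy∈) = from (intersection y) uy∈ in y∈ , Eichler-resp (moved y) gy∈) }
    where
    open Cartan G
    moved : ∀ y → conj (g ⁻¹) y ≈ᴹ conj (h ⁻¹) y
    moved y = conj-cong (⁻¹-congᴳ g≈h) ≈ᴹ-refl

  -- As v normalises M₂(𝒪), g and g v give the same conjugate of it.
  cartanʳ : ∀ g v → v ∈ Normalises M → Cartan (g ∙ v) → Cartan g
  cartanʳ g v v∈ G = record { u = u ; u-normalises = u-normalises ; level = level ; intersection = λ y → mk⇔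
    (λ (y∈ , gy∈) → to (intersection y) (y∈ , Eichler-resp (≈ᴹ-sym (conj-∙⁻¹ g v y)) (from (v⁻¹∈ (conj (g ⁻¹) y)) gy∈)))
    (λ uy∈ → let (y∈ , gvy∈) = from (intersection y) uy∈ in
      y∈ , to (v⁻¹∈ (conj (g ⁻¹) y)) (Eichler-resp (conj-∙⁻¹ g v y) gvy∈)) }
    where
    open Cartan G
    v⁻¹∈ : v ⁻¹ ∈ Normalises M
    v⁻¹∈ = Normalises-⁻¹ Eichler-resp {v} v∈

  -- Conjugation by v⁻¹ fixes M₂(𝒪) and takes the intersection for v g to the one for g; accordingly
  -- u becomes v⁻¹u.
  cartanˡ : ∀ g v → v ∈ Normalises M → Cartan (v ∙ g) → Cartan g
  cartanˡ g v v∈ G = record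
    { u = v ⁻¹ ∙ u
    ; u-normalises = Normalises-∙ Eichler-resp {v ⁻¹} {u} (Normalises-⁻¹ Eichler-resp {v} v∈) u-normalises
    ; level = level
    ; intersection = λ y → mk⇔
        (λ (y∈ , gy∈) → Eichler-resp (≈ᴹ-sym (moved y)) (to (intersection (conj v y))
          (from (v∈ y) y∈ , Eichler-resp (≈ᴹ-sym (removed y)) gy∈)))
        (λ uy∈ → let (vy∈ , gvy∈) = from (intersection (conj v y)) (Eichler-resp (moved y) uy∈) in
          to (v∈ y) vy∈ , Eichler-resp (removed y) gvy∈) }
    where
    open Cartan G
    moved : ∀ y → conj ((v ⁻¹ ∙ u) ⁻¹) y ≈ᴹ conj (u ⁻¹) (conj v y)
    moved y = ≈ᴹ-trans (conj-∙⁻¹ (v ⁻¹) u y) (conj-congʳ (u ⁻¹) (conj-cong (⁻¹-involutive v) ≈ᴹ-refl))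
    removed : ∀ y → conj ((v ∙ g) ⁻¹) (conj v y) ≈ᴹ conj (g ⁻¹) y
    removed y = ≈ᴹ-trans (conj-∙⁻¹ v g (conj v y)) (conj-congʳ (g ⁻¹) (conj-⁻¹ˡ v y))

  private
    det-diagonal : ∀ n → (1# * π^ n - 0# * 0#) * π^⁻¹ n ≈ 1#
    det-diagonal n = trans (*-congʳ (solve 1 (λ q → :1 :* q :- :0 :* :0 := q) refl (π^ n))) (ππ⁻¹ n)

    diagonal : ℕ → GL₂
    diagonal n = fromDet (mat 1# 0# 0# (π^ n)) (π^⁻¹ n) (det-diagonal n)

  cartan-diagonal : ∀ n → Cartan (diagonal n)
  cartan-diagonal n = record
    { u = ε
    ; u-normalises = λ y → mk⇔ (Eichler-resp (conj-ε y)) (Eichler-resp (≈ᴹ-sym (conj-ε y)))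
    ; level = n
    ; intersection = λ y → mk⇔
        (λ (y∈ , dy∈) → Eichler-resp (≈ᴹ-sym (ε⁻¹y y)) (there y y∈ dy∈ (conj-elim g {y} {conj (g ⁻¹) y} (≈ᴹ-sym (conj-⁻¹ʳ g y)))))
        (λ uy∈ → back y (Eichler-resp (ε⁻¹y y) uy∈))
    }
    where
    q : Carrier
    q = π^ n
    g : GL₂
    g = diagonal n
    ε⁻¹y : ∀ y → conj (ε ⁻¹) y ≈ᴹ y
    ε⁻¹y y = ≈ᴹ-trans (≈ᴹ-sym (conj-congʳ (ε ⁻¹) (conj-ε y))) (conj-⁻¹ˡ ε y)
    there : ∀ y {z} → y ∈ M → z ∈ M → y *ᴹ matrix g ≈ᴹ matrix g *ᴹ z → y ∈ Eichler n
    there y {z} (eichler y₁ y₂ y₃ y₄) (eichler _ _ z₃ _) e = eichler y₁ y₂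
      (mk𝔭 (m₂₁ z) (𝔭⇒𝒪 z₃) (trans (solve 2 (λ a b → a := a :* :1 :+ b :* :0) refl (m₂₁ y) (m₂₂ y))
        (trans (_≈ᴹ_.≈₂₁ e) (solve 3 (λ q a b → :0 :* a :+ q :* b := q :* b) refl q (m₁₁ z) (m₂₁ z))))) y₄
    back : ∀ y → y ∈ Eichler n → y ∈ M × conj (g ⁻¹) y ∈ M
    back y (eichler y₁ y₂ y₃@(mk𝔭 z z∈ y₃≈) y₄) = eichler y₁ y₂ (𝒪⇒𝔭0 (𝔭⇒𝒪 y₃)) y₄ ,
      Eichler-resp (conj-move g (≈ᴹ-sym (conj-intro g {y} {mat (m₁₁ y) (m₁₂ y * q) z (m₂₂ y)} (mat≈
        (solve 3 (λ a b z → a :* :1 :+ b :* :0 := :1 :* a :+ :0 :* z) refl (m₁₁ y) (m₁₂ y) z)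
        (solve 4 (λ a b q d → a :* :0 :+ b :* q := :1 :* (b :* q) :+ :0 :* d) refl (m₁₁ y) (m₁₂ y) q (m₂₂ y))
        (trans (+-congʳ (*-congʳ y₃≈)) (solve 4 (λ q z d a → (q :* z) :* :1 :+ d :* :0 := :0 :* a :+ q :* z) refl q z (m₂₂ y) (m₁₁ y)))
        (solve 4 (λ c d q b → c :* :0 :+ d :* q := :0 :* b :+ q :* d) refl (m₂₁ y) (m₂₂ y) q (m₁₂ y * q))))))
      (eichler y₁ (*∈𝒪 y₂ (π^∈𝒪 n)) (𝒪⇒𝔭0 z∈) y₄)

  private
    lower-normalises : ∀ z (u : Unit 1#) → z ∈ 𝒪 → lowerUnit z u ∈ Normalises M
    lower-normalises z u z∈ = unit-normalises (lowerUnit z u) (lowerUnit-unit (𝒪⇒𝔭0 z∈) u)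

    borel-normalises′ : ∀ q → borel q ∈ Normalises M
    borel-normalises′ q@((x , x∈) , (z , unit z∈ z⁻¹ z⁻¹∈ _)) = unit-normalises (borel q)
      (eichler 1∈𝒪 x∈ (𝔭-0 0) z∈ , eichler 1∈𝒪 (-∈𝒪 (*∈𝒪 x∈ z⁻¹∈)) (𝔭-0 0) z⁻¹∈)

    swap : GL₂
    swap = reversal 0

    swap-normalises : swap ∈ Normalises M
    swap-normalises = reversal-normalises 0

    shear : ∀ {x} → x ∈ 𝒪 → GL₂
    shear {x} x∈ = borel ((x , x∈) , (1# , Unit-1))

    shear-normalises : ∀ {x} (x∈ : x ∈ 𝒪) → shear x∈ ∈ Normalises M
    shear-normalises {x} x∈ = borel-normalises′ ((x , x∈) , (1# , Unit-1))

    -- One elimination step. `Q` collects what is known of the entries of the product, so that the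
    -- next step can speak of an arbitrary h of that shape.
    stepʳ : ∀ (Q : Pred Mat ℓ) g v → v ∈ Normalises M → matrix g *ᴹ matrix v ∈ Q →
            (∀ h → matrix h ∈ Q → Cartan h) → Cartan g
    stepʳ Q g v v∈ gv∈ next = cartanʳ g v v∈ (next (g ∙ v) (≡.subst Q (≡.sym (matrix-∙ g v)) gv∈))

    stepˡ : ∀ (Q : Pred Mat ℓ) g v → v ∈ Normalises M → matrix v *ᴹ matrix g ∈ Q →
            (∀ h → matrix h ∈ Q → Cartan h) → Cartan g
    stepˡ Q g v v∈ vg∈ next = cartanˡ g v v∈ (next (v ∙ g) (≡.subst Q (≡.sym (matrix-∙ v g)) vg∈))

    Diagonal : Pred Mat ℓ
    Diagonal x = m₁₂ x ≈ 0# × m₂₁ x ≈ 0#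

    firstˡ : ∀ a b → 1# * a + 0# * b ≈ a
    firstˡ = solve 2 (λ a b → :1 :* a :+ :0 :* b := a) refl
    secondˡ : ∀ a b → 0# * a + 1# * b ≈ b
    secondˡ = solve 2 (λ a b → :0 :* a :+ :1 :* b := b) refl
    firstʳ : ∀ a b → a * 1# + b * 0# ≈ a
    firstʳ = solve 2 (λ a b → a :* :1 :+ b :* :0 := a) refl
    secondʳ : ∀ a b → a * 0# + b * 1# ≈ b
    secondʳ = solve 2 (λ a b → a :* :0 :+ b :* :1 := b) refl

    eliminate : ∀ {a b z} → b ≈ a * z → a * (- z) + b * 1# ≈ 0#
    eliminate {a} {b} {z} b≈ = trans (+-congˡ (*-congʳ b≈))
      (solve 2 (λ a z → a :* (:- z) :+ (a :* z) :* :1 := :0) refl a z)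

    eliminate′ : ∀ {a b z} → b ≈ a * z → 1# * b + (- z) * a ≈ 0#
    eliminate′ {a} {b} {z} b≈ = trans (solve 3 (λ a b z → :1 :* b :+ (:- z) :* a := a :* (:- z) :+ b :* :1) refl a b z)
      (eliminate b≈)

    diagonal-unit : ∀ z → z ∈ 𝒪 → ¬ (z ≈ 0#) → ∀ g → matrix g ≈ᴹ mat 1# 0# 0# z → Cartan g
    diagonal-unit z z∈ z≉0 g g≈ =
      let (n , e , e-unit , z≈) = factor z∈ z≉0
          q = (0# , 0∈𝒪) , (e , e-unit)
      in cartan-resp (≈ᴳ-sym (wrap (≈ᴹ-trans g≈ (≈ᴹ-trans (mat≈
          (solve 0 (:1 := :1 :* :1 :+ :0 :* :0) refl)
          (solve 1 (λ e → :0 := :1 :* :0 :+ :0 :* e) refl e)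
          (solve 1 (λ p → :0 := :0 :* :1 :+ p :* :0) refl (π^ n))
          (trans z≈ (solve 2 (λ p e → p :* e := :0 :* :0 :+ p :* e) refl (π^ n) e)))
          (≈ᴹ-reflexive (≡.sym (matrix-∙ (diagonal n) (borel q))))))))
        (cartan-∙ʳ (diagonal n) (borel q) (borel-normalises′ q) (cartan-diagonal n))
      where
      cartan-∙ʳ : ∀ g v → v ∈ Normalises M → Cartan g → Cartan (g ∙ v)
      cartan-∙ʳ g v v∈ G = cartanʳ (g ∙ v) (v ⁻¹) (Normalises-⁻¹ Eichler-resp {v} v∈) (cartan-resp (≈ᴳ-sym ([h∙g]∙g⁻¹≈h v g)) G)

    cartan-divides : ∀ {z} → z ∈ 𝒪 → ∀ g → Diagonal (matrix g) → m₂₂ (matrix g) ≈ m₁₁ (matrix g) * z → Cartan g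
    cartan-divides {z} z∈ g (b≈0 , c≈0) d≈ =
      let (a⁻¹ , aa⁻¹) = inverse a a≉0
          a⁻¹a = trans (*-comm a⁻¹ a) aa⁻¹
      in cartanˡ g (scalar a⁻¹a) (scalar-normalises Eichler-resp a⁻¹a)
        (diagonal-unit z z∈ z≉0 (scalar a⁻¹a ∙ g) (≈ᴹ-trans (scalar-∙ a⁻¹a g) (mat≈
          a⁻¹a (trans (*-congˡ b≈0) (zeroʳ a⁻¹)) (trans (*-congˡ c≈0) (zeroʳ a⁻¹))
          (trans (*-congˡ d≈) (trans (sym (*-assoc a⁻¹ a z)) (trans (*-congʳ a⁻¹a) (*-identityˡ z)))))))
      where
      a = m₁₁ (matrix g)
      aaz≉0 : ¬ (a * (a * z) ≈ 0#)
      aaz≉0 e = det≉0 g (trans (+-cong (*-congˡ d≈) (-‿cong (trans (*-congʳ b≈0) (zeroˡ _))))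
        (trans (solve 1 (λ x → x :- :0 := x) refl _) e))
      a≉0 : ¬ (a ≈ 0#)
      a≉0 a≈0 = aaz≉0 (trans (*-congʳ a≈0) (zeroˡ _))
      z≉0 : ¬ (z ≈ 0#)
      z≉0 z≈0 = aaz≉0 (trans (*-congˡ (trans (*-congˡ z≈0) (zeroʳ a))) (zeroʳ a))

    -- If the second diagonal entry divides the first, multiplication by `swap` on both sides
    -- exchanges the two.
    cartan-diag : ∀ g → Diagonal (matrix g) → Cartan g
    cartan-diag g (b≈0 , c≈0) = choose (divides (m₁₁ (matrix g)) (m₂₂ (matrix g)))
      where
      choose : (∃[ z ] z ∈ 𝒪 × m₂₂ (matrix g) ≈ m₁₁ (matrix g) * z) ⊎
               (∃[ z ] z ∈ 𝔭 1 × m₁₁ (matrix g) ≈ m₂₂ (matrix g) * z) → Cartan g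
      choose (inj₁ (z , z∈ , d≈)) = cartan-divides z∈ g (b≈0 , c≈0) d≈
      choose (inj₂ (z , z∈ , a≈)) =
        stepʳ (λ x → m₁₁ x ≈ 0# × m₂₂ x ≈ 0# × m₁₂ x ≈ m₂₁ x * z) g swap swap-normalises
          (trans (secondʳ _ _) b≈0 , trans (firstʳ _ _) c≈0 ,
           trans (firstʳ _ _) (trans a≈ (*-congʳ (sym (secondʳ _ _)))))
          (λ h (h₁₁ , h₂₂ , e) → stepˡ (λ x → (m₁₂ x ≈ 0# × m₂₁ x ≈ 0#) × m₂₂ x ≈ m₁₁ x * z) h swap swap-normalises
            ((trans (secondˡ _ _) h₂₂ , trans (firstˡ _ _) h₁₁) ,
             trans (firstˡ _ _) (trans e (*-congʳ (sym (secondˡ _ _)))))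
            (λ i (D , e′) → cartan-divides (𝔭⇒𝒪 z∈) i D e′))

    -- The corner entry is cleared by a row operation if a divides it, and by a column operation if
    -- d does. Otherwise it divides both a and d, which are cleared instead; the antidiagonal matrix
    -- that remains becomes diagonal after one `swap`.
    cartan-lower : ∀ g → m₁₂ (matrix g) ≈ 0# → Cartan g
    cartan-lower g e = choose (divides a b)
      where
      a b d : Carrier
      a = m₁₁ (matrix g)
      b = m₂₁ (matrix g)
      d = m₂₂ (matrix g)
      third : ∀ {z} → z ∈ 𝒪 → a ≈ b * z → (∃[ y ] y ∈ 𝒪 × d ≈ b * y) ⊎ (∃[ y ] y ∈ 𝔭 1 × b ≈ d * y) → Cartan g
      third z∈ a≈ (inj₂ (y , y∈ , b≈)) = stepʳ Diagonal g (lowerUnit (- y) Unit-1) (lower-normalises (- y) Unit-1 (-∈𝒪 (𝔭⇒𝒪 y∈)))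
        (trans (secondʳ _ _) e , trans (+-comm _ _) (eliminate b≈)) cartan-diag
      third {z} z∈ a≈ (inj₁ (y , y∈ , d≈)) =
        stepˡ (λ x → m₁₁ x ≈ 0# × m₂₂ x ≈ m₂₁ x * y) g (shear (-∈𝒪 z∈)) (shear-normalises (-∈𝒪 z∈))
          (eliminate′ a≈ , trans (secondˡ _ _) (trans d≈ (*-congʳ (sym (secondˡ _ _)))))
          (λ h (h₁₁ , d≈′) → stepʳ (λ x → m₁₁ x ≈ 0# × m₂₂ x ≈ 0#) h (shear (-∈𝒪 y∈)) (shear-normalises (-∈𝒪 y∈))
            (trans (firstʳ _ _) h₁₁ , eliminate d≈′)
            (λ i (i₁₁ , i₂₂) → stepˡ Diagonal i swap swap-normalises
              (trans (secondˡ _ _) i₂₂ , trans (firstˡ _ _) i₁₁) cartan-diag))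
      choose : (∃[ z ] z ∈ 𝒪 × b ≈ a * z) ⊎ (∃[ z ] z ∈ 𝔭 1 × a ≈ b * z) → Cartan g
      choose (inj₁ (z , z∈ , b≈)) = stepˡ Diagonal g (lowerUnit (- z) Unit-1) (lower-normalises (- z) Unit-1 (-∈𝒪 z∈))
        (trans (firstˡ _ _) e , trans (+-comm _ _) (eliminate′ b≈)) cartan-diag
      choose (inj₂ (z , z∈ , a≈)) = third (𝔭⇒𝒪 z∈) a≈ (divides b d)

    cartan-row : ∀ {z} → z ∈ 𝒪 → ∀ g → m₁₂ (matrix g) ≈ m₁₁ (matrix g) * z → Cartan g
    cartan-row z∈ g b≈ = stepʳ (λ x → m₁₂ x ≈ 0#) g (shear (-∈𝒪 z∈)) (shear-normalises (-∈𝒪 z∈)) (eliminate b≈) cartan-lower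

  cartan : ∀ g → Cartan g
  cartan g = choose (divides (m₁₁ (matrix g)) (m₁₂ (matrix g)))
    where
    choose : (∃[ z ] z ∈ 𝒪 × m₁₂ (matrix g) ≈ m₁₁ (matrix g) * z) ⊎
             (∃[ z ] z ∈ 𝔭 1 × m₁₁ (matrix g) ≈ m₁₂ (matrix g) * z) → Cartan g
    choose (inj₁ (z , z∈ , b≈)) = cartan-row z∈ g b≈
    choose (inj₂ (z , z∈ , a≈)) = stepʳ (λ x → m₁₂ x ≈ m₁₁ x * z) g swap swap-normalises
      (trans (firstʳ _ _) (trans a≈ (*-congʳ (sym (secondʳ _ _))))) (cartan-row (𝔭⇒𝒪 z∈))

  -- The level r of the module isomorphism is determined by the annihilator of D/E.
  module _ (D : Order) (E : Subset) (h : GL₂) {n r : ℕ}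
           (D⇔ : ∀ x → x ∈ Order.carrier D ⇔ conj (h ⁻¹) x ∈ M)
           (E⇔ : ∀ x → x ∈ E ⇔ conj (h ⁻¹) x ∈ Eichler n)
           (iso : ∃ (LeftModuleMorphisms.IsLeftModuleIsomorphism (D / E) (𝒪/π^ r))) where
    private
      f = proj₁ iso
      open LeftModuleMorphisms.IsLeftModuleIsomorphism (proj₂ iso) using (⟦⟧-cong; injective; surjective; *ₗ-homo; 0ᴹ-homo)

      0D : ∃ (Order.carrier D)
      0D = 0ᴹ , Order.0-closed D

      scale : ℕ → ∃ (Order.carrier D) → ∃ (Order.carrier D)
      scale i (x , x∈) = π^ i ·ᴹ x , Order.·-closed D (π^∈𝒪 i) x∈

      f-scale : ∀ i x → ∃[ z ] z ∈ 𝒪 × proj₁ (f (scale i x)) - π^ i * proj₁ (f x) ≈ π^ r * z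
      f-scale i x = *ₗ-homo (π^ i , π^∈𝒪 i) x

      minus-0 : ∀ x → x -ᴹ 0ᴹ ≈ᴹ x
      minus-0 x = mat≈ (e _) (e _) (e _) (e _)
        where
        e : ∀ a → a - 0# ≈ a
        e = solve 1 (λ a → a :- :0 := a) refl

      f0 : proj₁ (f 0D) ∈ 𝔭 r
      f0 = let (z , z∈ , e) = 0ᴹ-homo in mk𝔭 z z∈ (trans (solve 1 (λ a → a := a :- :0) refl _) e)

      E-resp : ∀ {x y} → x ≈ᴹ y → x ∈ E → y ∈ E
      E-resp {x} {y} x≈y x∈ = from (E⇔ y) (Eichler-resp (conj-congʳ (h ⁻¹) x≈y) (to (E⇔ x) x∈))

      kernel⇒E : ∀ x → proj₁ (f x) ∈ 𝔭 r → proj₁ x ∈ E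
      kernel⇒E x fx∈ = E-resp (minus-0 (proj₁ x)) (injective {x} {0D} (quotient (𝔭-+ fx∈ (𝔭-neg f0))))
        where
        quotient : ∀ {a} → a ∈ 𝔭 r → ∃[ z ] z ∈ 𝒪 × a ≈ π^ r * z
        quotient (mk𝔭 z z∈ e) = z , z∈ , e

      E⇒kernel : ∀ x → proj₁ x ∈ E → proj₁ (f x) ∈ 𝔭 r
      E⇒kernel x x∈ = 𝔭-resp (solve 2 (λ a b → (a :- b) :+ b := a) refl (proj₁ (f x)) (proj₁ (f 0D)))
        (𝔭-+ (let (z , z∈ , e) = ⟦⟧-cong {x} {0D} (E-resp (≈ᴹ-sym (minus-0 (proj₁ x))) x∈) in mk𝔭 z z∈ e) f0)

      -- πʳ annihilates 𝒪/πʳ, so πʳ times the conjugate of `E₂₁` lies in E, and its lower left entry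
      -- says πʳ ∈ 𝔭ⁿ. All equations for f hold only modulo 𝔭ʳ.
      n≤r : n ℕ.≤ r
      n≤r = unit∣⇒≤ {n} {r} Unit-1 (𝔭-resp (solve 1 (λ q → q :* :1 := q :* :1) refl (π^ r)) (e₂₁ (Eichler-resp
        (≈ᴹ-trans (conj-· (h ⁻¹) (π^ r) (conj h E₂₁)) (·ᴹ-congˡ (conj-⁻¹ˡ h E₂₁))) (to (E⇔ (π^ r ·ᴹ conj h E₂₁)) scaled∈))))
        where
        x : ∃ (Order.carrier D)
        x = conj h E₂₁ , from (D⇔ (conj h E₂₁)) (Eichler-resp (≈ᴹ-sym (conj-⁻¹ˡ h E₂₁)) (eichler 0∈𝒪 0∈𝒪 (𝒪⇒𝔭0 1∈𝒪) 0∈𝒪))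
        scaled∈ : π^ r ·ᴹ conj h E₂₁ ∈ E
        scaled∈ = kernel⇒E (scale r x) (let (z , z∈ , e) = f-scale r x in
          𝔭-resp (solve 2 (λ a b → (a :- b) :+ b := a) refl (proj₁ (f (scale r x))) (π^ r * proj₁ (f x)))
            (𝔭-+ (mk𝔭 z z∈ e) (mk𝔭 (proj₁ (f x)) (proj₂ (f x)) refl)))

      -- πⁿ annihilates D/E. Applied to a preimage x of 1 this gives πⁿ f(x) ∈ 𝔭ʳ with f(x) ≡ 1,
      -- hence πⁿ ∈ 𝔭ʳ.
      r≤n : r ℕ.≤ n
      r≤n = unit∣⇒≤ {r} {n} Unit-1 (𝔭-resp (solve 3 (λ q a b → (q :* a :- q :* (a :- :1)) := q :* :1) refl (π^ n) (proj₁ (f x)) 0#)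
        (𝔭-+ qfx∈ (𝔭-neg (𝔭-*ˡ (π^∈𝒪 n) fx-1∈))))
        where
        preimage : ∃[ x ] (∀ {z} → _ → ∃[ w ] w ∈ 𝒪 × proj₁ (f z) - 1# ≈ π^ r * w)
        preimage = surjective (1# , 1∈𝒪)
        x : ∃ (Order.carrier D)
        x = proj₁ preimage
        x-x∈E : proj₁ x -ᴹ proj₁ x ∈ E
        x-x∈E = E-resp (mat≈ (sym (-‿inverseʳ _)) (sym (-‿inverseʳ _)) (sym (-‿inverseʳ _)) (sym (-‿inverseʳ _)))
          (from (E⇔ 0ᴹ) (Eichler-resp (≈ᴹ-sym (conj-0 (h ⁻¹))) Eichler-0))
        fx-1∈ : proj₁ (f x) - 1# ∈ 𝔭 r
        fx-1∈ = let (w , w∈ , e) = proj₂ preimage {x} x-x∈E in mk𝔭 w w∈ e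
        qfx∈ : π^ n * proj₁ (f x) ∈ 𝔭 r
        qfx∈ = let (z , z∈ , e) = f-scale n x in
          𝔭-resp (solve 2 (λ a b → a :- (a :- b) := b) refl (proj₁ (f (scale n x))) (π^ n * proj₁ (f x)))
            (𝔭-+ (E⇒kernel (scale n x) scaled∈) (𝔭-neg (mk𝔭 z z∈ e)))
          where
          y : Mat
          y = conj (h ⁻¹) (proj₁ x)
          y∈ : y ∈ M
          y∈ = to (D⇔ (proj₁ x)) (proj₂ x)
          scaled∈ : π^ n ·ᴹ proj₁ x ∈ E
          scaled∈ = from (E⇔ _) (Eichler-resp (≈ᴹ-sym (conj-· (h ⁻¹) (π^ n) (proj₁ x)))
            (eichler (*∈𝒪 (π^∈𝒪 n) (e₁₁ y∈)) (*∈𝒪 (π^∈𝒪 n) (e₁₂ y∈)) (mk𝔭 (m₂₁ y) (𝔭⇒𝒪 (e₂₁ y∈)) refl) (*∈𝒪 (π^∈𝒪 n) (e₂₂ y∈))))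

    level-unique : n ≡ r
    level-unique = ℕₚ.≤-antisym n≤r r≤n

  -- Conjugation by P₁⁻¹ turns D₁ into M₂(𝒪) and D₂ into its conjugate by P₁⁻¹P₂, to which the
  -- Cartan decomposition applies. As u normalises M₂(𝒪), the conjugator P₁u makes E standard while
  -- D₁ still becomes M₂(𝒪), as the comparison of levels requires.
  eichler⇒conjugate : ∀ (E : Subset) r → IsEichlerOrder E r → Σ[ h ∈ GL₂ ] (∀ x → x ∈ E ⇔ conj (h ⁻¹) x ∈ Eichler r)
  eichler⇒conjugate E r E-eichler =
    let (P₁ , D₁⇔) = maximal⇒conjugate D₁ maximal₁
        (P₂ , D₂⇔) = maximal⇒conjugate D₂ maximal₂
    in standardise P₁ D₁⇔ P₂ D₂⇔ (cartan (P₁ ⁻¹ ∙ P₂))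
    where
    open IsEichlerOrder E-eichler
    standardise : ∀ P₁ → (∀ x → x ∈ Order.carrier D₁ ⇔ conj (P₁ ⁻¹) x ∈ M) → ∀ P₂ → (∀ x → x ∈ Order.carrier D₂ ⇔ conj (P₂ ⁻¹) x ∈ M) →
      Cartan (P₁ ⁻¹ ∙ P₂) → Σ[ h ∈ GL₂ ] (∀ x → x ∈ E ⇔ conj (h ⁻¹) x ∈ Eichler r)
    standardise P₁ D₁⇔ P₂ D₂⇔ G = P₁ ∙ u , λ x →
      ≡.subst (λ n → x ∈ E ⇔ conj ((P₁ ∙ u) ⁻¹) x ∈ Eichler n) (level-unique D₁ E (P₁ ∙ u) {level} {r} D⇔ E⇔ level₁) (E⇔ x)
      where
      open Cartan G
      moved : ∀ x → conj ((P₁ ⁻¹ ∙ P₂) ⁻¹) (conj (P₁ ⁻¹) x) ≈ᴹ conj (P₂ ⁻¹) x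
      moved x = ≈ᴹ-trans (≈ᴹ-sym (conj-∙ ((P₁ ⁻¹ ∙ P₂) ⁻¹) (P₁ ⁻¹) x)) (conj-cong cancel ≈ᴹ-refl)
        where
        cancel : (P₁ ⁻¹ ∙ P₂) ⁻¹ ∙ P₁ ⁻¹ ≈ᴳ P₂ ⁻¹
        cancel = ≈ᴳ-trans (∙-congʳ (⁻¹-anti-homo-∙ (P₁ ⁻¹) P₂)) ([h∙g⁻¹]∙g≈h (P₁ ⁻¹) (P₂ ⁻¹))
      E⇔ : ∀ x → x ∈ E ⇔ conj ((P₁ ∙ u) ⁻¹) x ∈ Eichler level
      E⇔ x = mk⇔
        (λ x∈ → let (x∈₁ , x∈₂) = proj₁ E≐D₁∩D₂ x∈ in Eichler-resp (≈ᴹ-sym (conj-∙⁻¹ P₁ u x))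
          (to (intersection (conj (P₁ ⁻¹) x)) (to (D₁⇔ x) x∈₁ , Eichler-resp (≈ᴹ-sym (moved x)) (to (D₂⇔ x) x∈₂))))
        (λ ux∈ → let (x∈₁ , x∈₂) = from (intersection (conj (P₁ ⁻¹) x)) (Eichler-resp (conj-∙⁻¹ P₁ u x) ux∈) in
          proj₂ E≐D₁∩D₂ (from (D₁⇔ x) x∈₁ , from (D₂⇔ x) (Eichler-resp (moved x) x∈₂)))
      D⇔ : ∀ x → x ∈ Order.carrier D₁ ⇔ conj ((P₁ ∙ u) ⁻¹) x ∈ M
      D⇔ x = mk⇔
        (λ x∈ → Eichler-resp (≈ᴹ-sym (conj-∙⁻¹ P₁ u x)) (from (u⁻¹∈ (conj (P₁ ⁻¹) x)) (to (D₁⇔ x) x∈)))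
        (λ ux∈ → from (D₁⇔ x) (to (u⁻¹∈ (conj (P₁ ⁻¹) x)) (Eichler-resp (conj-∙⁻¹ P₁ u x) ux∈)))
        where
        u⁻¹∈ : u ⁻¹ ∈ Normalises M
        u⁻¹∈ = Normalises-⁻¹ Eichler-resp {u} u-normalises

-- The embedding numbers of H in an arbitrary Eichler order.

module EmbeddingCounts {c ℓ} (k : LocalField c ℓ) {r t : ℕ} where
  open LocalField k using (p)
  open Residues k
  open MatrixAlgebra k
  open Optimality k
  open Classification k
  open Orbits k
  open Counting k {r} {t}
  open Transfer k {r} {t}
  open TransferSuborders k {r} {t}
  open Correspondence k {r} {t} using (H)

  private
    parameterCount : ℕ
    parameterCount = p ℕ.^ t ℕ.* unitCount t

  module _ (E : Subset) (h : GL₂) (E⇔ : ∀ x → x ∈ E ⇔ conj (h ⁻¹) x ∈ Eichler r) where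
    -- Necessity is part of the classification of the element attached to an embedding; conversely
    -- the base point M is itself an optimal element.
    embeds⇔ : OptimalEmbedding H E ⇔ 2 ℕ.* t ℕ.≤ r
    embeds⇔ = mk⇔
      (λ φ → proj₁ (classify {r} {t} {genX E h E⇔ φ} (genX-optimal E h E⇔ φ)))
      (λ 2t≤r → embedding E h E⇔ (basepoint r t) (basepoint-optimal {r} {t} 2t≤r))

    module _ (2t≤r : 2 ℕ.* t ℕ.≤ r) where
      private
        module C = Count (representatives 2t≤r)
        module FX = C.Family (genX E h E⇔) (genX-optimal E h E⇔) (genX-onto E h E⇔)
        module FY = C.Family (genY E h E⇔) (genY-optimal E h E⇔) (genY-onto E h E⇔)
        orbit-X₁ = genX-orbit E h E⇔ (Γ₁-conjugate E h E⇔)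
        orbit-X₂ = genX-orbit E h E⇔ (Γ₂-conjugate E h E⇔)
        orbit-Y₁ = genY-orbit E h E⇔ (Γ₁-conjugate E h E⇔)
        orbit-Y₂ = genY-orbit E h E⇔ (Γ₂-conjugate E h E⇔)

      numbers-long : 2 ℕ.* t ℕ.< r → EmbeddingNumbers H E (2 ℕ.* parameterCount , parameterCount , 2 , 1)
      numbers-long 2t<r = record
        { ∣X/Γ₁∣ = FX.Long.card-R₁ 2t<r orbit-X₁ (card-parameters t)
        ; ∣X/Γ₂∣ = FX.Long.card-R₂ 2t<r orbit-X₂ (card-parameters t)
        ; ∣Y/Γ₁∣ = FY.Long.card-S₁ 2t<r orbit-Y₁
        ; ∣Y/Γ₂∣ = FY.card-S₂ orbit-Y₂
        }

      numbers-short : r ≡ 2 ℕ.* t →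
        ∀ {m} → HasCardinality Parameter (λ q q′ → q ≋ᵖ q′ [mod t ] ⊎ q ≋ᵖ flip q′ [mod t ]) m →
        EmbeddingNumbers H E (parameterCount , m , 1 , 1)
      numbers-short r≡2t card/flip = record
        { ∣X/Γ₁∣ = FX.Short.card-R₁ r≡2t orbit-X₁ (card-parameters t)
        ; ∣X/Γ₂∣ = FX.Short.card-R₂ r≡2t orbit-X₂ card/flip
        ; ∣Y/Γ₁∣ = FY.Short.card-S₁ r≡2t orbit-Y₁
        ; ∣Y/Γ₂∣ = FY.card-S₂ orbit-Y₂
        }

open import Defs
open import Data.Nat using (ℕ; _*_; _∸_; _^_; _≤_; _<_)
open import Data.Product using (∃-syntax; _×_; _,_)
open import Function.Bundles using (_⇔_)
open import Level using (Level)
open import Relation.Binary.PropositionalEquality using (_≡_)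
open LocalField using (p)
open Matrices

theorem1p3 : {c ℓ : Level} (k : LocalField c ℓ) (E : Subset k) (r t : ℕ) →
  IsEichlerOrder k E r →
  let H = _^[_] k (H₀ k) t
      N = (p k ∸ 1) * p k ^ (2 * t ∸ 1) in
  (OptimalEmbedding k H E ⇔ 2 * t ≤ r) ×
  (0 < t → r ≡ 2 * t → ∃[ e₂ ] 2 * e₂ ≡ N × EmbeddingNumbers k H E (N , e₂ , 1 , 1)) ×
  (0 < t → 2 * t < r → EmbeddingNumbers k H E (2 * N , N , 2 , 1)) ×
  (t ≡ 0 → r ≡ 0 → EmbeddingNumbers k H E (1 , 1 , 1 , 1)) ×
  (t ≡ 0 → 0 < r → EmbeddingNumbers k H E (2 , 1 , 2 , 1))
theorem1p3 k E r t E-eichler = fromFrame (EichlerOrders.eichler⇒conjugate k E r E-eichler)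
  where
  open MatrixAlgebra k using (_⁻¹)
  open Optimality k using (Eichler)
  open Residues k
  open EmbeddingCounts k {r} {t}

  Numbers : _ → Set _
  Numbers = EmbeddingNumbers k (_^[_] k (H₀ k) t) E

  fromFrame : Σ[ h ∈ GL₂ k ] (∀ x → x ∈ E ⇔ conj k (h ⁻¹) x ∈ Eichler r) → _
  fromFrame (h , E⇔) =
    embeds⇔ E h E⇔ ,
    (λ 0<t r≡2t → let (m , 2m≡ , card) = card-parameters/flip t 0<t in
      m , ≡.trans 2m≡ (parameterCount-suc t 0<t) ,
      ≡.subst (λ n → Numbers (n , m , 1 , 1)) (parameterCount-suc t 0<t)
        (numbers-short E h E⇔ (ℕₚ.≤-reflexive (≡.sym r≡2t)) r≡2t card)) ,
    (λ 0<t 2t<r → ≡.subst (λ n → Numbers (2 * n , n , 2 , 1)) (parameterCount-suc t 0<t)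
      (numbers-long E h E⇔ (ℕₚ.<⇒≤ 2t<r) 2t<r)) ,
    -- For t = 0 the number of parameters, p⁰ times `unitCount 0`, computes to 1, and 2t ≤ r becomes
    -- `z≤n`.
    (λ { ≡.refl r≡0 → numbers-short E h E⇔ z≤n r≡0 card-parameters/flip-0 }) ,
    (λ { ≡.refl 0<r → numbers-long E h E⇔ z≤n 0<r })
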